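{- Fix $n,k\ge1$. Then, as formal power series in $x_1,\ldots,x_n,y_1,\ldots,y_n$, \[\sum_{\bm{\lambda}}t^{d(\bm{\lambda})}\mathcal{L}_{\bm{\lambda}}(x_1,\ldots,x_n;t)\,\mathcal{L}_{\bm{\lambda}}(y_1,\ldots,y_n;t)=\prod_{i,j=1}^n\prod_{m=0}^{k-1}\left(1-x_iy_jt^m\right)^{ -1},\] where the sum is over all $k$-tuples $\bm{\lambda}=(\lambda^{(1)},\ldots,\lambda^{(k)})$ of partitions each with $n$ non-negative parts, and \[d(\bm{\lambda})=\binom n2\binom k2-\#\{(i,j,a,b):1\le i,j\le n,\ 1\le a<b\le k,\ \lambda^{(b)}_i-i<\lambda^{(a)}_j-j\}.\]
   Context: $\mathcal{L}_{\bm{\lambda}}$ is the coinversion LLT polynomial of $\bm{\lambda}$ (i.e. of $\bm{\lambda}/\bm 0$ with each $\lambda^{(a)}$ and the zero partition having $n$ parts): cells are $(r,c)\in\mathbb{Z}^2$ (row $r$, column $c$, rows bottom to top), $\lambda^{(a)}$ consists of cells $(r,c)$ with $1\le r\le n$, $1\le c\le\lambda^{(a)}_r$, content of $(r,c)$ is $c-r$. A tableau $T=(T^{(1)},\ldots,T^{(k)})$ fills each $\lambda^{(a)}$ with entries in $[n]$, weakly increasing along rows and strictly increasing up columns; $x^T=\prod_u x_{T(u)}$. A triple is $(u,v,w)$ where for some $a<b$: $v$ is a cell of $\lambda^{(a)}$, $u=(r,c-1)$, $w=(r,c)$ with $1\le r\le n$, $w$ of the same content as $v$, $c\ge1$, $c\le\lambda^{(b)}_r+1$.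 With $b'$ the entry of $v$, $a'$ the entry of $u$ in $T^{(b)}$ (or $0$ if $u\notin\lambda^{(b)}$), $c'$ the entry of $w$ in $T^{(b)}$ (or $\infty$ if $w\notin\lambda^{(b)}$), it is a coinversion triple if $a'\le b'\le c'$. $\mathcal{L}_{\bm{\lambda}}=\sum_Tt^{\mathrm{coinv}(T)}x^T$, $\mathrm{coinv}(T)$ the number of coinversion triples. -}

module Defs where

open import Data.Bool using (Bool; true; false; _∧_; _∨_; if_then_else_)
open import Data.Nat using (ℕ; zero; suc; _+_; _*_; _∸_; _≡ᵇ_; _<ᵇ_; _≤ᵇ_)
open import Data.Nat.Combinatorics using (_C_)
open import Data.Fin using (Fin; toℕ)
open import Data.Integer as ℤ using (ℤ; +_)
open import Data.List using (List; []; _∷_; map; concatMap; allFin; upTo; filterᵇ; length; foldr)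
open import Data.Bool.ListAction using (and)
open import Data.Nat.ListAction using (sum)
import Data.List as L
open import Data.Vec as V using (Vec; []; _∷_; tabulate; lookup; toList; zipWith)
open import Data.Maybe using (Maybe; just; nothing)
open import Data.Product using (_×_; _,_)
open import Relation.Nullary using (does)

∑ : {A : Set} → List A → (A → ℕ) → ℕ
∑ xs f = sum (map f xs)

𝟙 : Bool → ℕ
𝟙 true  = 1
𝟙 false = 0

choices : {A : Set} {m : ℕ} → Vec (List A) m → List (Vec A m)
choices []         = [] ∷ []
choices (xs ∷ xss) = concatMap (λ x → map (x ∷_) (choices xss)) xs

atM : {A : Set} → List A → ℕ → Maybe A
atM []       _       = nothing
atM (x ∷ xs) zero    = just x
atM (x ∷ xs) (suc i) = atM xs i

vecEq : {m : ℕ} → Vec ℕ m → Vec ℕ m → Bool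
vecEq u v = and (toList (zipWith _≡ᵇ_ u v))

-- Monomials x^α y^β t^e (e ∈ ℤ) and polynomials with coefficients in ℕ,
-- represented as lists of monomials (with multiplicity).

Mon : ℕ → Set
Mon n = Vec ℕ n × Vec ℕ n × ℤ

monEq : {n : ℕ} → Mon n → Mon n → Bool
monEq (α , β , e) (α' , β' , e') = vecEq α α' ∧ vecEq β β' ∧ does (e ℤ.≟ e')

monMul : {n : ℕ} → Mon n → Mon n → Mon n
monMul (α , β , e) (α' , β' , e') = zipWith _+_ α α' , zipWith _+_ β β' , e ℤ.+ e'

coeff : {n : ℕ} → List (Mon n) → Mon n → ℕ
coeff P m = length (filterᵇ (monEq m) P)

polyMul : {n : ℕ} → List (Mon n) → List (Mon n) → List (Mon n)
polyMul P Q = concatMap (λ p → map (monMul p) Q) P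

one : {n : ℕ} → List (Mon n)
one = (tabulate (λ _ → 0) , tabulate (λ _ → 0) , + 0) ∷ []

-- Partitions, tableaux, coinversions.  Fix n (rows / alphabet [n]) and
-- k (number of partitions).  Rows r ∈ Fin n are 0-based (row r+1 of the
-- paper); columns are 1-based; the entry i : Fin n stands for i+1 ∈ [n].

module _ (n k : ℕ) where

  Tuple : Set
  Tuple = Vec (Vec ℕ n) k

  weaklyDecreasing : List ℕ → Bool
  weaklyDecreasing (x ∷ y ∷ xs) = (y ≤ᵇ x) ∧ weaklyDecreasing (y ∷ xs)
  weaklyDecreasing _            = true

  isPartition : Vec ℕ n → Bool
  isPartition p = weaklyDecreasing (toList p)

  tuplesUpTo : ℕ → List Tuple
  tuplesUpTo D =
    filterᵇ (λ λs → and (toList (V.map isPartition λs)))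
            (choices (V.replicate k (choices (V.replicate n (upTo (suc D))))))

  -- a filling of one diagram: row r is the list of entries of the
  -- cells (r,1),(r,2),… ; a tableau is a k-tuple of fillings
  Filling : Set
  Filling = Vec (List (Fin n)) n

  Tableau : Set
  Tableau = Vec Filling k

  ent : Fin n → ℕ
  ent i = suc (toℕ i)

  words : ℕ → List (List (Fin n))
  words zero    = [] ∷ []
  words (suc l) = concatMap (λ w → map (_∷ w) (allFin n)) (words l)

  rowOK : List (Fin n) → Bool
  rowOK (x ∷ y ∷ xs) = (ent x ≤ᵇ ent y) ∧ rowOK (y ∷ xs)
  rowOK _            = true

  colOK : List (Fin n) → List (Fin n) → Bool
  colOK lower upper = and (map check (upTo (length upper)))
    where
      check : ℕ → Bool
      check c with atM lower c | atM upper c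
      ... | just x  | just y  = ent x <ᵇ ent y
      ... | nothing | just _  = false
      ... | _       | nothing = true

  colsOK : List (List (Fin n)) → Bool
  colsOK (r₁ ∷ r₂ ∷ rs) = colOK r₁ r₂ ∧ colsOK (r₂ ∷ rs)
  colsOK _              = true

  fillingOK : Filling → Bool
  fillingOK F = and (toList (V.map rowOK F)) ∧ colsOK (toList F)

  tableaux : Tuple → List Tableau
  tableaux λs =
    filterᵇ (λ T → and (toList (V.map fillingOK T)))
            (choices (V.map (λ p → choices (V.map words p)) λs))

  content : Tableau → Vec ℕ n
  content T = tabulate (λ i →
    ∑ (toList T) (λ F → ∑ (toList F) (λ row →
      length (filterᵇ (λ x → toℕ x ≡ᵇ toℕ i) row))))

  cellEntry : Filling → Fin n → ℕ → Maybe ℕ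
  cellEntry F r zero    = nothing
  cellEntry F r (suc c) with atM (lookup F r) c
  ... | just x  = just (ent x)
  ... | nothing = nothing

  -- a' (0 if absent), c' (∞ = n+1 > every entry, if absent)
  entryOr0 : Maybe ℕ → ℕ
  entryOr0 (just x) = x
  entryOr0 nothing  = 0

  entryOr∞ : Maybe ℕ → ℕ
  entryOr∞ (just x) = x
  entryOr∞ nothing  = suc n

  -- number of coinversion triples.  For a < b, v = (r₀,c₀) ∈ λ^(a),
  -- w = (r,c) with content c - r = c₀ - r₀, c ≥ 1, c ≤ λ^(b)_r + 1,
  -- u = (r,c-1); coinversion iff a' ≤ b' ≤ c'.
  coinv : Tuple → Tableau → ℕ
  coinv λs T =
    ∑ (allFin k) λ a → ∑ (allFin k) λ b → 𝟙 (toℕ a <ᵇ toℕ b) *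
    ∑ (allFin n) (λ r₀ → ∑ (map suc (upTo (lookup (lookup λs a) r₀))) λ c₀ →
    ∑ (allFin n) λ r → triple a b r₀ c₀ r)
    where
      triple : Fin k → Fin k → Fin n → ℕ → Fin n → ℕ
      triple a b r₀ c₀ r =
        let c  = (c₀ + toℕ r) ∸ toℕ r₀
            b' = entryOr0 (cellEntry (lookup T a) r₀ c₀)
            a' = entryOr0 (cellEntry (lookup T b) r (c ∸ 1))
            c' = entryOr∞ (cellEntry (lookup T b) r c)
        in 𝟙 ((toℕ r₀ <ᵇ c₀ + toℕ r)               -- c ≥ 1
              ∧ (c ≤ᵇ suc (lookup (lookup λs b) r))
              ∧ (a' ≤ᵇ b') ∧ (b' ≤ᵇ c'))

  -- the coinversion LLT polynomial in one alphabet, as a list of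
  -- (exponent vector, t-exponent) pairs, one per tableau
  LLT : Tuple → List (Vec ℕ n × ℕ)
  LLT λs = map (λ T → content T , coinv λs T) (tableaux λs)

  dstat : Tuple → ℤ
  dstat λs = (+ ((n C 2) * (k C 2))) ℤ.- (+
    ∑ (allFin n) λ i → ∑ (allFin n) λ j → ∑ (allFin k) λ a → ∑ (allFin k) λ b →
      𝟙 ((toℕ a <ᵇ toℕ b) ∧
         does (((+ lookup (lookup λs b) i) ℤ.- (+ ent i)) ℤ.<?
               ((+ lookup (lookup λs a) j) ℤ.- (+ ent j)))))

  summand : Tuple → List (Mon n)
  summand λs =
    concatMap (λ { (α , e₁) → map (λ { (β , e₂) →
                 (α , β , dstat λs ℤ.+ (+ e₁) ℤ.+ (+ e₂)) }) (LLT λs) }) (LLT λs)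

  -- left-hand side, summed over all tuples with parts ≤ D
  -- (this contains every monomial of x-degree ≤ D of the full series)
  lhsUpTo : ℕ → List (Mon n)
  lhsUpTo D = concatMap summand (tuplesUpTo D)

  unitTimes : ℕ → Fin n → Vec ℕ n
  unitTimes p i = tabulate (λ i' → if toℕ i ≡ᵇ toℕ i' then p else 0)

  -- (1 - x_i y_j t^m)^{-1} truncated: Σ_{p=0}^{D} (x_i y_j t^m)^p
  geomUpTo : ℕ → Fin n → Fin n → Fin k → List (Mon n)
  geomUpTo D i j m =
    map (λ p → unitTimes p i , unitTimes p j , + (p * toℕ m)) (upTo (suc D))

  -- ∏_{i,j ∈ [n]} ∏_{m=0}^{k-1} of the truncated geometric series
  -- (agrees with the full product in every monomial of x-degree ≤ D)
  rhsUpTo : ℕ → List (Mon n)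
  rhsUpTo D =
    foldr polyMul one
      (concatMap (λ i → concatMap (λ j → map (λ m → geomUpTo D i j m)
        (allFin k)) (allFin n)) (allFin n))

{-# OPTIONS --safe #-}

-- A k-tuple of partitions is a word of coloured particles: row r of λ^(c) is a particle of colour c at the
-- site λ_r + n - 1 - r.  Adding a horizontal strip to each partition moves particles to the right, and is
-- a transfer operator T(x): a queue of k bits, one per colour, passes over the sites, with a factor x for
-- each step of a particle and a factor q (t = q²) for each other colour travelling past it.  Conjugating
-- by q^inv turns these symmetric weights into the coinversion statistic, and also produces t^d(λ); since
-- semistandard tableaux are chains of horizontal strips, L_λ is then a matrix coefficient of a product of
-- operators T.  A row T(x) and a transposed row T*(y) are exchanged by an intertwiner ℛ on the pairs of
-- queues, built letter by letter, which costs the factor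
--   ∏_{m<k} (1 - x y t^m) · T*(y) T(x) = T(x) T*(y)
-- up to terms of high degree in x.  As T*(y) fixes the vacuum, T(x_n) ⋯ T(x_1) applied to the vacuum is an
-- eigenvector of T*(y), and the Cauchy identity follows one variable y at a time.

module Submission where

open import Defs
open import Algebra.Bundles using (CommutativeSemiring; CommutativeRing; RawRing)
import Algebra.Properties.AbelianGroup as AbelianProps
import Algebra.Properties.CommutativeSemigroup as CSProps
import Algebra.Properties.Group as GroupProps
import Algebra.Properties.Ring as RingProps
import Algebra.Properties.Semiring.Exp as Exp
import Algebra.Properties.Semiring.Mult.TCOptimised as MultProps
import Algebra.Solver.Ring as RingSolver
open import Algebra.Solver.Ring.AlmostCommutativeRing using (fromCommutativeRing; _-Raw-AlmostCommutative⟶_)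
open import Data.Bool as Bool using (Bool; true; false; _∧_; _∨_; not; if_then_else_)
open import Data.Bool.ListAction using (and)
import Data.Bool.Properties as Boolₚ
open import Data.Empty using (⊥; ⊥-elim)
open import Data.Fin using (Fin; zero; suc; toℕ; fromℕ<)
import Data.Fin.Properties as Finₚ
open import Data.Integer as ℤ using (ℤ; -[1+_])
import Data.Integer.Properties as ℤₚ
open import Data.Integer.Solver using () renaming (module +-*-Solver to ℤ-Solver)
open import Data.List using (List; []; _∷_; _++_; _∷ʳ_; map; concatMap; foldr; filterᵇ; allFin; upTo; tabulate; cartesianProductWith; replicate; length; zip)
import Data.List.Membership.Propositional as Mem
open Mem using (_∈_; _∉_)
import Data.List.Membership.Propositional.Properties as ∈ₚ
import Data.List.Properties as Listₚ
open import Data.List.Relation.Unary.All as All using (All; []; _∷_)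
import Data.List.Relation.Unary.All.Properties as Allₚ
open import Data.List.Relation.Unary.AllPairs using ([]; _∷_)
import Data.List.Relation.Unary.Any as Any
open Any using (here; there)
open import Data.List.Relation.Unary.Unique.Propositional using (Unique)
import Data.List.Relation.Unary.Unique.Propositional.Properties as Uniqueₚ
open import Data.Maybe using (Maybe; just; nothing)
open import Data.Maybe.Properties using (just-injective)
open import Data.Nat using (ℕ; zero; suc; _+_; _*_; _∸_; _≤_; _<_; z≤n; s≤s; _≡ᵇ_; _<ᵇ_; _≤ᵇ_)
import Data.Nat.Properties as ℕₚ
open import Data.Nat.Solver using (module +-*-Solver)
open import Data.Product using (∃; _×_; _,_; proj₁; proj₂; swap)
import Data.Product.Properties as ×ₚ
import Data.Sign as Sign
open import Data.Sum using (_⊎_; inj₁; inj₂)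
open import Data.Unit using (⊤; tt)
open import Data.Vec as Vec using (Vec; []; _∷_; lookup; toList; sum)
import Data.Vec.Properties as Vecₚ
open import Data.Vec.Relation.Unary.All as VAll using ([]; _∷_) renaming (All to VAll)
import Data.Vec.Relation.Unary.All.Properties as VAllₚ
open import Function using (_∘_; id)
open import Function.Bundles using (Equivalence)
open import Level using (Level; 0ℓ)
open import Relation.Binary.Definitions using (tri<; tri≈; tri>)
open import Relation.Binary.PropositionalEquality as ≡ using (_≡_; _≢_; refl; cong; cong₂; subst; subst₂)
import Relation.Binary.Reasoning.Setoid as SetoidReasoning
open import Relation.Nullary using (¬_; Dec; yes; no; does)
open import Relation.Nullary.Decidable using (_×-dec_; _→-dec_)

-- The exchange of two rows is local: a site rotates one colour from the head of the queue to its
-- end, and only the letter of that colour changes. Hence ℛ must be computable from either end of a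
-- word. The factor ∏ (1 - x y t^m) is the ratio of the values of ℛ at the two boundaries. On the
-- right, rows that end empty leave only letters `𝟘𝟘`. On the left, an unread colour could be `𝟘𝟘`
-- or `𝟘𝟚`; the two choices merge into one letter `⋆` when the colour has a particle on its first
-- site. So the commutation is proved in front of states whose first column is full. Each T(x) can
-- open only the last full column, so the n full columns of the vacuum suffice for n variables x.
-- The line has only n + D sites, and particles may run off its right end. Together with the moves
-- made since the vacuum this costs more than D factors x, which is zero in the ring truncated in
-- x-degree; no truncation in y is made. The symmetric weights need a square root q of t, so
-- exponents of t are doubled on the way in, and coefficients are compared at doubled monomials on
-- the way out.

-- Finite sums and enumerations of choices.

module FiniteSum {c ℓ : Level} (S : CommutativeSemiring c ℓ) where
  private variable
    A B : Set

  open CommutativeSemiring S hiding (zero) renaming (_+_ to _⊕_; _*_ to _⊗_; refl to ≈-refl; sym to ≈-sym; trans to ≈-trans)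
  open CSProps +-commutativeSemigroup using (interchange)
  open SetoidReasoning setoid

  ⅀ : List A → (A → Carrier) → Carrier
  ⅀ xs f = foldr _⊕_ 0# (map f xs)

  ⅀-cong∈ : (xs : List A) {f g : A → Carrier} → (∀ x → x ∈ xs → f x ≈ g x) → ⅀ xs f ≈ ⅀ xs g
  ⅀-cong∈ []       h = ≈-refl
  ⅀-cong∈ (x ∷ xs) h = +-cong (h x (here refl)) (⅀-cong∈ xs (λ y y∈ → h y (there y∈)))

  ⅀-cong : (xs : List A) {f g : A → Carrier} → (∀ x → f x ≈ g x) → ⅀ xs f ≈ ⅀ xs g
  ⅀-cong xs h = ⅀-cong∈ xs (λ x _ → h x)

  ⅀-zero∈ : (xs : List A) {f : A → Carrier} → (∀ x → x ∈ xs → f x ≈ 0#) → ⅀ xs f ≈ 0#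
  ⅀-zero∈ []       h = ≈-refl
  ⅀-zero∈ (x ∷ xs) h = ≈-trans (+-cong (h x (here refl)) (⅀-zero∈ xs (λ y y∈ → h y (there y∈)))) (+-identityˡ 0#)

  ⅀-zero : (xs : List A) → ⅀ xs (λ _ → 0#) ≈ 0#
  ⅀-zero xs = ⅀-zero∈ xs (λ _ _ → ≈-refl)

  ⅀-++ : (xs ys : List A) (f : A → Carrier) → ⅀ (xs ++ ys) f ≈ ⅀ xs f ⊕ ⅀ ys f
  ⅀-++ []       ys f = ≈-sym (+-identityˡ _)
  ⅀-++ (x ∷ xs) ys f = ≈-trans (+-congˡ (⅀-++ xs ys f)) (≈-sym (+-assoc _ _ _))

  ⅀-map : (g : A → B) (xs : List A) (f : B → Carrier) → ⅀ (map g xs) f ≈ ⅀ xs (f ∘ g)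
  ⅀-map g []       f = ≈-refl
  ⅀-map g (x ∷ xs) f = +-congˡ (⅀-map g xs f)

  ⅀-concatMap : (g : A → List B) (xs : List A) (f : B → Carrier) →
    ⅀ (concatMap g xs) f ≈ ⅀ xs (λ x → ⅀ (g x) f)
  ⅀-concatMap g []       f = ≈-refl
  ⅀-concatMap g (x ∷ xs) f = ≈-trans (⅀-++ (g x) (concatMap g xs) f) (+-congˡ (⅀-concatMap g xs f))

  ⅀-+ : (xs : List A) (f g : A → Carrier) → ⅀ xs (λ x → f x ⊕ g x) ≈ ⅀ xs f ⊕ ⅀ xs g
  ⅀-+ []       f g = ≈-sym (+-identityˡ _)
  ⅀-+ (x ∷ xs) f g = ≈-trans (+-congˡ (⅀-+ xs f g)) (interchange _ _ _ _)

  ⅀-swap : (xs : List A) (ys : List B) (f : A → B → Carrier) →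
    ⅀ xs (λ x → ⅀ ys (f x)) ≈ ⅀ ys (λ y → ⅀ xs (λ x → f x y))
  ⅀-swap []       ys f = ≈-sym (⅀-zero ys)
  ⅀-swap (x ∷ xs) ys f = ≈-trans (+-congˡ (⅀-swap xs ys f)) (≈-sym (⅀-+ ys (f x) _))

  ⅀-*ˡ : (xs : List A) (a : Carrier) (f : A → Carrier) → a ⊗ ⅀ xs f ≈ ⅀ xs (λ x → a ⊗ f x)
  ⅀-*ˡ []       a f = zeroʳ a
  ⅀-*ˡ (x ∷ xs) a f = ≈-trans (distribˡ a _ _) (+-congˡ (⅀-*ˡ xs a f))

  ⅀-*ʳ : (xs : List A) (a : Carrier) (f : A → Carrier) → ⅀ xs f ⊗ a ≈ ⅀ xs (λ x → f x ⊗ a)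
  ⅀-*ʳ xs a f = ≈-trans (*-comm _ a) (≈-trans (⅀-*ˡ xs a f) (⅀-cong xs (λ x → *-comm a (f x))))

  ⅀-filterᵇ : (p : A → Bool) (xs : List A) (f : A → Carrier) →
    ⅀ (filterᵇ p xs) f ≈ ⅀ xs (λ x → if p x then f x else 0#)
  ⅀-filterᵇ p []       f = ≈-refl
  ⅀-filterᵇ p (x ∷ xs) f with p x
  ... | true  = +-congˡ (⅀-filterᵇ p xs f)
  ... | false = ≈-trans (⅀-filterᵇ p xs f) (≈-sym (+-identityˡ _))

  ⅀-choices : {m : ℕ} (xs : List A) (xss : Vec (List A) m) (f : Vec A (suc m) → Carrier) →
    ⅀ (choices (xs ∷ xss)) f ≈ ⅀ xs (λ x → ⅀ (choices xss) (λ v → f (x ∷ v)))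
  ⅀-choices xs xss f = ≈-trans (⅀-concatMap _ xs f) (⅀-cong xs (λ x → ⅀-map (x ∷_) (choices xss) f))

  ⅀-allFin-suc : (k : ℕ) (f : Fin (suc k) → Carrier) →
    ⅀ (allFin (suc k)) f ≈ f zero ⊕ ⅀ (allFin k) (f ∘ suc)
  ⅀-allFin-suc k f = +-congˡ (≈-trans (reflexive (cong (λ l → ⅀ l f) (≡.sym (Listₚ.map-tabulate id suc))))
                                      (⅀-map suc (allFin k) f))

  ⅀-remove : (xs ys : List A) (z : A) (f : A → Carrier) → ⅀ (xs ++ z ∷ ys) f ≈ f z ⊕ ⅀ (xs ++ ys) f
  ⅀-remove []       ys z f = ≈-refl
  ⅀-remove (x ∷ xs) ys z f = begin
    f x ⊕ ⅀ (xs ++ z ∷ ys) f     ≈⟨ +-congˡ (⅀-remove xs ys z f) ⟩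
    f x ⊕ (f z ⊕ ⅀ (xs ++ ys) f) ≈⟨ ≈-sym (+-assoc _ _ _) ⟩
    (f x ⊕ f z) ⊕ ⅀ (xs ++ ys) f ≈⟨ +-congʳ (+-comm _ _) ⟩
    (f z ⊕ f x) ⊕ ⅀ (xs ++ ys) f ≈⟨ +-assoc _ _ _ ⟩
    f z ⊕ (f x ⊕ ⅀ (xs ++ ys) f) ∎

  private
    unique-remove : (xs ys : List A) (z : A) → Unique (xs ++ z ∷ ys) → Unique (xs ++ ys) × z ∉ (xs ++ ys)
    unique-remove []       ys z (z∉ ∷ u) = u , λ z∈ → All.lookup z∉ z∈ refl
    unique-remove (x ∷ xs) ys z (x∉ ∷ u) with unique-remove xs ys z u
    ... | u' , z∉ = All.tabulate (λ w∈ → All.lookup x∉ (weaken w∈)) ∷ u'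
                  , λ { (here refl) → All.lookup x∉ (∈ₚ.∈-++⁺ʳ xs (here refl)) refl ; (there z∈) → z∉ z∈ }
      where
      weaken : ∀ {w} → w ∈ xs ++ ys → w ∈ xs ++ z ∷ ys
      weaken w∈ with ∈ₚ.∈-++⁻ xs w∈
      ... | inj₁ p = ∈ₚ.∈-++⁺ˡ p
      ... | inj₂ p = ∈ₚ.∈-++⁺ʳ xs (there p)

  ⅀-subset : (zs ys : List A) (f : A → Carrier) → Unique zs → Unique ys →
    (∀ z → z ∈ zs → z ∈ ys) → (∀ y → y ∈ ys → f y ≈ 0# ⊎ y ∈ zs) → ⅀ zs f ≈ ⅀ ys f
  ⅀-subset []       ys f _ _ _ supp = ≈-sym (⅀-zero∈ ys λ y y∈ → case0 (supp y y∈))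
    where
    case0 : ∀ {y} → f y ≈ 0# ⊎ y ∈ [] → f y ≈ 0#
    case0 (inj₁ p) = p
  ⅀-subset (z ∷ zs) ys f (z∉ ∷ uzs) uys sub supp with ∈ₚ.∈-∃++ (sub z (here refl))
  ... | as , bs , refl with unique-remove as bs z uys
  ... | u' , z∉' = ≈-trans (+-congˡ (⅀-subset zs (as ++ bs) f uzs u' sub' supp')) (≈-sym (⅀-remove as bs z f))
    where
    sub' : ∀ w → w ∈ zs → w ∈ as ++ bs
    sub' w w∈ with ∈ₚ.∈-++⁻ as (sub w (there w∈))
    ... | inj₁ p = ∈ₚ.∈-++⁺ˡ p
    ... | inj₂ (here refl) = ⊥-elim (All.lookup z∉ w∈ refl)
    ... | inj₂ (there p) = ∈ₚ.∈-++⁺ʳ as p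
    weaken : ∀ {w} → w ∈ as ++ bs → w ∈ as ++ z ∷ bs
    weaken w∈ with ∈ₚ.∈-++⁻ as w∈
    ... | inj₁ p = ∈ₚ.∈-++⁺ˡ p
    ... | inj₂ p = ∈ₚ.∈-++⁺ʳ as (there p)
    supp' : ∀ w → w ∈ as ++ bs → f w ≈ 0# ⊎ w ∈ zs
    supp' w w∈ with supp w (weaken w∈)
    ... | inj₁ p = inj₁ p
    ... | inj₂ (here refl) = ⊥-elim (z∉' w∈)
    ... | inj₂ (there p) = inj₂ p

  -- An injection may miss terms as long as these vanish. In this way sums over tuples become sums
  -- over all words, and sums over tableaux become sums over all chains of tuples.
  ⅀-reindex : (xs : List A) (ys : List B) (φ : A → B) (f : B → Carrier) → Unique xs → Unique ys →
    (∀ x x' → x ∈ xs → x' ∈ xs → φ x ≡ φ x' → x ≡ x') → (∀ x → x ∈ xs → φ x ∈ ys) →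
    (∀ y → y ∈ ys → f y ≈ 0# ⊎ (∃ λ x → x ∈ xs × φ x ≡ y)) → ⅀ xs (f ∘ φ) ≈ ⅀ ys f
  ⅀-reindex xs ys φ f uxs uys inj sub supp =
    ≈-trans (≈-sym (⅀-map φ xs f)) (⅀-subset (map φ xs) ys f (unique-map xs uxs inj) uys sub' supp')
    where
    unique-map : ∀ xs → Unique xs → (∀ x x' → x ∈ xs → x' ∈ xs → φ x ≡ φ x' → x ≡ x') → Unique (map φ xs)
    unique-map []       _        _ = []
    unique-map (x ∷ xs) (x∉ ∷ u) i = All.tabulate fresh ∷ unique-map xs u (λ a b a∈ b∈ → i a b (there a∈) (there b∈))
      where
      fresh : ∀ {y} → y ∈ map φ xs → φ x ≢ y
      fresh y∈ e with ∈ₚ.∈-map⁻ φ y∈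
      ... | x' , x'∈ , refl = All.lookup x∉ x'∈ (i x x' (here refl) (there x'∈) e)
    sub' : ∀ z → z ∈ map φ xs → z ∈ ys
    sub' z z∈ with ∈ₚ.∈-map⁻ φ z∈
    ... | x , x∈ , refl = sub x x∈
    supp' : ∀ y → y ∈ ys → f y ≈ 0# ⊎ y ∈ map φ xs
    supp' y y∈ with supp y y∈
    ... | inj₁ p = inj₁ p
    ... | inj₂ (x , x∈ , refl) = inj₂ (∈ₚ.∈-map⁺ φ x∈)

∈-choices⁺ : {A : Set} {m : ℕ} (xss : Vec (List A) m) (v : Vec A m) → (∀ i → lookup v i ∈ lookup xss i) → v ∈ choices xss
∈-choices⁺ []         []      h = here refl
∈-choices⁺ (xs ∷ xss) (x ∷ v) h =
  ∈ₚ.∈-concatMap⁺ _ (Any.map (λ { refl → ∈ₚ.∈-map⁺ (x ∷_) (∈-choices⁺ xss v (h ∘ suc)) }) (h zero))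

∈-choices⁻ : {A : Set} {m : ℕ} (xss : Vec (List A) m) (v : Vec A m) → v ∈ choices xss → ∀ i → lookup v i ∈ lookup xss i
∈-choices⁻ (xs ∷ xss) v v∈ i with Mem.find (∈ₚ.∈-concatMap⁻ (λ x → map (x ∷_) (choices xss)) {xs = xs} v∈)
... | x , x∈ , v∈' with ∈ₚ.∈-map⁻ (x ∷_) v∈'
∈-choices⁻ (xs ∷ xss) v v∈ zero    | x , x∈ , v∈' | v' , v'∈ , refl = x∈
∈-choices⁻ (xs ∷ xss) v v∈ (suc i) | x , x∈ , v∈' | v' , v'∈ , refl = ∈-choices⁻ xss v' v'∈ i

concatMap-cartesian : {A B C : Set} (f : A → B → C) (xs : List A) (ys : List B) →
  concatMap (λ x → map (f x) ys) xs ≡ cartesianProductWith f xs ys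
concatMap-cartesian f []       ys = refl
concatMap-cartesian f (x ∷ xs) ys = cong (map (f x) ys ++_) (concatMap-cartesian f xs ys)

choices-unique : {A : Set} {m : ℕ} (xss : Vec (List A) m) → (∀ i → Unique (lookup xss i)) → Unique (choices xss)
choices-unique []         u = [] ∷ []
choices-unique (xs ∷ xss) u = subst Unique (≡.sym (concatMap-cartesian _∷_ xs (choices xss)))
  (Uniqueₚ.cartesianProductWith⁺ _∷_ Vecₚ.∷-injective (u zero) (choices-unique xss (u ∘ suc)))

-- A ring solver with integer coefficients over any commutative ring.

module IntegerRingSolver {c ℓ : Level} (R : CommutativeRing c ℓ) where
  open CommutativeRing R hiding (zero) renaming (_+_ to _⊕_; _*_ to _⊗_; -_ to ⊝_; refl to ≈-refl; sym to ≈-sym; trans to ≈-trans)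
  open RingProps ring using (-‿distribˡ-*; -‿distribʳ-*)
  open AbelianProps +-abelianGroup using (⁻¹-∙-comm; ⁻¹-involutive; ε⁻¹≈ε; xyx⁻¹≈y)
  module M = MultProps semiring
  open SetoidReasoning setoid

  fromℕ : ℕ → Carrier
  fromℕ n = n M.× 1#

  fromℤ : ℤ → Carrier
  fromℤ (ℤ.+ n)    = fromℕ n
  fromℤ -[1+ n ] = ⊝ fromℕ (suc n)

  private
    from-suc : ∀ n → fromℕ (suc n) ≈ 1# ⊕ fromℕ n
    from-suc n = M.×-homo-+ 1# 1 n

    from-neg : ∀ i → fromℤ (ℤ.- i) ≈ ⊝ fromℤ i
    from-neg (ℤ.+ zero)  = ≈-sym ε⁻¹≈ε
    from-neg (ℤ.+ suc n) = ≈-refl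
    from-neg -[1+ n ]  = ≈-sym (⁻¹-involutive _)

    from-⊖ : ∀ m n → fromℤ (m ℤ.⊖ n) ≈ fromℕ m ⊕ ⊝ fromℕ n
    from-⊖ m       zero    = ≈-sym (≈-trans (+-congˡ ε⁻¹≈ε) (+-identityʳ _))
    from-⊖ zero    (suc n) = ≈-sym (+-identityˡ _)
    from-⊖ (suc m) (suc n) = begin
      fromℤ (suc m ℤ.⊖ suc n)                    ≡⟨ cong fromℤ (ℤₚ.[1+m]⊖[1+n]≡m⊖n m n) ⟩
      fromℤ (m ℤ.⊖ n)                            ≈⟨ from-⊖ m n ⟩
      fromℕ m ⊕ ⊝ fromℕ n                        ≈⟨ +-congʳ (≈-sym (xyx⁻¹≈y 1# (fromℕ m))) ⟩
      ((1# ⊕ fromℕ m) ⊕ ⊝ 1#) ⊕ ⊝ fromℕ n        ≈⟨ +-assoc _ _ _ ⟩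
      (1# ⊕ fromℕ m) ⊕ (⊝ 1# ⊕ ⊝ fromℕ n)        ≈⟨ +-cong (≈-sym (from-suc m)) (≈-trans (⁻¹-∙-comm _ _) (-‿cong (≈-sym (from-suc n)))) ⟩
      fromℕ (suc m) ⊕ ⊝ fromℕ (suc n)            ∎

    from-+ : ∀ i j → fromℤ (i ℤ.+ j) ≈ fromℤ i ⊕ fromℤ j
    from-+ (ℤ.+ m)    (ℤ.+ n)    = M.×-homo-+ 1# m n
    from-+ (ℤ.+ m)    -[1+ n ] = from-⊖ m (suc n)
    from-+ -[1+ m ] (ℤ.+ n)    = ≈-trans (from-⊖ n (suc m)) (+-comm _ _)
    from-+ -[1+ m ] -[1+ n ] = begin
      ⊝ fromℕ (suc (suc (m + n)))        ≡⟨ cong (⊝_ ∘ fromℕ ∘ suc) (≡.sym (ℕₚ.+-suc m n)) ⟩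
      ⊝ fromℕ (suc m + suc n)            ≈⟨ -‿cong (M.×-homo-+ 1# (suc m) (suc n)) ⟩
      ⊝ (fromℕ (suc m) ⊕ fromℕ (suc n))  ≈⟨ ≈-sym (⁻¹-∙-comm _ _) ⟩
      ⊝ fromℕ (suc m) ⊕ ⊝ fromℕ (suc n)  ∎

    from-* : ∀ i j → fromℤ (i ℤ.* j) ≈ fromℤ i ⊗ fromℤ j
    from-* (ℤ.+ m)    (ℤ.+ n)    = ≈-trans (reflexive (cong fromℤ (ℤₚ.+◃n≡+n (m * n)))) (M.×1-homo-* m n)
    from-* (ℤ.+ m)    -[1+ n ] = begin
      fromℤ (Sign.- ℤ.◃ (m * suc n))  ≡⟨ cong fromℤ (ℤₚ.-◃n≡-n (m * suc n)) ⟩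
      fromℤ (ℤ.- (ℤ.+ (m * suc n)))     ≈⟨ from-neg (ℤ.+ (m * suc n)) ⟩
      ⊝ fromℕ (m * suc n)             ≈⟨ -‿cong (M.×1-homo-* m (suc n)) ⟩
      ⊝ (fromℕ m ⊗ fromℕ (suc n))     ≈⟨ -‿distribʳ-* _ _ ⟩
      fromℕ m ⊗ ⊝ fromℕ (suc n)       ∎
    from-* -[1+ m ] (ℤ.+ n)    = begin
      fromℤ (Sign.- ℤ.◃ (suc m * n))  ≡⟨ cong fromℤ (ℤₚ.-◃n≡-n (suc m * n)) ⟩
      fromℤ (ℤ.- (ℤ.+ (suc m * n)))     ≈⟨ from-neg (ℤ.+ (suc m * n)) ⟩
      ⊝ fromℕ (suc m * n)             ≈⟨ -‿cong (M.×1-homo-* (suc m) n) ⟩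
      ⊝ (fromℕ (suc m) ⊗ fromℕ n)     ≈⟨ -‿distribˡ-* _ _ ⟩
      ⊝ fromℕ (suc m) ⊗ fromℕ n       ∎
    from-* -[1+ m ] -[1+ n ] = begin
      fromℕ (suc m * suc n)                  ≈⟨ M.×1-homo-* (suc m) (suc n) ⟩
      fromℕ (suc m) ⊗ fromℕ (suc n)          ≈⟨ ≈-sym (⁻¹-involutive _) ⟩
      ⊝ (⊝ (fromℕ (suc m) ⊗ fromℕ (suc n)))  ≈⟨ -‿cong (-‿distribˡ-* _ _) ⟩
      ⊝ (⊝ fromℕ (suc m) ⊗ fromℕ (suc n))    ≈⟨ -‿distribʳ-* _ _ ⟩
      ⊝ fromℕ (suc m) ⊗ ⊝ fromℕ (suc n)      ∎

    ℤ-rawRing : RawRing 0ℓ 0ℓ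
    ℤ-rawRing = CommutativeRing.rawRing ℤₚ.+-*-commutativeRing

    morphism : ℤ-rawRing -Raw-AlmostCommutative⟶ fromCommutativeRing R
    morphism = record
      { ⟦_⟧ = fromℤ ; +-homo = from-+ ; *-homo = from-* ; -‿homo = from-neg ; 0-homo = ≈-refl ; 1-homo = ≈-refl }

    -- Equality in the carrier need not be decidable. Normal forms only require comparing
    -- coefficients, and these are integers in all the identities below.
    coeff≟ : ∀ i j → Maybe (fromℤ i ≈ fromℤ j)
    coeff≟ i j with i ℤ.≟ j
    ... | yes refl = just ≈-refl
    ... | no _     = nothing

  open RingSolver ℤ-rawRing (fromCommutativeRing R) morphism coeff≟ public
    using (solve; Polynomial; _:=_; _:+_; _:*_; :-_; _:-_; con)

-- Exchange letters and the weights of a single site.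

bits : List Bool
bits = false ∷ true ∷ []

bools : (m : ℕ) → List (Vec Bool m)
bools m = choices (Vec.replicate m bits)

Letter : Set
Letter = Bool × Bool

-- A letter of a pair of queues: "ab" records whether the colour travels in both rows before (a)
-- and after (b) the exchange of the rows; 𝕏 and 𝕐 travel in the x-row, respectively the y-row, only;
-- ⋆ is a colour whose first site has not been read yet.
data Exchange : Set where
  𝟘𝟘 𝟘𝟚 𝟚𝟘 𝟚𝟚 𝕏 𝕐 ⋆ : Exchange

before after : Exchange → Letter
before 𝟘𝟘 = false , false
before 𝟘𝟚 = false , false
before 𝟚𝟘 = true , true
before 𝟚𝟚 = true , true
before 𝕏  = true , false
before 𝕐  = false , true
before ⋆  = false , false
after 𝟘𝟘 = false , false
after 𝟘𝟚 = true , true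
after 𝟚𝟘 = false , false
after 𝟚𝟚 = true , true
after 𝕏  = true , false
after 𝕐  = false , true
after ⋆  = false , false

full only : Letter → Bool
full (jx , jy) = jx ∧ jy
only (jx , jy) = jx ∧ not jy

exchanges : Letter → List Exchange
exchanges (false , false) = 𝟘𝟘 ∷ 𝟘𝟚 ∷ []
exchanges (true , true)   = 𝟚𝟘 ∷ 𝟚𝟚 ∷ []
exchanges (true , false)  = 𝕏 ∷ []
exchanges (false , true)  = 𝕐 ∷ []

lifts : List Letter → List (List Exchange)
lifts []      = [] ∷ []
lifts (c ∷ w) = concatMap (λ τ → map (τ ∷_) (lifts w)) (exchanges c)

-- A site reads, for a hidden bit h, the (bottom, top) bits of the x-row and of the y-row.
Site : Set
Site = Bool → (Bool × Bool) × (Bool × Bool)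

-- In `siteL` both rows end at the hidden bit, in `siteR` both start from it. With the y-row read
-- backwards, each of the two leads from `i` to `o`: by the x-row first in `siteL`, by the y-row
-- first in `siteR`.
siteL siteR : Bool → Bool → Site
siteL i o h = (i , h) , (o , h)
siteR i o h = (h , o) , (h , i)

-- Polymorphic in the carrier, so that the same formulas serve as terms and as solver expressions.
module Local {c} {C : Set c} (_⊕_ _⊗_ : C → C → C) (⊝_ : C → C) (0# 1# : C) where

  ⅀' : {A : Set} → List A → (A → C) → C
  ⅀' xs f = foldr _⊕_ 0# (map f xs)

  -- The bits `i` and `j` enter from below and along the row, `m` leaves at the top, and
  -- conservation fixes the outgoing bit handed to `H`; two particles of one colour never share a
  -- site. `X` stands for q to the number of other travelling colours and is charged whenever a
  -- particle is present, `x` whenever it travels on.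
  vertex : (x X : C) (i j m : Bool) (H : Bool → C) → C
  vertex x X false false false H = H false
  vertex x X false false true  H = 0#
  vertex x X false true  false H = x ⊗ (X ⊗ H true)
  vertex x X false true  true  H = X ⊗ H false
  vertex x X true  false false H = x ⊗ (X ⊗ H true)
  vertex x X true  false true  H = X ⊗ H false
  vertex x X true  true  _     H = 0#

  vertex² : (x y X Y : C) (c : Letter) (s : Site) (H : Letter → C) → C
  vertex² x y X Y (jx , jy) s H = ⅀' bits λ h →
    vertex x X (proj₁ (proj₁ (s h))) jx (proj₂ (proj₁ (s h))) λ ex →
    vertex y Y (proj₁ (proj₂ (s h))) jy (proj₂ (proj₂ (s h))) λ ey → H (ex , ey)

  -- Powers of q whose exponents count the letters of a word: full before (`a`), full after (`b`),
  -- not full after (`c'`), travelling in the x-row only (`p`), in the y-row only (`n`). So the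
  -- queues weigh a p and a n before the exchange, b p and b n after it, and b c' is q to the length
  -- of the word.
  record Counts : Set c where
    constructor ⟨_,_,_,_,_⟩
    field a b c' p n : C

  sq : C → C
  sq a = a ⊗ a

  _^ᵇ_ : C → Bool → C
  q ^ᵇ true  = q
  q ^ᵇ false = 1#

  _+ₑ_ : C → Exchange → Counts → Counts
  (q +ₑ τ) ⟨ a , b , c' , p , n ⟩ =
    ⟨ (q ^ᵇ full (before τ)) ⊗ a , (q ^ᵇ full (after τ)) ⊗ b , (q ^ᵇ not (full (after τ))) ⊗ c' , (q ^ᵇ only (before τ)) ⊗ p , (q ^ᵇ only (swap (before τ))) ⊗ n ⟩

  -- For a word of length l this is (1 - z t^l) t^l. At z = x y it is the source of the factors 1 -
  -- x y t^m.
  v : C → Counts → C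
  v z ⟨ a , b , c' , p , n ⟩ = (1# ⊕ (⊝ (z ⊗ sq (b ⊗ c')))) ⊗ sq (b ⊗ c')

  -- R z (τ ∷ u) = α · R z u + β · R (z q²) u
  α β : Exchange → C → Counts → C
  α 𝟘𝟘 z k = v z k
  α 𝟘𝟚 z k = ⊝ v z k
  α _  z k = 0#
  β 𝟘𝟘 z _ = 0#
  β 𝟘𝟚 z ⟨ a , b , c' , p , n ⟩ = sq a ⊗ sq c'
  β 𝟚𝟘 z ⟨ a , b , c' , p , n ⟩ = (p ⊗ n) ⊗ (sq a ⊗ sq (b ⊗ c'))
  β 𝟚𝟚 z ⟨ a , b , c' , p , n ⟩ = ⊝ ((p ⊗ n) ⊗ (sq a ⊗ sq (b ⊗ c')))
  β 𝕏  z ⟨ a , b , c' , p , n ⟩ = n ⊗ (sq a ⊗ (sq c' ⊗ b))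
  β 𝕐  z ⟨ a , b , c' , p , n ⟩ = p ⊗ (sq a ⊗ (sq c' ⊗ b))
  β ⋆  z ⟨ a , b , c' , p , n ⟩ = sq a ⊗ sq c'

  left : Exchange → C → Counts → C → C → C
  left τ z k r₀ r₁ = (α τ z k ⊗ r₀) ⊕ (β τ z k ⊗ r₁)

  -- R z (u ∷ʳ τ) in terms of R z u and R (z q²) u, for 𝟚𝟘 multiplied by z
  right : Exchange → C → Counts → C → C → C
  right 𝟘𝟘 z k r₀ r₁ = v z k ⊗ r₀
  right 𝟘𝟚 z ⟨ a , b , c' , p , n ⟩ r₀ r₁ = z ⊗ (((p ⊗ n) ⊗ (sq a ⊗ sq (b ⊗ c'))) ⊗ r₁)
  right 𝟚𝟘 z k@(⟨ a , b , c' , p , n ⟩) r₀ r₁ = (sq (b ⊗ c') ⊗ r₁) ⊕ (⊝ (v z k ⊗ r₀))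
  right 𝟚𝟚 z ⟨ a , b , c' , p , n ⟩ r₀ r₁ = ⊝ (((p ⊗ n) ⊗ (sq a ⊗ sq (b ⊗ c'))) ⊗ r₁)
  right 𝕏  z ⟨ a , b , c' , p , n ⟩ r₀ r₁ = (n ⊗ (a ⊗ sq (b ⊗ c'))) ⊗ r₁
  right 𝕐  z ⟨ a , b , c' , p , n ⟩ r₀ r₁ = (p ⊗ (a ⊗ sq (b ⊗ c'))) ⊗ r₁
  right ⋆  z k r₀ r₁ = 0#

  -- The values of R at u ∷ʳ τ and at τ ∷ u, in terms of r = R (xy) (u ∷ʳ 𝟚𝟘) and ω = R (xy q²) u.
  outer inner : (x y r ω : C) → Counts → Exchange → C
  outer x y r ω ⟨ a , b , c' , p , n ⟩ 𝟘𝟘 = (sq (b ⊗ c') ⊗ ω) ⊕ (⊝ ((x ⊗ y) ⊗ r))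
  outer x y r ω k 𝟚𝟘 = r
  outer x y r ω k τ  = right τ (x ⊗ y) k ω ω
  inner x y r ω ⟨ a , b , c' , p , n ⟩ 𝟘𝟘 = (sq (b ⊗ c') ⊗ ω) ⊕ (⊝ ((x ⊗ y) ⊗ r))
  inner x y r ω ⟨ a , b , c' , p , n ⟩ 𝟘𝟚 =
    (⊝ ((sq (b ⊗ c') ⊗ ω) ⊕ (⊝ ((x ⊗ y) ⊗ r)))) ⊕ ((sq a ⊗ sq c') ⊗ ω)
  inner x y r ω k τ  = β τ (x ⊗ y) k ⊗ ω

  -- A site reads the letter `c` at the head of the queue and hands an outcome to `G`. In
  -- `exchangeL` the rows are exchanged after the site, in `exchangeR` before it. The other letters
  -- are held fixed and enter through their counts and the values `r` of ℛ.
  exchangeL exchangeR : (x y : C) (k : Counts) (c : Letter) (i o : Bool) (G : Letter → C) → (Exchange → C) → C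
  exchangeL x y ⟨ a , b , c' , p , n ⟩ c i o G r =
    vertex² x y (a ⊗ p) (a ⊗ n) c (siteL i o) λ d → ⅀' (exchanges d) λ τ → r τ ⊗ G (after τ)
  exchangeR x y ⟨ a , b , c' , p , n ⟩ c i o G r =
    ⅀' (exchanges c) λ τ → r τ ⊗ vertex² x y (b ⊗ p) (b ⊗ n) (after τ) (siteR i o) G

  exchange⋆ : (x y : C) (k : Counts) (o : Bool) (G : Letter → C) → (Exchange → C) → C
  exchange⋆ x y ⟨ a , b , c' , p , n ⟩ o G r =
    r ⋆ ⊗ vertex² x y (b ⊗ p) (b ⊗ n) (false , false) (siteR true o) G

  values : (g₀ g₂ gₚ gₙ : C) → Letter → C
  values g₀ g₂ gₚ gₙ (false , false) = g₀
  values g₀ g₂ gₚ gₙ (true , true)   = g₂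
  values g₀ g₂ gₚ gₙ (true , false)  = gₚ
  values g₀ g₂ gₚ gₙ (false , true)  = gₙ

-- The intertwiner ℛ and its exchange relation at one site.

module RowOperators {c ℓ : Level} (R : CommutativeRing c ℓ) (q : CommutativeRing.Carrier R) where
  open CommutativeRing R hiding (zero) renaming (_+_ to _⊕_; _*_ to _⊗_; -_ to ⊝_; refl to ≈-refl; sym to ≈-sym; trans to ≈-trans)
  open FiniteSum commutativeSemiring
  open IntegerRingSolver R
  open SetoidReasoning setoid
  open Local _⊕_ _⊗_ ⊝_ 0# 1#

  q² : Carrier
  q² = q ⊗ q

  counts : List Exchange → Counts
  counts []      = ⟨ 1# , 1# , 1# , 1# , 1# ⟩
  counts (τ ∷ u) = (q +ₑ τ) (counts u)

  ℛ : Carrier → List Exchange → Carrier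
  ℛ z []      = 1#
  ℛ z (τ ∷ u) = left τ z (counts u) (ℛ z u) (ℛ (z ⊗ q²) u)

  record _≈ᶜ_ (k k' : Counts) : Set ℓ where
    constructor mk
    private
      module K = Counts k
      module K' = Counts k'
    field
      a≈ : K.a ≈ K'.a
      b≈ : K.b ≈ K'.b
      c≈ : K.c' ≈ K'.c'
      p≈ : K.p ≈ K'.p
      n≈ : K.n ≈ K'.n

  counts-∷ʳ : ∀ u τ → counts (u ∷ʳ τ) ≈ᶜ (q +ₑ τ) (counts u)
  counts-∷ʳ []      τ = mk ≈-refl ≈-refl ≈-refl ≈-refl ≈-refl
  counts-∷ʳ (σ ∷ u) τ with counts-∷ʳ u τ
  ... | mk a b c' p n = mk (commute a) (commute b) (commute c') (commute p) (commute n)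
    where
    commute : ∀ {s t k k'} → k ≈ t ⊗ k' → s ⊗ k ≈ t ⊗ (s ⊗ k')
    commute {s} {t} {k' = k'} e = ≈-trans (*-congˡ e) (solve 3 (λ s t k → s :* (t :* k) := t :* (s :* k)) ≈-refl s t k')

  v-cong : ∀ z {k k'} → k ≈ᶜ k' → v z k ≈ v z k'
  v-cong z (mk a b c' p n) = *-cong (+-congˡ (-‿cong (*-congˡ bc))) bc
    where bc = *-cong (*-cong b c') (*-cong b c')

  α-cong : ∀ τ z {k k'} → k ≈ᶜ k' → α τ z k ≈ α τ z k'
  α-cong 𝟘𝟘 z e = v-cong z e
  α-cong 𝟘𝟚 z e = -‿cong (v-cong z e)
  α-cong 𝟚𝟘 z e = ≈-refl
  α-cong 𝟚𝟚 z e = ≈-refl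
  α-cong 𝕏  z e = ≈-refl
  α-cong 𝕐  z e = ≈-refl
  α-cong ⋆  z e = ≈-refl

  β-cong : ∀ τ z {k k'} → k ≈ᶜ k' → β τ z k ≈ β τ z k'
  β-cong 𝟘𝟘 z e = ≈-refl
  β-cong 𝟘𝟚 z (mk a b c' p n) = *-cong (*-cong a a) (*-cong c' c')
  β-cong 𝟚𝟘 z (mk a b c' p n) = *-cong (*-cong p n) (*-cong (*-cong a a) (*-cong (*-cong b c') (*-cong b c')))
  β-cong 𝟚𝟚 z (mk a b c' p n) = -‿cong (*-cong (*-cong p n) (*-cong (*-cong a a) (*-cong (*-cong b c') (*-cong b c'))))
  β-cong 𝕏  z (mk a b c' p n) = *-cong n (*-cong (*-cong a a) (*-cong (*-cong c' c') b))
  β-cong 𝕐  z (mk a b c' p n) = *-cong p (*-cong (*-cong a a) (*-cong (*-cong c' c') b))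
  β-cong ⋆  z (mk a b c' p n) = *-cong (*-cong a a) (*-cong c' c')

  left-cong : ∀ τ z {k k' r₀ r₀' r₁ r₁'} → k ≈ᶜ k' → r₀ ≈ r₀' → r₁ ≈ r₁' → left τ z k r₀ r₁ ≈ left τ z k' r₀' r₁'
  left-cong τ z e e₀ e₁ = +-cong (*-cong (α-cong τ z e) e₀) (*-cong (β-cong τ z e) e₁)

  private
    Poly : ℕ → Set
    Poly = Polynomial
    module Sym {n} = Local {C = Poly n} _:+_ _:*_ :-_ (con (ℤ.+ 0)) (con (ℤ.+ 1))
    open Sym using () renaming (left to :left; right to :right; _+ₑ_ to _:+ₑ_; α to :α; β to :β; inner to :inner; outer to :outer;
      exchangeL to :exchangeL; exchangeR to :exchangeR; exchange⋆ to :exchange⋆; values to :values)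

    peel : (σ τ : Exchange) → Poly 10 → Poly 10 → Poly 10 → Poly 10 → Poly 10 → Poly 10 → Poly 10 → Poly 10 → Poly 10 → Poly 10 → Poly 10 × Poly 10
    peel σ τ q z a b c' p n r₀ r₁ r₂ =
      let k = Sym.⟨ a , b , c' , p , n ⟩ ; z' = z :* (q :* q) in
      :left σ z ((q :+ₑ τ) k) (:right τ z k r₀ r₁) (:right τ z' k r₁ r₂)
      := :right τ z ((q :+ₑ σ) k) (:left σ z k r₀ r₁) (:left σ z' k r₁ r₂)

    -- Peeling `σ` from the left and `τ` from the right may be done in either order. Each peeling
    -- keeps the parameter or multiplies it by q², so `r₀`, `r₁`, `r₂` (the values of ℛ at z, z q²,
    -- z q⁴) are all that can occur. The letter `𝟚𝟘` is excluded since `right 𝟚𝟘` computes z times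
    -- the value, and `⋆` since it never stands at the end of a queue.
    peel-step : ∀ σ τ → τ ≢ 𝟚𝟘 → τ ≢ ⋆ → ∀ z k r₀ r₁ r₂ →
      left σ z ((q +ₑ τ) k) (right τ z k r₀ r₁) (right τ (z ⊗ q²) k r₁ r₂)
      ≈ right τ z ((q +ₑ σ) k) (left σ z k r₀ r₁) (left σ (z ⊗ q²) k r₁ r₂)
    peel-step 𝟘𝟘 𝟘𝟘 _ _ z ⟨ a , b , c' , p , n ⟩ r₀ r₁ r₂ = solve 10 (peel 𝟘𝟘 𝟘𝟘) ≈-refl q z a b c' p n r₀ r₁ r₂
    peel-step 𝟘𝟚 𝟘𝟘 _ _ z ⟨ a , b , c' , p , n ⟩ r₀ r₁ r₂ = solve 10 (peel 𝟘𝟚 𝟘𝟘) ≈-refl q z a b c' p n r₀ r₁ r₂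
    peel-step 𝟚𝟘 𝟘𝟘 _ _ z ⟨ a , b , c' , p , n ⟩ r₀ r₁ r₂ = solve 10 (peel 𝟚𝟘 𝟘𝟘) ≈-refl q z a b c' p n r₀ r₁ r₂
    peel-step 𝟚𝟚 𝟘𝟘 _ _ z ⟨ a , b , c' , p , n ⟩ r₀ r₁ r₂ = solve 10 (peel 𝟚𝟚 𝟘𝟘) ≈-refl q z a b c' p n r₀ r₁ r₂
    peel-step 𝕏 𝟘𝟘 _ _ z ⟨ a , b , c' , p , n ⟩ r₀ r₁ r₂ = solve 10 (peel 𝕏 𝟘𝟘) ≈-refl q z a b c' p n r₀ r₁ r₂
    peel-step 𝕐 𝟘𝟘 _ _ z ⟨ a , b , c' , p , n ⟩ r₀ r₁ r₂ = solve 10 (peel 𝕐 𝟘𝟘) ≈-refl q z a b c' p n r₀ r₁ r₂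
    peel-step ⋆ 𝟘𝟘 _ _ z ⟨ a , b , c' , p , n ⟩ r₀ r₁ r₂ = solve 10 (peel ⋆ 𝟘𝟘) ≈-refl q z a b c' p n r₀ r₁ r₂
    peel-step 𝟘𝟘 𝟘𝟚 _ _ z ⟨ a , b , c' , p , n ⟩ r₀ r₁ r₂ = solve 10 (peel 𝟘𝟘 𝟘𝟚) ≈-refl q z a b c' p n r₀ r₁ r₂
    peel-step 𝟘𝟚 𝟘𝟚 _ _ z ⟨ a , b , c' , p , n ⟩ r₀ r₁ r₂ = solve 10 (peel 𝟘𝟚 𝟘𝟚) ≈-refl q z a b c' p n r₀ r₁ r₂
    peel-step 𝟚𝟘 𝟘𝟚 _ _ z ⟨ a , b , c' , p , n ⟩ r₀ r₁ r₂ = solve 10 (peel 𝟚𝟘 𝟘𝟚) ≈-refl q z a b c' p n r₀ r₁ r₂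
    peel-step 𝟚𝟚 𝟘𝟚 _ _ z ⟨ a , b , c' , p , n ⟩ r₀ r₁ r₂ = solve 10 (peel 𝟚𝟚 𝟘𝟚) ≈-refl q z a b c' p n r₀ r₁ r₂
    peel-step 𝕏 𝟘𝟚 _ _ z ⟨ a , b , c' , p , n ⟩ r₀ r₁ r₂ = solve 10 (peel 𝕏 𝟘𝟚) ≈-refl q z a b c' p n r₀ r₁ r₂
    peel-step 𝕐 𝟘𝟚 _ _ z ⟨ a , b , c' , p , n ⟩ r₀ r₁ r₂ = solve 10 (peel 𝕐 𝟘𝟚) ≈-refl q z a b c' p n r₀ r₁ r₂
    peel-step ⋆ 𝟘𝟚 _ _ z ⟨ a , b , c' , p , n ⟩ r₀ r₁ r₂ = solve 10 (peel ⋆ 𝟘𝟚) ≈-refl q z a b c' p n r₀ r₁ r₂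
    peel-step 𝟘𝟘 𝟚𝟚 _ _ z ⟨ a , b , c' , p , n ⟩ r₀ r₁ r₂ = solve 10 (peel 𝟘𝟘 𝟚𝟚) ≈-refl q z a b c' p n r₀ r₁ r₂
    peel-step 𝟘𝟚 𝟚𝟚 _ _ z ⟨ a , b , c' , p , n ⟩ r₀ r₁ r₂ = solve 10 (peel 𝟘𝟚 𝟚𝟚) ≈-refl q z a b c' p n r₀ r₁ r₂
    peel-step 𝟚𝟘 𝟚𝟚 _ _ z ⟨ a , b , c' , p , n ⟩ r₀ r₁ r₂ = solve 10 (peel 𝟚𝟘 𝟚𝟚) ≈-refl q z a b c' p n r₀ r₁ r₂
    peel-step 𝟚𝟚 𝟚𝟚 _ _ z ⟨ a , b , c' , p , n ⟩ r₀ r₁ r₂ = solve 10 (peel 𝟚𝟚 𝟚𝟚) ≈-refl q z a b c' p n r₀ r₁ r₂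
    peel-step 𝕏 𝟚𝟚 _ _ z ⟨ a , b , c' , p , n ⟩ r₀ r₁ r₂ = solve 10 (peel 𝕏 𝟚𝟚) ≈-refl q z a b c' p n r₀ r₁ r₂
    peel-step 𝕐 𝟚𝟚 _ _ z ⟨ a , b , c' , p , n ⟩ r₀ r₁ r₂ = solve 10 (peel 𝕐 𝟚𝟚) ≈-refl q z a b c' p n r₀ r₁ r₂
    peel-step ⋆ 𝟚𝟚 _ _ z ⟨ a , b , c' , p , n ⟩ r₀ r₁ r₂ = solve 10 (peel ⋆ 𝟚𝟚) ≈-refl q z a b c' p n r₀ r₁ r₂
    peel-step 𝟘𝟘 𝕏 _ _ z ⟨ a , b , c' , p , n ⟩ r₀ r₁ r₂ = solve 10 (peel 𝟘𝟘 𝕏) ≈-refl q z a b c' p n r₀ r₁ r₂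
    peel-step 𝟘𝟚 𝕏 _ _ z ⟨ a , b , c' , p , n ⟩ r₀ r₁ r₂ = solve 10 (peel 𝟘𝟚 𝕏) ≈-refl q z a b c' p n r₀ r₁ r₂
    peel-step 𝟚𝟘 𝕏 _ _ z ⟨ a , b , c' , p , n ⟩ r₀ r₁ r₂ = solve 10 (peel 𝟚𝟘 𝕏) ≈-refl q z a b c' p n r₀ r₁ r₂
    peel-step 𝟚𝟚 𝕏 _ _ z ⟨ a , b , c' , p , n ⟩ r₀ r₁ r₂ = solve 10 (peel 𝟚𝟚 𝕏) ≈-refl q z a b c' p n r₀ r₁ r₂
    peel-step 𝕏 𝕏 _ _ z ⟨ a , b , c' , p , n ⟩ r₀ r₁ r₂ = solve 10 (peel 𝕏 𝕏) ≈-refl q z a b c' p n r₀ r₁ r₂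
    peel-step 𝕐 𝕏 _ _ z ⟨ a , b , c' , p , n ⟩ r₀ r₁ r₂ = solve 10 (peel 𝕐 𝕏) ≈-refl q z a b c' p n r₀ r₁ r₂
    peel-step ⋆ 𝕏 _ _ z ⟨ a , b , c' , p , n ⟩ r₀ r₁ r₂ = solve 10 (peel ⋆ 𝕏) ≈-refl q z a b c' p n r₀ r₁ r₂
    peel-step 𝟘𝟘 𝕐 _ _ z ⟨ a , b , c' , p , n ⟩ r₀ r₁ r₂ = solve 10 (peel 𝟘𝟘 𝕐) ≈-refl q z a b c' p n r₀ r₁ r₂
    peel-step 𝟘𝟚 𝕐 _ _ z ⟨ a , b , c' , p , n ⟩ r₀ r₁ r₂ = solve 10 (peel 𝟘𝟚 𝕐) ≈-refl q z a b c' p n r₀ r₁ r₂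
    peel-step 𝟚𝟘 𝕐 _ _ z ⟨ a , b , c' , p , n ⟩ r₀ r₁ r₂ = solve 10 (peel 𝟚𝟘 𝕐) ≈-refl q z a b c' p n r₀ r₁ r₂
    peel-step 𝟚𝟚 𝕐 _ _ z ⟨ a , b , c' , p , n ⟩ r₀ r₁ r₂ = solve 10 (peel 𝟚𝟚 𝕐) ≈-refl q z a b c' p n r₀ r₁ r₂
    peel-step 𝕏 𝕐 _ _ z ⟨ a , b , c' , p , n ⟩ r₀ r₁ r₂ = solve 10 (peel 𝕏 𝕐) ≈-refl q z a b c' p n r₀ r₁ r₂
    peel-step 𝕐 𝕐 _ _ z ⟨ a , b , c' , p , n ⟩ r₀ r₁ r₂ = solve 10 (peel 𝕐 𝕐) ≈-refl q z a b c' p n r₀ r₁ r₂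
    peel-step ⋆ 𝕐 _ _ z ⟨ a , b , c' , p , n ⟩ r₀ r₁ r₂ = solve 10 (peel ⋆ 𝕐) ≈-refl q z a b c' p n r₀ r₁ r₂
    peel-step _ 𝟚𝟘 ne _ _ _ _ _ _ = ⊥-elim (ne refl)
    peel-step _ ⋆ _ ne _ _ _ _ _ = ⊥-elim (ne refl)

    peel𝟚𝟘 : (σ : Exchange) → Poly 10 → Poly 10 → Poly 10 → Poly 10 → Poly 10 → Poly 10 → Poly 10 → Poly 10 → Poly 10 → Poly 10 → Poly 10 × Poly 10
    peel𝟚𝟘 σ q z a b c' p n r₀ r₁ r₂ =
      let k = Sym.⟨ a , b , c' , p , n ⟩ ; z' = z :* (q :* q) in
      (:α σ z ((q :+ₑ 𝟚𝟘) k) :* :right 𝟚𝟘 z k r₀ r₁) :+ (((q :* q) :* :β σ z k) :* :right 𝟚𝟘 z' k r₁ r₂)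
      := :right 𝟚𝟘 z ((q :+ₑ σ) k) (:left σ z k r₀ r₁) (:left σ z' k r₁ r₂)

    peel𝟚𝟘-step : ∀ σ z k r₀ r₁ r₂ →
      (α σ z ((q +ₑ 𝟚𝟘) k) ⊗ right 𝟚𝟘 z k r₀ r₁) ⊕ ((q² ⊗ β σ z k) ⊗ right 𝟚𝟘 (z ⊗ q²) k r₁ r₂)
      ≈ right 𝟚𝟘 z ((q +ₑ σ) k) (left σ z k r₀ r₁) (left σ (z ⊗ q²) k r₁ r₂)
    peel𝟚𝟘-step 𝟘𝟘 z ⟨ a , b , c' , p , n ⟩ r₀ r₁ r₂ = solve 10 (peel𝟚𝟘 𝟘𝟘) ≈-refl q z a b c' p n r₀ r₁ r₂
    peel𝟚𝟘-step 𝟘𝟚 z ⟨ a , b , c' , p , n ⟩ r₀ r₁ r₂ = solve 10 (peel𝟚𝟘 𝟘𝟚) ≈-refl q z a b c' p n r₀ r₁ r₂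
    peel𝟚𝟘-step 𝟚𝟘 z ⟨ a , b , c' , p , n ⟩ r₀ r₁ r₂ = solve 10 (peel𝟚𝟘 𝟚𝟘) ≈-refl q z a b c' p n r₀ r₁ r₂
    peel𝟚𝟘-step 𝟚𝟚 z ⟨ a , b , c' , p , n ⟩ r₀ r₁ r₂ = solve 10 (peel𝟚𝟘 𝟚𝟚) ≈-refl q z a b c' p n r₀ r₁ r₂
    peel𝟚𝟘-step 𝕏 z ⟨ a , b , c' , p , n ⟩ r₀ r₁ r₂ = solve 10 (peel𝟚𝟘 𝕏) ≈-refl q z a b c' p n r₀ r₁ r₂
    peel𝟚𝟘-step 𝕐 z ⟨ a , b , c' , p , n ⟩ r₀ r₁ r₂ = solve 10 (peel𝟚𝟘 𝕐) ≈-refl q z a b c' p n r₀ r₁ r₂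
    peel𝟚𝟘-step ⋆ z ⟨ a , b , c' , p , n ⟩ r₀ r₁ r₂ = solve 10 (peel𝟚𝟘 ⋆) ≈-refl q z a b c' p n r₀ r₁ r₂

    -- Every coefficient β is divisible by a², whence the extra letter 𝟚𝟘 contributes a factor q⁴,
    -- half of which turns z into the parameter z q² of the second term.
    shift𝟚𝟘 : (σ : Exchange) → Poly 9 → Poly 9 → Poly 9 → Poly 9 → Poly 9 → Poly 9 → Poly 9 → Poly 9 → Poly 9 → Poly 9 × Poly 9
    shift𝟚𝟘 σ q z a b c' p n s₀ s₁ =
      let k = Sym.⟨ a , b , c' , p , n ⟩ in
      z :* :left σ z ((q :+ₑ 𝟚𝟘) k) s₀ s₁
      := (:α σ z ((q :+ₑ 𝟚𝟘) k) :* (z :* s₀)) :+ (((q :* q) :* :β σ z k) :* ((z :* (q :* q)) :* s₁))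

    shift𝟚𝟘-step : ∀ σ z k s₀ s₁ → z ⊗ left σ z ((q +ₑ 𝟚𝟘) k) s₀ s₁
      ≈ (α σ z ((q +ₑ 𝟚𝟘) k) ⊗ (z ⊗ s₀)) ⊕ ((q² ⊗ β σ z k) ⊗ ((z ⊗ q²) ⊗ s₁))
    shift𝟚𝟘-step 𝟘𝟘 z ⟨ a , b , c' , p , n ⟩ s₀ s₁ = solve 9 (shift𝟚𝟘 𝟘𝟘) ≈-refl q z a b c' p n s₀ s₁
    shift𝟚𝟘-step 𝟘𝟚 z ⟨ a , b , c' , p , n ⟩ s₀ s₁ = solve 9 (shift𝟚𝟘 𝟘𝟚) ≈-refl q z a b c' p n s₀ s₁
    shift𝟚𝟘-step 𝟚𝟘 z ⟨ a , b , c' , p , n ⟩ s₀ s₁ = solve 9 (shift𝟚𝟘 𝟚𝟘) ≈-refl q z a b c' p n s₀ s₁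
    shift𝟚𝟘-step 𝟚𝟚 z ⟨ a , b , c' , p , n ⟩ s₀ s₁ = solve 9 (shift𝟚𝟘 𝟚𝟚) ≈-refl q z a b c' p n s₀ s₁
    shift𝟚𝟘-step 𝕏 z ⟨ a , b , c' , p , n ⟩ s₀ s₁ = solve 9 (shift𝟚𝟘 𝕏) ≈-refl q z a b c' p n s₀ s₁
    shift𝟚𝟘-step 𝕐 z ⟨ a , b , c' , p , n ⟩ s₀ s₁ = solve 9 (shift𝟚𝟘 𝕐) ≈-refl q z a b c' p n s₀ s₁
    shift𝟚𝟘-step ⋆ z ⟨ a , b , c' , p , n ⟩ s₀ s₁ = solve 9 (shift𝟚𝟘 ⋆) ≈-refl q z a b c' p n s₀ s₁

    base : (τ : Exchange) → Poly 2 → Poly 2 → Poly 2 × Poly 2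
    base τ q z = let k = Sym.⟨ con (ℤ.+ 1) , con (ℤ.+ 1) , con (ℤ.+ 1) , con (ℤ.+ 1) , con (ℤ.+ 1) ⟩ in
      :left τ z k (con (ℤ.+ 1)) (con (ℤ.+ 1)) := :right τ z k (con (ℤ.+ 1)) (con (ℤ.+ 1))

  -- A site removes a letter at the head of the queue but appends one at its end, so the defining
  -- recursion from the left needs a counterpart from the right. Induction on the word reduces it to
  -- `peel-step`.
  ℛ-∷ʳ : ∀ u τ → τ ≢ 𝟚𝟘 → τ ≢ ⋆ → ∀ z → ℛ z (u ∷ʳ τ) ≈ right τ z (counts u) (ℛ z u) (ℛ (z ⊗ q²) u)
  ℛ-∷ʳ [] 𝟘𝟘 _ _ z = solve 2 (base 𝟘𝟘) ≈-refl q z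
  ℛ-∷ʳ [] 𝟘𝟚 _ _ z = solve 1 (λ z → :left 𝟘𝟚 z Sym.⟨ con (ℤ.+ 1) , con (ℤ.+ 1) , con (ℤ.+ 1) , con (ℤ.+ 1) , con (ℤ.+ 1) ⟩ (con (ℤ.+ 1)) (con (ℤ.+ 1))
                          := :right 𝟘𝟚 z Sym.⟨ con (ℤ.+ 1) , con (ℤ.+ 1) , con (ℤ.+ 1) , con (ℤ.+ 1) , con (ℤ.+ 1) ⟩ (con (ℤ.+ 1)) (con (ℤ.+ 1))) ≈-refl z
  ℛ-∷ʳ [] 𝟚𝟘 ne _ z = ⊥-elim (ne refl)
  ℛ-∷ʳ [] 𝟚𝟚 _ _ z = solve 2 (base 𝟚𝟚) ≈-refl q z
  ℛ-∷ʳ [] 𝕏  _ _ z = solve 2 (base 𝕏) ≈-refl q z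
  ℛ-∷ʳ [] 𝕐  _ _ z = solve 2 (base 𝕐) ≈-refl q z
  ℛ-∷ʳ [] ⋆  _ ne z = ⊥-elim (ne refl)
  ℛ-∷ʳ (σ ∷ u) τ ne ne' z = ≈-trans
    (left-cong σ z (counts-∷ʳ u τ) (ℛ-∷ʳ u τ ne ne' z) (ℛ-∷ʳ u τ ne ne' (z ⊗ q²)))
    (peel-step σ τ ne ne' z (counts u) _ _ _)

  -- The formula for ℛ itself would require division by z, which is x y in the application and has
  -- no inverse there.
  ℛ-∷ʳ𝟚𝟘 : ∀ u z → z ⊗ ℛ z (u ∷ʳ 𝟚𝟘) ≈ right 𝟚𝟘 z (counts u) (ℛ z u) (ℛ (z ⊗ q²) u)
  ℛ-∷ʳ𝟚𝟘 [] z = solve 1 (λ z → z :* :left 𝟚𝟘 z Sym.⟨ con (ℤ.+ 1) , con (ℤ.+ 1) , con (ℤ.+ 1) , con (ℤ.+ 1) , con (ℤ.+ 1) ⟩ (con (ℤ.+ 1)) (con (ℤ.+ 1))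
                          := :right 𝟚𝟘 z Sym.⟨ con (ℤ.+ 1) , con (ℤ.+ 1) , con (ℤ.+ 1) , con (ℤ.+ 1) , con (ℤ.+ 1) ⟩ (con (ℤ.+ 1)) (con (ℤ.+ 1))) ≈-refl z
  ℛ-∷ʳ𝟚𝟘 (σ ∷ u) z = begin
    z ⊗ ℛ z (σ ∷ (u ∷ʳ 𝟚𝟘))
      ≈⟨ *-congˡ (left-cong σ z (counts-∷ʳ u 𝟚𝟘) ≈-refl ≈-refl) ⟩
    z ⊗ left σ z ((q +ₑ 𝟚𝟘) (counts u)) (ℛ z (u ∷ʳ 𝟚𝟘)) (ℛ (z ⊗ q²) (u ∷ʳ 𝟚𝟘))
      ≈⟨ shift𝟚𝟘-step σ z (counts u) _ _ ⟩
    (α σ z ((q +ₑ 𝟚𝟘) (counts u)) ⊗ (z ⊗ ℛ z (u ∷ʳ 𝟚𝟘))) ⊕ ((q² ⊗ β σ z (counts u)) ⊗ ((z ⊗ q²) ⊗ ℛ (z ⊗ q²) (u ∷ʳ 𝟚𝟘)))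
      ≈⟨ +-cong (*-congˡ (ℛ-∷ʳ𝟚𝟘 u z)) (*-congˡ (ℛ-∷ʳ𝟚𝟘 u (z ⊗ q²))) ⟩
    _ ≈⟨ peel𝟚𝟘-step σ z (counts u) _ _ _ ⟩
    right 𝟚𝟘 z (counts (σ ∷ u)) (ℛ z (σ ∷ u)) (ℛ (z ⊗ q²) (σ ∷ u)) ∎

  private
    exch : Letter → Bool → Bool → Poly 13 → Poly 13 → Poly 13 → Poly 13 → Poly 13 → Poly 13 → Poly 13 → Poly 13 → Poly 13 → Poly 13 → Poly 13 → Poly 13 → Poly 13 → Poly 13 × Poly 13
    exch c i o x y a b c' p n r ω g₀ g₂ gₚ gₙ =
      let k = Sym.⟨ a , b , c' , p , n ⟩ in
      :exchangeL x y k c i o (:values g₀ g₂ gₚ gₙ) (:outer x y r ω k)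
      := :exchangeR x y k c i o (:values g₀ g₂ gₚ gₙ) (:inner x y r ω k)

    exch⋆ : Bool → Poly 13 → Poly 13 → Poly 13 → Poly 13 → Poly 13 → Poly 13 → Poly 13 → Poly 13 → Poly 13 → Poly 13 → Poly 13 → Poly 13 → Poly 13 → Poly 13 × Poly 13
    exch⋆ o x y a b c' p n r ω g₀ g₂ gₚ gₙ =
      let k = Sym.⟨ a , b , c' , p , n ⟩ in
      :exchangeL x y k (false , false) true o (:values g₀ g₂ gₚ gₙ) (:outer x y r ω k)
      := :exchange⋆ x y k o (:values g₀ g₂ gₚ gₙ) (:inner x y r ω k)

  vertex-cong : ∀ x {X X'} i j m {H H' : Bool → Carrier} → X ≈ X' → (∀ e → H e ≈ H' e) →
    vertex x X i j m H ≈ vertex x X' i j m H'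
  vertex-cong x false false false eX eH = eH false
  vertex-cong x false false true  eX eH = ≈-refl
  vertex-cong x false true  false eX eH = *-congˡ (*-cong eX (eH true))
  vertex-cong x false true  true  eX eH = *-cong eX (eH false)
  vertex-cong x true  false false eX eH = *-congˡ (*-cong eX (eH true))
  vertex-cong x true  false true  eX eH = *-cong eX (eH false)
  vertex-cong x true  true  m     eX eH = ≈-refl

  vertex-⅀ : ∀ {A : Set} (U : List A) x X i j m (H : Bool → A → Carrier) →
    vertex x X i j m (λ e → ⅀ U (H e)) ≈ ⅀ U (λ u → vertex x X i j m (λ e → H e u))
  vertex-⅀ U x X false false false H = ≈-refl
  vertex-⅀ U x X false false true  H = ≈-sym (⅀-zero U)
  vertex-⅀ U x X false true  false H = ≈-trans (*-congˡ (⅀-*ˡ U X _)) (⅀-*ˡ U x _)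
  vertex-⅀ U x X false true  true  H = ⅀-*ˡ U X _
  vertex-⅀ U x X true  false false H = ≈-trans (*-congˡ (⅀-*ˡ U X _)) (⅀-*ˡ U x _)
  vertex-⅀ U x X true  false true  H = ⅀-*ˡ U X _
  vertex-⅀ U x X true  true  m     H = ≈-sym (⅀-zero U)

  vertex²-cong : ∀ x y {X X' Y Y'} c s {H H' : Letter → Carrier} → X ≈ X' → Y ≈ Y' → (∀ d → H d ≈ H' d) →
    vertex² x y X Y c s H ≈ vertex² x y X' Y' c s H'
  vertex²-cong x y (jx , jy) s eX eY eH = ⅀-cong bits λ h →
    vertex-cong x (proj₁ (proj₁ (s h))) jx (proj₂ (proj₁ (s h))) eX λ ex →
    vertex-cong y (proj₁ (proj₂ (s h))) jy (proj₂ (proj₂ (s h))) eY λ ey → eH (ex , ey)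

  vertex²-⅀ : ∀ {A : Set} (U : List A) x y X Y c s (H : Letter → A → Carrier) →
    vertex² x y X Y c s (λ d → ⅀ U (H d)) ≈ ⅀ U (λ u → vertex² x y X Y c s (λ d → H d u))
  vertex²-⅀ U x y X Y (jx , jy) s H = ≈-trans
    (⅀-cong bits λ h → ≈-trans
      (vertex-cong x (proj₁ (proj₁ (s h))) jx (proj₂ (proj₁ (s h))) ≈-refl
        (λ ex → vertex-⅀ U y Y (proj₁ (proj₂ (s h))) jy (proj₂ (proj₂ (s h))) (λ ey → H (ex , ey))))
      (vertex-⅀ U x X (proj₁ (proj₁ (s h))) jx (proj₂ (proj₁ (s h))) _))
    (⅀-swap bits U (λ h u → vertex x X (proj₁ (proj₁ (s h))) jx (proj₂ (proj₁ (s h))) λ ex →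
      vertex y Y (proj₁ (proj₂ (s h))) jy (proj₂ (proj₂ (s h))) λ ey → H (ex , ey) u))

  exchangeL-cong : ∀ x y k c i o {G G' r r'} → (∀ d → G d ≈ G' d) → (∀ τ → τ ≢ ⋆ → r τ ≈ r' τ) →
    exchangeL x y k c i o G r ≈ exchangeL x y k c i o G' r'
  exchangeL-cong x y ⟨ a , b , c' , p , n ⟩ c i o eG er = vertex²-cong x y c (siteL i o) ≈-refl ≈-refl
    λ d → ⅀-cong∈ (exchanges d) λ τ τ∈ → *-cong (er τ (λ { refl → ⋆∉exchanges d τ∈ })) (eG (after τ))
    where
    ⋆∉exchanges : ∀ d → ⋆ ∉ exchanges d
    ⋆∉exchanges (false , false) (there (there ()))
    ⋆∉exchanges (true , true)   (there (there ()))
    ⋆∉exchanges (true , false)  (there ())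
    ⋆∉exchanges (false , true)  (there ())

  exchangeR-cong : ∀ x y k c i o {G G' r r'} → (∀ d → G d ≈ G' d) → (∀ τ → r τ ≈ r' τ) →
    exchangeR x y k c i o G r ≈ exchangeR x y k c i o G' r'
  exchangeR-cong x y ⟨ a , b , c' , p , n ⟩ c i o eG er = ⅀-cong (exchanges c)
    λ τ → *-cong (er τ) (vertex²-cong x y (after τ) (siteR i o) ≈-refl ≈-refl eG)

  private
    values-η : ∀ (G : Letter → Carrier) d → G d ≈ values (G (false , false)) (G (true , true)) (G (true , false)) (G (false , true)) d
    values-η G (false , false) = ≈-refl
    values-η G (false , true)  = ≈-refl
    values-η G (true , false)  = ≈-refl
    values-η G (true , true)   = ≈-refl

    -- Once the values of ℛ are expressed through `r` and `ω` and the continuation through its four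
    -- values, the exchange relation is a polynomial identity for each of the sixteen choices of
    -- letter and boundary bits.
    exchange-values : ∀ x y k c i o g₀ g₂ gₚ gₙ r ω →
      exchangeL x y k c i o (values g₀ g₂ gₚ gₙ) (outer x y r ω k) ≈ exchangeR x y k c i o (values g₀ g₂ gₚ gₙ) (inner x y r ω k)
    exchange-values x y ⟨ a , b , c' , p , n ⟩ (false , false) false false g₀ g₂ gₚ gₙ r ω = solve 13 (exch (false , false) false false) ≈-refl x y a b c' p n r ω g₀ g₂ gₚ gₙ
    exchange-values x y ⟨ a , b , c' , p , n ⟩ (false , false) false true g₀ g₂ gₚ gₙ r ω = solve 13 (exch (false , false) false true) ≈-refl x y a b c' p n r ω g₀ g₂ gₚ gₙ
    exchange-values x y ⟨ a , b , c' , p , n ⟩ (false , false) true false g₀ g₂ gₚ gₙ r ω = solve 13 (exch (false , false) true false) ≈-refl x y a b c' p n r ω g₀ g₂ gₚ gₙ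
    exchange-values x y ⟨ a , b , c' , p , n ⟩ (false , false) true true g₀ g₂ gₚ gₙ r ω = solve 13 (exch (false , false) true true) ≈-refl x y a b c' p n r ω g₀ g₂ gₚ gₙ
    exchange-values x y ⟨ a , b , c' , p , n ⟩ (false , true) false false g₀ g₂ gₚ gₙ r ω = solve 13 (exch (false , true) false false) ≈-refl x y a b c' p n r ω g₀ g₂ gₚ gₙ
    exchange-values x y ⟨ a , b , c' , p , n ⟩ (false , true) false true g₀ g₂ gₚ gₙ r ω = solve 13 (exch (false , true) false true) ≈-refl x y a b c' p n r ω g₀ g₂ gₚ gₙ
    exchange-values x y ⟨ a , b , c' , p , n ⟩ (false , true) true false g₀ g₂ gₚ gₙ r ω = solve 13 (exch (false , true) true false) ≈-refl x y a b c' p n r ω g₀ g₂ gₚ gₙ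
    exchange-values x y ⟨ a , b , c' , p , n ⟩ (false , true) true true g₀ g₂ gₚ gₙ r ω = solve 13 (exch (false , true) true true) ≈-refl x y a b c' p n r ω g₀ g₂ gₚ gₙ
    exchange-values x y ⟨ a , b , c' , p , n ⟩ (true , false) false false g₀ g₂ gₚ gₙ r ω = solve 13 (exch (true , false) false false) ≈-refl x y a b c' p n r ω g₀ g₂ gₚ gₙ
    exchange-values x y ⟨ a , b , c' , p , n ⟩ (true , false) false true g₀ g₂ gₚ gₙ r ω = solve 13 (exch (true , false) false true) ≈-refl x y a b c' p n r ω g₀ g₂ gₚ gₙ
    exchange-values x y ⟨ a , b , c' , p , n ⟩ (true , false) true false g₀ g₂ gₚ gₙ r ω = solve 13 (exch (true , false) true false) ≈-refl x y a b c' p n r ω g₀ g₂ gₚ gₙ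
    exchange-values x y ⟨ a , b , c' , p , n ⟩ (true , false) true true g₀ g₂ gₚ gₙ r ω = solve 13 (exch (true , false) true true) ≈-refl x y a b c' p n r ω g₀ g₂ gₚ gₙ
    exchange-values x y ⟨ a , b , c' , p , n ⟩ (true , true) false false g₀ g₂ gₚ gₙ r ω = solve 13 (exch (true , true) false false) ≈-refl x y a b c' p n r ω g₀ g₂ gₚ gₙ
    exchange-values x y ⟨ a , b , c' , p , n ⟩ (true , true) false true g₀ g₂ gₚ gₙ r ω = solve 13 (exch (true , true) false true) ≈-refl x y a b c' p n r ω g₀ g₂ gₚ gₙ
    exchange-values x y ⟨ a , b , c' , p , n ⟩ (true , true) true false g₀ g₂ gₚ gₙ r ω = solve 13 (exch (true , true) true false) ≈-refl x y a b c' p n r ω g₀ g₂ gₚ gₙ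
    exchange-values x y ⟨ a , b , c' , p , n ⟩ (true , true) true true g₀ g₂ gₚ gₙ r ω = solve 13 (exch (true , true) true true) ≈-refl x y a b c' p n r ω g₀ g₂ gₚ gₙ

    -- After the exchange the y-row has top bit `true`. This forces the hidden bit to be `true` for
    -- `𝟘𝟘` and `false` for `𝟘𝟚`; in both cases exactly one particle is present in each row and the
    -- weights agree. So the two letters can be merged, and their coefficients add up to a² c'² ω,
    -- the coefficient of `⋆`.
    exchange⋆-values : ∀ x y k o g₀ g₂ gₚ gₙ r ω →
      exchangeL x y k (false , false) true o (values g₀ g₂ gₚ gₙ) (outer x y r ω k) ≈ exchange⋆ x y k o (values g₀ g₂ gₚ gₙ) (inner x y r ω k)
    exchange⋆-values x y ⟨ a , b , c' , p , n ⟩ false g₀ g₂ gₚ gₙ r ω = solve 13 (exch⋆ false) ≈-refl x y a b c' p n r ω g₀ g₂ gₚ gₙ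
    exchange⋆-values x y ⟨ a , b , c' , p , n ⟩ true g₀ g₂ gₚ gₙ r ω = solve 13 (exch⋆ true) ≈-refl x y a b c' p n r ω g₀ g₂ gₚ gₙ

  private
    -- The value ℛ z u occurs only for `𝟘𝟘`, and there multiplied by `v`. The recursion for `𝟚𝟘` at
    -- the right end trades this product for an expression in r and ω, without any division.
    outer-value : ∀ x y u τ → τ ≢ ⋆ →
      ℛ (x ⊗ y) (u ∷ʳ τ) ≈ outer x y (ℛ (x ⊗ y) (u ∷ʳ 𝟚𝟘)) (ℛ ((x ⊗ y) ⊗ q²) u) (counts u) τ
    outer-value x y u 𝟘𝟘 ne = begin
      ℛ z (u ∷ʳ 𝟘𝟘)                       ≈⟨ ℛ-∷ʳ u 𝟘𝟘 (λ ()) (λ ()) z ⟩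
      V                                   ≈⟨ solve 2 (λ v m → v := m :+ (:- (m :+ (:- v)))) ≈-refl V W ⟩
      W ⊕ (⊝ (W ⊕ (⊝ V)))                 ≈⟨ +-congˡ (-‿cong (≈-sym (ℛ-∷ʳ𝟚𝟘 u z))) ⟩
      W ⊕ (⊝ (z ⊗ ℛ z (u ∷ʳ 𝟚𝟘)))         ∎
      where
      z = x ⊗ y
      V = v z (counts u) ⊗ ℛ z u
      W = sq (Counts.b (counts u) ⊗ Counts.c' (counts u)) ⊗ ℛ (z ⊗ q²) u
    outer-value x y u 𝟘𝟚 ne = ℛ-∷ʳ u 𝟘𝟚 (λ ()) (λ ()) _
    outer-value x y u 𝟚𝟘 ne = ≈-refl
    outer-value x y u 𝟚𝟚 ne = ℛ-∷ʳ u 𝟚𝟚 (λ ()) (λ ()) _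
    outer-value x y u 𝕏  ne = ℛ-∷ʳ u 𝕏 (λ ()) (λ ()) _
    outer-value x y u 𝕐  ne = ℛ-∷ʳ u 𝕐 (λ ()) (λ ()) _
    outer-value x y u ⋆  ne = ⊥-elim (ne refl)

    inner-value : ∀ x y u τ →
      ℛ (x ⊗ y) (τ ∷ u) ≈ inner x y (ℛ (x ⊗ y) (u ∷ʳ 𝟚𝟘)) (ℛ ((x ⊗ y) ⊗ q²) u) (counts u) τ
    inner-value x y u 𝟘𝟘 = begin
      (V ⊗ ℛ z u) ⊕ (0# ⊗ ω)       ≈⟨ solve 3 (λ v r ω → (v :* r) :+ (con (ℤ.+ 0) :* ω) := v :* r) ≈-refl V (ℛ z u) ω ⟩
      -- Prepending `𝟘𝟘` and appending it both multiply by `v`, so the value is already known from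
      -- `outer-value`.
      V ⊗ ℛ z u                    ≈⟨ ≈-sym (ℛ-∷ʳ u 𝟘𝟘 (λ ()) (λ ()) z) ⟩
      ℛ z (u ∷ʳ 𝟘𝟘)                ≈⟨ outer-value x y u 𝟘𝟘 (λ ()) ⟩
      _                            ∎
      where
      z = x ⊗ y
      ω = ℛ (z ⊗ q²) u
      V = v z (counts u)
    inner-value x y u 𝟘𝟚 = begin
      ((⊝ V) ⊗ ℛ z u) ⊕ (b ⊗ ω)    ≈⟨ solve 4 (λ v r b ω → ((:- v) :* r) :+ (b :* ω) := (:- (v :* r)) :+ (b :* ω)) ≈-refl V (ℛ z u) b ω ⟩
      (⊝ (V ⊗ ℛ z u)) ⊕ (b ⊗ ω)    ≈⟨ +-congʳ (-‿cong (≈-sym (ℛ-∷ʳ u 𝟘𝟘 (λ ()) (λ ()) z))) ⟩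
      (⊝ ℛ z (u ∷ʳ 𝟘𝟘)) ⊕ (b ⊗ ω)  ≈⟨ +-congʳ (-‿cong (outer-value x y u 𝟘𝟘 (λ ()))) ⟩
      _                            ∎
      where
      z = x ⊗ y
      ω = ℛ (z ⊗ q²) u
      V = v z (counts u)
      b = β 𝟘𝟚 z (counts u)
    inner-value x y u 𝟚𝟘 = ≈-trans (+-congʳ (zeroˡ _)) (+-identityˡ _)
    inner-value x y u 𝟚𝟚 = ≈-trans (+-congʳ (zeroˡ _)) (+-identityˡ _)
    inner-value x y u 𝕏  = ≈-trans (+-congʳ (zeroˡ _)) (+-identityˡ _)
    inner-value x y u 𝕐  = ≈-trans (+-congʳ (zeroˡ _)) (+-identityˡ _)
    inner-value x y u ⋆  = ≈-trans (+-congʳ (zeroˡ _)) (+-identityˡ _)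

  -- A relation of Yang-Baxter type: ℛ passes one site while the letter being read moves from the
  -- head of the queue to its end.
  exchange : ∀ x y u c i o (G : Letter → Carrier) →
    exchangeL x y (counts u) c i o G (λ τ → ℛ (x ⊗ y) (u ∷ʳ τ)) ≈ exchangeR x y (counts u) c i o G (λ τ → ℛ (x ⊗ y) (τ ∷ u))
  exchange x y u c i o G = begin
    _ ≈⟨ exchangeL-cong x y (counts u) c i o (values-η G) (outer-value x y u) ⟩
    _ ≈⟨ exchange-values x y (counts u) c i o _ _ _ _ _ _ ⟩
    _ ≈⟨ exchangeR-cong x y (counts u) c i o (λ d → ≈-sym (values-η G d)) (λ τ → ≈-sym (inner-value x y u τ)) ⟩
    _ ∎

  exchange-first : ∀ x y u o (G : Letter → Carrier) →
    exchangeL x y (counts u) (false , false) true o G (λ τ → ℛ (x ⊗ y) (u ∷ʳ τ)) ≈ exchange⋆ x y (counts u) o G (λ τ → ℛ (x ⊗ y) (τ ∷ u))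
  exchange-first x y u o G = begin
    _ ≈⟨ exchangeL-cong x y (counts u) (false , false) true o (values-η G) (outer-value x y u) ⟩
    _ ≈⟨ exchange⋆-values x y (counts u) o _ _ _ _ _ _ ⟩
    _ ≈⟨ *-cong (≈-sym (inner-value x y u ⋆)) (vertex²-cong x y (false , false) (siteR true o) ≈-refl ≈-refl (λ d → ≈-sym (values-η G d))) ⟩
    _ ∎

-- Words of letters, rows of sites and pairs of rows.

exchange-only : ∀ τ → only (before τ) ≡ only (after τ) × only (swap (before τ)) ≡ only (swap (after τ))
exchange-only 𝟘𝟘 = refl , refl
exchange-only 𝟘𝟚 = refl , refl
exchange-only 𝟚𝟘 = refl , refl
exchange-only 𝟚𝟚 = refl , refl
exchange-only 𝕏  = refl , refl
exchange-only 𝕐  = refl , refl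
exchange-only ⋆  = refl , refl

exchanges-before : ∀ c τ → τ ∈ exchanges c → before τ ≡ c
exchanges-before (false , false) _ (here refl)         = refl
exchanges-before (false , false) _ (there (here refl)) = refl
exchanges-before (true , true)   _ (here refl)         = refl
exchanges-before (true , true)   _ (there (here refl)) = refl
exchanges-before (true , false)  _ (here refl)         = refl
exchanges-before (false , true)  _ (here refl)         = refl

lifts-before : ∀ w u → u ∈ lifts w → map before u ≡ w
lifts-before []      _ (here refl) = refl
lifts-before (c ∷ w) u u∈ with Mem.find (∈ₚ.∈-concatMap⁻ (λ τ → map (τ ∷_) (lifts w)) {xs = exchanges c} u∈)
... | τ , τ∈ , u∈' with ∈ₚ.∈-map⁻ (τ ∷_) u∈'
... | u' , u'∈ , refl = cong₂ _∷_ (exchanges-before c τ τ∈) (lifts-before w u' u'∈)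

module RowProducts {c ℓ : Level} (R : CommutativeRing c ℓ) (q : CommutativeRing.Carrier R) where
  open CommutativeRing R hiding (zero) renaming (_+_ to _⊕_; _*_ to _⊗_; -_ to ⊝_; refl to ≈-refl; sym to ≈-sym; trans to ≈-trans)
  open FiniteSum commutativeSemiring
  open IntegerRingSolver R
  open SetoidReasoning setoid
  open Exp semiring renaming (_^_ to _↑_)
  open Local _⊕_ _⊗_ ⊝_ 0# 1#
  open RowOperators R q

  qcount : List Bool → Carrier
  qcount []      = 1#
  qcount (b ∷ Q) = (q ^ᵇ b) ⊗ qcount Q

  -- Weight of the row with bottom bits is and top bits ms, read from left to right; the queue
  -- holds the travelling bits of the colours, that of the next site first.
  row : {m : ℕ} → Carrier → (List Bool → Carrier) → List Bool → Vec Bool m → Vec Bool m → Carrier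
  row x E Q       []       []       = E Q
  row x E []      (_ ∷ _)  (_ ∷ _)  = 0#
  row x E (j ∷ Q) (i ∷ is) (m ∷ ms) = vertex x (qcount Q) i j m (λ e → row x E (Q ∷ʳ e) is ms)

  row² : {m : ℕ} → Carrier → Carrier → (List Bool → List Bool → Carrier) → List Letter → Vec Site m → Carrier
  row² x y E w       []       = E (map proj₁ w) (map proj₂ w)
  row² x y E []      (_ ∷ _)  = 0#
  row² x y E (c ∷ w) (s ∷ ss) = vertex² x y (qcount (map proj₁ w)) (qcount (map proj₂ w)) c s (λ d → row² x y E (w ∷ʳ d) ss)

  vertex-congʰ : ∀ x X i j m {H H' : Bool → Carrier} → (∀ e → H e ≈ H' e) → vertex x X i j m H ≈ vertex x X i j m H'
  vertex-congʰ x X i j m = vertex-cong x i j m ≈-refl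

  length-∷ʳ : {A : Set} (Q : List A) (e : A) → length (Q ∷ʳ e) ≡ suc (length Q)
  length-∷ʳ Q e = ≡.trans (Listₚ.length-++ Q) (ℕₚ.+-comm (length Q) 1)

  row-cong : ∀ {m} x {E E'} Q (is ms : Vec Bool m) → (∀ Q' → length Q' ≡ length Q → E Q' ≈ E' Q') → row x E Q is ms ≈ row x E' Q is ms
  row-cong x Q       []       []       h = h Q refl
  row-cong x []      (_ ∷ _)  (_ ∷ _)  h = ≈-refl
  row-cong x (j ∷ Q) (i ∷ is) (m ∷ ms) h = vertex-cong x i j m ≈-refl
    (λ e → row-cong x (Q ∷ʳ e) is ms (λ Q' eq → h Q' (≡.trans eq (length-∷ʳ Q e))))

  vertex-*ˡ : ∀ a x X i j m H → vertex x X i j m (λ e → a ⊗ H e) ≈ a ⊗ vertex x X i j m H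
  vertex-*ˡ a x X false false false H = ≈-refl
  vertex-*ˡ a x X false false true  H = ≈-sym (zeroʳ a)
  vertex-*ˡ a x X false true  false H = solve 4 (λ a x X h → x :* (X :* (a :* h)) := a :* (x :* (X :* h))) ≈-refl a x X (H true)
  vertex-*ˡ a x X false true  true  H = solve 3 (λ a X h → X :* (a :* h) := a :* (X :* h)) ≈-refl a X (H false)
  vertex-*ˡ a x X true  false false H = solve 4 (λ a x X h → x :* (X :* (a :* h)) := a :* (x :* (X :* h))) ≈-refl a x X (H true)
  vertex-*ˡ a x X true  false true  H = solve 3 (λ a X h → X :* (a :* h) := a :* (X :* h)) ≈-refl a X (H false)
  vertex-*ˡ a x X true  true  m     H = ≈-sym (zeroʳ a)

  vertex-+ : ∀ x X i j m H H' → vertex x X i j m (λ e → H e ⊕ H' e) ≈ vertex x X i j m H ⊕ vertex x X i j m H'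
  vertex-+ x X false false false H H' = ≈-refl
  vertex-+ x X false false true  H H' = ≈-sym (+-identityˡ _)
  vertex-+ x X false true  false H H' = ≈-trans (*-congˡ (distribˡ X _ _)) (distribˡ x _ _)
  vertex-+ x X false true  true  H H' = distribˡ X _ _
  vertex-+ x X true  false false H H' = ≈-trans (*-congˡ (distribˡ X _ _)) (distribˡ x _ _)
  vertex-+ x X true  false true  H H' = distribˡ X _ _
  vertex-+ x X true  true  m     H H' = ≈-sym (+-identityˡ _)

  row-*ˡ : ∀ {m} a x E Q (is ms : Vec Bool m) → row x (λ Q → a ⊗ E Q) Q is ms ≈ a ⊗ row x E Q is ms
  row-*ˡ a x E Q       []       []       = ≈-refl
  row-*ˡ a x E []      (_ ∷ _)  (_ ∷ _)  = ≈-sym (zeroʳ a)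
  row-*ˡ a x E (j ∷ Q) (i ∷ is) (m ∷ ms) = ≈-trans
    (vertex-cong x i j m ≈-refl (λ e → row-*ˡ a x E (Q ∷ʳ e) is ms)) (vertex-*ˡ a x _ i j m _)

  row-+ : ∀ {m} x E E' Q (is ms : Vec Bool m) → row x (λ Q → E Q ⊕ E' Q) Q is ms ≈ row x E Q is ms ⊕ row x E' Q is ms
  row-+ x E E' Q       []       []       = ≈-refl
  row-+ x E E' []      (_ ∷ _)  (_ ∷ _)  = ≈-sym (+-identityˡ _)
  row-+ x E E' (j ∷ Q) (i ∷ is) (m ∷ ms) = ≈-trans
    (vertex-cong x i j m ≈-refl (λ e → row-+ x E E' (Q ∷ʳ e) is ms)) (vertex-+ x _ i j m _ _)

  row-0 : ∀ {m} x Q (is ms : Vec Bool m) → row x (λ _ → 0#) Q is ms ≈ 0#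
  row-0 x Q is ms = ≈-trans (row-cong x Q is ms (λ _ _ → ≈-sym (zeroˡ 0#))) (≈-trans (row-*ˡ 0# x (λ _ → 0#) Q is ms) (zeroˡ _))

  row-++ : ∀ {m m'} x E Q (is ms : Vec Bool m) (is' ms' : Vec Bool m') →
    row x E Q (is Vec.++ is') (ms Vec.++ ms') ≈ row x (λ Q' → row x E Q' is' ms') Q is ms
  row-++ x E Q       []       []       is' ms' = ≈-refl
  row-++ x E []      (_ ∷ _)  (_ ∷ _)  is' ms' = ≈-refl
  row-++ x E (j ∷ Q) (i ∷ is) (m ∷ ms) is' ms' = vertex-cong x i j m ≈-refl (λ e → row-++ x E (Q ∷ʳ e) is ms is' ms')

  row-vertex : ∀ {m} x y Y i j h Q (is ms : Vec Bool m) (E : Bool → List Bool → Carrier) →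
    row x (λ Q' → vertex y Y i j h (λ e → E e Q')) Q is ms ≈ vertex y Y i j h (λ e → row x (E e) Q is ms)
  row-vertex x y Y false false false Q is ms E = ≈-refl
  row-vertex x y Y false false true  Q is ms E = row-0 x Q is ms
  row-vertex x y Y false true  false Q is ms E = ≈-trans (row-*ˡ y x _ Q is ms) (*-congˡ (row-*ˡ Y x _ Q is ms))
  row-vertex x y Y false true  true  Q is ms E = row-*ˡ Y x _ Q is ms
  row-vertex x y Y true  false false Q is ms E = ≈-trans (row-*ˡ y x _ Q is ms) (*-congˡ (row-*ˡ Y x _ Q is ms))
  row-vertex x y Y true  false true  Q is ms E = row-*ˡ Y x _ Q is ms
  row-vertex x y Y true  true  h     Q is ms E = row-0 x Q is ms

  bottomˣ topˣ bottomʸ topʸ : ∀ {m} → Vec Site m → Vec Bool m → Vec Bool m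
  bottomˣ = Vec.zipWith (λ s h → proj₁ (proj₁ (s h)))
  topˣ    = Vec.zipWith (λ s h → proj₂ (proj₁ (s h)))
  bottomʸ = Vec.zipWith (λ s h → proj₁ (proj₂ (s h)))
  topʸ    = Vec.zipWith (λ s h → proj₂ (proj₂ (s h)))

  -- The weights of the y-row do not involve the x-queue, so a vertex of the y-row can be moved past
  -- the rest of the x-row (`row-vertex`). This collects each row in one piece and leaves a single
  -- sum over all hidden bits.
  row²-expand : ∀ {m} x y E w (ss : Vec Site m) → row² x y E w ss ≈
    ⅀ (bools m) (λ hs → row x (λ Q → row y (E Q) (map proj₂ w) (bottomʸ ss hs) (topʸ ss hs)) (map proj₁ w) (bottomˣ ss hs) (topˣ ss hs))
  row²-expand x y E w []       = ≈-sym (+-identityʳ _)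
  row²-expand {suc m} x y E [] (s ∷ ss) = ≈-sym (⅀-zero∈ (bools (suc m)) (λ { (h ∷ hs) _ → ≈-refl }))
  row²-expand {suc m} x y E ((jx , jy) ∷ w) (s ∷ ss) = begin
    row² x y E ((jx , jy) ∷ w) (s ∷ ss)
      ≈⟨ ⅀-cong bits (λ h → vertex-congʰ x X (i h) jx (t h) λ ex → vertex-congʰ y Y (i' h) jy (t' h) λ ey →
           row²-expand x y E (w ∷ʳ (ex , ey)) ss) ⟩
    ⅀ bits (λ h → vertex x X (i h) jx (t h) λ ex → vertex y Y (i' h) jy (t' h) λ ey →
      ⅀ (bools m) (λ hs → Tm (w ∷ʳ (ex , ey)) hs))
      ≈⟨ ⅀-cong bits (λ h → ≈-trans
           (vertex-congʰ x X (i h) jx (t h) λ ex → vertex-⅀ (bools m) y Y (i' h) jy (t' h) (λ ey → Tm (w ∷ʳ (ex , ey))))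
           (vertex-⅀ (bools m) x X (i h) jx (t h) (λ ex hs → vertex y Y (i' h) jy (t' h) λ ey → Tm (w ∷ʳ (ex , ey)) hs))) ⟩
    ⅀ bits (λ h → ⅀ (bools m) (λ hs → vertex x X (i h) jx (t h) λ ex → vertex y Y (i' h) jy (t' h) λ ey → Tm (w ∷ʳ (ex , ey)) hs))
      ≈⟨ ⅀-cong bits (λ h → ⅀-cong (bools m) (first h)) ⟩
    ⅀ bits (λ h → ⅀ (bools m) (λ hs → row x (λ Q → row y (E Q) (jy ∷ map proj₂ w) (bottomʸ (s ∷ ss) (h ∷ hs)) (topʸ (s ∷ ss) (h ∷ hs)))
      (jx ∷ map proj₁ w) (bottomˣ (s ∷ ss) (h ∷ hs)) (topˣ (s ∷ ss) (h ∷ hs))))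
      ≈⟨ ≈-sym (⅀-choices bits (Vec.replicate m bits) _) ⟩
    _ ∎
    where
    X = qcount (map proj₁ w)
    Y = qcount (map proj₂ w)
    i t i' t' : Bool → Bool
    i h  = proj₁ (proj₁ (s h))
    t h  = proj₂ (proj₁ (s h))
    i' h = proj₁ (proj₂ (s h))
    t' h = proj₂ (proj₂ (s h))
    Tm : List Letter → Vec Bool m → Carrier
    Tm w' hs = row x (λ Q → row y (E Q) (map proj₂ w') (bottomʸ ss hs) (topʸ ss hs)) (map proj₁ w') (bottomˣ ss hs) (topˣ ss hs)
    split : ∀ hs ex ey → Tm (w ∷ʳ (ex , ey)) hs ≡
      row x (λ Q → row y (E Q) (map proj₂ w ∷ʳ ey) (bottomʸ ss hs) (topʸ ss hs)) (map proj₁ w ∷ʳ ex) (bottomˣ ss hs) (topˣ ss hs)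
    first : ∀ h hs → vertex x X (i h) jx (t h) (λ ex → vertex y Y (i' h) jy (t' h) (λ ey → Tm (w ∷ʳ (ex , ey)) hs))
      ≈ row x (λ Q → row y (E Q) (jy ∷ map proj₂ w) (bottomʸ (s ∷ ss) (h ∷ hs)) (topʸ (s ∷ ss) (h ∷ hs)))
          (jx ∷ map proj₁ w) (bottomˣ (s ∷ ss) (h ∷ hs)) (topˣ (s ∷ ss) (h ∷ hs))
    first h hs = vertex-congʰ x X (i h) jx (t h) λ ex → ≈-trans
      (vertex-congʰ y Y (i' h) jy (t' h) λ ey → reflexive (split hs ex ey))
      (≈-sym (row-vertex x y Y (i' h) jy (t' h) (map proj₁ w ∷ʳ ex) (bottomˣ ss hs) (topˣ ss hs)
        (λ ey Q → row y (E Q) (map proj₂ w ∷ʳ ey) (bottomʸ ss hs) (topʸ ss hs))))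
    split hs ex ey rewrite Listₚ.map-++ proj₁ w ((ex , ey) ∷ []) | Listₚ.map-++ proj₂ w ((ex , ey) ∷ []) = refl

  private
    q-split : ∀ c → (q ^ᵇ proj₁ c ≈ (q ^ᵇ full c) ⊗ (q ^ᵇ only c)) × (q ^ᵇ proj₂ c ≈ (q ^ᵇ full c) ⊗ (q ^ᵇ only (swap c)))
    q-split (false , false) = ≈-sym (*-identityˡ _) , ≈-sym (*-identityˡ _)
    q-split (false , true)  = ≈-sym (*-identityˡ _) , ≈-sym (*-identityˡ _)
    q-split (true , false)  = ≈-sym (*-identityˡ _) , ≈-sym (*-identityˡ _)
    q-split (true , true)   = ≈-sym (*-identityʳ _) , ≈-sym (*-identityʳ _)

    merge : ∀ {s t f o a b} → s ≈ f ⊗ o → t ≈ a ⊗ b → s ⊗ t ≈ (f ⊗ a) ⊗ (o ⊗ b)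
    merge {f = f} {o} {a} {b} e e' = ≈-trans (*-cong e e')
      (solve 4 (λ f o a b → (f :* o) :* (a :* b) := (f :* a) :* (o :* b)) ≈-refl f o a b)

  counts-before : ∀ u → let open Counts (counts u) in
    (qcount (map proj₁ (map before u)) ≈ a ⊗ p) × (qcount (map proj₂ (map before u)) ≈ a ⊗ n)
  counts-before []      = ≈-sym (*-identityˡ _) , ≈-sym (*-identityˡ _)
  counts-before (τ ∷ u) = merge (proj₁ (q-split (before τ))) (proj₁ (counts-before u))
                        , merge (proj₂ (q-split (before τ))) (proj₂ (counts-before u))

  counts-after : ∀ u → let open Counts (counts u) in
    (qcount (map proj₁ (map after u)) ≈ b ⊗ p) × (qcount (map proj₂ (map after u)) ≈ b ⊗ n)
  counts-after []      = ≈-sym (*-identityˡ _) , ≈-sym (*-identityˡ _)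
  counts-after (τ ∷ u) rewrite proj₁ (exchange-only τ) | proj₂ (exchange-only τ) =
    merge (proj₁ (q-split (after τ))) (proj₁ (counts-after u)) , merge (proj₂ (q-split (after τ))) (proj₂ (counts-after u))

  vacant : List Bool → Carrier
  vacant []          = 1#
  vacant (true ∷ Q)  = 0#
  vacant (false ∷ Q) = vacant Q

  vacant² : List Bool → List Bool → Carrier
  vacant² Q Q' = vacant Q ⊗ vacant Q'

  vacant-zeros : ∀ k → vacant (replicate k false) ≡ 1#
  vacant-zeros zero    = refl
  vacant-zeros (suc k) = vacant-zeros k

  vacantRow : ∀ {m} → ℕ → Carrier → Vec Bool m → Vec Bool m → Carrier
  vacantRow k x = row x vacant (replicate k false)

  -- This is q^(k(k-1)), the value of ℛ on k letters `⋆`. It also divides the value on k letters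
  -- `𝟘𝟘` and is cancelled in the end.
  triangle : ℕ → Carrier
  triangle zero    = 1#
  triangle (suc k) = sq (q ↑ k) ⊗ triangle k

-- The exchange of two rows and its boundary terms.

module Commutation {c ℓ : Level} (R : CommutativeRing c ℓ) (q x y : CommutativeRing.Carrier R) where
  open CommutativeRing R hiding (zero) renaming (_+_ to _⊕_; _*_ to _⊗_; -_ to ⊝_; refl to ≈-refl; sym to ≈-sym; trans to ≈-trans)
  open FiniteSum commutativeSemiring
  open IntegerRingSolver R
  open SetoidReasoning setoid
  open Exp semiring renaming (_^_ to _↑_)
  open Local _⊕_ _⊗_ ⊝_ 0# 1#
  open RowOperators R q
  open RowProducts R q

  z : Carrier
  z = x ⊗ y

  qX qY : List Letter → Carrier
  qX w = qcount (map proj₁ w)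
  qY w = qcount (map proj₂ w)

  private
    reweigh : ∀ {X X' Y Y'} c s (H : Letter → Carrier) → X ≈ X' → Y ≈ Y' → vertex² x y X Y c s H ≈ vertex² x y X' Y' c s H
    reweigh c s H eX eY = vertex²-cong x y c s {H} {H} eX eY (λ _ → ≈-refl)

    -- The words in `U` are spectators of the site: the one-letter relation holds for each of them
    -- separately, since all have the same queues before the exchange and thus the same weights on
    -- the left.
    exchange-lifts : ∀ (U : List (List Exchange)) w c i o (H : List Exchange → Letter → Carrier) → (∀ u → u ∈ U → map before u ≡ w) →
      vertex² x y (qX w) (qY w) c (siteL i o) (λ d → ⅀ U λ u → ⅀ (exchanges d) λ τ → ℛ z (u ∷ʳ τ) ⊗ H u (after τ))
      ≈ ⅀ (exchanges c) λ τ → ⅀ U λ u → ℛ z (τ ∷ u) ⊗ vertex² x y (qX (map after u)) (qY (map after u)) (after τ) (siteR i o) (H u)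
    exchange-lifts U w c i o H hyp = begin
      _ ≈⟨ vertex²-⅀ U x y (qX w) (qY w) c (siteL i o) (λ d u → ⅀ (exchanges d) λ τ → ℛ z (u ∷ʳ τ) ⊗ H u (after τ)) ⟩
      ⅀ U (λ u → vertex² x y (qX w) (qY w) c (siteL i o) (λ d → ⅀ (exchanges d) λ τ → ℛ z (u ∷ʳ τ) ⊗ H u (after τ)))
        ≈⟨ ⅀-cong∈ U (λ u u∈ → ≈-trans (reweigh c (siteL i o) (λ d → ⅀ (exchanges d) λ τ → ℛ z (u ∷ʳ τ) ⊗ H u (after τ)) (weightX u (hyp u u∈)) (weightY u (hyp u u∈)))
             (≈-trans (exchange x y u c i o (H u)) (⅀-cong (exchanges c) λ τ → *-congˡ
               (reweigh (after τ) (siteR i o) (H u) (≈-sym (proj₁ (counts-after u))) (≈-sym (proj₂ (counts-after u))))))) ⟩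
      ⅀ U (λ u → ⅀ (exchanges c) λ τ → ℛ z (τ ∷ u) ⊗ vertex² x y (qX (map after u)) (qY (map after u)) (after τ) (siteR i o) (H u))
        ≈⟨ ⅀-swap U (exchanges c) _ ⟩
      _ ∎
      where
      weightX : ∀ u → map before u ≡ w → qX w ≈ Counts.a (counts u) ⊗ Counts.p (counts u)
      weightX u refl = proj₁ (counts-before u)
      weightY : ∀ u → map before u ≡ w → qY w ≈ Counts.a (counts u) ⊗ Counts.n (counts u)
      weightY u refl = proj₂ (counts-before u)

    exchange-lifts⋆ : ∀ (U : List (List Exchange)) w o (H : List Exchange → Letter → Carrier) → (∀ u → u ∈ U → map before u ≡ w) →
      vertex² x y (qX w) (qY w) (false , false) (siteL true o) (λ d → ⅀ U λ u → ⅀ (exchanges d) λ τ → ℛ z (u ∷ʳ τ) ⊗ H u (after τ))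
      ≈ ⅀ U λ u → ℛ z (⋆ ∷ u) ⊗ vertex² x y (qX (map after u)) (qY (map after u)) (false , false) (siteR true o) (H u)
    exchange-lifts⋆ U w o H hyp = begin
      _ ≈⟨ vertex²-⅀ U x y (qX w) (qY w) (false , false) (siteL true o) (λ d u → ⅀ (exchanges d) λ τ → ℛ z (u ∷ʳ τ) ⊗ H u (after τ)) ⟩
      ⅀ U (λ u → vertex² x y (qX w) (qY w) (false , false) (siteL true o) (λ d → ⅀ (exchanges d) λ τ → ℛ z (u ∷ʳ τ) ⊗ H u (after τ)))
        ≈⟨ ⅀-cong∈ U (λ u u∈ → ≈-trans (reweigh (false , false) (siteL true o) (λ d → ⅀ (exchanges d) λ τ → ℛ z (u ∷ʳ τ) ⊗ H u (after τ)) (weightX u (hyp u u∈)) (weightY u (hyp u u∈)))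
             (≈-trans (exchange-first x y u o (H u)) (*-congˡ
               (reweigh (false , false) (siteR true o) (H u) (≈-sym (proj₁ (counts-after u))) (≈-sym (proj₂ (counts-after u))))))) ⟩
      _ ∎
      where
      weightX : ∀ u → map before u ≡ w → qX w ≈ Counts.a (counts u) ⊗ Counts.p (counts u)
      weightX u refl = proj₁ (counts-before u)
      weightY : ∀ u → map before u ≡ w → qY w ≈ Counts.a (counts u) ⊗ Counts.n (counts u)
      weightY u refl = proj₂ (counts-before u)

    lifts-∷ : ∀ c w (f : List Exchange → Carrier) → ⅀ (lifts (c ∷ w)) f ≈ ⅀ (exchanges c) λ τ → ⅀ (lifts w) λ u → f (τ ∷ u)
    lifts-∷ c w f = ≈-trans (⅀-concatMap _ (exchanges c) f) (⅀-cong (exchanges c) (λ τ → ⅀-map (τ ∷_) (lifts w) f))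

    lifts-∷ʳ : ∀ w d (f : List Exchange → Carrier) → ⅀ (lifts (w ∷ʳ d)) f ≈ ⅀ (lifts w) λ u → ⅀ (exchanges d) λ τ → f (u ∷ʳ τ)
    lifts-∷ʳ []      d f = ≈-trans (lifts-∷ d [] f) (≈-trans (⅀-cong (exchanges d) (λ τ → +-identityʳ _)) (≈-sym (+-identityʳ _)))
    lifts-∷ʳ (c ∷ w) d f = begin
      _ ≈⟨ lifts-∷ c (w ∷ʳ d) f ⟩
      _ ≈⟨ ⅀-cong (exchanges c) (λ τ → lifts-∷ʳ w d (λ u → f (τ ∷ u))) ⟩
      _ ≈⟨ ≈-sym (lifts-∷ c w (λ u → ⅀ (exchanges d) λ τ → f (u ∷ʳ τ))) ⟩
      _ ∎

  -- The end condition before the exchange that corresponds to vacant rows after it.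
  end : List Bool → List Bool → Carrier
  end Q Q' = ⅀ (lifts (zip Q Q')) λ u → ℛ z u ⊗ vacant² (map proj₁ (map after u)) (map proj₂ (map after u))

  sitesL sitesR : ∀ {m} → Vec Bool m → Vec Bool m → Vec Site m
  sitesL = Vec.zipWith siteL
  sitesR = Vec.zipWith siteR

  private
    zip-map : ∀ (w : List Letter) → zip (map proj₁ w) (map proj₂ w) ≡ w
    zip-map []      = refl
    zip-map (c ∷ w) = cong (c ∷_) (zip-map w)

    map-∷ʳ : ∀ u τ → map after (u ∷ʳ τ) ≡ map after u ∷ʳ after τ
    map-∷ʳ u τ = Listₚ.map-++ after u (τ ∷ [])

    -- The train argument: ℛ starts at the right end, where the relation holds by the choice of
    -- `end`, and is moved to the left through one site after the other.
    row²-exchange : ∀ {m} w (is os : Vec Bool m) →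
      row² x y end w (sitesL is os) ≈ ⅀ (lifts w) λ u → ℛ z u ⊗ row² x y vacant² (map after u) (sitesR is os)
    row²-exchange w [] [] = reflexive (cong (λ w' → ⅀ (lifts w') λ u → ℛ z u ⊗ vacant² (map proj₁ (map after u)) (map proj₂ (map after u))) (zip-map w))
    row²-exchange [] (i ∷ is) (o ∷ os) = solve 0 (con (ℤ.+ 0) := (con (ℤ.+ 1) :* con (ℤ.+ 0)) :+ con (ℤ.+ 0)) ≈-refl
    row²-exchange (c ∷ w) (i ∷ is) (o ∷ os) = begin
      _ ≈⟨ vertex²-cong x y c (siteL i o) ≈-refl ≈-refl (λ d → ≈-trans (row²-exchange (w ∷ʳ d) is os) (≈-trans (lifts-∷ʳ w d _)
             (⅀-cong (lifts w) λ u → ⅀-cong (exchanges d) λ τ → *-congˡ (reflexive (cong (λ w' → row² x y vacant² w' (sitesR is os)) (map-∷ʳ u τ)))))) ⟩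
      vertex² x y (qX w) (qY w) c (siteL i o) (λ d → ⅀ (lifts w) λ u → ⅀ (exchanges d) λ τ → ℛ z (u ∷ʳ τ) ⊗ row² x y vacant² (map after u ∷ʳ after τ) (sitesR is os))
        ≈⟨ exchange-lifts (lifts w) w c i o (λ u d → row² x y vacant² (map after u ∷ʳ d) (sitesR is os)) (lifts-before w) ⟩
      _ ≈⟨ ≈-sym (lifts-∷ c w _) ⟩
      _ ∎

    starred : ℕ → List Letter → List (List Exchange)
    starred r w = map (replicate r ⋆ ++_) (lifts w)

    starred-before : ∀ r w u → u ∈ starred r w → map before u ≡ replicate r (false , false) ++ w
    starred-before r w u u∈ with ∈ₚ.∈-map⁻ (replicate r ⋆ ++_) u∈
    ... | u' , u'∈ , refl = ≡.trans (Listₚ.map-++ before (replicate r ⋆) u')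
      (cong₂ _++_ (Listₚ.map-replicate before r ⋆) (lifts-before w u' u'∈))

    starred-∷ʳ : ∀ r w d (f : List Exchange → Carrier) →
      ⅀ (starred r (w ∷ʳ d)) f ≈ ⅀ (starred r w) λ u → ⅀ (exchanges d) λ τ → f (u ∷ʳ τ)
    starred-∷ʳ r w d f = begin
      _ ≈⟨ ⅀-map _ (lifts (w ∷ʳ d)) f ⟩
      _ ≈⟨ lifts-∷ʳ w d (λ u → f (replicate r ⋆ ++ u)) ⟩
      _ ≈⟨ ⅀-cong (lifts w) (λ u → ⅀-cong (exchanges d) λ τ → reflexive (cong f (≡.sym (Listₚ.++-assoc (replicate r ⋆) u (τ ∷ []))))) ⟩
      _ ≈⟨ ≈-sym (⅀-map _ (lifts w) (λ u → ⅀ (exchanges d) λ τ → f (u ∷ʳ τ))) ⟩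
      _ ∎

    starred-suc : ∀ r w (f : List Exchange → Carrier) → ⅀ (starred (suc r) w) f ≈ ⅀ (starred r w) (λ u → f (⋆ ∷ u))
    starred-suc r w f = ≈-trans (⅀-map _ (lifts w) f) (≈-sym (⅀-map _ (lifts w) (λ u → f (⋆ ∷ u))))

    -- In the first column every colour has a particle below the x-row and nothing is travelling
    -- yet, so each site there merges its two exchanges into `⋆`. For an empty queue, r = k, the sum
    -- over lifts thereby shrinks to one term.
    row²-exchange⋆ : ∀ {m} r w (is os : Vec Bool m) (os' : Vec Bool r) →
      row² x y end (replicate r (false , false) ++ w) (sitesL (Vec.replicate r true Vec.++ is) (os' Vec.++ os))
      ≈ ⅀ (starred r w) λ u → ℛ z u ⊗ row² x y vacant² (map after u) (sitesR (Vec.replicate r true Vec.++ is) (os' Vec.++ os))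
    row²-exchange⋆ zero    w is os []        = ≈-trans (row²-exchange w is os) (≈-sym (⅀-map _ (lifts w) _))
    row²-exchange⋆ (suc r) w is os (o ∷ os') = begin
      _ ≈⟨ vertex²-cong x y (false , false) (siteL true o) ≈-refl ≈-refl (λ d → ≈-trans
             (reflexive (cong (λ w' → row² x y end w' (sitesL is⁺ os⁺)) (Listₚ.++-assoc (replicate r (false , false)) w (d ∷ []))))
             (≈-trans (row²-exchange⋆ r (w ∷ʳ d) is os os') (≈-trans (starred-∷ʳ r w d _)
             (⅀-cong (starred r w) λ u → ⅀-cong (exchanges d) λ τ → *-congˡ (reflexive (cong (λ w' → row² x y vacant² w' (sitesR is⁺ os⁺)) (map-∷ʳ u τ))))))) ⟩
      vertex² x y (qX w⁺) (qY w⁺) (false , false) (siteL true o)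
          (λ d → ⅀ (starred r w) λ u → ⅀ (exchanges d) λ τ → ℛ z (u ∷ʳ τ) ⊗ row² x y vacant² (map after u ∷ʳ after τ) (sitesR is⁺ os⁺))
        ≈⟨ exchange-lifts⋆ (starred r w) w⁺ o (λ u d → row² x y vacant² (map after u ∷ʳ d) (sitesR is⁺ os⁺)) (starred-before r w) ⟩
      _ ≈⟨ ≈-sym (starred-suc r w _) ⟩
      _ ∎
      where
      w⁺ = replicate r (false , false) ++ w
      is⁺ = Vec.replicate r true Vec.++ is
      os⁺ = os' Vec.++ os

  pochhammer : ℕ → Carrier
  pochhammer zero    = 1#
  pochhammer (suc k) = (1# ⊕ (⊝ (z ⊗ sq (q ↑ k)))) ⊗ pochhammer k

  private
    counts-uniform : ∀ τ k → before τ ≡ (false , false) → after τ ≡ (false , false) → let open Counts (counts (replicate k τ)) in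
      (a ≈ 1#) × (b ≈ 1#) × (c' ≈ q ↑ k)
    counts-uniform τ zero    e e' = ≈-refl , ≈-refl , ≈-refl
    counts-uniform τ (suc k) e e' rewrite e | e' with counts-uniform τ k e e'
    ... | a≈ , b≈ , c≈ = ≈-trans (*-identityˡ _) a≈ , ≈-trans (*-identityˡ _) b≈ , *-congˡ c≈

    ℛ-stars : ∀ z k → ℛ z (replicate k ⋆) ≈ triangle k
    ℛ-stars z zero    = ≈-refl
    ℛ-stars z (suc k) with counts-uniform ⋆ k refl refl
    ... | a≈ , b≈ , c≈ = ≈-trans (+-cong (zeroˡ _) (*-cong (*-cong (*-cong a≈ a≈) (*-cong c≈ c≈)) (ℛ-stars (z ⊗ q²) k)))
      (solve 2 (λ s t → con (ℤ.+ 0) :+ (((con (ℤ.+ 1) :* con (ℤ.+ 1)) :* s) :* t) := s :* t) ≈-refl (sq (q ↑ k)) (triangle k))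

    -- No letter is full, so the counts are a = b = 1 and c' = q^j for j letters, and the next
    -- letter multiplies by (1 - z t^j) t^j.
    ℛ-zeros : ∀ k → ℛ z (replicate k 𝟘𝟘) ≈ triangle k ⊗ pochhammer k
    ℛ-zeros zero    = ≈-sym (*-identityˡ _)
    ℛ-zeros (suc k) with counts-uniform 𝟘𝟘 k refl refl
    ... | a≈ , b≈ , c≈ = ≈-trans (+-cong (*-cong (*-cong (+-congˡ (-‿cong (*-congˡ bc))) bc) (ℛ-zeros k)) (zeroˡ _))
      (solve 4 (λ z s t p → ((((con (ℤ.+ 1)) :+ (:- (z :* ((con (ℤ.+ 1) :* s) :* (con (ℤ.+ 1) :* s))))) :* ((con (ℤ.+ 1) :* s) :* (con (ℤ.+ 1) :* s))) :* (t :* p)) :+ con (ℤ.+ 0)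
        := ((s :* s) :* t) :* ((con (ℤ.+ 1) :+ (:- (z :* (s :* s)))) :* p)) ≈-refl z (q ↑ k) (triangle k) (pochhammer k))
      where bc = *-cong (*-cong b≈ c≈) (*-cong b≈ c≈)

    -- With an empty x-queue before the exchange and both queues empty after it, every letter must
    -- be `𝟘𝟘`: `𝟘𝟚` fills both queues and `𝕐` leaves the y-queue occupied.
    lifts-vacant : ∀ Q (f : List Exchange → Carrier) →
      ⅀ (lifts (zip (replicate (length Q) false) Q)) (λ u → f u ⊗ vacant² (map proj₁ (map after u)) (map proj₂ (map after u)))
      ≈ f (replicate (length Q) 𝟘𝟘) ⊗ vacant Q
    lifts-vacant [] f = solve 1 (λ a → (a :* (con (ℤ.+ 1) :* con (ℤ.+ 1))) :+ con (ℤ.+ 0) := a :* con (ℤ.+ 1)) ≈-refl (f [])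
    lifts-vacant (false ∷ Q) f = begin
      _ ≈⟨ lifts-∷ (false , false) w _ ⟩
      _ ≈⟨ +-cong (lifts-vacant Q (λ u → f (𝟘𝟘 ∷ u))) (+-congʳ (⅀-zero∈ (lifts w) (λ u _ → ≈-trans (*-congˡ (zeroˡ _)) (zeroʳ _)))) ⟩
      _ ≈⟨ solve 1 (λ a → a :+ (con (ℤ.+ 0) :+ con (ℤ.+ 0)) := a) ≈-refl _ ⟩
      _ ∎
      where w = zip (replicate (length Q) false) Q
    lifts-vacant (true ∷ Q) f = begin
      _ ≈⟨ lifts-∷ (false , true) w _ ⟩
      _ ≈⟨ +-congʳ (⅀-zero∈ (lifts w) (λ u _ → ≈-trans (*-congˡ (zeroʳ _)) (zeroʳ _))) ⟩
      0# ⊕ 0# ≈⟨ +-identityˡ 0# ⟩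
      0# ≈⟨ ≈-sym (zeroʳ _) ⟩
      _ ∎
      where w = zip (replicate (length Q) false) Q

  end-vacant : ∀ k Q → length Q ≡ k → end (replicate k false) Q ≈ (triangle k ⊗ pochhammer k) ⊗ vacant Q
  end-vacant k Q refl = ≈-trans (lifts-vacant Q (ℛ z)) (*-congʳ (ℛ-zeros (length Q)))

  -- The error made by letting the rows before the exchange end vacant too. It vanishes for an empty
  -- x-queue, so it only sees particles of the x-row that run off the right end.
  remainder : ℕ → List Bool → List Bool → Carrier
  remainder k Q Q' = end Q Q' ⊕ (⊝ ((triangle k ⊗ pochhammer k) ⊗ vacant² Q Q'))

  remainder-vacant : ∀ k Q → length Q ≡ k → remainder k (replicate k false) Q ≈ 0#
  remainder-vacant k Q e = ≈-trans (+-cong (end-vacant k Q e) (-‿cong (*-congˡ (≈-trans (*-congʳ (reflexive (vacant-zeros k))) (*-identityˡ _))))) (-‿inverseʳ _)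

  -- Both boundary values of ℛ are inserted here: `⋆` repeated on the left, `𝟘𝟘` repeated on the
  -- right. Their quotient is the factor ∏ (1 - x y t^m); the second sum is the error term of the
  -- right end.
  row-commute : ∀ {m} k (is os : Vec Bool m) (os' : Vec Bool k) →
    let is⁺ = Vec.replicate k true Vec.++ is ; os⁺ = os' Vec.++ os in
    ((triangle k ⊗ pochhammer k) ⊗ ⅀ (bools (k + m)) (λ hs → vacantRow k x is⁺ hs ⊗ vacantRow k y os⁺ hs))
      ⊕ ⅀ (bools (k + m)) (λ hs → row x (λ Q → row y (remainder k Q) (replicate k false) os⁺ hs) (replicate k false) is⁺ hs)
    ≈ triangle k ⊗ ⅀ (bools (k + m)) (λ hs → vacantRow k x hs os⁺ ⊗ vacantRow k y hs is⁺)
  row-commute {m} k is os os' = begin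
    (C ⊗ ⅀ B (λ hs → vacantRow k x is⁺ hs ⊗ vacantRow k y os⁺ hs)) ⊕ ⅀ B (λ hs → row x (λ Q → row y (remainder k Q) O os⁺ hs) O is⁺ hs)
      ≈⟨ +-congʳ (⅀-*ˡ B C _) ⟩
    _ ≈⟨ ≈-sym (⅀-+ B _ _) ⟩
    ⅀ B (λ hs → (C ⊗ (vacantRow k x is⁺ hs ⊗ vacantRow k y os⁺ hs)) ⊕ row x (λ Q → row y (remainder k Q) O os⁺ hs) O is⁺ hs)
      ≈⟨ ⅀-cong B (λ hs → ≈-sym (split hs)) ⟩
    ⅀ B (λ hs → row x (λ Q → row y (end Q) O os⁺ hs) O is⁺ hs)
      ≈⟨ ⅀-cong B (λ hs → reflexive (expandL hs)) ⟩
    _ ≈⟨ ≈-sym (row²-expand x y end O² (sitesL is⁺ os⁺)) ⟩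
    row² x y end O² (sitesL is⁺ os⁺)
      ≈⟨ reflexive (cong (λ w → row² x y end w (sitesL is⁺ os⁺)) (≡.sym (Listₚ.++-identityʳ O²))) ⟩
    row² x y end (O² ++ []) (sitesL is⁺ os⁺)
      -- No letter has been read yet, so the only exchange word is that of k letters `⋆`.
      ≈⟨ row²-exchange⋆ k [] is os os' ⟩
    (ℛ z (replicate k ⋆ ++ []) ⊗ row² x y vacant² (map after (replicate k ⋆ ++ [])) (sitesR is⁺ os⁺)) ⊕ 0#
      ≈⟨ ≈-trans (+-identityʳ _) (reflexive (cong (λ u → ℛ z u ⊗ row² x y vacant² (map after u) (sitesR is⁺ os⁺)) (Listₚ.++-identityʳ (replicate k ⋆)))) ⟩
    ℛ z (replicate k ⋆) ⊗ row² x y vacant² (map after (replicate k ⋆)) (sitesR is⁺ os⁺)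
      ≈⟨ *-cong (ℛ-stars z k) (reflexive (cong (λ w → row² x y vacant² w (sitesR is⁺ os⁺)) (Listₚ.map-replicate after k ⋆))) ⟩
    triangle k ⊗ row² x y vacant² O² (sitesR is⁺ os⁺)
      ≈⟨ *-congˡ (row²-expand x y vacant² O² (sitesR is⁺ os⁺)) ⟩
    _ ≈⟨ *-congˡ (⅀-cong B (λ hs → ≈-trans (reflexive (expandR hs)) (product hs))) ⟩
    triangle k ⊗ ⅀ B (λ hs → vacantRow k x hs os⁺ ⊗ vacantRow k y hs is⁺) ∎
    where
    C = triangle k ⊗ pochhammer k
    B = bools (k + m)
    O = replicate k false
    O² = replicate k (false , false)
    is⁺ = Vec.replicate k true Vec.++ is
    os⁺ = os' Vec.++ os
    zipL : ∀ {m} (is os hs : Vec Bool m) → bottomˣ (sitesL is os) hs ≡ is × topˣ (sitesL is os) hs ≡ hs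
      × bottomʸ (sitesL is os) hs ≡ os × topʸ (sitesL is os) hs ≡ hs
    zipL []       []       []       = refl , refl , refl , refl
    zipL (i ∷ is) (o ∷ os) (h ∷ hs) with zipL is os hs
    ... | a , b , c , d = cong (i ∷_) a , cong (h ∷_) b , cong (o ∷_) c , cong (h ∷_) d
    zipR : ∀ {m} (is os hs : Vec Bool m) → bottomˣ (sitesR is os) hs ≡ hs × topˣ (sitesR is os) hs ≡ os
      × bottomʸ (sitesR is os) hs ≡ hs × topʸ (sitesR is os) hs ≡ is
    zipR []       []       []       = refl , refl , refl , refl
    zipR (i ∷ is) (o ∷ os) (h ∷ hs) with zipR is os hs
    ... | a , b , c , d = cong (h ∷_) a , cong (o ∷_) b , cong (h ∷_) c , cong (i ∷_) d
    row²-≡ : ∀ {m} (E : List Bool → List Bool → Carrier) {Q Q' P₀ P'} {a a' b b' c c' d d' : Vec Bool m} →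
      Q ≡ Q' → P₀ ≡ P' → a ≡ a' → b ≡ b' → c ≡ c' → d ≡ d' →
      row x (λ S → row y (E S) P₀ c d) Q a b ≡ row x (λ S → row y (E S) P' c' d') Q' a' b'
    row²-≡ E refl refl refl refl refl refl = refl
    expandL : ∀ hs → row x (λ Q → row y (end Q) O os⁺ hs) O is⁺ hs ≡
      row x (λ Q → row y (end Q) (map proj₂ O²) (bottomʸ (sitesL is⁺ os⁺) hs) (topʸ (sitesL is⁺ os⁺) hs))
        (map proj₁ O²) (bottomˣ (sitesL is⁺ os⁺) hs) (topˣ (sitesL is⁺ os⁺) hs)
    expandL hs with zipL is⁺ os⁺ hs
    ... | a , b , c , d = ≡.sym (row²-≡ end (Listₚ.map-replicate proj₁ k (false , false)) (Listₚ.map-replicate proj₂ k (false , false)) a b c d)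
    expandR : ∀ hs → row x (λ Q → row y (vacant² Q) (map proj₂ O²) (bottomʸ (sitesR is⁺ os⁺) hs) (topʸ (sitesR is⁺ os⁺) hs))
        (map proj₁ O²) (bottomˣ (sitesR is⁺ os⁺) hs) (topˣ (sitesR is⁺ os⁺) hs) ≡ row x (λ Q → row y (vacant² Q) O hs is⁺) O hs os⁺
    expandR hs with zipR is⁺ os⁺ hs
    ... | a , b , c , d = row²-≡ vacant² (Listₚ.map-replicate proj₁ k (false , false)) (Listₚ.map-replicate proj₂ k (false , false)) a b c d
    factor : ∀ {m} (is os hs hs' : Vec Bool m) → row x (λ Q → row y (vacant² Q) O hs' os) O is hs ≈ row x vacant O is hs ⊗ row y vacant O hs' os
    factor is os hs hs' = begin
      row x (λ Q → row y (vacant² Q) O hs' os) O is hs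
        ≈⟨ row-cong x O is hs (λ Q _ → ≈-trans (row-*ˡ (vacant Q) y vacant O hs' os) (*-comm _ _)) ⟩
      row x (λ Q → row y vacant O hs' os ⊗ vacant Q) O is hs
        ≈⟨ row-*ˡ _ x vacant O is hs ⟩
      row y vacant O hs' os ⊗ row x vacant O is hs ≈⟨ *-comm _ _ ⟩
      row x vacant O is hs ⊗ row y vacant O hs' os ∎
    product : ∀ hs → row x (λ Q → row y (vacant² Q) O hs is⁺) O hs os⁺ ≈ vacantRow k x hs os⁺ ⊗ vacantRow k y hs is⁺
    product hs = factor hs is⁺ os⁺ hs
    split : ∀ hs → row x (λ Q → row y (end Q) O os⁺ hs) O is⁺ hs ≈
      (C ⊗ (vacantRow k x is⁺ hs ⊗ vacantRow k y os⁺ hs)) ⊕ row x (λ Q → row y (remainder k Q) O os⁺ hs) O is⁺ hs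
    split hs = begin
      row x (λ Q → row y (end Q) O os⁺ hs) O is⁺ hs
        ≈⟨ row-cong x O is⁺ hs (λ Q _ → ≈-trans
             (row-cong y O os⁺ hs (λ Q' _ → solve 2 (λ e c → e := c :+ (e :+ (:- c))) ≈-refl (end Q Q') (C ⊗ vacant² Q Q')))
             (row-+ y (λ Q' → C ⊗ vacant² Q Q') (remainder k Q) O os⁺ hs)) ⟩
      row x (λ Q → row y (λ Q' → C ⊗ vacant² Q Q') O os⁺ hs ⊕ row y (remainder k Q) O os⁺ hs) O is⁺ hs
        ≈⟨ row-+ x _ _ O is⁺ hs ⟩
      row x (λ Q → row y (λ Q' → C ⊗ vacant² Q Q') O os⁺ hs) O is⁺ hs ⊕ row x (λ Q → row y (remainder k Q) O os⁺ hs) O is⁺ hs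
        ≈⟨ +-congʳ (≈-trans (row-cong x O is⁺ hs (λ Q _ → row-*ˡ C y (vacant² Q) O os⁺ hs))
             (≈-trans (row-*ˡ C x _ O is⁺ hs) (*-congˡ (factor is⁺ hs hs os⁺)))) ⟩
      _ ∎

-- Degree filtrations, and transfer operators on words of columns.

-- An abstract x-degree: `F d` plays the ideal of elements of degree at least d, in a ring where
-- everything of degree above D is zero.
record Filtration {c ℓ} (R : CommutativeRing c ℓ) (D : ℕ) : Set (Level.suc (c Level.⊔ ℓ)) where
  open CommutativeRing R hiding (zero) renaming (_+_ to _⊕_; _*_ to _⊗_)
  field
    F      : ℕ → Carrier → Set ℓ
    F-0    : ∀ {r} → F 0 r
    F-zero : ∀ {d} → F d 0#
    F-resp : ∀ {d r s} → r ≈ s → F d r → F d s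
    F-+    : ∀ {d r s} → F d r → F d s → F d (r ⊕ s)
    F-*    : ∀ {d e r s} → F d r → F e s → F (d + e) (r ⊗ s)
    F-mono : ∀ {d e r} → d ≤ e → F e r → F d r
    F-top  : ∀ {r} → F (suc D) r → r ≈ 0#

module Words {c ℓ : Level} (R : CommutativeRing c ℓ) (q : CommutativeRing.Carrier R)
             (k n' D : ℕ) (filtration : Filtration R D)
             (q-cancel : ∀ {a b} → CommutativeRing._≈_ R (CommutativeRing._*_ R q a) (CommutativeRing._*_ R q b) → CommutativeRing._≈_ R a b) where
  open CommutativeRing R hiding (zero) renaming (_+_ to _⊕_; _*_ to _⊗_; -_ to ⊝_; refl to ≈-refl; sym to ≈-sym; trans to ≈-trans)
  open FiniteSum commutativeSemiring
  open IntegerRingSolver R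
  open SetoidReasoning setoid
  open Exp semiring renaming (_^_ to _↑_)
  open Local _⊕_ _⊗_ ⊝_ 0# 1#
  open RowOperators R q
  open RowProducts R q
  open Filtration filtration
  open Commutation R q using (remainder; remainder-vacant; row-commute; pochhammer)

  n : ℕ
  n = suc n'

  zeros ones : Vec Bool k
  zeros = Vec.replicate k false
  ones  = Vec.replicate k true

  O : List Bool
  O = replicate k false

  Word : ℕ → Set
  Word N = Vec (Vec Bool k) N

  words' : (N : ℕ) → List (Word N)
  words' N = choices (Vec.replicate N (bools k))

  rowᶜ : ∀ {N} → Carrier → (List Bool → Carrier) → List Bool → Word N → Word N → Carrier
  rowᶜ x E Q []       []       = E Q
  rowᶜ x E Q (i ∷ is) (m ∷ ms) = row x (λ Q' → rowᶜ x E Q' is ms) Q i m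

  row-concat : ∀ {N} x E Q (is ms : Word N) → row x E Q (Vec.concat is) (Vec.concat ms) ≈ rowᶜ x E Q is ms
  row-concat x E Q []       []       = ≈-refl
  row-concat x E Q (i ∷ is) (m ∷ ms) = ≈-trans (row-++ x E Q i m (Vec.concat is) (Vec.concat ms))
    (row-cong x Q i m (λ Q' _ → row-concat x E Q' is ms))

  ⅀-bools-++ : ∀ a b (f : Vec Bool (a + b) → Carrier) → ⅀ (bools (a + b)) f ≈ ⅀ (bools a) (λ u → ⅀ (bools b) (λ v → f (u Vec.++ v)))
  ⅀-bools-++ zero    b f = ≈-sym (+-identityʳ _)
  ⅀-bools-++ (suc a) b f = ≈-trans (⅀-choices bits (Vec.replicate (a + b) bits) f)
    (≈-trans (⅀-cong bits (λ h → ⅀-bools-++ a b (λ v → f (h ∷ v)))) (≈-sym (⅀-choices bits (Vec.replicate a bits) _)))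

  ⅀-concat : ∀ N (f : Vec Bool (N * k) → Carrier) → ⅀ (bools (N * k)) f ≈ ⅀ (words' N) (λ w → f (Vec.concat w))
  ⅀-concat zero    f = ≈-refl
  ⅀-concat (suc N) f = ≈-trans (⅀-bools-++ k (N * k) f)
    (≈-trans (⅀-cong (bools k) (λ u → ⅀-concat N (λ v → f (u Vec.++ v)))) (≈-sym (⅀-choices (bools k) (Vec.replicate N (bools k)) _)))

  vertex-0 : ∀ x X i j m {H : Bool → Carrier} → (∀ e → H e ≈ 0#) → vertex x X i j m H ≈ 0#
  vertex-0 x X false false false h = h false
  vertex-0 x X false false true  h = ≈-refl
  vertex-0 x X false true  false h = ≈-trans (*-congˡ (≈-trans (*-congˡ (h true)) (zeroʳ _))) (zeroʳ _)
  vertex-0 x X false true  true  h = ≈-trans (*-congˡ (h false)) (zeroʳ _)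
  vertex-0 x X true  false false h = ≈-trans (*-congˡ (≈-trans (*-congˡ (h true)) (zeroʳ _))) (zeroʳ _)
  vertex-0 x X true  false true  h = ≈-trans (*-congˡ (h false)) (zeroʳ _)
  vertex-0 x X true  true  m     h = ≈-refl

  vertex-F : ∀ x X i j m {H : Bool → Carrier} {d} → (∀ e → F d (H e)) → F d (vertex x X i j m H)
  vertex-F x X false false false h = h false
  vertex-F x X false false true  h = F-zero
  vertex-F x X false true  false h = F-* F-0 (F-* F-0 (h true))
  vertex-F x X false true  true  h = F-* F-0 (h false)
  vertex-F x X true  false false h = F-* F-0 (F-* F-0 (h true))
  vertex-F x X true  false true  h = F-* F-0 (h false)
  vertex-F x X true  true  m     h = F-zero

  row-F : ∀ {m} x {E} Q (is ms : Vec Bool m) {d} → (∀ Q' → length Q' ≡ length Q → F d (E Q')) → F d (row x E Q is ms)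
  row-F x Q       []       []       h = h Q refl
  row-F x []      (_ ∷ _)  (_ ∷ _)  h = F-zero
  row-F x (j ∷ Q) (i ∷ is) (m ∷ ms) h = vertex-F x (qcount Q) i j m (λ e → row-F x (Q ∷ʳ e) is ms (λ Q' eq → h Q' (≡.trans eq (length-∷ʳ Q e))))

  ++-∷ʳ : ∀ (Q Q' : List Bool) e → (Q ++ Q') ∷ʳ e ≡ Q ++ (Q' ∷ʳ e)
  ++-∷ʳ Q Q' e = Listₚ.++-assoc Q Q' (e ∷ [])

  replicate-∷ʳ : ∀ d → replicate d false ∷ʳ false ≡ replicate (suc d) false
  replicate-∷ʳ zero    = refl
  replicate-∷ʳ (suc d) = cong (false ∷_) (replicate-∷ʳ d)

  module _ (x : Carrier) (x∈F : F 1 x) (E : List Bool → Carrier) (h : ℕ) (E-F : ∀ Q → length Q ≡ k → F h (E Q)) (E-0 : E O ≈ 0#) where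

    private
      column : ∀ rest d {m} (is ms : Vec Bool m) → length rest ≡ m → length rest + d ≡ k →
        F (suc h) (row x E (rest ++ replicate d false) is ms)
      push : ∀ rest d X {m} (is ms : Vec Bool m) → length rest ≡ m → suc (length rest + d) ≡ k →
        F (suc h) (x ⊗ (X ⊗ row x E ((rest ++ replicate d false) ∷ʳ true) is ms))
      pass : ∀ rest d {m} (is ms : Vec Bool m) → length rest ≡ m → suc (length rest + d) ≡ k →
        F (suc h) (row x E ((rest ++ replicate d false) ∷ʳ false) is ms)
      column []         d [] [] _ e = F-resp (≈-sym (≈-trans (reflexive (cong (λ d → E (replicate d false)) e)) E-0)) F-zero
      column (j ∷ rest) d (i ∷ is) (m ∷ ms) e e' = go i j m
        where
        X = qcount (rest ++ replicate d false)
        e₁ = ℕₚ.suc-injective e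
        go : ∀ i j m → F (suc h) (vertex x X i j m (λ b → row x E ((rest ++ replicate d false) ∷ʳ b) is ms))
        go false false false = pass rest d is ms e₁ e'
        go false false true  = F-zero
        go false true  false = push rest d X is ms e₁ e'
        go false true  true  = F-* F-0 (pass rest d is ms e₁ e')
        go true  false false = push rest d X is ms e₁ e'
        go true  false true  = F-* F-0 (pass rest d is ms e₁ e')
        go true  true  m     = F-zero
      push rest d X is ms e e' = F-* x∈F (F-* F-0 (row-F x _ is ms (λ Q' eq → E-F Q'
        (≡.trans eq (≡.trans (length-∷ʳ (rest ++ replicate d false) true) (≡.trans (cong suc (≡.trans (Listₚ.length-++ rest) (cong (λ l → length rest + l) (Listₚ.length-replicate d {x = false})))) e'))))))
      pass rest d is ms e e' = subst (λ Q → F (suc h) (row x E Q is ms)) (≡.sym (≡.trans (++-∷ʳ rest _ false) (cong (rest ++_) (replicate-∷ʳ d))))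
        (column rest (suc d) is ms e (≡.trans (ℕₚ.+-suc (length rest) d) e'))

    -- All k bits of the queue that leaves a column were emitted in that column, and each bit `true`
    -- among them carries a factor x. The one queue without such a bit is the empty one, on which
    -- `E` vanishes.
    column-F : ∀ Q (i m : Vec Bool k) → length Q ≡ k → F (suc h) (row x E Q i m)
    column-F Q i m e = subst (λ Q' → F (suc h) (row x E Q' i m)) (Listₚ.++-identityʳ Q) (column Q 0 i m e (≡.trans (ℕₚ.+-identityʳ _) e))

  Quiet : ∀ {N} → ℕ → Word N → Set
  Quiet c       []       = ⊤
  Quiet zero    (i ∷ is) = i ≡ zeros × Quiet zero is
  Quiet (suc c) (i ∷ is) = Quiet c is

  Beyond : ∀ {N} → ℕ → Word N → Set
  Beyond c       []       = ⊥
  Beyond zero    (m ∷ ms) = m ≢ zeros ⊎ Beyond zero ms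
  Beyond (suc c) (m ∷ ms) = Beyond c ms

  quiet-or-beyond : ∀ {N} c (w : Word N) → Quiet c w ⊎ Beyond c w
  quiet-or-beyond c       []      = inj₁ tt
  quiet-or-beyond (suc c) (i ∷ w) = quiet-or-beyond c w
  quiet-or-beyond zero    (i ∷ w) with Vecₚ.≡-dec Bool._≟_ i zeros | quiet-or-beyond zero w
  ... | no i≢  | _      = inj₂ (inj₁ i≢)
  ... | yes i≡ | inj₁ p = inj₁ (i≡ , p)
  ... | yes i≡ | inj₂ p = inj₂ (inj₂ p)

  private
    quiet-column : ∀ {m} x E a d (ms : Vec Bool m) → a ≡ m → a + d ≡ k →
      row x E (replicate (a + d) false) (Vec.replicate m false) ms ≈ (if Vec.foldr′ _∨_ false ms then 0# else E O)
    quiet-column x E zero    d []       e e' = reflexive (cong (λ d → E (replicate d false)) e')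
    quiet-column x E (suc a) d (true ∷ ms)  e e' = ≈-refl
    quiet-column x E (suc a) d (false ∷ ms) e e' = ≈-trans
      (reflexive (cong (λ Q → row x E Q (Vec.replicate _ false) ms) (≡.trans (replicate-∷ʳ (a + d)) (cong (λ s → replicate s false) (≡.sym (ℕₚ.+-suc a d))))))
      (quiet-column x E a (suc d) ms (ℕₚ.suc-injective e) (≡.trans (ℕₚ.+-suc a d) e'))

    no-true : ∀ {m} (ms : Vec Bool m) → Vec.foldr′ _∨_ false ms ≡ false → ms ≡ Vec.replicate m false
    no-true []           e = refl
    no-true (false ∷ ms) e = cong (false ∷_) (no-true ms e)

  row-quiet : ∀ x E (m : Vec Bool k) → (m ≡ zeros × row x E O zeros m ≈ E O) ⊎ row x E O zeros m ≈ 0#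
  row-quiet x E m with quiet-column x E k 0 m refl (ℕₚ.+-identityʳ k)
  ... | e rewrite ℕₚ.+-identityʳ k with Vec.foldr′ _∨_ false m in eq
  ... | true  = inj₂ e
  ... | false = inj₁ (no-true m eq , e)

  rowᶜ-quiet-0 : ∀ {N} x E (is ms : Word N) → E O ≈ 0# → Quiet 0 is → rowᶜ x E O is ms ≈ 0#
  rowᶜ-quiet-0 x E []       []       z _ = z
  rowᶜ-quiet-0 x E (i ∷ is) (m ∷ ms) z (refl , quiet) with row-quiet x (λ Q' → rowᶜ x E Q' is ms) m
  ... | inj₁ (_ , e) = ≈-trans e (rowᶜ-quiet-0 x E is ms z quiet)
  ... | inj₂ e       = e

  rowᶜ-beyond-0 : ∀ {N} x E c (is ms : Word N) → Quiet 0 is → Beyond c ms → rowᶜ x E O is ms ≈ 0#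
  rowᶜ-beyond-0 x E c (i ∷ is) (m ∷ ms) (refl , quiet) b with row-quiet x (λ Q' → rowᶜ x E Q' is ms) m
  ... | inj₂ e = e
  rowᶜ-beyond-0 x E zero    (i ∷ is) (m ∷ ms) (refl , quiet) (inj₁ m≢) | inj₁ (m≡ , e) = ⊥-elim (m≢ m≡)
  rowᶜ-beyond-0 x E zero    (i ∷ is) (m ∷ ms) (refl , quiet) (inj₂ b)  | inj₁ (m≡ , e) = ≈-trans e (rowᶜ-beyond-0 x E zero is ms quiet b)
  rowᶜ-beyond-0 x E (suc c) (i ∷ is) (m ∷ ms) (refl , quiet) b         | inj₁ (m≡ , e) = ≈-trans e (rowᶜ-beyond-0 x E c is ms quiet b)

  -- No particle starts after column c. If the row does not end with an empty queue, some particle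
  -- travels out of every one of the columns c, ..., N - 1, at a factor x each.
  rowᶜ-F : ∀ {N} x → F 1 x → ∀ E c Q (is ms : Word N) → length Q ≡ k → E O ≈ 0# → Quiet (suc c) is → F (N ∸ c) (rowᶜ x E Q is ms)
  rowᶜ-F₀ : ∀ {N} x → F 1 x → ∀ E Q (is ms : Word N) → length Q ≡ k → E O ≈ 0# → Quiet 0 is → F N (rowᶜ x E Q is ms)
  rowᶜ-F₀ x x∈ E Q []       []       e z quiet = F-0
  rowᶜ-F₀ x x∈ E Q (i ∷ is) (m ∷ ms) e z (_ , quiet) = column-F x x∈ _ _
    (λ Q' e' → rowᶜ-F₀ x x∈ E Q' is ms e' z quiet) (rowᶜ-quiet-0 x E is ms z quiet) Q i m e
  rowᶜ-F x x∈ E c Q [] [] e z quiet = subst (λ d → F d (E Q)) (≡.sym (ℕₚ.0∸n≡0 c)) F-0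
  rowᶜ-F x x∈ E zero    Q (i ∷ is) (m ∷ ms) e z quiet = column-F x x∈ _ _
    (λ Q' e' → rowᶜ-F₀ x x∈ E Q' is ms e' z quiet) (rowᶜ-quiet-0 x E is ms z quiet) Q i m e
  rowᶜ-F x x∈ E (suc c) Q (i ∷ is) (m ∷ ms) e z quiet = row-F x Q i m (λ Q' e' → rowᶜ-F x x∈ E c Q' is ms (≡.trans e' e) z quiet)

  rowᶜ-beyond-F₀ : ∀ {N} x → F 1 x → ∀ E b Q (is ms : Word N) → length Q ≡ k → Quiet 0 is → Beyond b ms → F b (rowᶜ x E Q is ms)
  rowᶜ-beyond-F₀ x x∈ E zero    Q is       ms       e quiet bey = F-0
  rowᶜ-beyond-F₀ x x∈ E (suc b) Q (i ∷ is) (m ∷ ms) e (_ , quiet) bey = column-F x x∈ _ _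
    (λ Q' e' → rowᶜ-beyond-F₀ x x∈ E b Q' is ms e' quiet bey) (rowᶜ-beyond-0 x E b is ms quiet bey) Q i m e

  -- A particle that stops in column b or later started in column c or earlier and made at least b -
  -- c steps.
  rowᶜ-beyond-F : ∀ {N} x → F 1 x → ∀ E c b Q (is ms : Word N) → length Q ≡ k → Quiet (suc c) is → Beyond b ms → F (b ∸ c) (rowᶜ x E Q is ms)
  rowᶜ-beyond-F x x∈ E c       zero    Q is       ms       e quiet bey = subst (λ d → F d (rowᶜ x E Q is ms)) (≡.sym (ℕₚ.0∸n≡0 c)) F-0
  rowᶜ-beyond-F x x∈ E zero    (suc b) Q (i ∷ is) (m ∷ ms) e quiet bey = column-F x x∈ _ _
    (λ Q' e' → rowᶜ-beyond-F₀ x x∈ E b Q' is ms e' quiet bey) (rowᶜ-beyond-0 x E b is ms quiet bey) Q i m e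
  rowᶜ-beyond-F x x∈ E (suc c) (suc b) Q (i ∷ is) (m ∷ ms) e quiet bey =
    row-F x Q i m (λ Q' e' → rowᶜ-beyond-F x x∈ E c b Q' is ms (≡.trans e' e) quiet bey)

  V : ∀ {N} → Carrier → Word N → Word N → Carrier
  V x = rowᶜ x vacant O

  -- The word of the tuple of empty partitions: all particles packed to the left.
  vac : Word (n + D)
  vac = Vec.replicate n ones Vec.++ Vec.replicate D zeros

  private
    true-vacant : ∀ Q → true ∈ Q → vacant Q ≈ 0#
    true-vacant (true ∷ Q)  _          = ≈-refl
    true-vacant (false ∷ Q) (there t∈) = true-vacant Q t∈

    ∈-∷ʳ : ∀ {Q : List Bool} {e} → true ∈ Q → true ∈ Q ∷ʳ e
    ∈-∷ʳ t∈ = ∈ₚ.∈-++⁺ˡ t∈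

    ∈-last : ∀ (Q : List Bool) → true ∈ Q ∷ʳ true
    ∈-last Q = ∈ₚ.∈-++⁺ʳ Q (here refl)

    qcount-zeros : ∀ a → qcount (replicate a false) ≈ 1#
    qcount-zeros zero    = ≈-refl
    qcount-zeros (suc a) = ≈-trans (*-identityˡ _) (qcount-zeros a)

    shift : ∀ a d → replicate (a + d) false ∷ʳ false ≡ replicate (a + suc d) false
    shift a d = ≡.trans (replicate-∷ʳ (a + d)) (cong (λ s → replicate s false) (≡.sym (ℕₚ.+-suc a d)))

    stuck-zeros : ∀ {m} x E Q (is : Vec Bool m) → (∀ Q' → true ∈ Q' → E Q' ≈ 0#) → true ∈ Q → row x E Q is (Vec.replicate m false) ≈ 0#
    stuck-zeros x E Q           []           h t∈ = h Q t∈
    stuck-zeros x E (true ∷ Q)  (true ∷ is)  h t∈ = ≈-refl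
    stuck-zeros x E (true ∷ Q)  (false ∷ is) h t∈ =
      ≈-trans (*-congˡ (≈-trans (*-congˡ (stuck-zeros x E (Q ∷ʳ true) is h (∈-last Q))) (zeroʳ _))) (zeroʳ _)
    stuck-zeros x E (false ∷ Q) (true ∷ is)  h t∈ =
      ≈-trans (*-congˡ (≈-trans (*-congˡ (stuck-zeros x E (Q ∷ʳ true) is h (∈-last Q))) (zeroʳ _))) (zeroʳ _)
    stuck-zeros x E (false ∷ Q) (false ∷ is) h (there t∈) = stuck-zeros x E (Q ∷ʳ false) is h (∈-∷ʳ t∈)

    to-zeros : ∀ {m} x E a d (is : Vec Bool m) → a ≡ m → a + d ≡ k → (∀ Q' → true ∈ Q' → E Q' ≈ 0#) →
      (is ≡ Vec.replicate m false × row x E (replicate (a + d) false) is (Vec.replicate m false) ≈ E O)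
      ⊎ (is ≢ Vec.replicate m false × row x E (replicate (a + d) false) is (Vec.replicate m false) ≈ 0#)
    to-zeros x E zero    d [] e e' h = inj₁ (refl , reflexive (cong (λ d → E (replicate d false)) e'))
    to-zeros x E (suc a) d (true ∷ is) e e' h = inj₂ ((λ ()) ,
      ≈-trans (*-congˡ (≈-trans (*-congˡ (stuck-zeros x E (replicate (a + d) false ∷ʳ true) is h (∈-last (replicate (a + d) false)))) (zeroʳ _))) (zeroʳ _))
    to-zeros {suc m} x E (suc a) d (false ∷ is) e e' h rewrite shift a d
      with to-zeros x E a (suc d) is (ℕₚ.suc-injective e) (≡.trans (ℕₚ.+-suc a d) e') h
    ... | inj₁ (p , r) = inj₁ (cong (false ∷_) p , r)
    ... | inj₂ (p , r) = inj₂ ((λ eq → p (Vecₚ.∷-injectiveʳ eq)) , r)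

    to-ones : ∀ {m} x E a d (is : Vec Bool m) → a ≡ m → a + d ≡ k →
      (is ≡ Vec.replicate m true × row x E (replicate (a + d) false) is (Vec.replicate m true) ≈ E O)
      ⊎ (is ≢ Vec.replicate m true × row x E (replicate (a + d) false) is (Vec.replicate m true) ≈ 0#)
    to-ones x E zero    d [] e e' = inj₁ (refl , reflexive (cong (λ d → E (replicate d false)) e'))
    to-ones x E (suc a) d (false ∷ is) e e' = inj₂ ((λ ()) , ≈-refl)
    to-ones x E (suc a) d (true ∷ is) e e' rewrite shift a d
      with to-ones x E a (suc d) is (ℕₚ.suc-injective e) (≡.trans (ℕₚ.+-suc a d) e')
    ... | inj₁ (p , r) = inj₁ (cong (true ∷_) p , ≈-trans (*-cong (qcount-zeros (a + d)) r) (*-identityˡ _))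
    ... | inj₂ (p , r) = inj₂ ((λ eq → p (Vecₚ.∷-injectiveʳ eq)) , ≈-trans (*-congˡ r) (zeroʳ _))

    column-zeros : ∀ x E (i : Vec Bool k) → (∀ Q' → true ∈ Q' → E Q' ≈ 0#) →
      (i ≡ zeros × row x E O i zeros ≈ E O) ⊎ (i ≢ zeros × row x E O i zeros ≈ 0#)
    column-zeros x E i h with to-zeros x E k 0 i refl (ℕₚ.+-identityʳ k) h
    ... | r rewrite ℕₚ.+-identityʳ k = r

    column-ones : ∀ x E (i : Vec Bool k) →
      (i ≡ ones × row x E O i ones ≈ E O) ⊎ (i ≢ ones × row x E O i ones ≈ 0#)
    column-ones x E i with to-ones x E k 0 i refl (ℕₚ.+-identityʳ k)
    ... | r rewrite ℕₚ.+-identityʳ k = r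

    stuck : ∀ D x Q (is : Word D) → true ∈ Q → rowᶜ x vacant Q is (Vec.replicate D zeros) ≈ 0#
    stuck zero    x Q []       t∈ = true-vacant Q t∈
    stuck (suc D) x Q (i ∷ is) t∈ = stuck-zeros x _ Q i (λ Q' → stuck D x Q' is) t∈

    V-low : ∀ D x (is : Word D) → (is ≡ Vec.replicate D zeros × V x is (Vec.replicate D zeros) ≈ 1#)
      ⊎ (is ≢ Vec.replicate D zeros × V x is (Vec.replicate D zeros) ≈ 0#)
    V-low zero    x [] = inj₁ (refl , reflexive (vacant-zeros k))
    V-low (suc D) x (i ∷ is) with column-zeros x (λ Q → rowᶜ x vacant Q is (Vec.replicate D zeros)) i (λ Q' → stuck D x Q' is)
    ... | inj₂ (i≢ , r) = inj₂ ((λ eq → i≢ (Vecₚ.∷-injectiveˡ eq)) , r)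
    ... | inj₁ (refl , r) with V-low D x is
    ... | inj₁ (p , r') = inj₁ (cong (zeros ∷_) p , ≈-trans r r')
    ... | inj₂ (p , r') = inj₂ ((λ eq → p (Vecₚ.∷-injectiveʳ eq)) , ≈-trans r r')

    V-vac' : ∀ n x (is : Word (n + D)) → let v = Vec.replicate n ones Vec.++ Vec.replicate D zeros in
      (is ≡ v × V x is v ≈ 1#) ⊎ (is ≢ v × V x is v ≈ 0#)
    V-vac' zero    x is = V-low D x is
    V-vac' (suc n) x (i ∷ is) with column-ones x (λ Q → rowᶜ x vacant Q is (Vec.replicate n ones Vec.++ Vec.replicate D zeros)) i
    ... | inj₂ (i≢ , r) = inj₂ ((λ eq → i≢ (Vecₚ.∷-injectiveˡ eq)) , r)
    ... | inj₁ (refl , r) with V-vac' n x is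
    ... | inj₁ (p , r') = inj₁ (cong (ones ∷_) p , ≈-trans r r')
    ... | inj₂ (p , r') = inj₂ ((λ eq → p (Vecₚ.∷-injectiveʳ eq)) , ≈-trans r r')

  word-≟ : ∀ {N} (v w : Word N) → Dec (v ≡ w)
  word-≟ = Vecₚ.≡-dec (Vecₚ.≡-dec Bool._≟_)

  if-yes : {A : Set} (d : Dec A) {a b : Carrier} → A → (if does d then a else b) ≡ a
  if-yes (yes _) _ = refl
  if-yes (no ¬a) a = ⊥-elim (¬a a)

  δ : Word (n + D) → Carrier
  δ w = if does (word-≟ w vac) then 1# else 0#

  -- Particles move only to the right, so the packed state is reached only from itself and without
  -- any step. The queue then stays empty, and no power of x or q is charged.
  V-vac : ∀ x w → V x w vac ≈ δ w
  V-vac x w with word-≟ w vac | V-vac' n x w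
  ... | yes _ | inj₁ (_ , r)  = r
  ... | yes p | inj₂ (w≢ , _) = ⊥-elim (w≢ p)
  ... | no ¬p | inj₁ (p , _)  = ⊥-elim (¬p p)
  ... | no _  | inj₂ (_ , r)  = r

  words-unique : ∀ N → Unique (words' N)
  words-unique N = choices-unique (Vec.replicate N (bools k)) (λ i → subst Unique (≡.sym (Vecₚ.lookup-replicate i (bools k)))
    (choices-unique (Vec.replicate k bits) (λ j → subst Unique (≡.sym (Vecₚ.lookup-replicate j bits)) (((λ ()) ∷ []) ∷ [] ∷ []))))

  ∈-words : ∀ {N} (w : Word N) → w ∈ words' N
  ∈-words w = ∈-choices⁺ (Vec.replicate _ (bools k)) w (λ i → subst (lookup w i ∈_) (≡.sym (Vecₚ.lookup-replicate i (bools k)))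
    (∈-choices⁺ (Vec.replicate k bits) (lookup w i) (λ j → subst (lookup (lookup w i) j ∈_) (≡.sym (Vecₚ.lookup-replicate j bits)) (∈-bits _))))
    where
    ∈-bits : ∀ b → b ∈ bits
    ∈-bits false = here refl
    ∈-bits true  = there (here refl)

  ⅀-δ : ∀ (f : Word (n + D) → Carrier) → ⅀ (words' (n + D)) (λ w → δ w ⊗ f w) ≈ f vac
  ⅀-δ f = ≈-trans (≈-sym (⅀-subset (vac ∷ []) (words' (n + D)) (λ w → δ w ⊗ f w) ([] ∷ []) (words-unique (n + D)) (λ w _ → ∈-words w) supp))
    (≈-trans (+-identityʳ _) at-vac)
    where
    supp : ∀ w → w ∈ words' (n + D) → δ w ⊗ f w ≈ 0# ⊎ w ∈ vac ∷ []
    supp w _ with word-≟ w vac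
    ... | yes p = inj₂ (here p)
    ... | no _  = inj₁ (zeroˡ _)
    at-vac : δ vac ⊗ f vac ≈ f vac
    at-vac = ≈-trans (*-congʳ (reflexive (if-yes (word-≟ vac vac) refl))) (*-identityˡ _)

  -- The coefficient of a word in the state obtained from the vacuum by one row per variable; the
  -- head of the list acts last.
  Ψ : List Carrier → Word (n + D) → Carrier
  Ψ []       w = δ w
  Ψ (x ∷ xs) w = ⅀ (words' (n + D)) (λ w' → V x w' w ⊗ Ψ xs w')

  Full : ∀ {N} → ℕ → Word N → Set
  Full zero    w       = ⊤
  Full (suc c) []      = ⊥
  Full (suc c) (i ∷ w) = i ≡ ones × Full c w

  full? : ∀ {N} c (w : Word N) → Dec (Full c w)
  full? zero    w       = yes tt
  full? (suc c) []      = no (λ ())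
  full? (suc c) (i ∷ w) with Vecₚ.≡-dec Bool._≟_ i ones | full? c w
  ... | yes p | yes r = yes (p , r)
  ... | no ¬p | _     = no (λ { (p , _) → ¬p p })
  ... | _     | no ¬r = no (λ { (_ , r) → ¬r r })

  private
    blocked-ones : ∀ {m} x E Q (ms : Vec Bool m) → (∀ Q' → length Q' ≡ length Q → true ∈ Q' → E Q' ≈ 0#) → true ∈ Q →
      row x E Q (Vec.replicate m true) ms ≈ 0#
    blocked-ones x E Q           []           h t∈ = h Q refl t∈
    blocked-ones x E (true ∷ Q)  (m ∷ ms)     h t∈ = ≈-refl
    blocked-ones x E (false ∷ Q) (true ∷ ms)  h (there t∈) = ≈-trans (*-congˡ (blocked-ones x E (Q ∷ʳ false) ms
      (λ Q' e → h Q' (≡.trans e (length-∷ʳ Q false))) (∈-∷ʳ t∈))) (zeroʳ _)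
    blocked-ones x E (false ∷ Q) (false ∷ ms) h (there t∈) = ≈-trans (*-congˡ (≈-trans (*-congˡ (blocked-ones x E (Q ∷ʳ true) ms
      (λ Q' e → h Q' (≡.trans e (length-∷ʳ Q true))) (∈-last Q))) (zeroʳ _))) (zeroʳ _)

    collide : ∀ {m} x E rest done (ms : Vec Bool m) → length rest ≡ m → true ∈ rest → row x E (rest ++ done) (Vec.replicate m true) ms ≈ 0#
    collide x E (true ∷ rest)  done (m ∷ ms) e t∈ = ≈-refl
    collide x E (false ∷ rest) done (m ∷ ms) e (there t∈) = vertex-0 x (qcount (rest ++ done)) true false m
      (λ b → ≈-trans (reflexive (cong (λ Q → row x E Q (Vec.replicate _ true) ms) (++-∷ʳ rest done b)))
        (collide x E rest (done ∷ʳ b) ms (ℕₚ.suc-injective e) t∈))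

    collide-column : ∀ x E Q (m : Vec Bool k) → length Q ≡ k → true ∈ Q → row x E Q ones m ≈ 0#
    collide-column x E Q m e t∈ = ≈-trans (reflexive (cong (λ Q → row x E Q ones m) (≡.sym (Listₚ.++-identityʳ Q)))) (collide x E Q [] m e t∈)

    from-ones : ∀ {m} x E a d (ms : Vec Bool m) → a ≡ m → a + d ≡ k → (∀ Q' → length Q' ≡ k → true ∈ Q' → E Q' ≈ 0#) →
      row x E (replicate (a + d) false) (Vec.replicate m true) ms ≈ 0#
      ⊎ (ms ≡ Vec.replicate m true × row x E (replicate (a + d) false) (Vec.replicate m true) ms ≈ E O)
    from-ones x E zero d [] e e' h = inj₂ (refl , reflexive (cong (λ d → E (replicate d false)) e'))
    from-ones x E (suc a) d (false ∷ ms) e e' h = inj₁ (≈-trans (*-congˡ (≈-trans (*-congˡ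
      (blocked-ones x E (replicate (a + d) false ∷ʳ true) ms (λ Q' e″ → h Q' (≡.trans e″ (≡.trans (length-∷ʳ (replicate (a + d) false) true)
        (≡.trans (cong suc (Listₚ.length-replicate (a + d))) e')))) (∈-last (replicate (a + d) false)))) (zeroʳ _))) (zeroʳ _))
    from-ones x E (suc a) d (true ∷ ms) e e' h rewrite shift a d
      with from-ones x E a (suc d) ms (ℕₚ.suc-injective e) (≡.trans (ℕₚ.+-suc a d) e') h
    ... | inj₁ r       = inj₁ (≈-trans (*-congˡ r) (zeroʳ _))
    ... | inj₂ (p , r) = inj₂ (cong (true ∷_) p , ≈-trans (*-cong (qcount-zeros (a + d)) r) (*-identityˡ _))

    column-from-ones : ∀ x E (m : Vec Bool k) → (∀ Q' → length Q' ≡ k → true ∈ Q' → E Q' ≈ 0#) →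
      row x E O ones m ≈ 0# ⊎ (m ≡ ones × row x E O ones m ≈ E O)
    column-from-ones x E m h with from-ones x E k 0 m refl (ℕₚ.+-identityʳ k) h
    ... | r rewrite ℕₚ.+-identityʳ k = r

  -- A particle that leaves a full column followed by another full column runs into the particle of
  -- its own colour there. So only the last full column can lose particles.
  V-full : ∀ {N} c x (is ms : Word N) → Full (suc c) is → V x is ms ≈ 0# ⊎ Full c ms
  V-full zero    x is ms full = inj₂ tt
  V-full (suc c) x (i ∷ is@(_ ∷ is')) (m ∷ ms@(m' ∷ ms')) (refl , full@(refl , _))
    with column-from-ones x (λ Q → rowᶜ x vacant Q is ms) m (λ Q' e t∈ → collide-column x _ Q' m' e t∈)
  ... | inj₁ r = inj₁ r
  ... | inj₂ (m≡ , r) with V-full c x is ms full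
  ... | inj₁ r' = inj₁ (≈-trans r r')
  ... | inj₂ f  = inj₂ (m≡ , f)

  full-vac : ∀ a → Full a (Vec.replicate a ones Vec.++ Vec.replicate D zeros)
  full-vac zero    = tt
  full-vac (suc a) = refl , full-vac a

  -- Each row opens at most one of the n full columns of the vacuum. Consequently the first column
  -- is still full before each of the n rows is applied.
  Ψ-full : ∀ xs c → length xs + c ≡ n → ∀ w → Ψ xs w ≈ 0# ⊎ Full c w
  Ψ-full []       c refl w with word-≟ w vac
  ... | yes refl = inj₂ (full-vac n)
  ... | no _     = inj₁ ≈-refl
  Ψ-full (x ∷ xs) c e w with full? c w
  ... | yes f = inj₂ f
  ... | no ¬f = inj₁ (⅀-zero∈ (words' (n + D)) (λ w' _ → vanish w'))
    where
    vanish : ∀ w' → V x w' w ⊗ Ψ xs w' ≈ 0#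
    vanish w' with Ψ-full xs (suc c) (≡.trans (ℕₚ.+-suc (length xs) c) e) w'
    ... | inj₁ r = ≈-trans (*-congˡ r) (zeroʳ _)
    ... | inj₂ f with V-full c x w' w f
    ... | inj₁ r = ≈-trans (*-congʳ r) (zeroˡ _)
    ... | inj₂ g = ⊥-elim (¬f g)

  quiet-all : ∀ {N} (w : Word N) → Quiet N w
  quiet-all []      = tt
  quiet-all (i ∷ w) = quiet-all w

  frontier : ∀ {N} (w : Word N) a b → Quiet (a + b) w → Quiet a w ⊎ (∃ λ d → Beyond (a + d) w × Quiet (suc (a + d)) w)
  frontier w a zero    quiet = inj₁ (subst (λ c → Quiet c w) (ℕₚ.+-identityʳ a) quiet)
  frontier w a (suc b) quiet with quiet-or-beyond (a + b) w
  ... | inj₁ quiet' = frontier w a b quiet'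
  ... | inj₂ beyond = inj₂ (b , beyond , subst (λ c → Quiet c w) (ℕₚ.+-suc a b) quiet)

  not-beyond-vac : ∀ a d → ¬ Beyond (a + d) (Vec.replicate a ones Vec.++ Vec.replicate D zeros)
  not-beyond-vac zero    d = low d D
    where
    low : ∀ d D → ¬ Beyond d (Vec.replicate D zeros)
    low zero    (suc D) (inj₁ p) = p refl
    low zero    (suc D) (inj₂ p) = low zero D p
    low (suc d) (suc D) p        = low d D p
  not-beyond-vac (suc a) d = not-beyond-vac a d

  ⅀-F : ∀ {A : Set} {d} (xs : List A) (f : A → Carrier) → (∀ x → F d (f x)) → F d (⅀ xs f)
  ⅀-F []       f h = F-zero
  ⅀-F (x ∷ xs) f h = F-+ (h x) (⅀-F xs f h)

  private
    length-O : length O ≡ k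
    length-O = Listₚ.length-replicate k

    suc-∸ : ∀ a d → suc a + d ∸ a ≡ suc d
    suc-∸ a d = ≡.trans (cong (_∸ a) (≡.sym (ℕₚ.+-suc a d))) (ℕₚ.m+n∸m≡n a (suc d))

  -- The vacuum ends in column n - 1, so a particle in column n + d or later stands for at least d +
  -- 1 steps. The last occupied column of the previous state `w'` splits these between the earlier
  -- rows and the last one.
  Ψ-F : ∀ xs → All (F 1) xs → ∀ d w → Beyond (n + d) w → F (suc d) (Ψ xs w)
  Ψ-F []       _          d w beyond with word-≟ w vac
  ... | yes refl = ⊥-elim (not-beyond-vac n d beyond)
  ... | no _     = F-zero
  Ψ-F (x ∷ xs) (x∈ ∷ xs∈) d w beyond = ⅀-F (words' (n + D)) _ bound
    where
    bound : ∀ w' → F (suc d) (V x w' w ⊗ Ψ xs w')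
    bound w' with frontier w' n D (quiet-all w')
    ... | inj₁ quiet = subst (λ e → F e (V x w' w ⊗ Ψ xs w')) (≡.trans (ℕₚ.+-identityʳ _) (suc-∸ n' d))
      (F-* (rowᶜ-beyond-F x x∈ vacant n' (n + d) O w' w length-O quiet beyond) F-0)
    ... | inj₂ (d' , beyond' , quiet) = F-mono bigger
      (F-* (rowᶜ-beyond-F x x∈ vacant (n + d') (n + d) O w' w length-O quiet beyond) (Ψ-F xs xs∈ d' w' beyond'))
      where
      bigger : suc d ≤ n + d ∸ (n + d') + suc d'
      bigger = subst (λ e → suc d ≤ e + suc d') (≡.sym (ℕₚ.[m+n]∸[m+o]≡n∸o n d d'))
        (subst (suc d ≤_) (≡.sym (ℕₚ.+-suc (d ∸ d') d')) (s≤s (ℕₚ.≤-trans (ℕₚ.m≤n+m∸n d d') (ℕₚ.≤-reflexive (ℕₚ.+-comm d' (d ∸ d'))))))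

  private
    W : List (Word (n + D))
    W = words' (n + D)

  Φ : List Carrier → Carrier → Word (n + D) → Carrier
  Φ xs y ν = ⅀ W (λ w → V y ν w ⊗ Ψ xs w)

  private
    flat-V : ∀ {N} x (is ms : Word N) → vacantRow k x (Vec.concat is) (Vec.concat ms) ≈ V x is ms
    flat-V x is ms = row-concat x vacant O is ms

    junk : Carrier → Carrier → (μ ν w : Word (n + D)) → Carrier
    junk x y μ ν w = rowᶜ x (λ Q → row y (remainder x y k Q) O (Vec.concat ν) (Vec.concat w)) O μ w

    V-commute : ∀ x y (μ ν : Word (n + D)) → Full 1 μ →
      ((triangle k ⊗ pochhammer x y k) ⊗ ⅀ W (λ w → V x μ w ⊗ V y ν w)) ⊕ ⅀ W (junk x y μ ν)
      ≈ triangle k ⊗ ⅀ W (λ w → V x w ν ⊗ V y w μ)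
    V-commute x y (i ∷ μ) (o ∷ ν) (refl , tt) = begin
      _ ≈⟨ +-cong (*-congˡ (≈-sym (≈-trans (⅀-concat (n + D) _) (⅀-cong W (λ w → *-cong (flat-V x (ones ∷ μ) w) (flat-V y (o ∷ ν) w))))))
             (≈-sym (≈-trans (⅀-concat (n + D) _) (⅀-cong W (λ w → row-concat x (λ Q → row y (remainder x y k Q) O (Vec.concat (o ∷ ν)) (Vec.concat w)) O (ones ∷ μ) w)))) ⟩
      _ ≈⟨ row-commute x y k (Vec.concat μ) (Vec.concat ν) o ⟩
      _ ≈⟨ *-congˡ (≈-trans (⅀-concat (n + D) _) (⅀-cong W (λ w → *-cong (flat-V x w (o ∷ ν)) (flat-V y w (ones ∷ μ))))) ⟩
      _ ∎

    -- A particle that runs off the n + D columns accounts for more than D steps since the vacuum: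
    -- the steps up to the last occupied column of `μ` are in Ψ, those from there to the end are in
    -- the row.
    junk-F : ∀ x y xs → F 1 x → All (F 1) xs → ∀ μ ν → Ψ xs μ ⊗ ⅀ W (junk x y μ ν) ≈ 0#
    junk-F x y xs x∈ xs∈ μ ν = ≈-trans (⅀-*ˡ W _ _) (F-top (⅀-F W _ bound))
      where
      vanish : ∀ w → row y (remainder x y k O) O (Vec.concat ν) (Vec.concat w) ≈ 0#
      vanish w = ≈-trans (row-cong y O (Vec.concat ν) (Vec.concat w) (λ Q' e → remainder-vacant x y k Q' (≡.trans e length-O)))
        (row-0 y O (Vec.concat ν) (Vec.concat w))
      bound : ∀ w → F (suc D) (Ψ xs μ ⊗ junk x y μ ν w)
      bound w with frontier μ n D (quiet-all μ)
      ... | inj₁ quiet = subst (λ e → F e (Ψ xs μ ⊗ junk x y μ ν w)) (suc-∸ n' D)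
        (F-* {d = 0} F-0 (rowᶜ-F x x∈ _ n' O μ w length-O (vanish w) quiet))
      ... | inj₂ (d' , beyond' , quiet) = F-mono bigger
        (F-* (Ψ-F xs xs∈ d' μ beyond') (rowᶜ-F x x∈ _ (n + d') O μ w length-O (vanish w) quiet))
        where
        bigger : suc D ≤ suc d' + (n + D ∸ (n + d'))
        bigger = s≤s (subst (λ e → D ≤ d' + e) (≡.sym (ℕₚ.[m+n]∸[m+o]≡n∸o n D d')) (ℕₚ.m≤n+m∸n D d'))

    q-cancel^ : ∀ m {a b} → (q ↑ m) ⊗ a ≈ (q ↑ m) ⊗ b → a ≈ b
    q-cancel^ zero    e = ≈-trans (≈-sym (*-identityˡ _)) (≈-trans e (*-identityˡ _))
    q-cancel^ (suc m) e = q-cancel^ m (q-cancel (≈-trans (≈-sym (*-assoc _ _ _)) (≈-trans e (*-assoc _ _ _))))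

    triangle-cancel : ∀ m {a b} → triangle m ⊗ a ≈ triangle m ⊗ b → a ≈ b
    triangle-cancel zero    e = ≈-trans (≈-sym (*-identityˡ _)) (≈-trans e (*-identityˡ _))
    triangle-cancel (suc m) e = triangle-cancel m (q-cancel^ m (q-cancel^ m
      (≈-trans (regroup _ _ _) (≈-trans e (≈-sym (regroup _ _ _))))))
      where
      regroup : ∀ s t a → s ⊗ (s ⊗ (t ⊗ a)) ≈ ((s ⊗ s) ⊗ t) ⊗ a
      regroup = solve 3 (λ s t a → s :* (s :* (t :* a)) := ((s :* s) :* t) :* a) ≈-refl

    Ψ-commute : ∀ x y xs → F 1 x → All (F 1) xs → suc (length xs) ≤ n → ∀ μ ν →
      Ψ xs μ ⊗ (pochhammer x y k ⊗ ⅀ W (λ w → V x μ w ⊗ V y ν w)) ≈ Ψ xs μ ⊗ ⅀ W (λ w → V x w ν ⊗ V y w μ)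
    Ψ-commute x y xs x∈ xs∈ len μ ν with Ψ-full xs (n ∸ length xs) (ℕₚ.m+[n∸m]≡n (ℕₚ.<⇒≤ len)) μ
    ... | inj₁ r = ≈-trans (≈-trans (*-congʳ r) (zeroˡ _)) (≈-sym (≈-trans (*-congʳ r) (zeroˡ _)))
    -- `V-commute` carries `triangle k` on both sides; it is a power of q and can be cancelled.
    ... | inj₂ f = triangle-cancel k (begin
      T ⊗ (p ⊗ (h ⊗ s))                       ≈⟨ solve 4 (λ t p h s → t :* (p :* (h :* s)) := p :* ((t :* h) :* s)) ≈-refl T p h s ⟩
      p ⊗ ((T ⊗ h) ⊗ s)                       ≈⟨ ≈-sym (+-identityʳ _) ⟩
      (p ⊗ ((T ⊗ h) ⊗ s)) ⊕ 0#                ≈⟨ +-congˡ (≈-sym (junk-F x y xs x∈ xs∈ μ ν)) ⟩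
      (p ⊗ ((T ⊗ h) ⊗ s)) ⊕ (p ⊗ ⅀ W (junk x y μ ν)) ≈⟨ ≈-sym (distribˡ p _ _) ⟩
      p ⊗ (((T ⊗ h) ⊗ s) ⊕ ⅀ W (junk x y μ ν)) ≈⟨ *-congˡ (V-commute x y μ ν (full-1 (n ∸ length xs) μ (ℕₚ.m<n⇒0<n∸m len) f)) ⟩
      p ⊗ (T ⊗ s')                            ≈⟨ solve 3 (λ t p s → p :* (t :* s) := t :* (p :* s)) ≈-refl T p s' ⟩
      T ⊗ (p ⊗ s') ∎)
      where
      T = triangle k
      p = Ψ xs μ
      h = pochhammer x y k
      s = ⅀ W (λ w → V x μ w ⊗ V y ν w)
      s' = ⅀ W (λ w → V x w ν ⊗ V y w μ)
      full-1 : ∀ {N} c (w : Word N) → 0 < c → Full c w → Full 1 w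
      full-1 (suc c) (i ∷ w) _ (p , _) = p , tt

  pochhammers : List Carrier → Carrier → Carrier
  pochhammers []       y = 1#
  pochhammers (x ∷ xs) y = pochhammers xs y ⊗ pochhammer x y k

  -- The eigenvalue is the inverse of `pochhammers xs y`; with the product on the left no inverse
  -- has to be named. The last row is exchanged with that of y by `Ψ-commute`, and the vacuum is the
  -- base case.
  Ψ-eigen : ∀ xs y → All (F 1) xs → length xs ≤ n → ∀ ν → pochhammers xs y ⊗ Φ xs y ν ≈ Ψ xs ν
  Ψ-eigen [] y _ _ ν = begin
    1# ⊗ ⅀ W (λ w → V y ν w ⊗ δ w) ≈⟨ *-identityˡ _ ⟩
    ⅀ W (λ w → V y ν w ⊗ δ w)      ≈⟨ ⅀-cong W (λ w → *-comm _ _) ⟩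
    ⅀ W (λ w → δ w ⊗ V y ν w)      ≈⟨ ⅀-δ (V y ν) ⟩
    V y ν vac                      ≈⟨ V-vac y ν ⟩
    δ ν ∎
  Ψ-eigen (x ∷ xs) y (x∈ ∷ xs∈) len ν = begin
    (Π ⊗ h) ⊗ ⅀ W (λ w → V y ν w ⊗ ⅀ W (λ μ → V x μ w ⊗ Ψ xs μ))
      ≈⟨ *-congˡ (⅀-cong W (λ w → ⅀-*ˡ W _ _)) ⟩
    (Π ⊗ h) ⊗ ⅀ W (λ w → ⅀ W (λ μ → V y ν w ⊗ (V x μ w ⊗ Ψ xs μ)))
      ≈⟨ *-congˡ (⅀-swap W W _) ⟩
    (Π ⊗ h) ⊗ ⅀ W (λ μ → ⅀ W (λ w → V y ν w ⊗ (V x μ w ⊗ Ψ xs μ)))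
      ≈⟨ *-congˡ (⅀-cong W (λ μ → ≈-trans
           (⅀-cong W (λ w → solve 3 (λ a b c → a :* (b :* c) := c :* (b :* a)) ≈-refl (V y ν w) (V x μ w) (Ψ xs μ)))
           (≈-sym (⅀-*ˡ W _ _)))) ⟩
    (Π ⊗ h) ⊗ ⅀ W (λ μ → Ψ xs μ ⊗ ⅀ W (λ w → V x μ w ⊗ V y ν w))
      ≈⟨ *-assoc _ _ _ ⟩
    Π ⊗ (h ⊗ ⅀ W (λ μ → Ψ xs μ ⊗ ⅀ W (λ w → V x μ w ⊗ V y ν w)))
      ≈⟨ *-congˡ (≈-trans (⅀-*ˡ W _ _) (⅀-cong W (λ μ → ≈-trans
           (solve 3 (λ h p s → h :* (p :* s) := p :* (h :* s)) ≈-refl h (Ψ xs μ) _)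
           (Ψ-commute x y xs x∈ xs∈ len μ ν)))) ⟩
    Π ⊗ ⅀ W (λ μ → Ψ xs μ ⊗ ⅀ W (λ w → V x w ν ⊗ V y w μ))
      ≈⟨ *-congˡ (⅀-cong W (λ μ → ≈-trans (⅀-*ˡ W _ _)
           (⅀-cong W (λ w → solve 3 (λ p a b → p :* (a :* b) := a :* (b :* p)) ≈-refl (Ψ xs μ) (V x w ν) (V y w μ))))) ⟩
    Π ⊗ ⅀ W (λ μ → ⅀ W (λ w → V x w ν ⊗ (V y w μ ⊗ Ψ xs μ)))
      ≈⟨ *-congˡ (≈-trans (⅀-swap W W _) (⅀-cong W (λ w → ≈-sym (⅀-*ˡ W _ _)))) ⟩
    Π ⊗ ⅀ W (λ w → V x w ν ⊗ Φ xs y w)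
      ≈⟨ ≈-trans (⅀-*ˡ W _ _) (⅀-cong W (λ w → ≈-trans
           (solve 3 (λ p v f → p :* (v :* f) := v :* (p :* f)) ≈-refl Π (V x w ν) (Φ xs y w))
           (*-congˡ (Ψ-eigen xs y xs∈ (ℕₚ.<⇒≤ len) w)))) ⟩
    ⅀ W (λ w → V x w ν ⊗ Ψ xs w) ∎
    where
    Π = pochhammers xs y
    h = pochhammer x y k

  Ψ-vac : ∀ xs → Ψ xs vac ≈ 1#
  Ψ-vac []       = reflexive (if-yes (word-≟ vac vac) refl)
  Ψ-vac (x ∷ xs) = ≈-trans (⅀-cong W (λ w → *-congʳ (V-vac x w))) (≈-trans (⅀-δ (Ψ xs)) (Ψ-vac xs))

  allPochhammers : List Carrier → List Carrier → Carrier
  allPochhammers xs []       = 1#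
  allPochhammers xs (y ∷ ys) = allPochhammers xs ys ⊗ pochhammers xs y

  Ψ-cauchy : ∀ xs ys → All (F 1) xs → length xs ≤ n → allPochhammers xs ys ⊗ ⅀ W (λ w → Ψ xs w ⊗ Ψ ys w) ≈ 1#
  Ψ-cauchy xs [] xs∈ len = begin
    1# ⊗ ⅀ W (λ w → Ψ xs w ⊗ δ w) ≈⟨ *-identityˡ _ ⟩
    ⅀ W (λ w → Ψ xs w ⊗ δ w)      ≈⟨ ⅀-cong W (λ w → *-comm _ _) ⟩
    ⅀ W (λ w → δ w ⊗ Ψ xs w)      ≈⟨ ⅀-δ (Ψ xs) ⟩
    Ψ xs vac                      ≈⟨ Ψ-vac xs ⟩
    1# ∎
  Ψ-cauchy xs (y ∷ ys) xs∈ len = begin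
    (A ⊗ Π) ⊗ ⅀ W (λ w → Ψ xs w ⊗ ⅀ W (λ ν → V y ν w ⊗ Ψ ys ν))
      ≈⟨ *-congˡ (≈-trans (⅀-cong W (λ w → ⅀-*ˡ W _ _)) (⅀-swap W W _)) ⟩
    (A ⊗ Π) ⊗ ⅀ W (λ ν → ⅀ W (λ w → Ψ xs w ⊗ (V y ν w ⊗ Ψ ys ν)))
      ≈⟨ *-congˡ (⅀-cong W (λ ν → ≈-trans
           (⅀-cong W (λ w → solve 3 (λ a b c → a :* (b :* c) := c :* (b :* a)) ≈-refl (Ψ xs w) (V y ν w) (Ψ ys ν)))
           (≈-sym (⅀-*ˡ W _ _)))) ⟩
    -- Moved across the pairing, the row of `y` acts on Ψ xs by its transpose, for which Ψ xs is an
    -- eigenvector.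
    (A ⊗ Π) ⊗ ⅀ W (λ ν → Ψ ys ν ⊗ Φ xs y ν)
      ≈⟨ ≈-trans (*-assoc _ _ _) (*-congˡ (⅀-*ˡ W _ _)) ⟩
    A ⊗ ⅀ W (λ ν → Π ⊗ (Ψ ys ν ⊗ Φ xs y ν))
      ≈⟨ *-congˡ (⅀-cong W (λ ν → ≈-trans
           (solve 3 (λ p a f → p :* (a :* f) := (p :* f) :* a) ≈-refl Π (Ψ ys ν) (Φ xs y ν))
           (*-congʳ (Ψ-eigen xs y xs∈ len ν)))) ⟩
    A ⊗ ⅀ W (λ ν → Ψ xs ν ⊗ Ψ ys ν)
      ≈⟨ Ψ-cauchy xs ys xs∈ len ⟩
    1# ∎
    where
    A = allPochhammers xs ys
    Π = pochhammers xs y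

-- Partitions as particles on a line; horizontal strips as interlacing.

module Partitions where

  module ℕΣ = FiniteSum ℕₚ.+-*-commutativeSemiring

  -- The rows r = 0, 1, … of a partition with n parts are particles at the positions λ_r + (n - 1 - r).
  positions : ∀ {n} → Vec ℕ n → Vec ℕ n
  positions []             = []
  positions {suc n} (p ∷ ps) = p + n ∷ positions ps

  lookup-positions : ∀ {n} (p : Vec ℕ n) r → lookup (positions p) r ≡ lookup p r + (n ∸ suc (toℕ r))
  lookup-positions (p ∷ ps) zero    = refl
  lookup-positions (p ∷ ps) (suc r) = lookup-positions ps r

  occupied below : ∀ {n} → Vec ℕ n → ℕ → ℕ
  occupied []       x = 0
  occupied (a ∷ as) x = 𝟙 (a ≡ᵇ x) + occupied as x
  below []       x = 0
  below (a ∷ as) x = 𝟙 (a <ᵇ x) + below as x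

  -- Numbers of particles moving from a_r to b_r that cross from x to x + 1, or visit x.
  crossing present : ∀ {n} → Vec ℕ n → Vec ℕ n → ℕ → ℕ
  crossing []       []       x = 0
  crossing (a ∷ as) (b ∷ bs) x = 𝟙 ((a <ᵇ suc x) ∧ (x <ᵇ b)) + crossing as bs x
  present []       []       x = 0
  present (a ∷ as) (b ∷ bs) x = 𝟙 ((a <ᵇ suc x) ∧ (x <ᵇ suc b)) + present as bs x

  crossing⁻ : ∀ {n} → Vec ℕ n → Vec ℕ n → ℕ → ℕ
  crossing⁻ a b zero    = 0
  crossing⁻ a b (suc x) = crossing a b x

  private
    interchange : ∀ a b c d → (a + b) + (c + d) ≡ (a + c) + (b + d)
    interchange = solve 4 (λ a b c d → (a :+ b) :+ (c :+ d) := (a :+ c) :+ (b :+ d)) refl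
      where open +-*-Solver

    below₁ : ∀ a x → 𝟙 (a <ᵇ suc x) ≡ 𝟙 (a <ᵇ x) + 𝟙 (a ≡ᵇ x)
    below₁ zero    zero    = refl
    below₁ zero    (suc x) = refl
    below₁ (suc a) zero    = refl
    below₁ (suc a) (suc x) = below₁ a x

    shift₁ : ∀ a b x → a ≤ b → 𝟙 (a <ᵇ suc x) ≡ 𝟙 (b <ᵇ suc x) + 𝟙 ((a <ᵇ suc x) ∧ (x <ᵇ b))
    shift₁ zero    zero    x       le       = refl
    shift₁ zero    (suc b) zero    le       = refl
    shift₁ zero    (suc b) (suc x) le       = shift₁ zero b x z≤n
    shift₁ (suc a) (suc b) zero    le       = refl
    shift₁ (suc a) (suc b) (suc x) (s≤s le) = shift₁ a b x le

    leave₁ : ∀ a b x → a ≤ b → 𝟙 ((a <ᵇ suc x) ∧ (x <ᵇ suc b)) ≡ 𝟙 (b ≡ᵇ x) + 𝟙 ((a <ᵇ suc x) ∧ (x <ᵇ b))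
    leave₁ zero    zero    zero    le       = refl
    leave₁ zero    zero    (suc x) le       = refl
    leave₁ zero    (suc b) zero    le       = refl
    leave₁ zero    (suc b) (suc x) le       = leave₁ zero b x z≤n
    leave₁ (suc a) (suc b) zero    le       = refl
    leave₁ (suc a) (suc b) (suc x) (s≤s le) = leave₁ a b x le

    enter₁ : ∀ a b x → a ≤ b → 𝟙 ((a <ᵇ suc (suc x)) ∧ (suc x <ᵇ suc b)) ≡ 𝟙 (a ≡ᵇ suc x) + 𝟙 ((a <ᵇ suc x) ∧ (x <ᵇ b))
    enter₁ zero          b       x       le             = refl
    enter₁ (suc zero)    (suc b) zero    le             = refl
    enter₁ (suc (suc a)) (suc b) zero    le             = refl
    enter₁ (suc a)       (suc b) (suc x) (s≤s le)       = enter₁ a b x le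

    enter₀ : ∀ a b → a ≤ b → 𝟙 ((a <ᵇ 1) ∧ (0 <ᵇ suc b)) ≡ 𝟙 (a ≡ᵇ 0)
    enter₀ zero    b le = refl
    enter₀ (suc a) b le = refl

  Below : ∀ {n} → Vec ℕ n → Vec ℕ n → Set
  Below a b = ∀ r → lookup a r ≤ lookup b r

  below-suc : ∀ {n} (a : Vec ℕ n) x → below a (suc x) ≡ below a x + occupied a x
  below-suc []       x = refl
  below-suc (a ∷ as) x = ≡.trans (cong₂ _+_ (below₁ a x) (below-suc as x)) (interchange (𝟙 (a <ᵇ x)) _ _ _)

  below-crossing : ∀ {n} (a b : Vec ℕ n) x → Below a b → below a (suc x) ≡ below b (suc x) + crossing a b x
  below-crossing []       []       x le = refl
  below-crossing (a ∷ as) (b ∷ bs) x le =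
    ≡.trans (cong₂ _+_ (shift₁ a b x (le zero)) (below-crossing as bs x (le ∘ suc))) (interchange (𝟙 (b <ᵇ suc x)) _ _ _)

  present-leave : ∀ {n} (a b : Vec ℕ n) x → Below a b → present a b x ≡ occupied b x + crossing a b x
  present-leave []       []       x le = refl
  present-leave (a ∷ as) (b ∷ bs) x le =
    ≡.trans (cong₂ _+_ (leave₁ a b x (le zero)) (present-leave as bs x (le ∘ suc))) (interchange (𝟙 (b ≡ᵇ x)) _ _ _)

  present-enter : ∀ {n} (a b : Vec ℕ n) x → Below a b → present a b x ≡ occupied a x + crossing⁻ a b x
  present-enter []       []       zero    le = refl
  present-enter []       []       (suc x) le = refl
  present-enter (a ∷ as) (b ∷ bs) zero    le = ≡.trans (cong₂ _+_ (enter₀ a b (le zero)) (present-enter as bs zero (le ∘ suc)))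
    (≡.sym (ℕₚ.+-assoc (𝟙 (a ≡ᵇ 0)) _ 0))
  present-enter (a ∷ as) (b ∷ bs) (suc x) le =
    ≡.trans (cong₂ _+_ (enter₁ a b x (le zero)) (present-enter as bs (suc x) (le ∘ suc))) (interchange (𝟙 (a ≡ᵇ suc x)) _ _ _)

  -- The numbers of inversions of the two sequences change by the difference of the two crossing
  -- statistics: both sides telescope over the columns.
  inversions : ∀ {n} → ℕ → Vec ℕ n → Vec ℕ n → ℕ
  inversions N a b = ∑ (upTo N) (λ x → occupied a x * below b x)

  ∑-upTo-suc : ∀ N (f : ℕ → ℕ) → ∑ (upTo (suc N)) f ≡ ∑ (upTo N) f + f N
  ∑-upTo-suc N f = ≡.trans (cong (λ l → ∑ l f) (≡.sym (Listₚ.upTo-∷ʳ N)))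
    (≡.trans (ℕΣ.⅀-++ (upTo N) (N ∷ []) f) (cong (λ s → ∑ (upTo N) f + s) (ℕₚ.+-identityʳ (f N))))

  below-0 : ∀ {n} (a : Vec ℕ n) → below a 0 ≡ 0
  below-0 []       = refl
  below-0 (a ∷ as) = below-0 as

  below-crossing⁻ : ∀ {n} (a b : Vec ℕ n) x → Below a b → below a x ≡ below b x + crossing⁻ a b x
  below-crossing⁻ a b zero    le = ≡.trans (below-0 a) (≡.sym (≡.trans (ℕₚ.+-identityʳ _) (below-0 b)))
  below-crossing⁻ a b (suc x) le = below-crossing a b x le

  inversions-telescope : ∀ {n} N (a b a' b' : Vec ℕ n) → Below a a' → Below b b' →
    ∑ (upTo N) (λ x → crossing a a' x * present b b' x) + inversions N a b
    ≡ (inversions N a' b' + ∑ (upTo N) (λ x → crossing⁻ b b' x * present a a' x)) + crossing⁻ a a' N * below b N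
  inversions-telescope zero    a b a' b' le le' = refl
  inversions-telescope (suc N) a b a' b' le le' = begin
    ∑ (upTo (suc N)) (λ x → crossing a a' x * present b b' x) + inversions (suc N) a b
      ≡⟨ cong₂ _+_ (∑-upTo-suc N _) (∑-upTo-suc N _) ⟩
    (S + e * present b b' N) + (I + occupied a N * M)
      ≡⟨ solve 4 (λ s p i o → (s :+ p) :+ (i :+ o) := (s :+ i) :+ (p :+ o)) refl S (e * present b b' N) I (occupied a N * M) ⟩
    (S + I) + (e * present b b' N + occupied a N * M)
      ≡⟨ cong (_+ (e * present b b' N + occupied a N * M)) (inversions-telescope N a b a' b' le le') ⟩
    ((I' + S') + e⁻ * M) + (e * present b b' N + occupied a N * M)
      ≡⟨ cong (λ p → ((I' + S') + e⁻ * M) + (e * p + occupied a N * M)) (present-enter b b' N le') ⟩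
    ((I' + S') + e⁻ * M) + (e * (occupied b N + ε) + occupied a N * M)
      ≡⟨ solve 8 (λ i s e⁻ m e ob ε oa → ((i :+ s) :+ e⁻ :* m) :+ (e :* (ob :+ ε) :+ oa :* m)
           := (i :+ s) :+ ((oa :+ e⁻) :* m :+ (e :* (ob :+ ε)))) refl I' S' e⁻ M e (occupied b N) ε (occupied a N) ⟩
    (I' + S') + ((occupied a N + e⁻) * M + e * (occupied b N + ε))
      -- Two conservation laws at the site N: for `a`, what arrives equals what stops or leaves; for
      -- `b`, the numbers of particles below N before and after differ by the one in transit.
      ≡⟨ cong₂ (λ p m → (I' + S') + (p * m + e * (occupied b N + ε))) (≡.trans (≡.sym (present-enter a a' N le)) (present-leave a a' N le)) (below-crossing⁻ b b' N le') ⟩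
    (I' + S') + ((occupied a' N + e) * (M' + ε) + e * (occupied b N + ε))
      ≡⟨ solve 7 (λ i s o' e m' ε ob → (i :+ s) :+ ((o' :+ e) :* (m' :+ ε) :+ e :* (ob :+ ε))
           := ((i :+ o' :* m') :+ (s :+ ε :* (o' :+ e))) :+ e :* ((m' :+ ε) :+ ob)) refl I' S' (occupied a' N) e M' ε (occupied b N) ⟩
    ((I' + occupied a' N * M') + (S' + ε * (occupied a' N + e))) + e * ((M' + ε) + occupied b N)
      ≡⟨ cong₂ (λ p m → ((I' + occupied a' N * M') + (S' + ε * p)) + e * (m + occupied b N)) (≡.sym (present-leave a a' N le)) (≡.sym (below-crossing⁻ b b' N le')) ⟩
    ((I' + occupied a' N * M') + (S' + ε * present a a' N)) + e * (M + occupied b N)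
      ≡⟨ cong₂ (λ p m → p + e * m) (cong₂ _+_ (≡.sym (∑-upTo-suc N _)) (≡.sym (∑-upTo-suc N _))) (≡.sym (below-suc b N)) ⟩
    _ ∎
    where
    open ≡.≡-Reasoning
    open +-*-Solver
    S  = ∑ (upTo N) (λ x → crossing a a' x * present b b' x)
    S' = ∑ (upTo N) (λ x → crossing⁻ b b' x * present a a' x)
    I  = inversions N a b
    I' = inversions N a' b'
    e  = crossing a a' N
    e⁻ = crossing⁻ a a' N
    ε  = crossing⁻ b b' N
    M  = below b N
    M' = below b' N

  Decreasing : ∀ {n} → Vec ℕ n → Set
  Decreasing []       = ⊤
  Decreasing (a ∷ as) = VAll (_< a) as × Decreasing as

  Interlacing : ∀ {n} → Vec ℕ n → Vec ℕ n → Set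
  Interlacing []       []       = ⊤
  Interlacing (a ∷ as) (b ∷ bs) = a ≤ b × VAll (_< a) bs × Interlacing as bs

  <ᵇ-true : ∀ {m n} → m < n → (m <ᵇ n) ≡ true
  <ᵇ-true {zero}  {suc n} _        = refl
  <ᵇ-true {suc m} {suc n} (s≤s lt) = <ᵇ-true lt

  <ᵇ-false : ∀ {m n} → n ≤ m → (m <ᵇ n) ≡ false
  <ᵇ-false {m}     {zero}  _        = refl
  <ᵇ-false {suc m} {suc n} (s≤s le) = <ᵇ-false le

  private
    𝟙≤1 : ∀ b → 𝟙 b ≤ 1
    𝟙≤1 true  = s≤s z≤n
    𝟙≤1 false = z≤n

    present-0 : ∀ {n} x c (a b : Vec ℕ n) → VAll (_< c) b → c ≤ x → present a b x ≡ 0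
    present-0 x c []       []       _          le = refl
    present-0 x c (a ∷ as) (b ∷ bs) (b< ∷ bs<) le rewrite <ᵇ-false {x} {suc b} (ℕₚ.≤-trans b< le) | Boolₚ.∧-zeroʳ (a <ᵇ suc x) = present-0 x c as bs bs< le

  -- From the start of particle r on, all later particles have stopped strictly before; to the left
  -- of that start, particle r itself is absent.
  present≤1 : ∀ {n} (a b : Vec ℕ n) x → Interlacing a b → present a b x ≤ 1
  present≤1 []       []       x _ = z≤n
  present≤1 (a ∷ as) (b ∷ bs) x (a≤b , bs< , int) with a ℕₚ.≤? x
  ... | yes a≤x rewrite present-0 x a as bs bs< a≤x | ℕₚ.+-identityʳ (𝟙 ((a <ᵇ suc x) ∧ (x <ᵇ suc b))) = 𝟙≤1 _
  ... | no  a≰x rewrite <ᵇ-false {a} {suc x} (ℕₚ.≰⇒> a≰x) = present≤1 as bs x int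

  interlacing-below : ∀ {n} (a b : Vec ℕ n) → Interlacing a b → Below a b
  interlacing-below (a ∷ as) (b ∷ bs) (le , _ , int) zero    = le
  interlacing-below (a ∷ as) (b ∷ bs) (le , _ , int) (suc r) = interlacing-below as bs int r

  decreasing-interlacing : ∀ {n} (a : Vec ℕ n) → Decreasing a → Interlacing a a
  decreasing-interlacing []       _        = tt
  decreasing-interlacing (a ∷ as) (lt , d) = ℕₚ.≤-refl , lt , decreasing-interlacing as d

  occupied≤1 : ∀ {n} (a : Vec ℕ n) x → Decreasing a → occupied a x ≤ 1
  occupied≤1 a x d = ℕₚ.≤-trans (ℕₚ.m≤m+n _ _)
    (subst (_≤ 1) (present-leave a a x (λ _ → ℕₚ.≤-refl)) (present≤1 a a x (decreasing-interlacing a d)))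

  below≤ : ∀ {n} (a : Vec ℕ n) x → below a x ≤ n
  below≤ []       x = z≤n
  below≤ (a ∷ as) x = ℕₚ.+-mono-≤ (𝟙≤1 (a <ᵇ x)) (below≤ as x)

  below-all : ∀ {n} (a : Vec ℕ n) x → VAll (_< x) a → below a x ≡ n
  below-all []       x _          = refl
  below-all (a ∷ as) x (a< ∷ as<) rewrite <ᵇ-true a< = cong suc (below-all as x as<)

  -- Positions decrease, so with particle r all of the particles r, ..., n - 1 lie below x. With
  -- `below-lookup⁻` this recovers each position from the counting function `below`.
  below-lookup : ∀ {n} (a : Vec ℕ n) → Decreasing a → ∀ r x → lookup a r < x → n ≤ below a x + toℕ r
  below-lookup {suc n} (a ∷ as) (lt , d) zero    x a<x = ℕₚ.≤-reflexive (≡.sym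
    (≡.trans (ℕₚ.+-identityʳ _) (below-all (a ∷ as) x (a<x ∷ VAll.map (λ l → ℕₚ.<-trans l a<x) lt))))
  below-lookup {suc n} (a ∷ as) (lt , d) (suc r) x a<x = subst (suc n ≤_) (≡.sym (ℕₚ.+-suc _ (toℕ r)))
    (s≤s (ℕₚ.≤-trans (below-lookup as d r x a<x) (ℕₚ.+-monoˡ-≤ (toℕ r) (ℕₚ.m≤n+m (below as x) _))))

  below-lookup⁻ : ∀ {n} (a : Vec ℕ n) → Decreasing a → ∀ r x → x ≤ lookup a r → suc (below a x + toℕ r) ≤ n
  below-lookup⁻ (a ∷ as) (lt , d) zero    x x≤ rewrite <ᵇ-false x≤ | ℕₚ.+-identityʳ (below as x) = s≤s (below≤ as x)
  below-lookup⁻ (a ∷ as) (lt , d) (suc r) x x≤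
    rewrite <ᵇ-false {a} {x} (ℕₚ.≤-trans x≤ (ℕₚ.<⇒≤ (VAllₚ.lookup⁺ lt r))) | ℕₚ.+-suc (below as x) (toℕ r)
    = s≤s (below-lookup⁻ as d r x x≤)

  -- The difference of the counting functions at x is the number of particles in transit into x. The
  -- two hypotheses say that it is never negative and that at most one particle is present at a
  -- site, which is what the bits of a row provide.
  below-interlacing : ∀ {n} N (a b : Vec ℕ n) → Decreasing a → Decreasing b → (∀ r → lookup a r < N) → (∀ r → lookup b r < N) →
    (∀ x → x < N → below b x ≤ below a x) → (∀ x → x < N → below a (suc x) ≤ suc (below b x)) →
    Below a b × (∀ r s → toℕ r < toℕ s → lookup b s < lookup a r)
  below-interlacing N a b da db a< b< h h' = ab , ba
    where
    ab : Below a b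
    ab r with lookup a r ℕₚ.≤? lookup b r
    ... | yes le = le
    -- If b_r < a_r, then below a_r there are at least n - r particles of `b` but at most n - r - 1
    -- of `a`.
    ... | no  nle = ⊥-elim (ℕₚ.<-irrefl refl (ℕₚ.≤-trans (s≤s (ℕₚ.≤-trans (below-lookup b db r (lookup a r) (ℕₚ.≰⇒> nle))
            (ℕₚ.+-monoˡ-≤ (toℕ r) (h (lookup a r) (a< r))))) (below-lookup⁻ a da r (lookup a r) ℕₚ.≤-refl)))
    ba : ∀ r s → toℕ r < toℕ s → lookup b s < lookup a r
    ba r s r<s with lookup b s ℕₚ.<? lookup a r
    ... | yes lt = lt
    ... | no nlt = ⊥-elim (ℕₚ.<-irrefl refl (ℕₚ.≤-trans (s≤s (ℕₚ.≤-trans (below-lookup a da r (suc (lookup b s)) (s≤s (ℕₚ.≮⇒≥ nlt)))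
            (ℕₚ.≤-trans (ℕₚ.+-monoˡ-≤ (toℕ r) (h' (lookup b s) (b< s)))
              (ℕₚ.≤-trans (ℕₚ.≤-reflexive (≡.sym (ℕₚ.+-suc _ (toℕ r)))) (ℕₚ.+-monoʳ-≤ (below b (lookup b s)) r<s)))))
            (below-lookup⁻ b db s (lookup b s) ℕₚ.≤-refl)))

  private
    ≤ᵇ-true : ∀ m n → (m ≤ᵇ n) ≡ true → m ≤ n
    ≤ᵇ-true m n e = ℕₚ.≤ᵇ⇒≤ m n (subst Bool.T (≡.sym e) tt)

  ≤ᵇ-intro : ∀ {m n} → m ≤ n → (m ≤ᵇ n) ≡ true
  ≤ᵇ-intro {zero}  le = refl
  ≤ᵇ-intro {suc m} le = <ᵇ-true le

  ∧-true : ∀ {a b} → a ∧ b ≡ true → a ≡ true × b ≡ true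
  ∧-true {true} e = refl , e

  WeaklyDecreasing : ∀ {n} → Vec ℕ n → Set
  WeaklyDecreasing []       = ⊤
  WeaklyDecreasing (p ∷ ps) = VAll (_≤ p) ps × WeaklyDecreasing ps

  module _ (N k : ℕ) where

    private
      from-wd : ∀ {n} p (ps : Vec ℕ n) → weaklyDecreasing N k (p ∷ toList ps) ≡ true → WeaklyDecreasing (p ∷ ps)
      from-wd p []        _ = [] , tt
      from-wd p (p' ∷ ps) e with from-wd p' ps (proj₂ (∧-true {p' ≤ᵇ p} e))
      ... | w = (le ∷ VAll.map (λ l → ℕₚ.≤-trans l le) (proj₁ w)) , w
        where le = ≤ᵇ-true p' p (proj₁ (∧-true {p' ≤ᵇ p} e))

      to-wd : ∀ {n} p (ps : Vec ℕ n) → WeaklyDecreasing (p ∷ ps) → weaklyDecreasing N k (p ∷ toList ps) ≡ true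
      to-wd p []        _              = refl
      to-wd p (p' ∷ ps) ((le ∷ _) , w) rewrite ≤ᵇ-intro le = to-wd p' ps w

    weaklyDecreasing⁻ : ∀ {n} (p : Vec ℕ n) → weaklyDecreasing N k (toList p) ≡ true → WeaklyDecreasing p
    weaklyDecreasing⁻ []       _ = tt
    weaklyDecreasing⁻ (p ∷ ps) e = from-wd p ps e

    weaklyDecreasing⁺ : ∀ {n} (p : Vec ℕ n) → WeaklyDecreasing p → weaklyDecreasing N k (toList p) ≡ true
    weaklyDecreasing⁺ []       _ = refl
    weaklyDecreasing⁺ (p ∷ ps) w = to-wd p ps w

  positions-< : ∀ {n} (p : Vec ℕ n) c → VAll (_≤ c) p → VAll (_< c + n) (positions p)
  positions-< []       c _          = []
  positions-< {suc n} (p ∷ ps) c (le ∷ les) = subst (p + n <_) (≡.sym (ℕₚ.+-suc c n)) (s≤s (ℕₚ.+-monoˡ-≤ n le))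
    ∷ VAll.map (λ l → ℕₚ.<-≤-trans l (ℕₚ.+-monoʳ-≤ c (ℕₚ.n≤1+n n))) (positions-< ps c les)

  positions-decreasing : ∀ {n} (p : Vec ℕ n) → WeaklyDecreasing p → Decreasing (positions p)
  positions-decreasing []       _          = tt
  positions-decreasing (p ∷ ps) (les , w) = positions-< ps p les , positions-decreasing ps w

  Strip : ∀ {n} → Vec ℕ n → Vec ℕ n → Set
  Strip μ ν = (∀ r → lookup μ r ≤ lookup ν r) × (∀ r s → toℕ r < toℕ s → lookup ν s ≤ lookup μ r)

  strip? : ∀ {n} (μ ν : Vec ℕ n) → Dec (Strip μ ν)
  strip? μ ν = Finₚ.all? (λ r → lookup μ r ℕₚ.≤? lookup ν r)
    ×-dec Finₚ.all? (λ r → Finₚ.all? (λ s → (toℕ r ℕₚ.<? toℕ s) →-dec (lookup ν s ℕₚ.≤? lookup μ r)))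

  strip-interlacing : ∀ {n} (μ ν : Vec ℕ n) → Strip μ ν → Interlacing (positions μ) (positions ν)
  strip-interlacing []       []       _        = tt
  strip-interlacing {suc n} (m ∷ μ) (l ∷ ν) (le , le') =
    ℕₚ.+-monoˡ-≤ n (le zero) , positions-< ν m (VAllₚ.lookup⁻ (λ s → le' zero (suc s) (s≤s z≤n)))
    , strip-interlacing μ ν ((λ r → le (suc r)) , (λ r s r<s → le' (suc r) (suc s) (s≤s r<s)))

  strip-positions : ∀ {n} (μ ν : Vec ℕ n) → WeaklyDecreasing ν → Below (positions μ) (positions ν) →
    (∀ r s → toℕ r < toℕ s → lookup (positions ν) s < lookup (positions μ) r) → Strip μ ν
  strip-positions μ ν w le lt = (λ r → below' r (le r)) , (λ r s r<s → beneath μ ν w r s r<s lt)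
    where
    below' : ∀ r → lookup (positions μ) r ≤ lookup (positions ν) r → lookup μ r ≤ lookup ν r
    below' r le rewrite lookup-positions μ r | lookup-positions ν r = ℕₚ.+-cancelʳ-≤ _ _ _ le
    beneath : ∀ {n} (μ ν : Vec ℕ n) → WeaklyDecreasing ν → ∀ r s → toℕ r < toℕ s →
      (∀ r s → toℕ r < toℕ s → lookup (positions ν) s < lookup (positions μ) r) → lookup ν s ≤ lookup μ r
    beneath (m ∷ μ) (l ∷ l' ∷ ν) (_ , les , _) zero    (suc s) r<s lt = ℕₚ.≤-trans (head s) first
      where
      head : ∀ s → lookup (l' ∷ ν) s ≤ l'
      head zero    = ℕₚ.≤-refl
      head (suc s) = VAllₚ.lookup⁺ les s
      first : l' ≤ m
      first = ℕₚ.+-cancelʳ-≤ _ _ _ (ℕₚ.≤-pred (ℕₚ.≤-trans (lt zero (suc zero) (s≤s z≤n)) (ℕₚ.≤-reflexive (ℕₚ.+-suc m _))))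
    beneath (m ∷ μ) (l ∷ ν) (_ , w) (suc r) (suc s) (s≤s r<s) lt =
      beneath μ ν w r s r<s (λ r s r<s → lt (suc r) (suc s) (s≤s r<s))

  ≡ᵇ-refl : ∀ x → (x ≡ᵇ x) ≡ true
  ≡ᵇ-refl zero    = refl
  ≡ᵇ-refl (suc x) = ≡ᵇ-refl x

  ≡ᵇ-false : ∀ a x → x < a → (a ≡ᵇ x) ≡ false
  ≡ᵇ-false (suc a) zero    _        = refl
  ≡ᵇ-false (suc a) (suc x) (s≤s lt) = ≡ᵇ-false a x lt

  ≡ᵇ-false′ : ∀ a x → a < x → (a ≡ᵇ x) ≡ false
  ≡ᵇ-false′ zero    (suc x) _        = refl
  ≡ᵇ-false′ (suc a) (suc x) (s≤s lt) = ≡ᵇ-false′ a x lt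

  private
    cnt : (ℕ → Bool) → ℕ → ℕ
    cnt f zero    = 0
    cnt f (suc N) = 𝟙 (f N) + cnt f N

  count : (ℕ → Bool) → ℕ → ℕ
  count f N = ∑ (upTo N) (𝟙 ∘ f)

  private
    cnt≡count : ∀ f N → cnt f N ≡ count f N
    cnt≡count f zero    = refl
    cnt≡count f (suc N) = ≡.trans (ℕₚ.+-comm (𝟙 (f N)) _) (≡.trans (cong (_+ 𝟙 (f N)) (cnt≡count f N)) (≡.sym (∑-upTo-suc N (𝟙 ∘ f))))

    cnt≤ : ∀ f N → cnt f N ≤ N
    cnt≤ f zero    = z≤n
    cnt≤ f (suc N) = ℕₚ.+-mono-≤ (𝟙≤1 (f N)) (cnt≤ f N)

    -- The part belonging to a particle is the number of empty sites below it.
    parts : (f : ℕ → Bool) (N : ℕ) → Vec ℕ (cnt f N)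
    parts f zero    = []
    parts f (suc N) with f N
    ... | true  = N ∸ cnt f N ∷ parts f N
    ... | false = parts f N

    parts-≤ : ∀ f N → VAll (_≤ N ∸ cnt f N) (parts f N)
    parts-≤ f zero    = []
    parts-≤ f (suc N) with f N
    ... | true  = ℕₚ.≤-refl ∷ parts-≤ f N
    ... | false = VAll.map (λ l → ℕₚ.≤-trans l (ℕₚ.∸-monoˡ-≤ (cnt f N) (ℕₚ.n≤1+n N))) (parts-≤ f N)

    parts-decreasing : ∀ f N → WeaklyDecreasing (parts f N)
    parts-decreasing f zero    = tt
    parts-decreasing f (suc N) with f N
    ... | true  = parts-≤ f N , parts-decreasing f N
    ... | false = parts-decreasing f N

    parts-above : ∀ f N x → N ≤ x → occupied (positions (parts f N)) x ≡ 0
    parts-above f zero    x _ = refl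
    parts-above f (suc N) x N<x with f N
    ... | true  rewrite ℕₚ.m∸n+n≡m (cnt≤ f N) | ≡ᵇ-false′ N x N<x = parts-above f N x (ℕₚ.<⇒≤ N<x)
    ... | false = parts-above f N x (ℕₚ.<⇒≤ N<x)

    parts-occupied : ∀ f N x → x < N → occupied (positions (parts f N)) x ≡ 𝟙 (f x)
    parts-occupied f (suc N) x x<N with ℕₚ.m<1+n⇒m<n∨m≡n x<N
    parts-occupied f (suc N) x _ | inj₁ x<N with f N
    ... | true  rewrite ℕₚ.m∸n+n≡m (cnt≤ f N) | ≡ᵇ-false N x x<N = parts-occupied f N x x<N
    ... | false = parts-occupied f N x x<N
    parts-occupied f (suc N) x _ | inj₂ refl with f N
    ... | true  rewrite ℕₚ.m∸n+n≡m (cnt≤ f N) | ≡ᵇ-refl N = cong suc (parts-above f N N ℕₚ.≤-refl)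
    ... | false = parts-above f N N ℕₚ.≤-refl

  partition-of : ∀ n D f → count f (n + D) ≡ n →
    ∃ λ (p : Vec ℕ n) → WeaklyDecreasing p × VAll (_≤ D) p × (∀ x → x < n + D → occupied (positions p) x ≡ 𝟙 (f x))
  partition-of n D f e = from (cnt f (n + D)) (≡.trans (cnt≡count f (n + D)) e) (parts f (n + D)) (parts-decreasing f (n + D))
    (parts-≤ f (n + D)) (parts-occupied f (n + D))
    where
    -- The number of particles found by the scan equals n only propositionally, hence a general
    -- length m.
    from : ∀ m → m ≡ n → (p : Vec ℕ m) → WeaklyDecreasing p → VAll (_≤ n + D ∸ m) p → (∀ x → x < n + D → occupied (positions p) x ≡ 𝟙 (f x)) →
      ∃ λ (p : Vec ℕ n) → WeaklyDecreasing p × VAll (_≤ D) p × (∀ x → x < n + D → occupied (positions p) x ≡ 𝟙 (f x))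
    from m refl p w le occ = p , w , subst (λ d → VAll (_≤ d) p) (ℕₚ.m+n∸m≡n n D) le , occ

open Partitions

-- The value of a row along a path of bits.

-- i, j, m, e: bottom, incoming, top and outgoing bit of a site.
Passes : Bool → Bool → Bool → Bool → Set
Passes i j m e = 𝟙 i + 𝟙 j ≡ 𝟙 m + 𝟙 e × 𝟙 i + 𝟙 j ≤ 1

PassesAll : ∀ {a} → Vec Bool a → Vec Bool a → Vec Bool a → Vec Bool a → Set
PassesAll j i m e = ∀ c → Passes (lookup i c) (lookup j c) (lookup m c) (lookup e c)

trues : ∀ {a} → Vec Bool a → ℕ
trues []       = 0
trues (b ∷ bs) = 𝟙 b + trues bs

-- The exponent of q in one column. A colour with a particle present is charged for the other
-- travelling colours: `js` holds the incoming bits of those still to be read, `d` counts the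
-- outgoing bits of those already read.
passing : ∀ {a} → ℕ → Vec Bool a → Vec Bool a → Vec Bool a → ℕ
passing d []       []       []       = 0
passing d (j ∷ js) (i ∷ is) (e ∷ es) = 𝟙 (i ∨ j) * (trues js + d) + passing (d + 𝟙 e) js is es

pairs : (k : ℕ) → (Fin k → Fin k → ℕ) → ℕ
pairs k f = ∑ (allFin k) λ a → ∑ (allFin k) λ b → 𝟙 (toℕ a <ᵇ toℕ b) * f a b

trues-∑ : ∀ {a} (v : Vec Bool a) → trues v ≡ ∑ (allFin a) (λ c → 𝟙 (lookup v c))
trues-∑ []       = refl
trues-∑ (b ∷ bs) = ≡.trans (cong (𝟙 b +_) (trues-∑ bs)) (≡.sym (ℕΣ.⅀-allFin-suc _ (λ c → 𝟙 (lookup (b ∷ bs) c))))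

pairs-suc : ∀ k f → pairs (suc k) f ≡ ∑ (allFin k) (λ b → f zero (suc b)) + pairs k (λ a b → f (suc a) (suc b))
pairs-suc k f = ≡.trans (ℕΣ.⅀-allFin-suc k _) (cong₂ _+_
  (≡.trans (ℕΣ.⅀-allFin-suc k (λ b → 𝟙 (0 <ᵇ toℕ b) * f zero b)) (ℕΣ.⅀-cong (allFin k) (λ b → ℕₚ.+-identityʳ _)))
  (ℕΣ.⅀-cong (allFin k) (λ a → ℕΣ.⅀-allFin-suc k (λ b → 𝟙 (suc (toℕ a) <ᵇ toℕ b) * f (suc a) b))))

-- Colours are read in order. Of two colours b < c, the particle of c therefore sees the outgoing
-- bit of b, while the particle of b sees the incoming bit of c.
passing-pairs : ∀ {a} d (j i e : Vec Bool a) → let p = λ c → 𝟙 (lookup i c ∨ lookup j c) in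
  passing d j i e ≡ d * ∑ (allFin a) p + pairs a (λ b c → p c * 𝟙 (lookup e b) + p b * 𝟙 (lookup j c))
passing-pairs d []       []       []       = ≡.sym (≡.trans (ℕₚ.+-identityʳ _) (ℕₚ.*-zeroʳ d))
passing-pairs {suc a} d (j ∷ js) (i ∷ is) (e ∷ es) = begin
  p₀ * (trues js + d) + passing (d + e₀) js is es
    ≡⟨ cong₂ (λ t r → p₀ * (t + d) + r) (trues-∑ js) (passing-pairs (d + e₀) js is es) ⟩
  p₀ * (J + d) + ((d + e₀) * P + Q)
    ≡⟨ solve 6 (λ p j d e s q → p :* (j :+ d) :+ ((d :+ e) :* s :+ q) := d :* (p :+ s) :+ ((s :* e :+ p :* j) :+ q)) refl p₀ J d e₀ P Q ⟩
  d * (p₀ + P) + ((P * e₀ + p₀ * J) + Q)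
    ≡⟨ cong₂ (λ s r → d * s + (r + Q)) (≡.sym (ℕΣ.⅀-allFin-suc a _)) (cong₂ _+_ (ℕΣ.⅀-*ʳ (allFin a) e₀ p) (ℕΣ.⅀-*ˡ (allFin a) p₀ _)) ⟩
  d * ∑ (allFin (suc a)) p⁺ + ((∑ (allFin a) (λ c → p c * e₀) + ∑ (allFin a) (λ c → p₀ * 𝟙 (lookup js c))) + Q)
    ≡⟨ cong (λ s → d * ∑ (allFin (suc a)) p⁺ + (s + Q)) (≡.sym (ℕΣ.⅀-+ (allFin a) _ _)) ⟩
  d * ∑ (allFin (suc a)) p⁺ + (∑ (allFin a) (λ c → p c * e₀ + p₀ * 𝟙 (lookup js c)) + Q)
    ≡⟨ cong (d * ∑ (allFin (suc a)) p⁺ +_) (≡.sym (pairs-suc a _)) ⟩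
  _ ∎
  where
  open ≡.≡-Reasoning
  open +-*-Solver
  p₀ = 𝟙 (i ∨ j)
  e₀ = 𝟙 e
  p : Fin a → ℕ
  p c = 𝟙 (lookup is c ∨ lookup js c)
  p⁺ : Fin (suc a) → ℕ
  p⁺ c = 𝟙 (lookup (i ∷ is) c ∨ lookup (j ∷ js) c)
  J = ∑ (allFin a) (λ c → 𝟙 (lookup js c))
  P = ∑ (allFin a) p
  Q = pairs a (λ b c → p c * 𝟙 (lookup es b) + p b * 𝟙 (lookup js c))

module RowValues {c ℓ : Level} (R : CommutativeRing c ℓ) (q : CommutativeRing.Carrier R) where
  open CommutativeRing R hiding (zero) renaming (_+_ to _⊕_; _*_ to _⊗_; -_ to ⊝_; refl to ≈-refl; sym to ≈-sym; trans to ≈-trans)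
  open IntegerRingSolver R
  open SetoidReasoning setoid
  open Exp semiring renaming (_^_ to _↑_)
  open Local _⊕_ _⊗_ ⊝_ 0# 1#
  open RowOperators R q
  open RowProducts R q

  private
    trueˡ : List Bool → ℕ
    trueˡ []      = 0
    trueˡ (b ∷ Q) = 𝟙 b + trueˡ Q

    qcount-↑ : ∀ Q → qcount Q ≈ q ↑ trueˡ Q
    qcount-↑ []          = ≈-refl
    qcount-↑ (true ∷ Q)  = *-congˡ (qcount-↑ Q)
    qcount-↑ (false ∷ Q) = ≈-trans (*-identityˡ _) (qcount-↑ Q)

    trueˡ-++ : ∀ {a} (js : Vec Bool a) done → trueˡ (toList js ++ done) ≡ trues js + trueˡ done
    trueˡ-++ []       done = refl
    trueˡ-++ (j ∷ js) done = ≡.trans (cong (𝟙 j +_) (trueˡ-++ js done)) (≡.sym (ℕₚ.+-assoc (𝟙 j) _ _))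

    trueˡ-∷ʳ : ∀ done e → trueˡ (done ∷ʳ e) ≡ trueˡ done + 𝟙 e
    trueˡ-∷ʳ []         e = ℕₚ.+-identityʳ _
    trueˡ-∷ʳ (b ∷ done) e = ≡.trans (cong (𝟙 b +_) (trueˡ-∷ʳ done e)) (≡.sym (ℕₚ.+-assoc (𝟙 b) _ _))

    row-value : ∀ {a} x E done (j i m e : Vec Bool a) → PassesAll j i m e →
      row x E (toList j ++ done) i m ≈ (x ↑ trues e ⊗ q ↑ passing (trueˡ done) j i e) ⊗ E (done ++ toList e)
    row-value x E done []       []       []       []       h = ≈-trans (reflexive (cong E (≡.sym (Listₚ.++-identityʳ done))))
      (solve 1 (λ a → a := (con (ℤ.+ 1) :* con (ℤ.+ 1)) :* a) ≈-refl _)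
      where open import Data.Integer using (+_)
    row-value x E done (j ∷ js) (i ∷ is) (m ∷ ms) (e ∷ es) h = site i j m e (h zero)
      where
      Q = toList js ++ done
      d = trues js + trueˡ done
      tail : ∀ e → row x E (Q ∷ʳ e) is ms ≈ (x ↑ trues es ⊗ q ↑ passing (trueˡ done + 𝟙 e) js is es) ⊗ E (done ++ e ∷ toList es)
      tail e = begin
        row x E (Q ∷ʳ e) is ms
          ≈⟨ reflexive (cong (λ Q → row x E Q is ms) (Listₚ.++-assoc (toList js) done (e ∷ []))) ⟩
        row x E (toList js ++ (done ∷ʳ e)) is ms
          ≈⟨ row-value x E (done ∷ʳ e) js is ms es (h ∘ suc) ⟩
        (x ↑ trues es ⊗ q ↑ passing (trueˡ (done ∷ʳ e)) js is es) ⊗ E ((done ∷ʳ e) ++ toList es)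
          ≈⟨ reflexive (cong₂ (λ t l → (x ↑ trues es ⊗ q ↑ passing t js is es) ⊗ E l) (trueˡ-∷ʳ done e) (Listₚ.++-assoc done (e ∷ []) (toList es))) ⟩
        _ ∎
      weight : qcount Q ≈ q ↑ d
      weight = ≈-trans (qcount-↑ Q) (reflexive (cong (q ↑_) (trueˡ-++ js done)))
      q-1 : ∀ {p} → q ↑ ((d + 0) + p) ≈ q ↑ d ⊗ q ↑ p
      q-1 {p} = ≈-trans (^-homo-* q (d + 0) p) (*-congʳ (reflexive (cong (q ↑_) (ℕₚ.+-identityʳ d))))
      stay : qcount Q ⊗ row x E (Q ∷ʳ false) is ms
        ≈ (x ↑ trues es ⊗ q ↑ ((d + 0) + passing (trueˡ done + 0) js is es)) ⊗ E (done ++ false ∷ toList es)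
      stay = ≈-trans (*-cong weight (tail false)) (≈-trans
        (solve 4 (λ w a b c → w :* ((a :* b) :* c) := (a :* (w :* b)) :* c) ≈-refl _ _ _ _) (*-congʳ (*-congˡ (≈-sym q-1))))
      go : x ⊗ (qcount Q ⊗ row x E (Q ∷ʳ true) is ms)
        ≈ (x ↑ suc (trues es) ⊗ q ↑ ((d + 0) + passing (trueˡ done + 1) js is es)) ⊗ E (done ++ true ∷ toList es)
      go = ≈-trans (*-congˡ (*-cong weight (tail true))) (≈-trans
        (solve 5 (λ x w a b c → x :* (w :* ((a :* b) :* c)) := ((x :* a) :* (w :* b)) :* c) ≈-refl _ _ _ _ _) (*-congʳ (*-congˡ (≈-sym q-1))))
      site : ∀ i j m e → Passes i j m e → vertex x (qcount Q) i j m (λ b → row x E (Q ∷ʳ b) is ms)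
        ≈ (x ↑ (𝟙 e + trues es) ⊗ q ↑ (𝟙 (i ∨ j) * d + passing (trueˡ done + 𝟙 e) js is es)) ⊗ E (done ++ e ∷ toList es)
      site false false false false _ = tail false
      site false true  true  false _ = stay
      site false true  false true  _ = go
      site true  false true  false _ = stay
      site true  false false true  _ = go
      site false false false true  (() , _)
      site false false true  _     (() , _)
      site false true  false false (() , _)
      site false true  true  true  (() , _)
      site true  false false false (() , _)
      site true  false true  true  (() , _)
      site true  true  _     _     (_ , s≤s ())

    -- Conservation forces the outgoing bit at every site; the row vanishes as soon as no bit fits
    -- or two particles of one colour meet.
    row-dichotomy : ∀ {a} x E done (j i m : Vec Bool a) → (∃ λ e → PassesAll j i m e) ⊎ row x E (toList j ++ done) i m ≈ 0#
    row-dichotomy x E done []       []       []       = inj₁ ([] , λ ())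
    row-dichotomy x E done (j ∷ js) (i ∷ is) (m ∷ ms) = site i j m
      where
      Q = toList js ++ done
      tail : ∀ b → (∃ λ e → PassesAll js is ms e) ⊎ row x E (Q ∷ʳ b) is ms ≈ 0#
      tail b with row-dichotomy x E (done ∷ʳ b) js is ms
      ... | inj₁ r = inj₁ r
      ... | inj₂ r = inj₂ (≈-trans (reflexive (cong (λ Q → row x E Q is ms) (Listₚ.++-assoc (toList js) done (b ∷ [])))) r)
      passes : ∀ {i j m} e → Passes i j m e → (∃ λ es → PassesAll js is ms es) → ∃ λ es → PassesAll (j ∷ js) (i ∷ is) (m ∷ ms) es
      passes e p (es , ps) = e ∷ es , λ { zero → p ; (suc c) → ps c }
      site : ∀ i j m → (∃ λ e → PassesAll (j ∷ js) (i ∷ is) (m ∷ ms) e) ⊎ vertex x (qcount Q) i j m (λ b → row x E (Q ∷ʳ b) is ms) ≈ 0#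
      site false false true  = inj₂ ≈-refl
      site true  true  m     = inj₂ ≈-refl
      site false false false with tail false
      ... | inj₁ r = inj₁ (passes false (refl , z≤n) r)
      ... | inj₂ r = inj₂ r
      site false true  true  with tail false
      ... | inj₁ r = inj₁ (passes false (refl , s≤s z≤n) r)
      ... | inj₂ r = inj₂ (≈-trans (*-congˡ r) (zeroʳ _))
      site true  false true  with tail false
      ... | inj₁ r = inj₁ (passes false (refl , s≤s z≤n) r)
      ... | inj₂ r = inj₂ (≈-trans (*-congˡ r) (zeroʳ _))
      site false true  false with tail true
      ... | inj₁ r = inj₁ (passes true (refl , s≤s z≤n) r)
      ... | inj₂ r = inj₂ (≈-trans (*-congˡ (≈-trans (*-congˡ r) (zeroʳ _))) (zeroʳ _))
      site true  false false with tail true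
      ... | inj₁ r = inj₁ (passes true (refl , s≤s z≤n) r)
      ... | inj₂ r = inj₂ (≈-trans (*-congˡ (≈-trans (*-congˡ r) (zeroʳ _))) (zeroʳ _))

  column-value : ∀ {a} x E (j i m e : Vec Bool a) → PassesAll j i m e →
    row x E (toList j) i m ≈ (x ↑ trues e ⊗ q ↑ passing 0 j i e) ⊗ E (toList e)
  column-value x E j i m e h = ≈-trans (reflexive (cong (λ Q → row x E Q i m) (≡.sym (Listₚ.++-identityʳ (toList j))))) (row-value x E [] j i m e h)

  column-dichotomy : ∀ {a} x E (j i m : Vec Bool a) → (∃ λ e → PassesAll j i m e) ⊎ row x E (toList j) i m ≈ 0#
  column-dichotomy x E j i m with row-dichotomy x E [] j i m
  ... | inj₁ r = inj₁ r
  ... | inj₂ r = inj₂ (≈-trans (reflexive (cong (λ Q → row x E Q i m) (≡.sym (Listₚ.++-identityʳ (toList j))))) r)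

-- Filtered lists, vectors and sums along an interval.

∈-filterᵇ⁺ : {A : Set} (p : A → Bool) {xs : List A} {x : A} → x ∈ xs → p x ≡ true → x ∈ filterᵇ p xs
∈-filterᵇ⁺ p x∈ e = ∈ₚ.∈-filter⁺ (Bool.T? ∘ p) x∈ (subst Bool.T (≡.sym e) tt)

∈-filterᵇ⁻ : {A : Set} (p : A → Bool) {xs : List A} {x : A} → x ∈ filterᵇ p xs → x ∈ xs × p x ≡ true
∈-filterᵇ⁻ p x∈ with ∈ₚ.∈-filter⁻ (Bool.T? ∘ p) x∈
... | x∈' , t = x∈' , Equivalence.to Boolₚ.T-≡ t

filterᵇ-unique : {A : Set} (p : A → Bool) {xs : List A} → Unique xs → Unique (filterᵇ p xs)
filterᵇ-unique p = Uniqueₚ.filter⁺ (Bool.T? ∘ p)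

and-map⁺ : {A : Set} {m : ℕ} (p : A → Bool) (v : Vec A m) → (∀ i → p (lookup v i) ≡ true) → and (toList (Vec.map p v)) ≡ true
and-map⁺ p []      h = refl
and-map⁺ p (x ∷ v) h rewrite h zero = and-map⁺ p v (h ∘ suc)

and-map⁻ : {A : Set} {m : ℕ} (p : A → Bool) (v : Vec A m) → and (toList (Vec.map p v)) ≡ true → ∀ i → p (lookup v i) ≡ true
and-map⁻ p (x ∷ v) e zero    = proj₁ (∧-true e)
and-map⁻ p (x ∷ v) e (suc i) = and-map⁻ p v (proj₂ (∧-true {p x} e)) i

lookup-ext : {A : Set} {m : ℕ} (u v : Vec A m) → (∀ i → lookup u i ≡ lookup v i) → u ≡ v
lookup-ext []      []      h = refl
lookup-ext (x ∷ u) (y ∷ v) h = cong₂ _∷_ (h zero) (lookup-ext u v (h ∘ suc))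

sumFrom : (ℕ → ℕ) → ℕ → ℕ → ℕ
sumFrom f x zero    = 0
sumFrom f x (suc N) = f x + sumFrom f (suc x) N

sumFrom-∑ : ∀ f x N → sumFrom f x N ≡ ∑ (upTo N) (λ i → f (x + i))
sumFrom-∑ f x zero    = refl
sumFrom-∑ f x (suc N) = cong₂ _+_ (cong f (≡.sym (ℕₚ.+-identityʳ x))) (begin
  sumFrom f (suc x) N                          ≡⟨ sumFrom-∑ f (suc x) N ⟩
  ∑ (upTo N) (λ i → f (suc x + i))             ≡⟨ ℕΣ.⅀-cong (upTo N) (λ i → cong f (≡.sym (ℕₚ.+-suc x i))) ⟩
  ∑ (upTo N) (λ i → f (x + suc i))             ≡⟨ ≡.sym (ℕΣ.⅀-map suc (upTo N) (λ i → f (x + i))) ⟩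
  ∑ (map suc (upTo N)) (λ i → f (x + i))       ≡⟨ cong (λ l → ∑ l (λ i → f (x + i))) (Listₚ.map-upTo suc N) ⟩
  _ ∎)
  where open ≡.≡-Reasoning

-- Tuples of partitions in a box and the statistics of a strip.

module Tuples (k n D : ℕ) where

  N : ℕ
  N = n + D

  Tup : Set
  Tup = Vec (Vec ℕ n) k

  pos : Tup → Fin k → Vec ℕ n
  pos ν c = positions (lookup ν c)

  InBox : Tup → Set
  InBox ν = ∀ c → WeaklyDecreasing (lookup ν c) × VAll (_≤ D) (lookup ν c)

  StripAll : Tup → Tup → Set
  StripAll μ ν = ∀ c → Strip (lookup μ c) (lookup ν c)

  stripAll? : ∀ μ ν → Dec (StripAll μ ν)
  stripAll? μ ν = Finₚ.all? (λ c → strip? (lookup μ c) (lookup ν c))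

  inv : Tup → ℕ
  inv ν = pairs k (λ a b → inversions N (pos ν a) (pos ν b))

  -- The one-sided statistic: for colours a < b only the steps of a out of a site where b is present
  -- are counted. Summed over the letters it gives the coinversions, whereas the rows carry a
  -- symmetric version.
  moves stat : Tup → Tup → ℕ
  moves μ ν = ∑ (upTo N) (λ x → ∑ (allFin k) (λ c → crossing (pos μ c) (pos ν c) x))
  stat μ ν = pairs k (λ a b → ∑ (upTo N) (λ x → crossing (pos μ a) (pos ν a) x * present (pos μ b) (pos ν b) x))

  column : Tup → ℕ → Vec Bool k
  column ν x = Vec.map (λ p → 0 <ᵇ occupied (positions p) x) ν

  edges edges⁻ : Tup → Tup → ℕ → Vec Bool k
  edges  μ ν x = Vec.zipWith (λ m l → 0 <ᵇ crossing (positions m) (positions l) x) μ ν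
  edges⁻ μ ν x = Vec.zipWith (λ m l → 0 <ᵇ crossing⁻ (positions m) (positions l) x) μ ν

  positive : ∀ {m} → m ≤ 1 → 𝟙 (0 <ᵇ m) ≡ m
  positive {zero}        _        = refl
  positive {suc zero}    _        = refl
  positive {suc (suc m)} (s≤s ())

  interlacing-all : ∀ μ ν → StripAll μ ν → ∀ c → Interlacing (pos μ c) (pos ν c)
  interlacing-all μ ν s c = strip-interlacing (lookup μ c) (lookup ν c) (s c)

  strip-Below : ∀ μ ν → StripAll μ ν → ∀ c → Below (pos μ c) (pos ν c)
  strip-Below μ ν s c = interlacing-below (pos μ c) (pos ν c) (interlacing-all μ ν s c)

  module _ (μ ν : Tup) (s : StripAll μ ν) where

    private
      pr : Fin k → ℕ → ℕ
      pr c x = present (pos μ c) (pos ν c) x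
      pr≤1 : ∀ c x → pr c x ≤ 1
      pr≤1 c x = present≤1 (pos μ c) (pos ν c) x (interlacing-all μ ν s c)
      enter : ∀ c x → pr c x ≡ occupied (pos μ c) x + crossing⁻ (pos μ c) (pos ν c) x
      enter c x = present-enter (pos μ c) (pos ν c) x (strip-Below μ ν s c)
      leave : ∀ c x → pr c x ≡ occupied (pos ν c) x + crossing (pos μ c) (pos ν c) x
      leave c x = present-leave (pos μ c) (pos ν c) x (strip-Below μ ν s c)
      part₁ : ∀ {p a b} → p ≤ 1 → p ≡ a + b → a ≤ 1
      part₁ p≤1 refl = ℕₚ.≤-trans (ℕₚ.m≤m+n _ _) p≤1
      part₂ : ∀ {p a b} → p ≤ 1 → p ≡ a + b → b ≤ 1
      part₂ {a = a} p≤1 refl = ℕₚ.≤-trans (ℕₚ.m≤n+m _ a) p≤1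

    bit-column : ∀ c x → 𝟙 (lookup (column μ x) c) ≡ occupied (pos μ c) x
    bit-column c x rewrite Vecₚ.lookup-map c (λ p → 0 <ᵇ occupied (positions p) x) μ = positive (part₁ (pr≤1 c x) (enter c x))

    bit-column' : ∀ c x → 𝟙 (lookup (column ν x) c) ≡ occupied (pos ν c) x
    bit-column' c x rewrite Vecₚ.lookup-map c (λ p → 0 <ᵇ occupied (positions p) x) ν = positive (part₁ (pr≤1 c x) (leave c x))

    bit-edges : ∀ c x → 𝟙 (lookup (edges μ ν x) c) ≡ crossing (pos μ c) (pos ν c) x
    bit-edges c x rewrite Vecₚ.lookup-zipWith (λ m l → 0 <ᵇ crossing (positions m) (positions l) x) c μ ν = positive (part₂ (pr≤1 c x) (leave c x))

    bit-edges⁻ : ∀ c x → 𝟙 (lookup (edges⁻ μ ν x) c) ≡ crossing⁻ (pos μ c) (pos ν c) x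
    bit-edges⁻ c x rewrite Vecₚ.lookup-zipWith (λ m l → 0 <ᵇ crossing⁻ (positions m) (positions l) x) c μ ν = positive (part₂ (pr≤1 c x) (enter c x))

    -- The particles present at a site are counted once on arrival and once on departure, and
    -- interlacing leaves room for at most one.
    strip-passes : ∀ x → PassesAll (edges⁻ μ ν x) (column μ x) (column ν x) (edges μ ν x)
    strip-passes x c = ≡.trans (≡.sym in≡) (≡.trans (leave c x) (cong₂ _+_ (≡.sym (bit-column' c x)) (≡.sym (bit-edges c x)))) , subst (_≤ 1) in≡ (pr≤1 c x)
      where
      in≡ : pr c x ≡ 𝟙 (lookup (column μ x) c) + 𝟙 (lookup (edges⁻ μ ν x) c)
      in≡ = ≡.trans (enter c x) (cong₂ _+_ (≡.sym (bit-column c x)) (≡.sym (bit-edges⁻ c x)))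

    trues-edges : ∀ x → trues (edges μ ν x) ≡ ∑ (allFin k) (λ c → crossing (pos μ c) (pos ν c) x)
    trues-edges x = ≡.trans (trues-∑ (edges μ ν x)) (ℕΣ.⅀-cong (allFin k) (λ c → bit-edges c x))

    passing-column : ∀ x → passing 0 (edges⁻ μ ν x) (column μ x) (edges μ ν x) ≡
      pairs k (λ a b → crossing (pos μ a) (pos ν a) x * pr b x + crossing⁻ (pos μ b) (pos ν b) x * pr a x)
    passing-column x = ≡.trans (passing-pairs 0 (edges⁻ μ ν x) (column μ x) (edges μ ν x))
      (ℕΣ.⅀-cong (allFin k) λ a → ℕΣ.⅀-cong (allFin k) λ b → cong (𝟙 (toℕ a <ᵇ toℕ b) *_)
        (cong₂ _+_ (≡.trans (cong₂ _*_ (pr-bit b) (bit-edges a x)) (ℕₚ.*-comm (pr b x) _))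
                   (≡.trans (cong₂ _*_ (pr-bit a) (bit-edges⁻ b x)) (ℕₚ.*-comm (pr a x) _))))
      where
      ∨-sum : ∀ i j → 𝟙 i + 𝟙 j ≤ 1 → 𝟙 (i ∨ j) ≡ 𝟙 i + 𝟙 j
      ∨-sum true  true  (s≤s ())
      ∨-sum true  false _ = refl
      ∨-sum false j     _ = refl
      pr-bit : ∀ c → 𝟙 (lookup (column μ x) c ∨ lookup (edges⁻ μ ν x) c) ≡ pr c x
      pr-bit c = ≡.trans (∨-sum (lookup (column μ x) c) (lookup (edges⁻ μ ν x) c) (proj₂ (strip-passes x c)))
        (≡.trans (cong₂ _+_ (bit-column c x) (bit-edges⁻ c x)) (≡.sym (enter c x)))

    private
      pairs-∑ : ∀ M (f : ℕ → Fin k → Fin k → ℕ) → ∑ (upTo M) (λ x → pairs k (f x)) ≡ pairs k (λ a b → ∑ (upTo M) (λ x → f x a b))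
      pairs-∑ M f = begin
        ∑ (upTo M) (λ x → pairs k (f x))
          ≡⟨ ℕΣ.⅀-swap (upTo M) (allFin k) (λ x a → ∑ (allFin k) λ b → 𝟙 (toℕ a <ᵇ toℕ b) * f x a b) ⟩
        ∑ (allFin k) (λ a → ∑ (upTo M) (λ x → ∑ (allFin k) λ b → 𝟙 (toℕ a <ᵇ toℕ b) * f x a b))
          ≡⟨ ℕΣ.⅀-cong (allFin k) (λ a → ≡.trans (ℕΣ.⅀-swap (upTo M) (allFin k) (λ x b → 𝟙 (toℕ a <ᵇ toℕ b) * f x a b))
               (ℕΣ.⅀-cong (allFin k) (λ b → ≡.sym (ℕΣ.⅀-*ˡ (upTo M) (𝟙 (toℕ a <ᵇ toℕ b)) (λ x → f x a b))))) ⟩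
        _ ∎
        where open ≡.≡-Reasoning

      pairs-+ : ∀ (f g : Fin k → Fin k → ℕ) → pairs k (λ a b → f a b + g a b) ≡ pairs k f + pairs k g
      pairs-+ f g = ≡.trans (ℕΣ.⅀-cong (allFin k) λ a → ≡.trans
        (ℕΣ.⅀-cong (allFin k) λ b → ℕₚ.*-distribˡ-+ (𝟙 (toℕ a <ᵇ toℕ b)) (f a b) (g a b)) (ℕΣ.⅀-+ (allFin k) _ _)) (ℕΣ.⅀-+ (allFin k) _ _)

      pairs-cong : ∀ {f g : Fin k → Fin k → ℕ} → (∀ a b → f a b ≡ g a b) → pairs k f ≡ pairs k g
      pairs-cong h = ℕΣ.⅀-cong (allFin k) λ a → ℕΣ.⅀-cong (allFin k) λ b → cong (𝟙 (toℕ a <ᵇ toℕ b) *_) (h a b)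

    crossing-top : InBox ν → ∀ c → crossing⁻ (pos μ c) (pos ν c) N ≡ 0
    crossing-top box c = top N (subst (λ M → VAll (_< M) (pos ν c)) (ℕₚ.+-comm D n) (positions-< (lookup ν c) D (proj₂ (box c))))
      where
      low : ∀ {m} (a b : Vec ℕ m) x → VAll (_< suc x) b → crossing a b x ≡ 0
      low []      []      x _          = refl
      low (a ∷ as) (b ∷ bs) x (s≤s b≤ ∷ r) rewrite <ᵇ-false b≤ | Boolₚ.∧-zeroʳ (a <ᵇ suc x) = low as bs x r
      top : ∀ M → VAll (_< M) (pos ν c) → crossing⁻ (pos μ c) (pos ν c) M ≡ 0
      top zero    _ = refl
      top (suc x) h = low (pos μ c) (pos ν c) x h

    -- For a < b a column charges both the steps of a past b and those of b past a. By
    -- `inversions-telescope` the two totals differ by inv ν - inv μ; the boundary term at N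
    -- vanishes because nothing leaves the box. So the symmetric exponent is twice the one-sided
    -- one, up to the inversion numbers of the ends.
    stat-gauge : InBox ν → (stat μ ν + stat μ ν) + inv μ ≡ inv ν + sumFrom (λ x → passing 0 (edges⁻ μ ν x) (column μ x) (edges μ ν x)) 0 N
    stat-gauge box = begin
      (stat μ ν + stat μ ν) + inv μ
        ≡⟨ ℕₚ.+-assoc (stat μ ν) _ _ ⟩
      stat μ ν + (stat μ ν + inv μ)
        ≡⟨ cong (stat μ ν +_) (≡.trans (≡.sym (pairs-+ _ _)) (≡.trans (pairs-cong telescope) (pairs-+ _ _))) ⟩
      stat μ ν + (inv ν + S')
        ≡⟨ solve 3 (λ s i t → s :+ (i :+ t) := i :+ (s :+ t)) refl (stat μ ν) (inv ν) S' ⟩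
      inv ν + (stat μ ν + S')
        ≡⟨ cong (inv ν +_) (≡.sym (begin
             sumFrom _ 0 N ≡⟨ sumFrom-∑ _ 0 N ⟩
             ∑ (upTo N) (λ x → passing 0 (edges⁻ μ ν x) (column μ x) (edges μ ν x)) ≡⟨ ℕΣ.⅀-cong (upTo N) passing-column ⟩
             _ ≡⟨ pairs-∑ N (λ x a b → crossing (pos μ a) (pos ν a) x * pr b x + crossing⁻ (pos μ b) (pos ν b) x * pr a x) ⟩
             _ ≡⟨ pairs-cong (λ a b → ℕΣ.⅀-+ (upTo N) (λ x → crossing (pos μ a) (pos ν a) x * pr b x) (λ x → crossing⁻ (pos μ b) (pos ν b) x * pr a x)) ⟩
             _ ≡⟨ pairs-+ _ _ ⟩
             stat μ ν + S' ∎)) ⟩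
      _ ∎
      where
      open ≡.≡-Reasoning
      open +-*-Solver
      S' = pairs k (λ a b → ∑ (upTo N) (λ x → crossing⁻ (pos μ b) (pos ν b) x * pr a x))
      telescope : ∀ a b → ∑ (upTo N) (λ x → crossing (pos μ a) (pos ν a) x * pr b x) + inversions N (pos μ a) (pos μ b)
        ≡ inversions N (pos ν a) (pos ν b) + ∑ (upTo N) (λ x → crossing⁻ (pos μ b) (pos ν b) x * pr a x)
      telescope a b = ≡.trans (inversions-telescope N (pos μ a) (pos μ b) (pos ν a) (pos ν b) (strip-Below μ ν s a) (strip-Below μ ν s b))
        (≡.trans (cong (λ e → (inversions N (pos ν a) (pos ν b) + ∑ (upTo N) (λ x → crossing⁻ (pos μ b) (pos ν b) x * pr a x)) + e * below (pos μ b) N) (crossing-top box a))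
          (ℕₚ.+-identityʳ _))

    moves-sumFrom : sumFrom (λ x → trues (edges μ ν x)) 0 N ≡ moves μ ν
    moves-sumFrom = ≡.trans (sumFrom-∑ _ 0 N) (ℕΣ.⅀-cong (upTo N) trues-edges)

  private
    occupied-≤ : ∀ ν → InBox ν → ∀ c r → lookup (pos ν c) r < N
    occupied-≤ ν box c = VAllₚ.lookup⁺ (subst (λ M → VAll (_< M) (pos ν c)) (ℕₚ.+-comm D n) (positions-< (lookup ν c) D (proj₂ (box c))))

  decreasing-box : ∀ ν → InBox ν → ∀ c → Decreasing (pos ν c)
  decreasing-box ν box c = positions-decreasing (lookup ν c) (proj₁ (box c))

  strip-below : ∀ μ ν → InBox μ → InBox ν → ∀ c → (∀ x → x < N → below (pos ν c) x ≤ below (pos μ c) x) →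
    (∀ x → x < N → below (pos μ c) (suc x) ≤ suc (below (pos ν c) x)) → Strip (lookup μ c) (lookup ν c)
  strip-below μ ν boxμ boxν c h h' with below-interlacing N (pos μ c) (pos ν c) (decreasing-box μ boxμ c) (decreasing-box ν boxν c)
                                     (occupied-≤ μ boxμ c) (occupied-≤ ν boxν c) h h'
  ... | le , lt = strip-positions (lookup μ c) (lookup ν c) (proj₁ (boxν c)) le lt

  -- Equal occupation numbers give equal counting functions, which make each of the two tuples a
  -- strip over the other.
  box-injective : ∀ μ ν → InBox μ → InBox ν → (∀ c x → x < N → occupied (pos μ c) x ≡ occupied (pos ν c) x) → μ ≡ ν
  box-injective μ ν boxμ boxν occ = lookup-ext μ ν λ c → lookup-ext (lookup μ c) (lookup ν c) λ r → ℕₚ.≤-antisym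
    (proj₁ (strip-below μ ν boxμ boxν c (λ x x<N → ℕₚ.≤-reflexive (≡.sym (same c x (ℕₚ.<⇒≤ x<N)))) (λ x x<N → step {μ} {ν} c x boxμ (same c x (ℕₚ.<⇒≤ x<N)))) r)
    (proj₁ (strip-below ν μ boxν boxμ c (λ x x<N → ℕₚ.≤-reflexive (same c x (ℕₚ.<⇒≤ x<N))) (λ x x<N → step {ν} {μ} c x boxν (≡.sym (same c x (ℕₚ.<⇒≤ x<N))))) r)
    where
    same : ∀ c x → x ≤ N → below (pos μ c) x ≡ below (pos ν c) x
    same c zero    _   = ≡.trans (below-0 (pos μ c)) (≡.sym (below-0 (pos ν c)))
    same c (suc x) x<N = ≡.trans (below-suc (pos μ c) x) (≡.trans (cong₂ _+_ (same c x (ℕₚ.<⇒≤ x<N)) (occ c x x<N)) (≡.sym (below-suc (pos ν c) x)))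
    step : ∀ {α β} c x → InBox α → below (pos α c) x ≡ below (pos β c) x → below (pos α c) (suc x) ≤ suc (below (pos β c) x)
    step {α} {β} c x box e = subst (λ m → below (pos α c) (suc x) ≤ suc m) e (subst (_≤ suc (below (pos α c) x)) (≡.sym (below-suc (pos α c) x))
      (ℕₚ.≤-trans (ℕₚ.+-monoʳ-≤ (below (pos α c) x) (occupied≤1 (pos α c) x (decreasing-box α box c))) (ℕₚ.≤-reflexive (ℕₚ.+-comm _ 1))))

  tuples : List Tup
  tuples = tuplesUpTo n k D

  private
    box-lists : Vec (List (Vec ℕ n)) k
    box-lists = Vec.replicate k (choices (Vec.replicate n (upTo (suc D))))

  ∈-tuples⁺ : ∀ ν → InBox ν → ν ∈ tuples
  ∈-tuples⁺ ν box = ∈-filterᵇ⁺ (λ ν → and (toList (Vec.map (isPartition n k) ν)))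
    (∈-choices⁺ box-lists ν (λ c → subst (lookup ν c ∈_) (≡.sym (Vecₚ.lookup-replicate c _))
      (∈-choices⁺ (Vec.replicate n (upTo (suc D))) (lookup ν c) (λ r → subst (lookup (lookup ν c) r ∈_) (≡.sym (Vecₚ.lookup-replicate r _))
        (∈ₚ.∈-upTo⁺ (s≤s (VAllₚ.lookup⁺ (proj₂ (box c)) r)))))))
    (and-map⁺ (isPartition n k) ν (λ c → weaklyDecreasing⁺ n k (lookup ν c) (proj₁ (box c))))

  ∈-tuples⁻ : ∀ ν → ν ∈ tuples → InBox ν
  ∈-tuples⁻ ν ν∈ c with ∈-filterᵇ⁻ (λ ν → and (toList (Vec.map (isPartition n k) ν))) {xs = choices box-lists} ν∈
  ... | ν∈' , e = weaklyDecreasing⁻ n k (lookup ν c) (and-map⁻ (isPartition n k) ν e c)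
    , VAllₚ.lookup⁻ (λ r → ℕₚ.≤-pred (∈ₚ.∈-upTo⁻ (subst (lookup (lookup ν c) r ∈_) (Vecₚ.lookup-replicate r _)
        (∈-choices⁻ (Vec.replicate n (upTo (suc D))) (lookup ν c) (subst (lookup ν c ∈_) (Vecₚ.lookup-replicate c _) (∈-choices⁻ box-lists ν ν∈' c)) r))))

  tuples-unique : Unique tuples
  tuples-unique = filterᵇ-unique _ (choices-unique box-lists (λ c → subst Unique (≡.sym (Vecₚ.lookup-replicate c _))
    (choices-unique (Vec.replicate n (upTo (suc D))) (λ r → subst Unique (≡.sym (Vecₚ.lookup-replicate r _)) (Uniqueₚ.upTo⁺ (suc D))))))

-- The dictionary between tuples and words.

private
  conserve : ∀ i r j m e {s} → i + j ≡ m + e → r + e ≡ s → (i + r) + j ≡ m + s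
  conserve i r j m e p refl = ≡.trans (solve 3 (λ i r j → (i :+ r) :+ j := (i :+ j) :+ r) refl i r j)
    (≡.trans (cong (_+ r) p) (solve 3 (λ m e r → (m :+ e) :+ r := m :+ (r :+ e)) refl m e r))
    where open +-*-Solver

  transport : ∀ b j i o e → i + j ≡ o + e → (b + j) + i ≡ (b + o) + e
  transport b j i o e p = ≡.trans (solve 3 (λ b j i → (b :+ j) :+ i := b :+ (i :+ j)) refl b j i)
    (≡.trans (cong (b +_) p) (≡.sym (ℕₚ.+-assoc b o e)))
    where open +-*-Solver

module TupleWords {c ℓ : Level} (R : CommutativeRing c ℓ) (q : CommutativeRing.Carrier R)
             (k n' D : ℕ) (filtration : Filtration R D)
             (q-cancel : ∀ {a b} → CommutativeRing._≈_ R (CommutativeRing._*_ R q a) (CommutativeRing._*_ R q b) → CommutativeRing._≈_ R a b) where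
  open CommutativeRing R hiding (zero) renaming (_+_ to _⊕_; _*_ to _⊗_; -_ to ⊝_; refl to ≈-refl; sym to ≈-sym; trans to ≈-trans)
  open FiniteSum commutativeSemiring
  open IntegerRingSolver R
  open SetoidReasoning setoid
  open Exp semiring renaming (_^_ to _↑_)
  open RowProducts R q
  open RowValues R q
  open Words R q k n' D filtration q-cancel
  open Tuples k n D

  wordFrom : ℕ → (M : ℕ) → Tup → Word M
  wordFrom x zero    ν = []
  wordFrom x (suc M) ν = column ν x ∷ wordFrom (suc x) M ν

  word : Tup → Word N
  word = wordFrom 0 N

  private
    vacant-zeros' : ∀ {a} (v : Vec Bool a) → (∀ c → 𝟙 (lookup v c) ≡ 0) → vacant (toList v) ≈ 1#
    vacant-zeros' []          h = ≈-refl
    vacant-zeros' (false ∷ v) h = vacant-zeros' v (h ∘ suc)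
    vacant-zeros' (true ∷ v)  h with h zero
    ... | ()

    zeros-unique : ∀ {a} (v : Vec Bool a) → (∀ c → 𝟙 (lookup v c) ≡ 0) → v ≡ Vec.replicate a false
    zeros-unique []          h = refl
    zeros-unique (false ∷ v) h = cong (false ∷_) (zeros-unique v (h ∘ suc))
    zeros-unique (true ∷ v)  h with h zero
    ... | ()

    vacant-dichotomy : ∀ {a} (v : Vec Bool a) → v ≡ Vec.replicate a false ⊎ vacant (toList v) ≈ 0#
    vacant-dichotomy []          = inj₁ refl
    vacant-dichotomy (true ∷ v)  = inj₂ ≈-refl
    vacant-dichotomy (false ∷ v) with vacant-dichotomy v
    ... | inj₁ e = inj₁ (cong (false ∷_) e)
    ... | inj₂ r = inj₂ r

    toList-zeros : toList zeros ≡ O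
    toList-zeros = Vecₚ.toList-replicate k false

  module _ (x : Carrier) (μ ν : Tup) (boxν : InBox ν) (s : StripAll μ ν) where

    private
      mv pv : ℕ → ℕ
      mv p = trues (edges μ ν p)
      pv p = passing 0 (edges⁻ μ ν p) (column μ p) (edges μ ν p)

      value-from : ∀ M p → p + M ≡ N → rowᶜ x vacant (toList (edges⁻ μ ν p)) (wordFrom p M μ) (wordFrom p M ν)
        ≈ x ↑ sumFrom mv p M ⊗ q ↑ sumFrom pv p M
      value-from zero p e = ≈-trans (vacant-zeros' (edges⁻ μ ν p) (λ c → ≡.trans (bit-edges⁻ μ ν s c p)
        (≡.trans (cong (crossing⁻ (pos μ c) (pos ν c)) (≡.trans (≡.sym (ℕₚ.+-identityʳ p)) e)) (crossing-top μ ν s boxν c)))) (≈-sym (*-identityˡ _))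
      value-from (suc M) p e = begin
        rowᶜ x vacant (toList (edges⁻ μ ν p)) (wordFrom p (suc M) μ) (wordFrom p (suc M) ν)
          ≈⟨ column-value x _ (edges⁻ μ ν p) (column μ p) (column ν p) (edges μ ν p) (strip-passes μ ν s p) ⟩
        (x ↑ mv p ⊗ q ↑ pv p) ⊗ rowᶜ x vacant (toList (edges μ ν p)) (wordFrom (suc p) M μ) (wordFrom (suc p) M ν)
          ≈⟨ *-congˡ (value-from M (suc p) (≡.trans (≡.sym (ℕₚ.+-suc p M)) e)) ⟩
        (x ↑ mv p ⊗ q ↑ pv p) ⊗ (x ↑ sumFrom mv (suc p) M ⊗ q ↑ sumFrom pv (suc p) M)
          ≈⟨ solve 4 (λ a b c d → (a :* b) :* (c :* d) := (a :* c) :* (b :* d)) ≈-refl _ _ _ _ ⟩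
        (x ↑ mv p ⊗ x ↑ sumFrom mv (suc p) M) ⊗ (q ↑ pv p ⊗ q ↑ sumFrom pv (suc p) M)
          ≈⟨ *-cong (≈-sym (^-homo-* x (mv p) _)) (≈-sym (^-homo-* q (pv p) _)) ⟩
        _ ∎

      edges-inv₀ : toList (edges⁻ μ ν 0) ≡ O
      edges-inv₀ = ≡.trans (cong toList (zeros-unique (edges⁻ μ ν 0) (λ c → bit-edges⁻ μ ν s c 0))) toList-zeros

    V-strip : (x ↑ moves μ ν ⊗ q ↑ (stat μ ν + stat μ ν)) ⊗ q ↑ inv μ ≈ q ↑ inv ν ⊗ V x (word μ) (word ν)
    V-strip = begin
      (x ↑ moves μ ν ⊗ q ↑ (stat μ ν + stat μ ν)) ⊗ q ↑ inv μ
        ≈⟨ ≈-trans (*-assoc _ _ _) (*-congˡ (≈-sym (^-homo-* q (stat μ ν + stat μ ν) _))) ⟩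
      x ↑ moves μ ν ⊗ q ↑ ((stat μ ν + stat μ ν) + inv μ)
        ≈⟨ *-congˡ (≈-trans (reflexive (cong (q ↑_) (stat-gauge μ ν s boxν))) (^-homo-* q (inv ν) _)) ⟩
      x ↑ moves μ ν ⊗ (q ↑ inv ν ⊗ q ↑ sumFrom pv 0 N)
        ≈⟨ solve 3 (λ a b c → a :* (b :* c) := b :* (a :* c)) ≈-refl _ _ _ ⟩
      q ↑ inv ν ⊗ (x ↑ moves μ ν ⊗ q ↑ sumFrom pv 0 N)
        ≈⟨ *-congˡ (*-congʳ (reflexive (cong (x ↑_) (≡.sym (moves-sumFrom μ ν s))))) ⟩
      q ↑ inv ν ⊗ (x ↑ sumFrom mv 0 N ⊗ q ↑ sumFrom pv 0 N)
        ≈⟨ *-congˡ (≈-trans (≈-sym (value-from N 0 refl)) (reflexive (cong (λ Q → rowᶜ x vacant Q (word μ) (word ν)) edges-inv₀))) ⟩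
      q ↑ inv ν ⊗ V x (word μ) (word ν) ∎

  -- The intermediate queues of a row from its start to an empty end. If there is no path, the row
  -- has weight zero, so conservation laws can be read off from one.
  Path : ∀ {M} → Vec Bool k → Word M → Word M → Set
  Path j []       []       = j ≡ zeros
  Path j (i ∷ is) (m ∷ ms) = ∃ λ e → PassesAll j i m e × Path e is ms

  path-dichotomy : ∀ {M} x j (is ms : Word M) → Path j is ms ⊎ rowᶜ x vacant (toList j) is ms ≈ 0#
  path-dichotomy x j []       []       = vacant-dichotomy j
  path-dichotomy x j (i ∷ is) (m ∷ ms) with column-dichotomy x (λ Q → rowᶜ x vacant Q is ms) j i m
  ... | inj₂ r = inj₂ r
  ... | inj₁ (e , p) with path-dichotomy x e is ms
  ... | inj₁ path = inj₁ (e , p , path)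
  ... | inj₂ r    = inj₂ (≈-trans (column-value x _ j i m e p) (≈-trans (*-congˡ r) (zeroʳ _)))

  V-dichotomy : ∀ {M} x (is ms : Word M) → Path zeros is ms ⊎ V x is ms ≈ 0#
  V-dichotomy x is ms with path-dichotomy x zeros is ms
  ... | inj₁ p = inj₁ p
  ... | inj₂ r = inj₂ (≈-trans (reflexive (cong (λ Q → rowᶜ x vacant Q is ms) (≡.sym toList-zeros))) r)

  colourCount : ∀ {M} → Fin k → Word M → ℕ
  colourCount c []      = 0
  colourCount c (i ∷ w) = 𝟙 (lookup i c) + colourCount c w

  path-count : ∀ {M} j (is ms : Word M) → Path j is ms → ∀ c → colourCount c is + 𝟙 (lookup j c) ≡ colourCount c ms
  path-count j []       []       refl c = cong 𝟙 (Vecₚ.lookup-replicate c false)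
  path-count j (i ∷ is) (m ∷ ms) (e , p , path) c = conserve (𝟙 (lookup i c)) (colourCount c is) (𝟙 (lookup j c)) (𝟙 (lookup m c)) (𝟙 (lookup e c))
    (proj₁ (p c)) (path-count e is ms path c)

  -- The bit of a colour in transit at p is the excess of starts over stops below p. Followed along
  -- the path, this invariant yields the two conditions of `below-interlacing`.
  path-strip : ∀ μ ν → InBox μ → InBox ν → Path zeros (word μ) (word ν) → StripAll μ ν
  path-strip μ ν boxμ boxν path c = strip-below μ ν boxμ boxν c
    (λ x x<N → proj₁ (along N 0 zeros path inv₀ x z≤n x<N)) (λ x x<N → proj₂ (along N 0 zeros path inv₀ x z≤n x<N))
    where
    M₁ = below (pos μ c)
    M₂ = below (pos ν c)
    inv₀ : M₁ 0 ≡ M₂ 0 + 𝟙 (lookup zeros c)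
    inv₀ rewrite Vecₚ.lookup-replicate c false | below-0 (pos μ c) | below-0 (pos ν c) = refl
    bit : ∀ α x → InBox α → 𝟙 (lookup (column α x) c) ≡ occupied (pos α c) x
    bit α x box rewrite Vecₚ.lookup-map c (λ p → 0 <ᵇ occupied (positions p) x) α = positive (occupied≤1 (pos α c) x (decreasing-box α box c))
    along : ∀ M p j → Path j (wordFrom p M μ) (wordFrom p M ν) → M₁ p ≡ M₂ p + 𝟙 (lookup j c) → ∀ x → p ≤ x → x < p + M →
      M₂ x ≤ M₁ x × M₁ (suc x) ≤ suc (M₂ x)
    along zero p j path inv x p≤x x< = ⊥-elim (ℕₚ.<-irrefl refl (ℕₚ.<-≤-trans x< (ℕₚ.≤-trans (ℕₚ.≤-reflexive (ℕₚ.+-identityʳ p)) p≤x)))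
    along (suc M) p j (e , passes , path) inv x p≤x x< with ℕₚ.m≤n⇒m<n∨m≡n p≤x
    ... | inj₁ p<x = along M (suc p) e path next x p<x (ℕₚ.<-≤-trans x< (ℕₚ.≤-reflexive (ℕₚ.+-suc p M)))
      where
      next : M₁ (suc p) ≡ M₂ (suc p) + 𝟙 (lookup e c)
      next = ≡.trans (below-suc (pos μ c) p) (≡.trans (cong₂ _+_ inv (≡.sym (bit μ p boxμ)))
        (≡.trans (transport (M₂ p) (𝟙 (lookup j c)) (𝟙 (lookup (column μ p) c)) (occupied (pos ν c) p) (𝟙 (lookup e c))
          (≡.trans (proj₁ (passes c)) (cong (_+ 𝟙 (lookup e c)) (bit ν p boxν))))
          (cong (_+ 𝟙 (lookup e c)) (≡.sym (below-suc (pos ν c) p)))))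
    ... | inj₂ refl = subst (M₂ p ≤_) (≡.sym inv) (ℕₚ.m≤m+n _ _)
      , subst (_≤ suc (M₂ p)) (≡.sym (≡.trans (below-suc (pos μ c) p) (≡.trans (cong₂ _+_ inv (≡.sym (bit μ p boxμ))) (ℕₚ.+-assoc (M₂ p) _ _))))
          (ℕₚ.≤-trans (ℕₚ.+-monoʳ-≤ (M₂ p) (subst (_≤ 1) (ℕₚ.+-comm (𝟙 (lookup (column μ p) c)) _) (proj₂ (passes c)))) (ℕₚ.≤-reflexive (ℕₚ.+-comm (M₂ p) 1)))

  V-no-strip : ∀ x μ ν → InBox μ → InBox ν → ¬ StripAll μ ν → V x (word μ) (word ν) ≈ 0#
  V-no-strip x μ ν boxμ boxν ¬s with V-dichotomy x (word μ) (word ν)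
  ... | inj₁ p = ⊥-elim (¬s (path-strip μ ν boxμ boxν p))
  ... | inj₂ r = r

  Balanced : Word N → Set
  Balanced w = ∀ c → colourCount c w ≡ n

  private
    bitAt : ∀ {M} → Word M → Fin k → ℕ → Bool
    bitAt []      c x       = false
    bitAt (i ∷ w) c zero    = lookup i c
    bitAt (i ∷ w) c (suc x) = bitAt w c x

    count-bitAt : ∀ {M} (w : Word M) c → count (bitAt w c) M ≡ colourCount c w
    count-bitAt []      c = refl
    count-bitAt {suc M} (i ∷ w) c = cong (𝟙 (lookup i c) +_) (≡.trans
      (cong (λ l → ∑ l (𝟙 ∘ bitAt (i ∷ w) c)) (≡.sym (Listₚ.map-upTo suc M)))
      (≡.trans (ℕΣ.⅀-map suc (upTo M) (𝟙 ∘ bitAt (i ∷ w) c)) (count-bitAt w c)))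

    𝟙-positive : ∀ b → (0 <ᵇ 𝟙 b) ≡ b
    𝟙-positive true  = refl
    𝟙-positive false = refl

    word-ext : ∀ {M} ν p (w : Word M) → (∀ c x → x < M → occupied (pos ν c) (p + x) ≡ 𝟙 (bitAt w c x)) → wordFrom p M ν ≡ w
    word-ext ν p []      h = refl
    word-ext ν p (i ∷ w) h = cong₂ _∷_
      (lookup-ext _ _ (λ c → ≡.trans (Vecₚ.lookup-map c (λ m → 0 <ᵇ occupied (positions m) p) ν)
        (≡.trans (cong (0 <ᵇ_) (≡.trans (cong (occupied (pos ν c)) (≡.sym (ℕₚ.+-identityʳ p))) (h c 0 (s≤s z≤n)))) (𝟙-positive _))))
      (word-ext ν (suc p) w (λ c x x< → ≡.trans (cong (occupied (pos ν c)) (≡.sym (ℕₚ.+-suc p x))) (h c (suc x) (s≤s x<))))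

    bitAt-wordFrom : ∀ M p ν c x → x < M → bitAt (wordFrom p M ν) c x ≡ (0 <ᵇ occupied (pos ν c) (p + x))
    bitAt-wordFrom (suc M) p ν c zero    _        = ≡.trans (Vecₚ.lookup-map c (λ m → 0 <ᵇ occupied (positions m) p) ν)
      (cong (λ y → 0 <ᵇ occupied (pos ν c) y) (≡.sym (ℕₚ.+-identityʳ p)))
    bitAt-wordFrom (suc M) p ν c (suc x) (s≤s x<) = ≡.trans (bitAt-wordFrom M (suc p) ν c x x<) (cong (λ y → 0 <ᵇ occupied (pos ν c) y) (≡.sym (ℕₚ.+-suc p x)))

  balanced-word : ∀ w → Balanced w → ∃ λ ν → InBox ν × word ν ≡ w
  balanced-word w bal = ν , box , word-ext ν 0 w occ
    where
    part : ∀ c → ∃ λ (p : Vec ℕ n) → WeaklyDecreasing p × VAll (_≤ D) p × (∀ x → x < n + D → occupied (positions p) x ≡ 𝟙 (bitAt w c x))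
    part c = partition-of n D (bitAt w c) (≡.trans (count-bitAt w c) (bal c))
    ν : Tup
    ν = Vec.tabulate (λ c → proj₁ (part c))
    box : InBox ν
    box c rewrite Vecₚ.lookup∘tabulate (λ c → proj₁ (part c)) c = proj₁ (proj₂ (part c)) , proj₁ (proj₂ (proj₂ (part c)))
    occ : ∀ c x → x < N → occupied (pos ν c) x ≡ 𝟙 (bitAt w c x)
    occ c x x< rewrite Vecₚ.lookup∘tabulate (λ c → proj₁ (part c)) c = proj₂ (proj₂ (proj₂ (part c))) x x<

  word-injective : ∀ μ ν → InBox μ → InBox ν → word μ ≡ word ν → μ ≡ ν
  word-injective μ ν boxμ boxν e = box-injective μ ν boxμ boxν λ c x x< →
    ≡.trans (bitsOf μ boxμ c x x<) (≡.trans (cong (λ w → 𝟙 (bitAt w c x)) e) (≡.sym (bitsOf ν boxν c x x<)))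
    where
    bitsOf : ∀ ν → InBox ν → ∀ c x → x < N → occupied (pos ν c) x ≡ 𝟙 (bitAt (word ν) c x)
    bitsOf ν box c x x< = ≡.trans (≡.sym (positive (occupied≤1 (pos ν c) x (decreasing-box ν box c)))) (cong 𝟙 (≡.sym (bitAt-wordFrom N 0 ν c x x<)))

  vac-balanced : Balanced vac
  vac-balanced c = go n
    where
    low : ∀ D → colourCount c (Vec.replicate D zeros) ≡ 0
    low zero    = refl
    low (suc D) rewrite Vecₚ.lookup-replicate c false = low D
    go : ∀ a → colourCount c (Vec.replicate a ones Vec.++ Vec.replicate D zeros) ≡ a
    go zero    = low D
    go (suc a) rewrite Vecₚ.lookup-replicate c true = cong suc (go a)

  balanced? : ∀ w → Dec (Balanced w)
  balanced? w = Finₚ.all? (λ c → colourCount c w ℕₚ.≟ n)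

  -- A row that starts and ends with an empty queue keeps the number of particles of every colour,
  -- and the vacuum has n of each.
  Ψ-balanced : ∀ xs w → Ψ xs w ≈ 0# ⊎ Balanced w
  Ψ-balanced []       w with word-≟ w vac
  ... | yes refl = inj₂ vac-balanced
  ... | no _     = inj₁ ≈-refl
  Ψ-balanced (x ∷ xs) w with balanced? w
  ... | yes b = inj₂ b
  ... | no ¬b = inj₁ (⅀-zero∈ (words' N) (λ w' _ → vanish w'))
    where
    vanish : ∀ w' → V x w' w ⊗ Ψ xs w' ≈ 0#
    vanish w' with Ψ-balanced xs w'
    ... | inj₁ r = ≈-trans (*-congˡ r) (zeroʳ _)
    ... | inj₂ b with V-dichotomy x w' w
    ... | inj₂ r = ≈-trans (*-congʳ r) (zeroˡ _)
    ... | inj₁ p = ⊥-elim (¬b (λ c → ≡.trans (≡.sym (path-count zeros w' w p c))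
      (≡.trans (cong (λ b → colourCount c w' + 𝟙 b) (Vecₚ.lookup-replicate c false)) (≡.trans (ℕₚ.+-identityʳ _) (b c)))))

  -- Words with n particles of each colour on n + D sites correspond to tuples with parts at most D;
  -- on the remaining words Ψ vanishes.
  ⅀-word : ∀ xs (f : Word N → Carrier) → ⅀ tuples (λ ν → f (word ν) ⊗ Ψ xs (word ν)) ≈ ⅀ (words' N) (λ w → f w ⊗ Ψ xs w)
  ⅀-word xs f = ⅀-reindex tuples (words' N) word (λ w → f w ⊗ Ψ xs w) tuples-unique (words-unique N)
    (λ μ ν μ∈ ν∈ → word-injective μ ν (∈-tuples⁻ μ μ∈) (∈-tuples⁻ ν ν∈)) (λ ν _ → ∈-words (word ν)) supp
    where
    supp : ∀ w → w ∈ words' N → (f w ⊗ Ψ xs w ≈ 0#) ⊎ (∃ λ ν → ν ∈ tuples × word ν ≡ w)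
    supp w _ with Ψ-balanced xs w
    ... | inj₁ r = inj₁ (≈-trans (*-congˡ r) (zeroʳ _))
    ... | inj₂ b with balanced-word w b
    ... | ν , box , e = inj₂ (ν , ∈-tuples⁺ ν box , e)

  zeroTuple : Tup
  zeroTuple = Vec.replicate k (Vec.replicate n 0)

  word-zeroTuple : word zeroTuple ≡ vac
  word-zeroTuple = word-ext zeroTuple 0 vac λ c x _ →
    ≡.trans (cong (λ p → occupied (positions p) x) (Vecₚ.lookup-replicate c _)) (≡.trans (low n x) (cong 𝟙 (≡.sym (bit n c x))))
    where
    low : ∀ a x → occupied (positions (Vec.replicate a 0)) x ≡ 𝟙 (x <ᵇ a)
    low zero    x = refl
    low (suc a) x with ℕₚ.<-cmp a x
    ... | tri< a<x _ _ rewrite ≡ᵇ-false′ a x a<x | low a x | <ᵇ-false (ℕₚ.<⇒≤ a<x) | <ᵇ-false {x} {suc a} a<x = refl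
    ... | tri≈ _ refl _ rewrite ≡ᵇ-refl a | low a a | <ᵇ-false (ℕₚ.≤-refl {a}) | <ᵇ-true (ℕₚ.≤-refl {suc a}) = refl
    ... | tri> _ _ x<a rewrite ≡ᵇ-false a x x<a | low a x | <ᵇ-true x<a | <ᵇ-true (ℕₚ.m<n⇒m<1+n x<a) = refl
    none : ∀ D c x → bitAt (Vec.replicate D zeros) c x ≡ false
    none zero    c x       = refl
    none (suc D) c zero    = Vecₚ.lookup-replicate c false
    none (suc D) c (suc x) = none D c x
    bit : ∀ a c x → bitAt (Vec.replicate a ones Vec.++ Vec.replicate D zeros) c x ≡ (x <ᵇ a)
    bit zero    c x       = none D c x
    bit (suc a) c zero    = Vecₚ.lookup-replicate c true
    bit (suc a) c (suc x) = bit a c x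

  zeroTuple-box : InBox zeroTuple
  zeroTuple-box c rewrite Vecₚ.lookup-replicate c (Vec.replicate n 0) = flat n , VAllₚ.lookup⁻ (λ r → subst (_≤ D) (≡.sym (Vecₚ.lookup-replicate r 0)) z≤n)
    where
    flat : ∀ a → WeaklyDecreasing (Vec.replicate a 0)
    flat zero    = tt
    flat (suc a) = VAllₚ.lookup⁻ (λ r → ℕₚ.≤-reflexive (Vecₚ.lookup-replicate r 0)) , flat a

  tuple-≟ : (μ ν : Tup) → Dec (μ ≡ ν)
  tuple-≟ = Vecₚ.≡-dec (Vecₚ.≡-dec ℕₚ._≟_)

  stripWeight : Carrier → Tup → Tup → Carrier
  stripWeight x μ ν = if does (stripAll? μ ν) then x ↑ moves μ ν ⊗ q ↑ (stat μ ν + stat μ ν) else 0#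

  isZero : Tup → Carrier
  isZero ν = if does (tuple-≟ ν zeroTuple) then 1# else 0#

  stripSum : List Carrier → Tup → Carrier
  stripSum []       ν = isZero ν
  stripSum (x ∷ xs) ν = ⅀ tuples (λ μ → stripWeight x μ ν ⊗ stripSum xs μ)

  private
    if-no : {A : Set} (d : Dec A) {a b : Carrier} → ¬ A → (if does d then a else b) ≡ b
    if-no (yes a) ¬a = ⊥-elim (¬a a)
    if-no (no _)  _  = refl

  stripWeight-0 : ∀ x μ ν → ¬ StripAll μ ν → stripWeight x μ ν ≡ 0#
  stripWeight-0 x μ ν = if-no (stripAll? μ ν)

  stripWeight-strip : ∀ x μ ν → StripAll μ ν → stripWeight x μ ν ≡ x ↑ moves μ ν ⊗ q ↑ (stat μ ν + stat μ ν)
  stripWeight-strip x μ ν = if-yes (stripAll? μ ν)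

  isZero-1 : ∀ ν → ν ≡ zeroTuple → isZero ν ≡ 1#
  isZero-1 ν = if-yes (tuple-≟ ν zeroTuple)

  stripWeight-V : ∀ x μ ν → InBox μ → InBox ν → stripWeight x μ ν ⊗ q ↑ inv μ ≈ q ↑ inv ν ⊗ V x (word μ) (word ν)
  stripWeight-V x μ ν boxμ boxν = go (stripAll? μ ν)
    where
    go : (d : Dec (StripAll μ ν)) → (if does d then x ↑ moves μ ν ⊗ q ↑ (stat μ ν + stat μ ν) else 0#) ⊗ q ↑ inv μ ≈ q ↑ inv ν ⊗ V x (word μ) (word ν)
    go (yes s) = V-strip x μ ν boxν s
    go (no ¬s) = ≈-trans (zeroˡ _) (≈-sym (≈-trans (*-congˡ (V-no-strip x μ ν boxμ boxν ¬s)) (zeroʳ _)))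

  -- The factors q^inv telescope along a chain of strips and leave only those of its two ends.
  stripSum-Ψ : ∀ xs ν → InBox ν → q ↑ inv zeroTuple ⊗ stripSum xs ν ≈ q ↑ inv ν ⊗ Ψ xs (word ν)
  stripSum-Ψ [] ν box = go (tuple-≟ ν zeroTuple) (word-≟ (word ν) vac)
    where
    go : (d : Dec (ν ≡ zeroTuple)) (d' : Dec (word ν ≡ vac)) → q ↑ inv zeroTuple ⊗ (if does d then 1# else 0#) ≈ q ↑ inv ν ⊗ (if does d' then 1# else 0#)
    go (yes refl) (yes _) = ≈-refl
    go (yes refl) (no ¬e) = ⊥-elim (¬e word-zeroTuple)
    go (no ¬e)    (yes e) = ⊥-elim (¬e (word-injective ν zeroTuple box zeroTuple-box (≡.trans e (≡.sym word-zeroTuple))))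
    go (no _)     (no _)  = ≈-trans (zeroʳ _) (≈-sym (zeroʳ _))
  stripSum-Ψ (x ∷ xs) ν box = begin
    q ↑ inv zeroTuple ⊗ ⅀ tuples (λ μ → stripWeight x μ ν ⊗ stripSum xs μ)
      ≈⟨ ⅀-*ˡ tuples _ _ ⟩
    ⅀ tuples (λ μ → q ↑ inv zeroTuple ⊗ (stripWeight x μ ν ⊗ stripSum xs μ))
      ≈⟨ ⅀-cong∈ tuples (λ μ μ∈ → begin
           q ↑ inv zeroTuple ⊗ (stripWeight x μ ν ⊗ stripSum xs μ)
             ≈⟨ solve 3 (λ a b c → a :* (b :* c) := b :* (a :* c)) ≈-refl _ _ _ ⟩
           stripWeight x μ ν ⊗ (q ↑ inv zeroTuple ⊗ stripSum xs μ)
             ≈⟨ *-congˡ (stripSum-Ψ xs μ (∈-tuples⁻ μ μ∈)) ⟩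
           stripWeight x μ ν ⊗ (q ↑ inv μ ⊗ Ψ xs (word μ))
             ≈⟨ ≈-trans (≈-sym (*-assoc _ _ _)) (*-congʳ (stripWeight-V x μ ν (∈-tuples⁻ μ μ∈) box)) ⟩
           (q ↑ inv ν ⊗ V x (word μ) (word ν)) ⊗ Ψ xs (word μ)
             ≈⟨ *-assoc _ _ _ ⟩
           q ↑ inv ν ⊗ (V x (word μ) (word ν) ⊗ Ψ xs (word μ)) ∎) ⟩
    ⅀ tuples (λ μ → q ↑ inv ν ⊗ (V x (word μ) (word ν) ⊗ Ψ xs (word μ)))
      ≈⟨ ≈-sym (⅀-*ˡ tuples _ _) ⟩
    q ↑ inv ν ⊗ ⅀ tuples (λ μ → V x (word μ) (word ν) ⊗ Ψ xs (word μ))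
      ≈⟨ *-congˡ (⅀-word xs (λ w → V x w (word ν))) ⟩
    q ↑ inv ν ⊗ Ψ (x ∷ xs) (word ν) ∎

  chainWeight : (xs : List Carrier) → Tup → Vec Tup (length xs) → Carrier
  chainWeight []       ν []       = isZero ν
  chainWeight (x ∷ xs) ν (μ ∷ μs) = stripWeight x μ ν ⊗ chainWeight xs μ μs

  stripSum-chains : ∀ xs ν → stripSum xs ν ≈ ⅀ (choices (Vec.replicate (length xs) tuples)) (chainWeight xs ν)
  stripSum-chains []       ν = ≈-sym (+-identityʳ _)
  stripSum-chains (x ∷ xs) ν = ≈-trans
    (⅀-cong tuples (λ μ → ≈-trans (*-congˡ (stripSum-chains xs μ)) (⅀-*ˡ (choices (Vec.replicate (length xs) tuples)) _ _)))
    (≈-sym (⅀-choices tuples (Vec.replicate (length xs) tuples) _))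

-- Rows of tableaux and their counting functions.

and-lookup : {A : Set} {f : A → Bool} {xs : List A} → and (map f xs) ≡ true → ∀ x → x ∈ xs → f x ≡ true
and-lookup {f = f} {y ∷ xs} e x (here refl) = proj₁ (∧-true e)
and-lookup {f = f} {y ∷ xs} e x (there x∈)  = and-lookup {f = f} (proj₂ (∧-true {f y} e)) x x∈

and-false : {A : Set} {f : A → Bool} {xs : List A} → and (map f xs) ≡ false → ∃ λ x → x ∈ xs × f x ≡ false
and-false {f = f} {x ∷ xs} e with f x in eq
... | false = x , here refl , eq
... | true with and-false {f = f} {xs} e
... | y , y∈ , e' = y , there y∈ , e'

<ᵇ-< : ∀ m n → (m <ᵇ n) ≡ true → m < n
<ᵇ-< m n e = ℕₚ.<ᵇ⇒< m n (subst Bool.T (≡.sym e) tt)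

<ᵇ-≥ : ∀ m n → (m <ᵇ n) ≡ false → n ≤ m
<ᵇ-≥ m n e with n ℕₚ.≤? m
... | yes le = le
... | no nle with ≡.trans (≡.sym e) (<ᵇ-true (ℕₚ.≰⇒> nle))
... | ()

module RowCounts (n k : ℕ) where

  Row : Set
  Row = List (Fin n)

  cnt : ℕ → Row → ℕ
  cnt i row = length (filterᵇ (λ x → toℕ x <ᵇ i) row)

  equal : ℕ → Row → ℕ
  equal i row = length (filterᵇ (λ x → toℕ x ≡ᵇ i) row)

  Sorted : Row → Set
  Sorted []       = ⊤
  Sorted (x ∷ xs) = All (λ y → toℕ x ≤ toℕ y) xs × Sorted xs

  private
    cnt-∷ : ∀ i x row → cnt i (x ∷ row) ≡ 𝟙 (toℕ x <ᵇ i) + cnt i row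
    cnt-∷ i x row with toℕ x <ᵇ i
    ... | true  = refl
    ... | false = refl

    equal-∷ : ∀ i x row → equal i (x ∷ row) ≡ 𝟙 (toℕ x ≡ᵇ i) + equal i row
    equal-∷ i x row with toℕ x ≡ᵇ i
    ... | true  = refl
    ... | false = refl

    suc-split : ∀ a i → 𝟙 (a <ᵇ suc i) ≡ 𝟙 (a <ᵇ i) + 𝟙 (a ≡ᵇ i)
    suc-split zero    zero    = refl
    suc-split zero    (suc i) = refl
    suc-split (suc a) zero    = refl
    suc-split (suc a) (suc i) = suc-split a i

    interchange : ∀ a b c d → (a + b) + (c + d) ≡ (a + c) + (b + d)
    interchange = solve 4 (λ a b c d → (a :+ b) :+ (c :+ d) := (a :+ c) :+ (b :+ d)) refl
      where open +-*-Solver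

  cnt-suc : ∀ i row → cnt (suc i) row ≡ cnt i row + equal i row
  cnt-suc i []        = refl
  cnt-suc i (x ∷ row) rewrite cnt-∷ (suc i) x row | cnt-∷ i x row | equal-∷ i x row | suc-split (toℕ x) i | cnt-suc i row =
    interchange (𝟙 (toℕ x <ᵇ i)) _ _ _

  cnt-mono : ∀ i row → cnt i row ≤ cnt (suc i) row
  cnt-mono i row = subst (cnt i row ≤_) (≡.sym (cnt-suc i row)) (ℕₚ.m≤m+n _ _)

  cnt-0 : ∀ row → cnt 0 row ≡ 0
  cnt-0 []        = refl
  cnt-0 (x ∷ row) = cnt-0 row

  cnt-n : ∀ row → cnt n row ≡ length row
  cnt-n []        = refl
  cnt-n (x ∷ row) = ≡.trans (cnt-∷ n x row) (cong₂ (λ b m → 𝟙 b + m) (<ᵇ-true (Finₚ.toℕ<n x)) (cnt-n row))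

  cnt≤length : ∀ i row → cnt i row ≤ length row
  cnt≤length i []        = z≤n
  cnt≤length i (x ∷ row) rewrite cnt-∷ i x row with toℕ x <ᵇ i
  ... | true  = s≤s (cnt≤length i row)
  ... | false = ℕₚ.m≤n⇒m≤1+n (cnt≤length i row)

  private
    cnt-none : ∀ i row → All (λ y → i ≤ toℕ y) row → cnt i row ≡ 0
    cnt-none i []        _          = refl
    cnt-none i (x ∷ row) (le ∷ les) = ≡.trans (cnt-∷ i x row) (cong₂ (λ b m → 𝟙 b + m) (<ᵇ-false le) (cnt-none i row les))

  atM-< : ∀ i row → Sorted row → ∀ y → y < cnt i row → ∃ λ x → atM row y ≡ just x × toℕ x < i
  atM-< i (x ∷ row) (les , s) y y< rewrite cnt-∷ i x row with toℕ x <ᵇ i in eq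
  atM-< i (x ∷ row) (les , s) zero    y<       | true  = x , refl , <ᵇ-< (toℕ x) i eq
  atM-< i (x ∷ row) (les , s) (suc y) (s≤s y<) | true  = atM-< i row s y y<
  atM-< i (x ∷ row) (les , s) y       y<       | false rewrite cnt-none i row (All.map (ℕₚ.≤-trans (<ᵇ-≥ (toℕ x) i eq)) les) with y<
  ... | ()

  atM-≥ : ∀ i row → Sorted row → ∀ y {x} → cnt i row ≤ y → atM row y ≡ just x → i ≤ toℕ x
  atM-≥ i (x ∷ row) (les , s) y le e rewrite cnt-∷ i x row with toℕ x <ᵇ i in eq
  atM-≥ i (x ∷ row) (les , s) (suc y) (s≤s le) e    | true  = atM-≥ i row s y le e
  atM-≥ i (x ∷ row) (les , s) zero    le       refl | false = <ᵇ-≥ (toℕ x) i eq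
  atM-≥ i (x ∷ row) (les , s) (suc y) le       e    | false = atM-≥ i row s y (subst (_≤ y) (≡.sym (cnt-none i row (All.map (ℕₚ.≤-trans (<ᵇ-≥ (toℕ x) i eq)) les))) z≤n) e

  atM-just : ∀ (row : Row) y → y < length row → ∃ λ x → atM row y ≡ just x
  atM-just (z ∷ row) zero    _        = z , refl
  atM-just (z ∷ row) (suc y) (s≤s y<) = atM-just row y y<

  private
    atM-ext : ∀ (row row' : Row) → length row ≡ length row' → (∀ y x x' → atM row y ≡ just x → atM row' y ≡ just x' → x ≡ x') → row ≡ row'
    atM-ext []        []         _ h = refl
    atM-ext (x ∷ row) (x' ∷ row') e h = cong₂ _∷_ (h 0 x x' refl refl) (atM-ext row row' (ℕₚ.suc-injective e) (λ y → h (suc y)))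

  sorted-ext : ∀ row row' → Sorted row → Sorted row' → (∀ i → i ≤ n → cnt i row ≡ cnt i row') → row ≡ row'
  sorted-ext row row' s s' h = atM-ext row row' (≡.trans (≡.sym (cnt-n row)) (≡.trans (h n ℕₚ.≤-refl) (cnt-n row'))) λ y x x' e e' →
    Finₚ.toℕ-injective (ℕₚ.≤-antisym (half row row' s s' h y x x' e e') (half row' row s' s (λ i le → ≡.sym (h i le)) y x' x e' e))
    where
    half : ∀ row row' → Sorted row → Sorted row' → (∀ i → i ≤ n → cnt i row ≡ cnt i row') →
      ∀ y x x' → atM row y ≡ just x → atM row' y ≡ just x' → toℕ x ≤ toℕ x'
    half row row' s s' h y x x' e e' with ℕₚ.<-≤-connex y (cnt (toℕ x) row)
    ... | inj₂ le = atM-≥ (toℕ x) row' s' y (subst (_≤ y) (h (toℕ x) (ℕₚ.<⇒≤ (Finₚ.toℕ<n x))) le) e'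
    ... | inj₁ y< with atM-< (toℕ x) row s y y<
    ... | z , e″ , z< with ≡.trans (≡.sym e) e″
    ... | refl = ⊥-elim (ℕₚ.<-irrefl refl z<)

  private
    rowOK-from : ∀ x xs → rowOK n k (x ∷ xs) ≡ true → Sorted (x ∷ xs)
    rowOK-from x []       _ = [] , tt
    rowOK-from x (y ∷ xs) e with rowOK-from y xs (proj₂ (∧-true {suc (toℕ x) ≤ᵇ suc (toℕ y)} e))
    ... | s = (le ∷ All.map (ℕₚ.≤-trans le) (proj₁ s)) , s
      where le = ℕₚ.≤-pred (<ᵇ-< (toℕ x) (suc (toℕ y)) (proj₁ (∧-true {suc (toℕ x) ≤ᵇ suc (toℕ y)} e)))

    rowOK-to : ∀ x xs → Sorted (x ∷ xs) → rowOK n k (x ∷ xs) ≡ true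
    rowOK-to x []       _              = refl
    rowOK-to x (y ∷ xs) ((le ∷ _) , s) rewrite <ᵇ-true (s≤s le) = rowOK-to y xs s

  rowOK⁻ : ∀ row → rowOK n k row ≡ true → Sorted row
  rowOK⁻ []       _ = tt
  rowOK⁻ (x ∷ xs) e = rowOK-from x xs e

  rowOK⁺ : ∀ row → Sorted row → rowOK n k row ≡ true
  rowOK⁺ []       _ = refl
  rowOK⁺ (x ∷ xs) s = rowOK-to x xs s

  -- Column strictness letter by letter: the cells of the upper row with letter at most i rest on
  -- cells of the lower row with letter below i. In this form it is the strip condition between
  -- consecutive shapes.
  Columns : Row → Row → Set
  Columns lower upper = ∀ i → i < n → cnt (suc i) upper ≤ cnt i lower

  colOK⁻ : ∀ lower upper → Sorted lower → Sorted upper → colOK n k lower upper ≡ true → Columns lower upper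
  colOK⁻ lower upper sl su ok i i<n with ℕₚ.≤-<-connex (cnt (suc i) upper) (cnt i lower)
  ... | inj₁ le = le
  -- If the inequality failed at i, then in column `cnt i lower` a letter at most i would stand
  -- above a letter at least i.
  ... | inj₂ lt with atM-< (suc i) upper su (cnt i lower) lt
  ... | z , e , z<
    with atM lower (cnt i lower) in el | atM upper (cnt i lower) in eu
       | and-lookup ok (cnt i lower) (∈ₚ.∈-upTo⁺ (ℕₚ.<-≤-trans lt (cnt≤length (suc i) upper)))
  ... | just x | just z' | x<z = ⊥-elim (ℕₚ.<-irrefl refl (ℕₚ.<-≤-trans (subst (λ w → toℕ w < suc i) (just-injective (≡.sym e)) z<)
    (ℕₚ.≤-trans (s≤s (atM-≥ i lower sl (cnt i lower) ℕₚ.≤-refl el)) (ℕₚ.≤-pred (<ᵇ-< (suc (toℕ x)) (suc (toℕ z')) x<z)))))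
  colOK⁻ lower upper sl su ok i i<n | inj₂ lt | z , () , z< | just x | nothing | _
  colOK⁻ lower upper sl su ok i i<n | inj₂ lt | z , () , z< | nothing | nothing | _
  colOK⁻ lower upper sl su ok i i<n | inj₂ lt | z , e , z< | nothing | just _ | ()

  colOK⁺ : ∀ lower upper → Sorted lower → Sorted upper → Columns lower upper → colOK n k lower upper ≡ true
  colOK⁺ lower upper sl su cols with colOK n k lower upper in eq
  ... | true  = refl
  ... | false with and-false eq
  ... | y , y∈ , e with atM-just upper y (∈ₚ.∈-upTo⁻ y∈)
  ... | z , eu with atM-< (toℕ z) lower sl y (ℕₚ.<-≤-trans (ℕₚ.≰⇒> (λ le → ℕₚ.<-irrefl refl (atM-≥ (suc (toℕ z)) upper su y le eu))) (cols (toℕ z) (Finₚ.toℕ<n z)))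
  ... | x , el , x<z with atM lower y | atM upper y | e
  colOK⁺ lower upper sl su cols | false | y , y∈ , e | z , refl | x , refl , x<z | _ | _ | e' = ≡.trans (≡.sym e') (<ᵇ-true (s≤s x<z))

  private
    sorted-++ : ∀ row a d → Sorted row → All (λ y → toℕ y ≤ toℕ a) row → Sorted (row ++ replicate d a)
    sorted-++ []        a zero    s les = tt
    sorted-++ []        a (suc d) s les = All.tabulate (λ y∈ → ℕₚ.≤-reflexive (cong toℕ (same d y∈))) , sorted-++ [] a d tt []
      where
      same : ∀ d {y} → y ∈ replicate d a → a ≡ y
      same (suc d) (here refl) = refl
      same (suc d) (there y∈)  = same d y∈
    sorted-++ (x ∷ row) a d (l , s) (le ∷ les) = All.tabulate bound , sorted-++ row a d s les
      where
      bound : ∀ {y} → y ∈ row ++ replicate d a → toℕ x ≤ toℕ y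
      bound y∈ with ∈ₚ.∈-++⁻ row y∈
      ... | inj₁ p = All.lookup l p
      ... | inj₂ p = subst (λ y → toℕ x ≤ toℕ y) (same d p) le
        where
        same : ∀ d {y} → y ∈ replicate d a → a ≡ y
        same (suc d) (here refl) = refl
        same (suc d) (there y∈)  = same d y∈

    cnt-++ : ∀ i row row' → cnt i (row ++ row') ≡ cnt i row + cnt i row'
    cnt-++ i []        row' = refl
    cnt-++ i (x ∷ row) row' = ≡.trans (cnt-∷ i x (row ++ row')) (≡.trans (cong (𝟙 (toℕ x <ᵇ i) +_) (cnt-++ i row row'))
      (≡.trans (≡.sym (ℕₚ.+-assoc (𝟙 (toℕ x <ᵇ i)) _ _)) (cong (_+ cnt i row') (≡.sym (cnt-∷ i x row)))))

    cnt-replicate : ∀ i d a → cnt i (replicate d a) ≡ d * 𝟙 (toℕ a <ᵇ i)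
    cnt-replicate i zero    a = refl
    cnt-replicate i (suc d) a = ≡.trans (cnt-∷ i a (replicate d a)) (cong (𝟙 (toℕ a <ᵇ i) +_) (cnt-replicate i d a))

    build : (c : ℕ → ℕ) (m : ℕ) → m ≤ n → Row
    build c zero    _  = []
    build c (suc m) le = build c m (ℕₚ.<⇒≤ le) ++ replicate (c (suc m) ∸ c m) (fromℕ< le)

    build-< : ∀ c m le → All (λ y → toℕ y < m) (build c m le)
    build-< c zero    le = []
    build-< c (suc m) le = Allₚ.++⁺ (All.map ℕₚ.m<n⇒m<1+n (build-< c m (ℕₚ.<⇒≤ le)))
      (Allₚ.replicate⁺ (c (suc m) ∸ c m) (ℕₚ.≤-reflexive (cong suc (Finₚ.toℕ-fromℕ< le))))

    build-sorted : ∀ c m le → Sorted (build c m le)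
    build-sorted c zero    le = tt
    build-sorted c (suc m) le = sorted-++ (build c m _) (fromℕ< le) _ (build-sorted c m _)
      (All.map (λ lt → ℕₚ.≤-trans (ℕₚ.<⇒≤ lt) (ℕₚ.≤-reflexive (≡.sym (Finₚ.toℕ-fromℕ< le)))) (build-< c m _))

    build-cnt : ∀ c → c 0 ≡ 0 → (∀ i → i < n → c i ≤ c (suc i)) → ∀ m le i → (i ≤ m → cnt i (build c m le) ≡ c i) × (m ≤ i → cnt i (build c m le) ≡ c m)
    build-cnt c c0 mono zero le i = (λ { z≤n → ≡.sym c0 }) , (λ _ → ≡.sym c0)
    build-cnt c c0 mono (suc m) le i = low , high
      where
      lt = ℕₚ.<⇒≤ le
      step : cnt i (build c (suc m) le) ≡ cnt i (build c m lt) + (c (suc m) ∸ c m) * 𝟙 (m <ᵇ i)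
      step = ≡.trans (cnt-++ i (build c m lt) _) (cong (cnt i (build c m lt) +_)
        (≡.trans (cnt-replicate i (c (suc m) ∸ c m) (fromℕ< le)) (cong (λ t → (c (suc m) ∸ c m) * 𝟙 (t <ᵇ i)) (Finₚ.toℕ-fromℕ< le))))
      high : suc m ≤ i → cnt i (build c (suc m) le) ≡ c (suc m)
      high le' rewrite step | <ᵇ-true le' | proj₂ (build-cnt c c0 mono m lt i) (ℕₚ.<⇒≤ le') | ℕₚ.*-identityʳ (c (suc m) ∸ c m) = ℕₚ.m+[n∸m]≡n (mono m le)
      low : i ≤ suc m → cnt i (build c (suc m) le) ≡ c i
      low le' with ℕₚ.m≤n⇒m<n∨m≡n le'
      ... | inj₂ refl = high ℕₚ.≤-refl
      ... | inj₁ (s≤s i≤m) rewrite step | <ᵇ-false i≤m | ℕₚ.*-zeroʳ (c (suc m) ∸ c m) | ℕₚ.+-identityʳ (cnt i (build c m lt)) = proj₁ (build-cnt c c0 mono m lt i) i≤m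

  row-with-counts : ∀ c → c 0 ≡ 0 → (∀ i → i < n → c i ≤ c (suc i)) → ∃ λ row → Sorted row × (∀ i → i ≤ n → cnt i row ≡ c i)
  row-with-counts c c0 mono = build c n ℕₚ.≤-refl , build-sorted c n ℕₚ.≤-refl , λ i → proj₁ (build-cnt c c0 mono n ℕₚ.≤-refl i)

-- Sums over intervals and enumeration of words.

bool-iff : ∀ {a b : Bool} → (a ≡ true → b ≡ true) → (b ≡ true → a ≡ true) → a ≡ b
bool-iff {true}  {b}     f g = ≡.sym (f refl)
bool-iff {false} {true}  f g = g refl
bool-iff {false} {false} f g = refl

∧-intro : ∀ {a b} → a ≡ true → b ≡ true → a ∧ b ≡ true
∧-intro refl e = e

∑-upTo-head : ∀ N (f : ℕ → ℕ) → ∑ (upTo (suc N)) f ≡ f 0 + ∑ (upTo N) (f ∘ suc)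
∑-upTo-head N f = cong (f 0 +_) (≡.trans (cong (λ l → ∑ l f) (≡.sym (Listₚ.map-upTo suc N))) (ℕΣ.⅀-map suc (upTo N) f))

∑-upTo-+ : ∀ M N (f : ℕ → ℕ) → ∑ (upTo (M + N)) f ≡ ∑ (upTo M) f + ∑ (upTo N) (λ i → f (M + i))
∑-upTo-+ zero    N f = refl
∑-upTo-+ (suc M) N f = ≡.trans (∑-upTo-head (M + N) f) (≡.trans (cong (f 0 +_) (∑-upTo-+ M N (f ∘ suc)))
  (≡.trans (≡.sym (ℕₚ.+-assoc (f 0) _ _)) (cong (_+ ∑ (upTo N) (λ i → f (suc M + i))) (≡.sym (∑-upTo-head M f)))))

∑-upTo-cong : ∀ N {f g : ℕ → ℕ} → (∀ i → i < N → f i ≡ g i) → ∑ (upTo N) f ≡ ∑ (upTo N) g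
∑-upTo-cong N h = ℕΣ.⅀-cong∈ (upTo N) (λ i i∈ → h i (∈ₚ.∈-upTo⁻ i∈))

∑-upTo-0 : ∀ N {f : ℕ → ℕ} → (∀ i → i < N → f i ≡ 0) → ∑ (upTo N) f ≡ 0
∑-upTo-0 N h = ℕΣ.⅀-zero∈ (upTo N) (λ i i∈ → h i (∈ₚ.∈-upTo⁻ i∈))

between : ℕ → ℕ → ℕ → Bool
between a b x = (a <ᵇ suc x) ∧ (x <ᵇ b)

-- Passes from sites of the line to columns of a row, which is placed on the line with offset `o`;
-- the indicator vanishes at all sites outside the row.
∑-between-shift : ∀ N L o m l (g : ℕ → ℕ) → l ≤ L → L + o ≤ N →
  ∑ (upTo N) (λ x → 𝟙 (between (m + o) (l + o) x) * g x) ≡ ∑ (upTo L) (λ c → 𝟙 (between m l c) * g (c + o))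
∑-between-shift N L o m l g l≤L le = begin
  ∑ (upTo N) f                                        ≡⟨ cong (λ N → ∑ (upTo N) f) (≡.sym (ℕₚ.m+[n∸m]≡n le)) ⟩
  ∑ (upTo ((L + o) + (N ∸ (L + o)))) f                ≡⟨ ∑-upTo-+ (L + o) _ f ⟩
  ∑ (upTo (L + o)) f + ∑ (upTo (N ∸ (L + o))) (λ i → f ((L + o) + i))
    ≡⟨ cong₂ _+_ (≡.trans (cong (λ M → ∑ (upTo M) f) (ℕₚ.+-comm L o)) (∑-upTo-+ o L f)) (∑-upTo-0 (N ∸ (L + o)) high) ⟩
  (∑ (upTo o) f + ∑ (upTo L) (λ c → f (o + c))) + 0   ≡⟨ ≡.trans (ℕₚ.+-identityʳ _) (cong (_+ ∑ (upTo L) (λ c → f (o + c))) (∑-upTo-0 o low)) ⟩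
  ∑ (upTo L) (λ c → f (o + c))                        ≡⟨ ∑-upTo-cong L (λ c _ → ≡.trans (cong f (ℕₚ.+-comm o c)) (cong (λ b → 𝟙 b * g (c + o)) (cancel c))) ⟩
  _ ∎
  where
  open ≡.≡-Reasoning
  f : ℕ → ℕ
  f x = 𝟙 (between (m + o) (l + o) x) * g x
  high : ∀ i → i < _ → f ((L + o) + i) ≡ 0
  high i _ rewrite <ᵇ-false {(L + o) + i} {l + o} (ℕₚ.≤-trans (ℕₚ.+-monoˡ-≤ o l≤L) (ℕₚ.m≤m+n _ i)) | Boolₚ.∧-zeroʳ (m + o <ᵇ suc ((L + o) + i)) = refl
  low : ∀ i → i < o → f i ≡ 0
  low i i<o rewrite <ᵇ-false {m + o} {suc i} (ℕₚ.≤-trans i<o (ℕₚ.m≤n+m o m)) = refl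
  +-<ᵇ : ∀ a b o → (a + o <ᵇ b + o) ≡ (a <ᵇ b)
  +-<ᵇ a b zero    = cong₂ _<ᵇ_ (ℕₚ.+-identityʳ a) (ℕₚ.+-identityʳ b)
  +-<ᵇ a b (suc o) = ≡.trans (cong₂ _<ᵇ_ (ℕₚ.+-suc a o) (ℕₚ.+-suc b o)) (+-<ᵇ a b o)
  cancel : ∀ c → between (m + o) (l + o) (c + o) ≡ between m l c
  cancel c = cong₂ _∧_ (+-<ᵇ m (suc c) o) (+-<ᵇ c l o)

∑-between : ∀ L m l → m ≤ l → l ≤ L → m + ∑ (upTo L) (λ c → 𝟙 (between m l c)) ≡ l
∑-between L m l m≤l l≤L = begin
  m + ∑ (upTo L) (λ c → 𝟙 (between m l c))
    ≡⟨ cong (_+ ∑ (upTo L) (λ c → 𝟙 (between m l c))) (≡.sym (initial L m (ℕₚ.≤-trans m≤l l≤L))) ⟩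
  ∑ (upTo L) (λ c → 𝟙 (c <ᵇ m)) + ∑ (upTo L) (λ c → 𝟙 (between m l c))
    ≡⟨ ≡.sym (ℕΣ.⅀-+ (upTo L) _ _) ⟩
  ∑ (upTo L) (λ c → 𝟙 (c <ᵇ m) + 𝟙 (between m l c))
    ≡⟨ ℕΣ.⅀-cong (upTo L) (λ c → ≡.sym (split c m l m≤l)) ⟩
  ∑ (upTo L) (λ c → 𝟙 (c <ᵇ l))
    ≡⟨ initial L l l≤L ⟩
  l ∎
  where
  open ≡.≡-Reasoning
  initial : ∀ L l → l ≤ L → ∑ (upTo L) (λ c → 𝟙 (c <ᵇ l)) ≡ l
  initial L       zero    le       = ∑-upTo-0 L (λ _ _ → refl)
  initial (suc L) (suc l) (s≤s le) = ≡.trans (∑-upTo-head L (λ c → 𝟙 (c <ᵇ suc l))) (cong suc (initial L l le))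
  split : ∀ c m l → m ≤ l → 𝟙 (c <ᵇ l) ≡ 𝟙 (c <ᵇ m) + 𝟙 (between m l c)
  split c       zero    l       le       = refl
  split zero    (suc m) (suc l) le       = refl
  split (suc c) (suc m) (suc l) (s≤s le) = split c m l le

∑-pick : ∀ N j (B : ℕ → Bool) (h : ℕ → ℕ) → j < N → B j ≡ true → (∀ i → i < N → B i ≡ true → i ≡ j) → ∑ (upTo N) (λ i → 𝟙 (B i) * h i) ≡ h j
∑-pick (suc N) j B h j<N bj uniq with ℕₚ.m<1+n⇒m<n∨m≡n j<N
... | inj₁ j<N' = ≡.trans (∑-upTo-suc N _) (≡.trans (cong₂ _+_ (∑-pick N j B h j<N' bj (λ i i< → uniq i (ℕₚ.m<n⇒m<1+n i<)))
  (off N (λ e → ℕₚ.<-irrefl (≡.sym (uniq N ℕₚ.≤-refl e)) j<N'))) (ℕₚ.+-identityʳ (h j)))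
  where
  off : ∀ i → ¬ (B i ≡ true) → 𝟙 (B i) * h i ≡ 0
  off i ne with B i
  ... | true  = ⊥-elim (ne refl)
  ... | false = refl
... | inj₂ refl = ≡.trans (∑-upTo-suc N _) (cong₂ _+_ (∑-upTo-0 N (λ i i<N → off i (λ e → ℕₚ.<-irrefl (uniq i (ℕₚ.m<n⇒m<1+n i<N) e) i<N))) on)
  where
  off : ∀ i → ¬ (B i ≡ true) → 𝟙 (B i) * h i ≡ 0
  off i ne with B i
  ... | true  = ⊥-elim (ne refl)
  ... | false = refl
  on : 𝟙 (B N) * h N ≡ h N
  on rewrite bj = ℕₚ.+-identityʳ (h N)

words-∈⁺ : ∀ n k l (row : List (Fin n)) → length row ≡ l → row ∈ words n k l
words-∈⁺ n k zero    []        refl = here refl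
words-∈⁺ n k (suc l) (x ∷ row) refl = ∈ₚ.∈-concatMap⁺ (λ w → map (_∷ w) (allFin n))
  (Any.map (λ { refl → ∈ₚ.∈-map⁺ (_∷ row) (∈ₚ.∈-allFin x) }) (words-∈⁺ n k l row refl))

words-∈⁻ : ∀ n k l (row : List (Fin n)) → row ∈ words n k l → length row ≡ l
words-∈⁻ n k zero    _   (here refl) = refl
words-∈⁻ n k (suc l) row row∈ with Mem.find (∈ₚ.∈-concatMap⁻ (λ w → map (_∷ w) (allFin n)) {xs = words n k l} row∈)
... | w , w∈ , row∈' with ∈ₚ.∈-map⁻ (_∷ w) row∈'
... | x , _ , refl = cong suc (words-∈⁻ n k l w w∈)

words-rows-unique : ∀ n k l → Unique (words n k l)
words-rows-unique n k zero    = [] ∷ []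
words-rows-unique n k (suc l) = subst Unique (≡.sym (concatMap-cartesian (λ w x → x ∷ w) (words n k l) (allFin n)))
  (Uniqueₚ.cartesianProductWith⁺ (λ w x → x ∷ w) (λ e → proj₂ (Listₚ.∷-injective e) , proj₁ (Listₚ.∷-injective e))
    (words-rows-unique n k l) (Uniqueₚ.allFin⁺ n))

-- Tableaux as chains of horizontal strips; coinversions by letters.

module Tableaux (k n D : ℕ) where
  open Tuples k n D
  open RowCounts n k

  Tab : Set
  Tab = Vec (Vec Row n) k

  rowAt : Tab → Fin k → Fin n → Row
  rowAt T c r = lookup (lookup T c) r

  -- The cells with entries in [i]; the bound on `toℕ` is strict because entries are stored from 0.
  shape : ℕ → Tab → Tup
  shape i T = Vec.map (Vec.map (cnt i)) T

  lookup-shape : ∀ i T c r → lookup (lookup (shape i T) c) r ≡ cnt i (rowAt T c r)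
  lookup-shape i T c r = ≡.trans (cong (λ F → lookup F r) (Vecₚ.lookup-map c (Vec.map (cnt i)) T)) (Vecₚ.lookup-map r (cnt i) (lookup T c))

  Valid : Tab → Set
  Valid T = (∀ c r → Sorted (rowAt T c r)) × (∀ c r s → toℕ s ≡ suc (toℕ r) → Columns (rowAt T c r) (rowAt T c s))

  private
    colsOK⁻ : ∀ {m} f (F : Vec Row m) → colsOK n k (f ∷ toList F) ≡ true → ∀ r s → toℕ s ≡ suc (toℕ r) → colOK n k (lookup (f ∷ F) r) (lookup (f ∷ F) s) ≡ true
    colsOK⁻ f []        e zero    zero ()
    colsOK⁻ f (f' ∷ F)  e zero    (suc zero) refl = proj₁ (∧-true {colOK n k f f'} e)
    colsOK⁻ f (f' ∷ F)  e (suc r) (suc s) eq = colsOK⁻ f' F (proj₂ (∧-true {colOK n k f f'} e)) r s (ℕₚ.suc-injective eq)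

    colsOK⁺ : ∀ {m} f (F : Vec Row m) → (∀ r s → toℕ s ≡ suc (toℕ r) → colOK n k (lookup (f ∷ F) r) (lookup (f ∷ F) s) ≡ true) → colsOK n k (f ∷ toList F) ≡ true
    colsOK⁺ f []       h = refl
    colsOK⁺ f (f' ∷ F) h = ∧-intro (h zero (suc zero) refl) (colsOK⁺ f' F (λ r s e → h (suc r) (suc s) (cong suc e)))

    colsOK-⁻ : ∀ {m} (F : Vec Row m) → colsOK n k (toList F) ≡ true → ∀ r s → toℕ s ≡ suc (toℕ r) → colOK n k (lookup F r) (lookup F s) ≡ true
    colsOK-⁻ (f ∷ F) = colsOK⁻ f F

    colsOK-⁺ : ∀ {m} (F : Vec Row m) → (∀ r s → toℕ s ≡ suc (toℕ r) → colOK n k (lookup F r) (lookup F s) ≡ true) → colsOK n k (toList F) ≡ true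
    colsOK-⁺ []      h = refl
    colsOK-⁺ (f ∷ F) h = colsOK⁺ f F h

    fillings : Tup → Vec (List (Vec Row n)) k
    fillings ν = Vec.map (λ p → choices (Vec.map (words n k) p)) ν

    allOK : Tab → Bool
    allOK T = and (toList (Vec.map (fillingOK n k) T))

  ∈-tableaux⁻ : ∀ ν T → T ∈ tableaux n k ν → Valid T × (∀ c r → length (rowAt T c r) ≡ lookup (lookup ν c) r)
  ∈-tableaux⁻ ν T T∈ = (sorted , λ c r s e → colOK⁻ _ _ (sorted c r) (sorted c s) (colsOK-⁻ (lookup T c) (proj₂ (ok c)) r s e)) , lengths
    where
    split = ∈-filterᵇ⁻ allOK {xs = choices (fillings ν)} T∈
    ok : ∀ c → and (toList (Vec.map (rowOK n k) (lookup T c))) ≡ true × colsOK n k (toList (lookup T c)) ≡ true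
    ok c = ∧-true (and-map⁻ (fillingOK n k) T (proj₂ split) c)
    sorted : ∀ c r → Sorted (rowAt T c r)
    sorted c r = rowOK⁻ (rowAt T c r) (and-map⁻ (rowOK n k) (lookup T c) (proj₁ (ok c)) r)
    lengths : ∀ c r → length (rowAt T c r) ≡ lookup (lookup ν c) r
    lengths c r = words-∈⁻ n k _ (rowAt T c r) (subst (rowAt T c r ∈_) (Vecₚ.lookup-map r (words n k) (lookup ν c))
      (∈-choices⁻ (Vec.map (words n k) (lookup ν c)) (lookup T c)
        (subst (lookup T c ∈_) (Vecₚ.lookup-map c (λ p → choices (Vec.map (words n k) p)) ν) (∈-choices⁻ (fillings ν) T (proj₁ split) c)) r))

  ∈-tableaux⁺ : ∀ ν T → Valid T → (∀ c r → length (rowAt T c r) ≡ lookup (lookup ν c) r) → T ∈ tableaux n k ν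
  ∈-tableaux⁺ ν T (sorted , cols) lengths = ∈-filterᵇ⁺ allOK
    (∈-choices⁺ (fillings ν) T (λ c → subst (lookup T c ∈_) (≡.sym (Vecₚ.lookup-map c (λ p → choices (Vec.map (words n k) p)) ν))
      (∈-choices⁺ (Vec.map (words n k) (lookup ν c)) (lookup T c) (λ r → subst (rowAt T c r ∈_) (≡.sym (Vecₚ.lookup-map r (words n k) (lookup ν c)))
        (words-∈⁺ n k _ (rowAt T c r) (lengths c r))))))
    (and-map⁺ (fillingOK n k) T (λ c → ∧-intro
      (and-map⁺ (rowOK n k) (lookup T c) (λ r → rowOK⁺ (rowAt T c r) (sorted c r)))
      (colsOK-⁺ (lookup T c) (λ r s e → colOK⁺ _ _ (sorted c r) (sorted c s) (cols c r s e)))))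

  tableaux-unique : ∀ ν → Unique (tableaux n k ν)
  tableaux-unique ν = filterᵇ-unique allOK (choices-unique (fillings ν) (λ c → subst Unique (≡.sym (Vecₚ.lookup-map c (λ p → choices (Vec.map (words n k) p)) ν))
    (choices-unique (Vec.map (words n k) (lookup ν c)) (λ r → subst Unique (≡.sym (Vecₚ.lookup-map r (words n k) (lookup ν c))) (words-rows-unique n k (lookup (lookup ν c) r))))))

  tableau-ext : ∀ T T' → Valid T → Valid T' → (∀ i → i ≤ n → shape i T ≡ shape i T') → T ≡ T'
  tableau-ext T T' (sorted , _) (sorted' , _) h = lookup-ext T T' λ c → lookup-ext _ _ λ r →
    sorted-ext (rowAt T c r) (rowAt T' c r) (sorted c r) (sorted' c r) λ i i≤n →
      ≡.trans (≡.sym (lookup-shape i T c r)) (≡.trans (cong (λ s → lookup (lookup s c) r) (h i i≤n)) (lookup-shape i T' c r))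

  shape-n : ∀ ν T → (∀ c r → length (rowAt T c r) ≡ lookup (lookup ν c) r) → shape n T ≡ ν
  shape-n ν T h = lookup-ext _ _ λ c → lookup-ext _ _ λ r → ≡.trans (lookup-shape n T c r) (≡.trans (cnt-n (rowAt T c r)) (h c r))

  shape-0 : ∀ T → shape 0 T ≡ Vec.replicate k (Vec.replicate n 0)
  shape-0 T = lookup-ext _ _ λ c → lookup-ext _ _ λ r → ≡.trans (lookup-shape 0 T c r) (≡.trans (cnt-0 (rowAt T c r))
    (≡.sym (≡.trans (cong (λ v → lookup v r) (Vecₚ.lookup-replicate c _)) (Vecₚ.lookup-replicate r 0))))

  private
    wd-adjacent : ∀ {m} (p : Vec ℕ m) → (∀ r s → toℕ s ≡ suc (toℕ r) → lookup p s ≤ lookup p r) → WeaklyDecreasing p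
    wd-adjacent []           h = tt
    wd-adjacent (p ∷ [])     h = [] , tt
    wd-adjacent (p ∷ p' ∷ ps) h with wd-adjacent (p' ∷ ps) (λ r s e → h (suc r) (suc s) (cong suc e))
    ... | w = (h zero (suc zero) refl ∷ VAll.map (λ l → ℕₚ.≤-trans l (h zero (suc zero) refl)) (proj₁ w)) , w

    wd-lookup : ∀ {m} (p : Vec ℕ m) → WeaklyDecreasing p → ∀ r s → toℕ r ≤ toℕ s → lookup p s ≤ lookup p r
    wd-lookup (p ∷ ps) w         zero    zero    _        = ℕₚ.≤-refl
    wd-lookup (p ∷ ps) (les , w) zero    (suc s) _        = VAllₚ.lookup⁺ les s
    wd-lookup (p ∷ ps) (les , w) (suc r) (suc s) (s≤s le) = wd-lookup ps w r s le

  shape-decreasing : ∀ T → Valid T → ∀ i → i ≤ n → ∀ c → WeaklyDecreasing (lookup (shape i T) c)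
  shape-decreasing T (sorted , cols) i i≤n c = wd-adjacent _ λ r s e →
    subst₂ _≤_ (≡.sym (lookup-shape i T c s)) (≡.sym (lookup-shape i T c r)) (go i i≤n r s e)
    where
    go : ∀ i → i ≤ n → ∀ r s → toℕ s ≡ suc (toℕ r) → cnt i (rowAt T c s) ≤ cnt i (rowAt T c r)
    go zero    _   r s e = subst (_≤ cnt 0 (rowAt T c r)) (≡.sym (cnt-0 (rowAt T c s))) z≤n
    go (suc i) i<n r s e = ℕₚ.≤-trans (cols c r s e i i<n) (cnt-mono i (rowAt T c r))

  shape-box : ∀ ν T → InBox ν → Valid T → (∀ c r → length (rowAt T c r) ≡ lookup (lookup ν c) r) → ∀ i → i ≤ n → InBox (shape i T)
  shape-box ν T box valid lengths i i≤n c = shape-decreasing T valid i i≤n c , VAllₚ.lookup⁻ λ r →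
    subst (_≤ D) (≡.sym (lookup-shape i T c r)) (ℕₚ.≤-trans (cnt≤length i (rowAt T c r)) (subst (_≤ D) (≡.sym (lengths c r)) (VAllₚ.lookup⁺ (proj₂ (box c)) r)))

  shape-strip : ∀ T → Valid T → ∀ i → i < n → StripAll (shape i T) (shape (suc i) T)
  shape-strip T valid@(sorted , cols) i i<n c =
    (λ r → subst₂ _≤_ (≡.sym (lookup-shape i T c r)) (≡.sym (lookup-shape (suc i) T c r)) (cnt-mono i (rowAt T c r)))
    -- Column strictness compares only the adjacent rows r and `s'` = r + 1; the remaining rows
    -- follow because shapes are partitions.
    , λ r s r<s → let s' = fromℕ< (ℕₚ.≤-<-trans r<s (Finₚ.toℕ<n s)) ; e = Finₚ.toℕ-fromℕ< (ℕₚ.≤-<-trans r<s (Finₚ.toℕ<n s)) in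
        ℕₚ.≤-trans (wd-lookup _ (shape-decreasing T valid (suc i) i<n c) s' s (subst (_≤ toℕ s) (≡.sym e) r<s))
          (subst₂ _≤_ (≡.sym (lookup-shape (suc i) T c s')) (≡.sym (lookup-shape i T c r)) (cols c r s' e i i<n))

  -- A chain prescribes the counting function of every row, and the strip condition for neighbouring
  -- rows is column strictness.
  tableau-of : ∀ (χ : ℕ → Tup) → χ 0 ≡ Vec.replicate k (Vec.replicate n 0) → (∀ i → i < n → StripAll (χ i) (χ (suc i))) →
    ∃ λ T → T ∈ tableaux n k (χ n) × (∀ i → i ≤ n → shape i T ≡ χ i)
  tableau-of χ χ0 strips = T , ∈-tableaux⁺ (χ n) T (sorted , cols) (λ c r → ≡.trans (≡.sym (cnt-n (rowAt T c r))) (counts c r n ℕₚ.≤-refl))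
    , λ i i≤n → lookup-ext _ _ λ c → lookup-ext _ _ λ r → ≡.trans (lookup-shape i T c r) (counts c r i i≤n)
    where
    χ0-at : ∀ c r → lookup (lookup (χ 0) c) r ≡ 0
    χ0-at c r = ≡.trans (cong (λ v → lookup (lookup v c) r) χ0) (≡.trans (cong (λ v → lookup v r) (Vecₚ.lookup-replicate c _)) (Vecₚ.lookup-replicate r 0))
    row : ∀ c r → ∃ λ row → Sorted row × (∀ i → i ≤ n → cnt i row ≡ lookup (lookup (χ i) c) r)
    row c r = row-with-counts (λ i → lookup (lookup (χ i) c) r) (χ0-at c r) (λ i i<n → proj₁ (strips i i<n c) r)
    T : Tab
    T = Vec.tabulate (λ c → Vec.tabulate (λ r → proj₁ (row c r)))
    at : ∀ c r → rowAt T c r ≡ proj₁ (row c r)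
    at c r = ≡.trans (cong (λ F → lookup F r) (Vecₚ.lookup∘tabulate (λ c → Vec.tabulate (λ r → proj₁ (row c r))) c)) (Vecₚ.lookup∘tabulate _ r)
    sorted : ∀ c r → Sorted (rowAt T c r)
    sorted c r = subst Sorted (≡.sym (at c r)) (proj₁ (proj₂ (row c r)))
    counts : ∀ c r i → i ≤ n → cnt i (rowAt T c r) ≡ lookup (lookup (χ i) c) r
    counts c r i i≤n = ≡.trans (cong (cnt i) (at c r)) (proj₂ (proj₂ (row c r)) i i≤n)
    cols : ∀ c r s → toℕ s ≡ suc (toℕ r) → Columns (rowAt T c r) (rowAt T c s)
    cols c r s e i i<n = subst₂ _≤_ (≡.sym (counts c s (suc i) i<n)) (≡.sym (counts c r i (ℕₚ.<⇒≤ i<n)))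
      (proj₂ (strips i i<n c) r s (ℕₚ.≤-reflexive (≡.sym e)))

  offset : Fin n → ℕ
  offset r = n ∸ suc (toℕ r)

  crossing-∑ : ∀ (p p' : Vec ℕ n) x → crossing (positions p) (positions p') x
    ≡ ∑ (allFin n) (λ r → 𝟙 (between (lookup p r + offset r) (lookup p' r + offset r) x))
  crossing-∑ p p' x = ≡.trans (go (positions p) (positions p')) (ℕΣ.⅀-cong (allFin n) λ r →
    cong₂ (λ a b → 𝟙 (between a b x)) (lookup-positions p r) (lookup-positions p' r))
    where
    go : ∀ {m} (a b : Vec ℕ m) → crossing a b x ≡ ∑ (allFin m) (λ r → 𝟙 (between (lookup a r) (lookup b r) x))
    go []       []       = refl
    go {suc m} (a ∷ as) (b ∷ bs) = ≡.trans (cong (𝟙 (between a b x) +_) (go as bs))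
      (≡.sym (ℕΣ.⅀-allFin-suc m (λ r → 𝟙 (between (lookup (a ∷ as) r) (lookup (b ∷ bs) r) x))))

  present-∑ : ∀ (p p' : Vec ℕ n) x → present (positions p) (positions p') x
    ≡ ∑ (allFin n) (λ r → 𝟙 (between (lookup p r + offset r) (suc (lookup p' r + offset r)) x))
  present-∑ p p' x = ≡.trans (go (positions p) (positions p')) (ℕΣ.⅀-cong (allFin n) λ r →
    cong₂ (λ a b → 𝟙 (between a (suc b) x)) (lookup-positions p r) (lookup-positions p' r))
    where
    go : ∀ {m} (a b : Vec ℕ m) → present a b x ≡ ∑ (allFin m) (λ r → 𝟙 (between (lookup a r) (suc (lookup b r)) x))
    go []       []       = refl
    go {suc m} (a ∷ as) (b ∷ bs) = ≡.trans (cong (𝟙 (between a (suc b) x) +_) (go as bs))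
      (≡.sym (ℕΣ.⅀-allFin-suc m (λ r → 𝟙 (between (lookup (a ∷ as) r) (suc (lookup (b ∷ bs) r)) x))))

  module _ (ν : Tup) (T : Tab) (box : InBox ν) (valid : Valid T) (lengths : ∀ c r → length (rowAt T c r) ≡ lookup (lookup ν c) r) where

    private
      row-end : ∀ c r → length (rowAt T c r) + offset r ≤ N
      row-end c r = ℕₚ.≤-trans (ℕₚ.+-mono-≤ (subst (_≤ D) (≡.sym (lengths c r)) (VAllₚ.lookup⁺ (proj₂ (box c)) r)) (ℕₚ.m∸n≤m n (suc (toℕ r))))
        (ℕₚ.≤-reflexive (ℕₚ.+-comm D n))

      visit : ℕ → Fin k → Fin n → ℕ → ℕ
      visit i c r x = 𝟙 (between (cnt i (rowAt T c r) + offset r) (cnt (suc i) (rowAt T c r) + offset r) x)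

      crossing-shape : ∀ i c x → crossing (pos (shape i T) c) (pos (shape (suc i) T) c) x ≡ ∑ (allFin n) (λ r → visit i c r x)
      crossing-shape i c x = ≡.trans (crossing-∑ (lookup (shape i T) c) (lookup (shape (suc i) T) c) x) (ℕΣ.⅀-cong (allFin n) λ r →
        cong₂ (λ a b → 𝟙 (between (a + offset r) (b + offset r) x)) (lookup-shape i T c r) (lookup-shape (suc i) T c r))

      stay : ℕ → Fin k → Fin n → ℕ → ℕ
      stay i c r x = 𝟙 (between (cnt i (rowAt T c r) + offset r) (suc (cnt (suc i) (rowAt T c r) + offset r)) x)

      present-shape : ∀ i c x → present (pos (shape i T) c) (pos (shape (suc i) T) c) x ≡ ∑ (allFin n) (λ r → stay i c r x)
      present-shape i c x = ≡.trans (present-∑ (lookup (shape i T) c) (lookup (shape (suc i) T) c) x) (ℕΣ.⅀-cong (allFin n) λ r →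
        cong₂ (λ a b → 𝟙 (between (a + offset r) (suc (b + offset r)) x)) (lookup-shape i T c r) (lookup-shape (suc i) T c r))

      ∑-visit : ∀ i c r (g : ℕ → ℕ) → ∑ (upTo N) (λ x → visit i c r x * g x)
        ≡ ∑ (upTo (length (rowAt T c r))) (λ y → 𝟙 (between (cnt i (rowAt T c r)) (cnt (suc i) (rowAt T c r)) y) * g (y + offset r))
      ∑-visit i c r g = ∑-between-shift N (length (rowAt T c r)) (offset r) (cnt i (rowAt T c r)) (cnt (suc i) (rowAt T c r)) g (cnt≤length (suc i) (rowAt T c r)) (row-end c r)

    moves-shape : ∀ i → moves (shape i T) (shape (suc i) T) ≡ ∑ (allFin k) (λ c → ∑ (allFin n) (λ r → equal i (rowAt T c r)))
    moves-shape i = begin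
      ∑ (upTo N) (λ x → ∑ (allFin k) (λ c → crossing (pos (shape i T) c) (pos (shape (suc i) T) c) x))
        ≡⟨ ℕΣ.⅀-cong (upTo N) (λ x → ℕΣ.⅀-cong (allFin k) (λ c → crossing-shape i c x)) ⟩
      ∑ (upTo N) (λ x → ∑ (allFin k) (λ c → ∑ (allFin n) (λ r → visit i c r x)))
        ≡⟨ ℕΣ.⅀-swap (upTo N) (allFin k) (λ x c → ∑ (allFin n) (λ r → visit i c r x)) ⟩
      ∑ (allFin k) (λ c → ∑ (upTo N) (λ x → ∑ (allFin n) (λ r → visit i c r x)))
        ≡⟨ ℕΣ.⅀-cong (allFin k) (λ c → ≡.trans (ℕΣ.⅀-swap (upTo N) (allFin n) (λ x r → visit i c r x)) (ℕΣ.⅀-cong (allFin n) (λ r → visits c r))) ⟩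
      _ ∎
      where
      open ≡.≡-Reasoning
      visits : ∀ c r → ∑ (upTo N) (visit i c r) ≡ equal i (rowAt T c r)
      visits c r = ℕₚ.+-cancelˡ-≡ (cnt i row) _ _ (begin
        cnt i row + ∑ (upTo N) (visit i c r)
          ≡⟨ cong (cnt i row +_) (≡.trans (ℕΣ.⅀-cong (upTo N) (λ x → ≡.sym (ℕₚ.*-identityʳ (visit i c r x)))) (≡.trans (∑-visit i c r (λ _ → 1))
               (ℕΣ.⅀-cong (upTo (length row)) (λ y → ℕₚ.*-identityʳ (𝟙 (between (cnt i row) (cnt (suc i) row) y)))))) ⟩
        cnt i row + ∑ (upTo (length row)) (λ y → 𝟙 (between (cnt i row) (cnt (suc i) row) y))
          ≡⟨ ∑-between (length row) (cnt i row) (cnt (suc i) row) (cnt-mono i row) (cnt≤length (suc i) row) ⟩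
        cnt (suc i) row
          ≡⟨ cnt-suc i row ⟩
        cnt i row + equal i row ∎)
        where row = rowAt T c r

    content-moves : ∀ i → lookup (content n k T) i ≡ moves (shape (toℕ i) T) (shape (suc (toℕ i)) T)
    content-moves i = ≡.trans (Vecₚ.lookup∘tabulate _ i) (≡.trans (∑-toList T (λ F → ∑ (toList F) (equal (toℕ i))))
      (≡.trans (ℕΣ.⅀-cong (allFin k) (λ c → ∑-toList (lookup T c) (equal (toℕ i)))) (≡.sym (moves-shape (toℕ i)))))
      where
      ∑-toList : ∀ {A : Set} {m} (v : Vec A m) (f : A → ℕ) → ∑ (toList v) f ≡ ∑ (allFin m) (λ j → f (lookup v j))
      ∑-toList []      f = refl
      ∑-toList {m = suc m} (x ∷ v) f = ≡.trans (cong (f x +_) (∑-toList v f)) (≡.sym (ℕΣ.⅀-allFin-suc m (λ j → f (lookup (x ∷ v) j))))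

    private
      lo hi : ℕ → Fin k → Fin n → ℕ
      lo i c r = cnt i (rowAt T c r)
      hi i c r = cnt (suc i) (rowAt T c r)

      -- a triple (u , v , w) with v in the letter i and w in column suc d of row r is a coinversion iff lo ≤ d ≤ hi
      cell⁻ : ∀ i c r d → i < n → d ≤ length (rowAt T c r) → entryOr0 n k (cellEntry n k (lookup T c) r d) ≤ suc i →
        suc i ≤ entryOr∞ n k (cellEntry n k (lookup T c) r (suc d)) → lo i c r ≤ d × d ≤ hi i c r
      cell⁻ i c r d i<n d≤ below above = low above , high d d≤ below
        where
        row = rowAt T c r
        sorted = proj₁ valid c r
        low : suc i ≤ entryOr∞ n k (cellEntry n k (lookup T c) r (suc d)) → lo i c r ≤ d
        low above with lo i c r ℕₚ.≤? d
        ... | yes le = le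
        ... | no nle with atM-< i row sorted d (ℕₚ.≰⇒> nle)
        ... | x , e , x<i with atM row d | above
        low above | no nle | x , refl , x<i | _ | above' = ⊥-elim (ℕₚ.<-irrefl refl (ℕₚ.≤-trans above' x<i))
        high : ∀ d → d ≤ length row → entryOr0 n k (cellEntry n k (lookup T c) r d) ≤ suc i → d ≤ hi i c r
        high zero    _  _ = z≤n
        high (suc d) d< below with suc d ℕₚ.≤? hi i c r
        ... | yes le = le
        ... | no nle with atM-just row d d<
        ... | x , e with atM-≥ (suc i) row sorted d (ℕₚ.≤-pred (ℕₚ.≰⇒> nle)) e
        ... | i<x with atM row d | below
        high (suc d) d< below | no nle | x , refl | i<x | _ | below' = ⊥-elim (ℕₚ.<-irrefl refl (ℕₚ.<-≤-trans i<x (ℕₚ.≤-pred below')))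

      cell⁺ : ∀ i c r d → i < n → lo i c r ≤ d → d ≤ hi i c r → d ≤ length (rowAt T c r)
        × entryOr0 n k (cellEntry n k (lookup T c) r d) ≤ suc i × suc i ≤ entryOr∞ n k (cellEntry n k (lookup T c) r (suc d))
      cell⁺ i c r d i<n l h = ℕₚ.≤-trans h (cnt≤length (suc i) row) , high d h , low
        where
        row = rowAt T c r
        sorted = proj₁ valid c r
        low : suc i ≤ entryOr∞ n k (cellEntry n k (lookup T c) r (suc d))
        low with atM row d in e
        ... | just x  = s≤s (atM-≥ i row sorted d l e)
        -- An absent w counts as n + 1, above every entry.
        ... | nothing = s≤s (ℕₚ.<⇒≤ i<n)
        high : ∀ d → d ≤ hi i c r → entryOr0 n k (cellEntry n k (lookup T c) r d) ≤ suc i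
        high zero    _ = z≤n
        high (suc d) h with atM-< (suc i) row sorted d h
        ... | x , e , x< with atM row d
        high (suc d) h | x , refl , x< | _ = x<

      -- d = y + r - r₀ as positions on the line
      align : ∀ (l : ℕ) (r r₀ : Fin n) → (l + offset r) + suc (toℕ r + toℕ r₀) ≡ (l + toℕ r₀) + n
      align l r r₀ = ≡.trans (solve 4 (λ l o r s → (l :+ o) :+ (con 1 :+ (r :+ s)) := (l :+ s) :+ (o :+ (con 1 :+ r))) refl l (offset r) (toℕ r) (toℕ r₀))
        (cong (l + toℕ r₀ +_) (ℕₚ.m∸n+n≡m (Finₚ.toℕ<n r)))
        where open +-*-Solver

      -- Equal contents mean equal sites, d + `offset r` = y + `offset r₀`. So the test lo ≤ d ≤ hi
      -- of `cell⁻` and `cell⁺` says that, while letter i is added, the particle of row r in colour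
      -- b visits the site from which v makes its step.
      triple-count : ∀ i b r r₀ y {row₀} → i < n → row₀ ≡ suc i →
        𝟙 ((toℕ r₀ <ᵇ suc y + toℕ r) ∧ (((suc y + toℕ r) ∸ toℕ r₀) ≤ᵇ suc (lookup (lookup ν b) r))
          ∧ (entryOr0 n k (cellEntry n k (lookup T b) r (((suc y + toℕ r) ∸ toℕ r₀) ∸ 1)) ≤ᵇ row₀)
          ∧ (row₀ ≤ᵇ entryOr∞ n k (cellEntry n k (lookup T b) r ((suc y + toℕ r) ∸ toℕ r₀))))
        ≡ stay i b r (y + offset r₀)
      triple-count i b r r₀ y i<n refl = cong 𝟙 (bool-iff to from)
        where
        d = (y + toℕ r) ∸ toℕ r₀
        shifted : ∀ {l} → l + toℕ r₀ ≤ y + toℕ r → l + offset r ≤ y + offset r₀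
        shifted {l} le = ℕₚ.+-cancelʳ-≤ (suc (toℕ r + toℕ r₀)) _ _ (subst₂ _≤_ (≡.sym (align l r r₀))
          (≡.sym (≡.trans (cong (λ t → (y + offset r₀) + suc t) (ℕₚ.+-comm (toℕ r) (toℕ r₀))) (align y r₀ r))) (ℕₚ.+-monoˡ-≤ n le))
        shifted⁻ : ∀ {l} → l + offset r ≤ y + offset r₀ → l + toℕ r₀ ≤ y + toℕ r
        shifted⁻ {l} le = ℕₚ.+-cancelʳ-≤ n _ _ (subst₂ _≤_ (align l r r₀)
          (≡.trans (cong (λ t → (y + offset r₀) + suc t) (ℕₚ.+-comm (toℕ r) (toℕ r₀))) (align y r₀ r)) (ℕₚ.+-monoˡ-≤ (suc (toℕ r + toℕ r₀)) le))
        shiftedʳ : ∀ {h} → y + toℕ r ≤ h + toℕ r₀ → y + offset r₀ ≤ h + offset r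
        shiftedʳ {h} le = ℕₚ.+-cancelʳ-≤ (suc (toℕ r + toℕ r₀)) _ _ (subst₂ _≤_
          (≡.sym (≡.trans (cong (λ t → (y + offset r₀) + suc t) (ℕₚ.+-comm (toℕ r) (toℕ r₀))) (align y r₀ r))) (≡.sym (align h r r₀)) (ℕₚ.+-monoˡ-≤ n le))
        shiftedʳ⁻ : ∀ {h} → y + offset r₀ ≤ h + offset r → y + toℕ r ≤ h + toℕ r₀
        shiftedʳ⁻ {h} le = ℕₚ.+-cancelʳ-≤ n _ _ (subst₂ _≤_
          (≡.trans (cong (λ t → (y + offset r₀) + suc t) (ℕₚ.+-comm (toℕ r) (toℕ r₀))) (align y r₀ r)) (align h r r₀) (ℕₚ.+-monoˡ-≤ (suc (toℕ r + toℕ r₀)) le))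
        ≤ᵇ-≤ : ∀ m n → (m ≤ᵇ n) ≡ true → m ≤ n
        ≤ᵇ-≤ m n e = ℕₚ.≤ᵇ⇒≤ m n (subst Bool.T (≡.sym e) tt)
        to : _ ≡ true → between (lo i b r + offset r) (suc (hi i b r + offset r)) (y + offset r₀) ≡ true
        to e = ∧-intro (<ᵇ-true (s≤s (shifted (subst (lo i b r + toℕ r₀ ≤_) (ℕₚ.m∸n+n≡m r₀≤) (ℕₚ.+-monoˡ-≤ (toℕ r₀) (proj₁ cell))))))
                       (<ᵇ-true (s≤s (shiftedʳ (subst (_≤ hi i b r + toℕ r₀) (ℕₚ.m∸n+n≡m r₀≤) (ℕₚ.+-monoˡ-≤ (toℕ r₀) (proj₂ cell))))))
          where
          e₁ = ∧-true {toℕ r₀ <ᵇ suc y + toℕ r} e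
          e₂ = ∧-true {((suc y + toℕ r) ∸ toℕ r₀) ≤ᵇ suc (lookup (lookup ν b) r)} (proj₂ e₁)
          e₃ = ∧-true {entryOr0 n k (cellEntry n k (lookup T b) r (((suc y + toℕ r) ∸ toℕ r₀) ∸ 1)) ≤ᵇ suc i} (proj₂ e₂)
          -- The condition c ≥ 1 makes the truncated subtraction exact, so that w lies in column
          -- `suc d` and u in column d.
          r₀≤ : toℕ r₀ ≤ y + toℕ r
          r₀≤ = ℕₚ.≤-pred (<ᵇ-< (toℕ r₀) (suc y + toℕ r) (proj₁ e₁))
          sd : (suc y + toℕ r) ∸ toℕ r₀ ≡ suc d
          sd = ℕₚ.+-∸-assoc 1 r₀≤
          cell : lo i b r ≤ d × d ≤ hi i b r
          cell = cell⁻ i b r d i<n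
            (subst (d ≤_) (≡.sym (lengths b r)) (ℕₚ.≤-pred (subst (_≤ suc (lookup (lookup ν b) r)) sd (≤ᵇ-≤ _ _ (proj₁ e₂)))))
            (subst (λ t → entryOr0 n k (cellEntry n k (lookup T b) r (t ∸ 1)) ≤ suc i) sd (≤ᵇ-≤ _ _ (proj₁ e₃)))
            (subst (λ t → suc i ≤ entryOr∞ n k (cellEntry n k (lookup T b) r t)) sd (≤ᵇ-≤ (suc i) _ (proj₂ e₃)))
        from : between (lo i b r + offset r) (suc (hi i b r + offset r)) (y + offset r₀) ≡ true → _ ≡ true
        from e = ∧-intro (<ᵇ-true (s≤s r₀≤)) (∧-intro
            (≤ᵇ-intro (subst (_≤ suc (lookup (lookup ν b) r)) (≡.sym sd) (s≤s (subst (d ≤_) (lengths b r) (proj₁ cell)))))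
            (∧-intro (≤ᵇ-intro (subst (λ t → entryOr0 n k (cellEntry n k (lookup T b) r (t ∸ 1)) ≤ suc i) (≡.sym sd) (proj₁ (proj₂ cell))))
                     (≤ᵇ-intro (subst (λ t → suc i ≤ entryOr∞ n k (cellEntry n k (lookup T b) r t)) (≡.sym sd) (proj₂ (proj₂ cell))))))
          where
          e₁ = ∧-true {lo i b r + offset r <ᵇ suc (y + offset r₀)} e
          low : lo i b r + toℕ r₀ ≤ y + toℕ r
          low = shifted⁻ (ℕₚ.≤-pred (<ᵇ-< _ _ (proj₁ e₁)))
          high : y + toℕ r ≤ hi i b r + toℕ r₀
          high = shiftedʳ⁻ (ℕₚ.≤-pred (<ᵇ-< _ _ (proj₂ e₁)))
          r₀≤ : toℕ r₀ ≤ y + toℕ r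
          r₀≤ = ℕₚ.≤-trans (ℕₚ.m≤n+m _ (lo i b r)) low
          sd : (suc y + toℕ r) ∸ toℕ r₀ ≡ suc d
          sd = ℕₚ.+-∸-assoc 1 r₀≤
          cell = cell⁺ i b r d i<n (ℕₚ.m+n≤o⇒m≤o∸n (lo i b r) low) (ℕₚ.m≤n+o⇒m∸n≤o (y + toℕ r) (toℕ r₀) (subst (y + toℕ r ≤_) (ℕₚ.+-comm (hi i b r) _) high))

    -- A cell v holds exactly one letter and is a step of a particle while that letter is added.
    -- Summed over v, the triples become the steps of colour a at sites where colour b is present,
    -- sorted by the letter.
    coinv-stat : coinv n k ν T ≡ ∑ (upTo n) (λ i → stat (shape i T) (shape (suc i) T))
    coinv-stat = begin
      coinv n k ν T
        ≡⟨ ℕΣ.⅀-cong (allFin k) (λ a → ℕΣ.⅀-cong (allFin k) (λ b → cong (𝟙 (toℕ a <ᵇ toℕ b) *_) (pair a b))) ⟩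
      ∑ (allFin k) (λ a → ∑ (allFin k) λ b → 𝟙 (toℕ a <ᵇ toℕ b) * ∑ (upTo n) (λ i → S i a b))
        ≡⟨ ℕΣ.⅀-cong (allFin k) (λ a → ≡.trans (ℕΣ.⅀-cong (allFin k) (λ b → ℕΣ.⅀-*ˡ (upTo n) (𝟙 (toℕ a <ᵇ toℕ b)) (λ i → S i a b)))
             (ℕΣ.⅀-swap (allFin k) (upTo n) (λ b i → 𝟙 (toℕ a <ᵇ toℕ b) * S i a b))) ⟩
      ∑ (allFin k) (λ a → ∑ (upTo n) (λ i → ∑ (allFin k) λ b → 𝟙 (toℕ a <ᵇ toℕ b) * S i a b))
        ≡⟨ ℕΣ.⅀-swap (allFin k) (upTo n) (λ a i → ∑ (allFin k) λ b → 𝟙 (toℕ a <ᵇ toℕ b) * S i a b) ⟩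
      ∑ (upTo n) (λ i → stat (shape i T) (shape (suc i) T)) ∎
      where
      open ≡.≡-Reasoning
      S : ℕ → Fin k → Fin k → ℕ
      S i a b = ∑ (upTo N) (λ x → crossing (pos (shape i T) a) (pos (shape (suc i) T) a) x * present (pos (shape i T) b) (pos (shape (suc i) T) b) x)
      G : ℕ → Fin k → ℕ → ℕ
      G i b x = ∑ (allFin n) (λ r → stay i b r x)
      in-letter : ℕ → Fin k → Fin n → ℕ → Bool
      in-letter i a r y = between (cnt i (rowAt T a r)) (cnt (suc i) (rowAt T a r)) y
      S-rows : ∀ i a b → S i a b ≡ ∑ (allFin n) (λ r₀ → ∑ (upTo (length (rowAt T a r₀))) (λ y → 𝟙 (in-letter i a r₀ y) * G i b (y + offset r₀)))
      S-rows i a b = begin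
        S i a b
          ≡⟨ ℕΣ.⅀-cong (upTo N) (λ x → ≡.trans (cong₂ _*_ (crossing-shape i a x) (present-shape i b x)) (ℕΣ.⅀-*ʳ (allFin n) (G i b x) (λ r₀ → visit i a r₀ x))) ⟩
        ∑ (upTo N) (λ x → ∑ (allFin n) (λ r₀ → visit i a r₀ x * G i b x))
          ≡⟨ ℕΣ.⅀-swap (upTo N) (allFin n) (λ x r₀ → visit i a r₀ x * G i b x) ⟩
        ∑ (allFin n) (λ r₀ → ∑ (upTo N) (λ x → visit i a r₀ x * G i b x))
          ≡⟨ ℕΣ.⅀-cong (allFin n) (λ r₀ → ∑-visit i a r₀ (G i b)) ⟩
        _ ∎
      triples : Fin k → Fin k → Fin n → ℕ → ℕ
      triples a b r₀ y = ∑ (allFin n) λ r →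
        let b' = entryOr0 n k (cellEntry n k (lookup T a) r₀ (suc y)) ; d = (suc y + toℕ r) ∸ toℕ r₀ in
        𝟙 ((toℕ r₀ <ᵇ suc y + toℕ r) ∧ (d ≤ᵇ suc (lookup (lookup ν b) r))
          ∧ (entryOr0 n k (cellEntry n k (lookup T b) r (d ∸ 1)) ≤ᵇ b') ∧ (b' ≤ᵇ entryOr∞ n k (cellEntry n k (lookup T b) r d)))
      letter : ∀ a b r₀ y → y < length (rowAt T a r₀) →
        triples a b r₀ y ≡ ∑ (upTo n) (λ i → 𝟙 (in-letter i a r₀ y) * G i b (y + offset r₀))
      letter a b r₀ y y< with atM-just (rowAt T a r₀) y y<
      ... | x , e = ≡.trans (ℕΣ.⅀-cong (allFin n) (λ r → triple-count (toℕ x) b r r₀ y (Finₚ.toℕ<n x) entry))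
        (≡.sym (∑-pick n (toℕ x) (λ i → in-letter i a r₀ y) (λ i → G i b (y + offset r₀)) (Finₚ.toℕ<n x) here-letter only-letter))
        where
        row = rowAt T a r₀
        sorted = proj₁ valid a r₀
        entry : entryOr0 n k (cellEntry n k (lookup T a) r₀ (suc y)) ≡ suc (toℕ x)
        entry rewrite e = refl
        here-letter : in-letter (toℕ x) a r₀ y ≡ true
        here-letter = ∧-intro (<ᵇ-true (s≤s lo≤)) (<ᵇ-true y<hi)
          where
          lo≤ : cnt (toℕ x) row ≤ y
          lo≤ with cnt (toℕ x) row ℕₚ.≤? y
          ... | yes le = le
          ... | no nle with atM-< (toℕ x) row sorted y (ℕₚ.≰⇒> nle)
          ... | x' , e' , x'< with ≡.trans (≡.sym e) e'
          ... | refl = ⊥-elim (ℕₚ.<-irrefl refl x'<)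
          y<hi : y < cnt (suc (toℕ x)) row
          y<hi with y ℕₚ.<? cnt (suc (toℕ x)) row
          ... | yes lt = lt
          ... | no nlt = ⊥-elim (ℕₚ.<-irrefl refl (atM-≥ (suc (toℕ x)) row sorted y (ℕₚ.≮⇒≥ nlt) e))
        only-letter : ∀ i → i < n → in-letter i a r₀ y ≡ true → i ≡ toℕ x
        only-letter i _ b≡ = ℕₚ.≤-antisym (atM-≥ i row sorted y (ℕₚ.≤-pred (<ᵇ-< _ _ (proj₁ both))) e) (upper (atM-< (suc i) row sorted y (<ᵇ-< y _ (proj₂ both))))
          where
          both = ∧-true {cnt i row <ᵇ suc y} b≡
          upper : (∃ λ x' → atM row y ≡ just x' × toℕ x' < suc i) → toℕ x ≤ i
          upper (x' , e' , lt) with ≡.trans (≡.sym e) e'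
          ... | refl = ℕₚ.≤-pred lt
      pair : ∀ a b → _ ≡ ∑ (upTo n) (λ i → S i a b)
      pair a b = begin
        _ ≡⟨ ℕΣ.⅀-cong (allFin n) (λ r₀ → ≡.trans (ℕΣ.⅀-map suc (upTo (lookup (lookup ν a) r₀)) _)
               (≡.trans (cong (λ l → ∑ (upTo l) (triples a b r₀)) (≡.sym (lengths a r₀))) (∑-upTo-cong (length (rowAt T a r₀)) (letter a b r₀)))) ⟩
        ∑ (allFin n) (λ r₀ → ∑ (upTo (length (rowAt T a r₀))) (λ y → ∑ (upTo n) (λ i → 𝟙 (in-letter i a r₀ y) * G i b (y + offset r₀))))
          ≡⟨ ℕΣ.⅀-cong (allFin n) (λ r₀ → ℕΣ.⅀-swap (upTo (length (rowAt T a r₀))) (upTo n) (λ y i → 𝟙 (in-letter i a r₀ y) * G i b (y + offset r₀))) ⟩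
        ∑ (allFin n) (λ r₀ → ∑ (upTo n) (λ i → ∑ (upTo (length (rowAt T a r₀))) (λ y → 𝟙 (in-letter i a r₀ y) * G i b (y + offset r₀))))
          ≡⟨ ℕΣ.⅀-swap (allFin n) (upTo n) (λ r₀ i → ∑ (upTo (length (rowAt T a r₀))) (λ y → 𝟙 (in-letter i a r₀ y) * G i b (y + offset r₀))) ⟩
        ∑ (upTo n) (λ i → ∑ (allFin n) (λ r₀ → ∑ (upTo (length (rowAt T a r₀))) (λ y → 𝟙 (in-letter i a r₀ y) * G i b (y + offset r₀))))
          ≡⟨ ℕΣ.⅀-cong (upTo n) (λ i → ≡.sym (S-rows i a b)) ⟩
        _ ∎

-- Polynomials truncated in x-degree.

module ℤΣ = FiniteSum (CommutativeRing.commutativeSemiring ℤₚ.+-*-commutativeRing)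

-- Polynomials are compared up to monomials of x-degree > D, so that HasDegree D d, the ideal of x-degree at least d,
-- vanishes for d > D and the truncated geometric series are inverses.
module Polynomials (n : ℕ) where

  Term : Set
  Term = ℤ × Mon n

  Poly : Set
  Poly = List Term

  deg : Mon n → ℕ
  deg (α , _ , _) = Vec.sum α

  mon-≟ : (p m : Mon n) → Dec (p ≡ m)
  mon-≟ = ×ₚ.≡-dec (Vecₚ.≡-dec ℕₚ._≟_) (×ₚ.≡-dec (Vecₚ.≡-dec ℕₚ._≟_) ℤ._≟_)

  δᵐ : Mon n → Mon n → ℤ
  δᵐ p m = if does (mon-≟ p m) then ℤ.1ℤ else ℤ.0ℤ

  term : Mon n → Term → ℤ
  term m t = proj₁ t ℤ.* δᵐ (proj₂ t) m

  co : Poly → Mon n → ℤ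
  co P m = ℤΣ.⅀ P (term m)

  one-mon : Mon n
  one-mon = Vec.replicate n 0 , Vec.replicate n 0 , ℤ.+ 0

  times : Term → Term → Term
  times (a , p) (b , p') = a ℤ.* b , monMul p p'

  mul : Poly → Poly → Poly
  mul P Q = concatMap (λ t → map (times t) Q) P

  neg : Poly → Poly
  neg = map (λ t → ℤ.- proj₁ t , proj₂ t)

  _≈[_]_ : Poly → ℕ → Poly → Set
  P ≈[ D ] Q = ∀ m → deg m ≤ D → co P m ≡ co Q m

  private
    zip-comm : ∀ {l} (u v : Vec ℕ l) → Vec.zipWith _+_ u v ≡ Vec.zipWith _+_ v u
    zip-comm = Vecₚ.zipWith-comm ℕₚ.+-comm

    zip-assoc : ∀ {l} (u v w : Vec ℕ l) → Vec.zipWith _+_ (Vec.zipWith _+_ u v) w ≡ Vec.zipWith _+_ u (Vec.zipWith _+_ v w)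
    zip-assoc = Vecₚ.zipWith-assoc ℕₚ.+-assoc

    zip-identity : ∀ {l} (u : Vec ℕ l) → Vec.zipWith _+_ (Vec.replicate l 0) u ≡ u
    zip-identity = Vecₚ.zipWith-identityˡ ℕₚ.+-identityˡ

  monMul-comm : ∀ (p p' : Mon n) → monMul p p' ≡ monMul p' p
  monMul-comm (α , β , e) (α' , β' , e') = cong₂ _,_ (zip-comm α α') (cong₂ _,_ (zip-comm β β') (ℤₚ.+-comm e e'))

  monMul-assoc : ∀ (p p' p″ : Mon n) → monMul (monMul p p') p″ ≡ monMul p (monMul p' p″)
  monMul-assoc (α , β , e) (α' , β' , e') (α″ , β″ , e″) = cong₂ _,_ (zip-assoc α α' α″) (cong₂ _,_ (zip-assoc β β' β″) (ℤₚ.+-assoc e e' e″))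

  monMul-identity : ∀ (p : Mon n) → monMul one-mon p ≡ p
  monMul-identity (α , β , e) = cong₂ _,_ (zip-identity α) (cong₂ _,_ (zip-identity β) (ℤₚ.+-identityˡ e))

  sum-zipWith : ∀ {l} (u v : Vec ℕ l) → Vec.sum (Vec.zipWith _+_ u v) ≡ Vec.sum u + Vec.sum v
  sum-zipWith []      []      = refl
  sum-zipWith (a ∷ u) (b ∷ v) rewrite sum-zipWith u v = interchange a b (Vec.sum u) (Vec.sum v)
    where
    open import Algebra.Properties.CommutativeSemigroup ℕₚ.+-commutativeSemigroup using (interchange)

  deg-monMul : ∀ p p' → deg (monMul p p') ≡ deg p + deg p'
  deg-monMul (α , _ , _) (α' , _ , _) = sum-zipWith α α'

  private
    zip-cancel : ∀ {l} (u v w : Vec ℕ l) → Vec.zipWith _+_ u v ≡ Vec.zipWith _+_ u w → v ≡ w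
    zip-cancel []      []      []      e = refl
    zip-cancel (a ∷ u) (b ∷ v) (c ∷ w) e = cong₂ _∷_ (ℕₚ.+-cancelˡ-≡ a b c (Vecₚ.∷-injectiveˡ e)) (zip-cancel u v w (Vecₚ.∷-injectiveʳ e))

    zip-divide : ∀ {l} (u w : Vec ℕ l) → Dec (∃ λ v → Vec.zipWith _+_ u v ≡ w)
    zip-divide []      []      = yes ([] , refl)
    zip-divide (a ∷ u) (c ∷ w) with a ℕₚ.≤? c | zip-divide u w
    ... | yes le | yes (v , e) = yes ((c ∸ a) ∷ v , cong₂ _∷_ (ℕₚ.m+[n∸m]≡n le) e)
    ... | no nle | _           = no (λ { (b ∷ v , e) → nle (subst (a ≤_) (Vecₚ.∷-injectiveˡ e) (ℕₚ.m≤m+n a b)) })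
    ... | yes _  | no ¬d       = no (λ { (b ∷ v , e) → ¬d (v , Vecₚ.∷-injectiveʳ e) })

  monMul-cancel : ∀ (p r s : Mon n) → monMul p r ≡ monMul p s → r ≡ s
  monMul-cancel (α , β , e) (α' , β' , e') (α″ , β″ , e″) eq with ×ₚ.,-injective eq
  ... | eα , eq' with ×ₚ.,-injective eq'
  ... | eβ , ee = cong₂ _,_ (zip-cancel α α' α″ eα) (cong₂ _,_ (zip-cancel β β' β″ eβ) (ℤ-cancel e e' e″ ee))
    where open GroupProps (CommutativeRing.+-group ℤₚ.+-*-commutativeRing) using () renaming (∙-cancelˡ to ℤ-cancel)

  divide : ∀ (p m : Mon n) → Dec (∃ λ r → monMul p r ≡ m)
  divide (α , β , e) (α' , β' , e') with zip-divide α α' | zip-divide β β'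
  ... | yes (u , eu) | yes (v , ev) = yes ((u , v , ℤ.- e ℤ.+ e') , cong₂ _,_ eu (cong₂ _,_ ev (solve 2 (λ e e' → e :+ (:- e :+ e') := e') refl e e')))
    where open ℤ-Solver
  ... | no ¬u | _     = no (λ { ((u , v , _) , eq) → ¬u (u , proj₁ (×ₚ.,-injective eq)) })
  ... | yes _ | no ¬v = no (λ { ((u , v , _) , eq) → ¬v (v , proj₁ (×ₚ.,-injective (proj₂ (×ₚ.,-injective eq)))) })

  δᵐ-true : ∀ p m → p ≡ m → δᵐ p m ≡ ℤ.1ℤ
  δᵐ-true p m e with mon-≟ p m
  ... | yes _ = refl
  ... | no ¬e = ⊥-elim (¬e e)

  δᵐ-false : ∀ p m → p ≢ m → δᵐ p m ≡ ℤ.0ℤ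
  δᵐ-false p m ne with mon-≟ p m
  ... | yes e = ⊥-elim (ne e)
  ... | no _  = refl

  δᵐ-iff : ∀ p m p' m' → (p ≡ m → p' ≡ m') → (p' ≡ m' → p ≡ m) → δᵐ p m ≡ δᵐ p' m'
  δᵐ-iff p m p' m' f g with mon-≟ p m
  ... | yes e = ≡.sym (δᵐ-true p' m' (f e))
  ... | no ¬e = ≡.sym (δᵐ-false p' m' (¬e ∘ g))

  ⅀-mul : ∀ P Q (f : Term → ℤ) → ℤΣ.⅀ (mul P Q) f ≡ ℤΣ.⅀ P (λ s → ℤΣ.⅀ Q (λ t → f (times s t)))
  ⅀-mul P Q f = ≡.trans (ℤΣ.⅀-concatMap _ P f) (ℤΣ.⅀-cong P (λ s → ℤΣ.⅀-map (times s) Q f))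

  co-term-mul : ∀ s Q m → ℤΣ.⅀ Q (λ t → proj₁ (times s t) ℤ.* δᵐ (proj₂ (times s t)) m)
    ≡ proj₁ s ℤ.* ℤΣ.⅀ Q (λ t → proj₁ t ℤ.* δᵐ (monMul (proj₂ s) (proj₂ t)) m)
  co-term-mul (a , p) Q m = ≡.trans (ℤΣ.⅀-cong Q (λ t → ℤₚ.*-assoc a (proj₁ t) _)) (≡.sym (ℤΣ.⅀-*ˡ Q a _))

  -- Multiplication by a monomial p is injective on monomials, so the coefficient of m in p Q is
  -- that of m / p in Q, or zero if p does not divide m. As m / p has no larger degree than m,
  -- agreement up to degree D is preserved.
  mul-congˡ : ∀ D P {Q Q'} → Q ≈[ D ] Q' → mul P Q ≈[ D ] mul P Q'
  mul-congˡ D P {Q} {Q'} e m m≤D = ≡.trans (⅀-mul P Q (term m)) (≡.trans (ℤΣ.⅀-cong P each) (≡.sym (⅀-mul P Q' (term m))))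
    where
    quotient : ∀ p Q → (∃ λ r → monMul p r ≡ m × ℤΣ.⅀ Q (λ t → proj₁ t ℤ.* δᵐ (monMul p (proj₂ t)) m) ≡ co Q r)
      ⊎ (¬ (∃ λ r → monMul p r ≡ m))
    quotient p Q with divide p m
    ... | no ¬d         = inj₂ ¬d
    ... | yes (r , eq) = inj₁ (r , eq , ℤΣ.⅀-cong Q (λ t → cong (proj₁ t ℤ.*_)
          (δᵐ-iff (monMul p (proj₂ t)) m (proj₂ t) r (λ e → monMul-cancel p (proj₂ t) r (≡.trans e (≡.sym eq))) (λ e → ≡.trans (cong (monMul p) e) eq))))
    none : ∀ p Q → ¬ (∃ λ r → monMul p r ≡ m) → ℤΣ.⅀ Q (λ t → proj₁ t ℤ.* δᵐ (monMul p (proj₂ t)) m) ≡ ℤ.0ℤ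
    none p Q ¬d = ℤΣ.⅀-zero∈ Q (λ t _ → ≡.trans (cong (proj₁ t ℤ.*_) (δᵐ-false (monMul p (proj₂ t)) m (λ e → ¬d (proj₂ t , e)))) (ℤₚ.*-zeroʳ (proj₁ t)))
    inner : ∀ p → ℤΣ.⅀ Q (λ t → proj₁ t ℤ.* δᵐ (monMul p (proj₂ t)) m) ≡ ℤΣ.⅀ Q' (λ t → proj₁ t ℤ.* δᵐ (monMul p (proj₂ t)) m)
    inner p with quotient p Q | quotient p Q'
    ... | inj₂ ¬d | _ = ≡.trans (none p Q ¬d) (≡.sym (none p Q' ¬d))
    ... | _ | inj₂ ¬d = ≡.trans (none p Q ¬d) (≡.sym (none p Q' ¬d))
    ... | inj₁ (r , eq , c) | inj₁ (r' , eq' , c') with monMul-cancel p r r' (≡.trans eq (≡.sym eq'))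
    ... | refl = ≡.trans c (≡.trans (e r (ℕₚ.≤-trans (subst (deg r ≤_) (≡.trans (≡.sym (deg-monMul p r)) (cong deg eq)) (ℕₚ.m≤n+m (deg r) (deg p))) m≤D)) (≡.sym c'))
    each : ∀ s → ℤΣ.⅀ Q (λ t → proj₁ (times s t) ℤ.* δᵐ (proj₂ (times s t)) m) ≡ ℤΣ.⅀ Q' (λ t → proj₁ (times s t) ℤ.* δᵐ (proj₂ (times s t)) m)
    each s = ≡.trans (co-term-mul s Q m) (≡.trans (cong (proj₁ s ℤ.*_) (inner (proj₂ s))) (≡.sym (co-term-mul s Q' m)))

  mul-comm : ∀ P Q m → co (mul P Q) m ≡ co (mul Q P) m
  mul-comm P Q m = ≡.trans (⅀-mul P Q (term m)) (≡.trans (ℤΣ.⅀-swap P Q (λ s t → term m (times s t))) (≡.trans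
    (ℤΣ.⅀-cong Q (λ t → ℤΣ.⅀-cong P (λ s → cong₂ (λ a p → a ℤ.* δᵐ p m) (ℤₚ.*-comm (proj₁ s) (proj₁ t)) (monMul-comm (proj₂ s) (proj₂ t)))))
    (≡.sym (⅀-mul Q P (term m)))))

  mul-cong : ∀ D {P P' Q Q'} → P ≈[ D ] P' → Q ≈[ D ] Q' → mul P Q ≈[ D ] mul P' Q'
  mul-cong D {P} {P'} {Q} {Q'} eP eQ m m≤D = ≡.trans (mul-congˡ D P eQ m m≤D) (≡.trans (mul-comm P Q' m)
    (≡.trans (mul-congˡ D Q' eP m m≤D) (mul-comm Q' P' m)))

  mul-assoc : ∀ P Q S m → co (mul (mul P Q) S) m ≡ co (mul P (mul Q S)) m
  mul-assoc P Q S m = ≡.trans (⅀-mul (mul P Q) S (term m)) (≡.trans (⅀-mul P Q (λ s → ℤΣ.⅀ S (λ u → term m (times s u)))) (≡.trans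
    (ℤΣ.⅀-cong P (λ s → ≡.trans (ℤΣ.⅀-cong Q (λ t → ℤΣ.⅀-cong S (λ u → cong₂ (λ a p → a ℤ.* δᵐ p m)
      (ℤₚ.*-assoc (proj₁ s) (proj₁ t) (proj₁ u)) (monMul-assoc (proj₂ s) (proj₂ t) (proj₂ u)))))
      (≡.sym (⅀-mul Q S (λ w → proj₁ (times s w) ℤ.* δᵐ (proj₂ (times s w)) m)))))
    (≡.sym (⅀-mul P (mul Q S) (term m)))))

  mul-identityˡ : ∀ P m → co (mul ((ℤ.1ℤ , one-mon) ∷ []) P) m ≡ co P m
  mul-identityˡ P m = ≡.trans (⅀-mul ((ℤ.1ℤ , one-mon) ∷ []) P (λ t → proj₁ t ℤ.* δᵐ (proj₂ t) m)) (≡.trans (ℤₚ.+-identityʳ _) (ℤΣ.⅀-cong P (λ t →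
    cong₂ (λ a p → a ℤ.* δᵐ p m) (ℤₚ.*-identityˡ (proj₁ t)) (monMul-identity (proj₂ t)))))

  mul-distribˡ : ∀ P Q S m → co (mul P (Q ++ S)) m ≡ co (mul P Q ++ mul P S) m
  mul-distribˡ P Q S m = ≡.trans (⅀-mul P (Q ++ S) (term m)) (≡.trans (ℤΣ.⅀-cong P (λ s → ℤΣ.⅀-++ Q S _))
    (≡.trans (ℤΣ.⅀-+ P _ _) (≡.trans (≡.sym (cong₂ ℤ._+_ (⅀-mul P Q (term m)) (⅀-mul P S (term m)))) (≡.sym (ℤΣ.⅀-++ (mul P Q) (mul P S) (term m))))))

  co-++ : ∀ P Q m → co (P ++ Q) m ≡ co P m ℤ.+ co Q m
  co-++ P Q m = ℤΣ.⅀-++ P Q _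

  co-neg : ∀ P m → co (neg P) m ≡ ℤ.- co P m
  co-neg []            m = refl
  co-neg ((a , p) ∷ P) m = ≡.trans (cong₂ ℤ._+_ (≡.sym (ℤₚ.neg-distribˡ-* a _)) (co-neg P m)) (≡.sym (ℤₚ.neg-distrib-+ (a ℤ.* δᵐ p m) (co P m)))

  polyRing : ℕ → CommutativeRing 0ℓ 0ℓ
  polyRing D = record
    { Carrier = Poly ; _≈_ = _≈[ D ]_ ; _+_ = _++_ ; _*_ = mul ; -_ = neg ; 0# = [] ; 1# = (ℤ.1ℤ , one-mon) ∷ []
    ; isCommutativeRing = record
      { isRing = record
        { +-isAbelianGroup = record
          { isGroup = record
            { isMonoid = record
              { isSemigroup = record
                { isMagma = record
                  { isEquivalence = record
                    { refl = λ _ _ → refl ; sym = λ e m le → ≡.sym (e m le) ; trans = λ e e' m le → ≡.trans (e m le) (e' m le) }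
                  ; ∙-cong = λ {P} {P'} {Q} {Q'} e e' m le → ≡.trans (co-++ P Q m) (≡.trans (cong₂ ℤ._+_ (e m le) (e' m le)) (≡.sym (co-++ P' Q' m))) }
                ; assoc = λ P Q S m _ → cong (λ l → co l m) (Listₚ.++-assoc P Q S) }
              ; identity = (λ P m _ → refl) , (λ P m _ → cong (λ l → co l m) (Listₚ.++-identityʳ P)) }
            ; inverse = (λ P m _ → ≡.trans (co-++ (neg P) P m) (≡.trans (cong (ℤ._+ co P m) (co-neg P m)) (ℤₚ.+-inverseˡ (co P m))))
                      , (λ P m _ → ≡.trans (co-++ P (neg P) m) (≡.trans (cong (λ z → co P m ℤ.+ z) (co-neg P m)) (ℤₚ.+-inverseʳ (co P m))))
            ; ⁻¹-cong = λ {P} {Q} e m le → ≡.trans (co-neg P m) (≡.trans (cong ℤ.-_ (e m le)) (≡.sym (co-neg Q m))) }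
          ; comm = λ P Q m _ → ≡.trans (co-++ P Q m) (≡.trans (ℤₚ.+-comm (co P m) (co Q m)) (≡.sym (co-++ Q P m))) }
        ; *-cong = λ {P} {P'} {Q} {Q'} → mul-cong D {P} {P'} {Q} {Q'}
        ; *-assoc = λ P Q S m _ → mul-assoc P Q S m
        ; *-identity = (λ P m _ → mul-identityˡ P m) , (λ P m _ → ≡.trans (mul-comm P _ m) (mul-identityˡ P m))
        ; distrib = (λ P Q S m _ → mul-distribˡ P Q S m)
                  , (λ P Q S m _ → ≡.trans (mul-comm (Q ++ S) P m) (≡.trans (mul-distribˡ P Q S m)
                      (≡.trans (co-++ (mul P Q) (mul P S) m) (≡.trans (cong₂ ℤ._+_ (mul-comm P Q m) (mul-comm P S m)) (≡.sym (co-++ (mul Q P) (mul S P) m)))))) }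
      ; *-comm = λ P Q m _ → mul-comm P Q m } }

  -- The bound deg m ≤ D makes the condition compatible with truncated equality; for d > D it says
  -- that P is zero in the truncated ring.
  HasDegree : ℕ → ℕ → Poly → Set
  HasDegree D d P = ∀ m → deg m < d → deg m ≤ D → co P m ≡ ℤ.0ℤ

  private
    high : ℕ → Poly → Poly
    high d []      = []
    high d (t ∷ P) with d ℕₚ.≤? deg (proj₂ t)
    ... | yes _ = t ∷ high d P
    ... | no _  = high d P

    high-all : ∀ d P → All (λ t → d ≤ deg (proj₂ t)) (high d P)
    high-all d []      = []
    high-all d (t ∷ P) with d ℕₚ.≤? deg (proj₂ t)
    ... | yes le = le ∷ high-all d P
    ... | no _   = high-all d P

    high-co : ∀ d P m → d ≤ deg m → co (high d P) m ≡ co P m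
    high-co d []      m le = refl
    high-co d (t ∷ P) m le with d ℕₚ.≤? deg (proj₂ t)
    ... | yes _  = cong (λ z → proj₁ t ℤ.* δᵐ (proj₂ t) m ℤ.+ z) (high-co d P m le)
    ... | no nle = ≡.trans (high-co d P m le) (≡.trans (≡.sym (ℤₚ.+-identityˡ _)) (cong (ℤ._+ co P m)
      (≡.sym (≡.trans (cong (proj₁ t ℤ.*_) (δᵐ-false (proj₂ t) m (λ e → nle (subst (λ p → d ≤ deg p) (≡.sym e) le)))) (ℤₚ.*-zeroʳ (proj₁ t))))))

    low-co : ∀ d P → All (λ t → d ≤ deg (proj₂ t)) P → ∀ m → deg m < d → co P m ≡ ℤ.0ℤ
    low-co d []      _          m lt = refl
    low-co d (t ∷ P) (le ∷ les) m lt = ≡.trans (cong₂ ℤ._+_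
      (≡.trans (cong (proj₁ t ℤ.*_) (δᵐ-false (proj₂ t) m (λ e → ℕₚ.<-irrefl (cong deg (≡.sym e)) (ℕₚ.<-≤-trans lt le)))) (ℤₚ.*-zeroʳ (proj₁ t)))
      (low-co d P les m lt)) refl

    high-≈ : ∀ D d P → HasDegree D d P → P ≈[ D ] high d P
    high-≈ D d P h m m≤D with d ℕₚ.≤? deg m
    ... | yes le = ≡.sym (high-co d P m le)
    ... | no nle = ≡.trans (h m (ℕₚ.≰⇒> nle) m≤D) (≡.sym (low-co d (high d P) (high-all d P) m (ℕₚ.≰⇒> nle)))

  -- Low monomials may still occur in the lists and merely cancel. The factors are therefore
  -- replaced by their parts of high degree, whose products are of high degree monomial by monomial.
  HasDegree-* : ∀ {D d e P Q} → HasDegree D d P → HasDegree D e Q → HasDegree D (d + e) (mul P Q)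
  HasDegree-* {D} {d} {e} {P} {Q} hP hQ m lt m≤D = ≡.trans (mul-cong D {P} {high d P} {Q} {high e Q} (high-≈ D d P hP) (high-≈ D e Q hQ) m m≤D)
    (low-co (d + e) (mul (high d P) (high e Q)) (Allₚ.concat⁺ (Allₚ.map⁺ (All.map (λ {s} le → Allₚ.map⁺ (All.map (λ {t} le' →
      subst (d + e ≤_) (≡.sym (deg-monMul (proj₂ s) (proj₂ t))) (ℕₚ.+-mono-≤ le le')) (high-all e Q))) (high-all d P)))) m lt)

  filtration : ∀ D → Filtration (polyRing D) D
  filtration D = record
    { F      = HasDegree D
    ; F-0    = λ m ()
    ; F-zero = λ m _ _ → refl
    ; F-resp = λ e h m lt le → ≡.trans (≡.sym (e m le)) (h m lt le)
    ; F-+    = λ {d} {P} {Q} h h' m lt le → ≡.trans (co-++ P Q m) (cong₂ ℤ._+_ (h m lt le) (h' m lt le))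
    ; F-*    = λ {d} {e} {P} {Q} → HasDegree-* {D} {d} {e} {P} {Q}
    ; F-mono = λ d≤e h m lt le → h m (ℕₚ.<-≤-trans lt d≤e) le
    ; F-top  = λ h m le → h m (s≤s le) le
    }

  monomial : Mon n → Poly
  monomial p = (ℤ.1ℤ , p) ∷ []

  monomial-* : ∀ p p' m → co (mul (monomial p) (monomial p')) m ≡ co (monomial (monMul p p')) m
  monomial-* p p' m = refl

  monomial-degree : ∀ D d p → d ≤ deg p → HasDegree D d (monomial p)
  monomial-degree D d p le m lt _ = low-co d (monomial p) (le ∷ []) m lt

-- Products of truncated geometric series.

module Products {c ℓ : Level} (R : CommutativeRing c ℓ) where
  open CommutativeRing R hiding (zero) renaming (_+_ to _⊕_; _*_ to _⊗_; -_ to ⊝_; refl to ≈-refl; sym to ≈-sym; trans to ≈-trans)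
  open IntegerRingSolver R
  open SetoidReasoning setoid

  ∏ : ℕ → (ℕ → Carrier) → Carrier
  ∏ zero    f = 1#
  ∏ (suc N) f = ∏ N f ⊗ f N

  ∏-* : ∀ N f g → ∏ N f ⊗ ∏ N g ≈ ∏ N (λ i → f i ⊗ g i)
  ∏-* zero    f g = *-identityˡ _
  ∏-* (suc N) f g = ≈-trans (solve 4 (λ a b c d → (a :* b) :* (c :* d) := (a :* c) :* (b :* d)) ≈-refl _ _ _ _) (*-congʳ (∏-* N f g))

  ∏-1 : ∀ N {f} → (∀ i → i < N → f i ≈ 1#) → ∏ N f ≈ 1#
  ∏-1 zero    h = ≈-refl
  ∏-1 (suc N) h = ≈-trans (*-cong (∏-1 N (λ i i< → h i (ℕₚ.m<n⇒m<1+n i<))) (h N ℕₚ.≤-refl)) (*-identityˡ _)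

  ∏-swap : ∀ M N (f : ℕ → ℕ → Carrier) → ∏ M (λ i → ∏ N (f i)) ≈ ∏ N (λ j → ∏ M (λ i → f i j))
  ∏-swap zero    N f = ≈-sym (∏-1 N (λ _ _ → ≈-refl))
  ∏-swap (suc M) N f = ≈-trans (*-congʳ (∏-swap M N f)) (∏-* N _ _)

  ∏-inverse : ∀ N f g → (∀ i → i < N → f i ⊗ g i ≈ 1#) → ∏ N f ⊗ ∏ N g ≈ 1#
  ∏-inverse N f g h = ≈-trans (∏-* N f g) (∏-1 N h)

  ∏-head : ∀ N f → ∏ (suc N) f ≈ f 0 ⊗ ∏ N (f ∘ suc)
  ∏-head zero    f = *-comm _ _
  ∏-head (suc N) f = ≈-trans (*-congʳ (∏-head N f)) (*-assoc _ _ _)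

  product : List Carrier → Carrier
  product = foldr _⊗_ 1#

  product-++ : ∀ xs ys → product (xs ++ ys) ≈ product xs ⊗ product ys
  product-++ []       ys = ≈-sym (*-identityˡ _)
  product-++ (x ∷ xs) ys = ≈-trans (*-congˡ (product-++ xs ys)) (≈-sym (*-assoc _ _ _))

  product-allFin : ∀ N (f : ℕ → Carrier) → product (map (f ∘ toℕ) (allFin N)) ≈ ∏ N f
  product-allFin zero    f = ≈-refl
  product-allFin (suc N) f = ≈-trans (*-congˡ (≈-trans (reflexive (cong product shift)) (product-allFin N (f ∘ suc)))) (≈-sym (∏-head N f))
    where
    shift : map (f ∘ toℕ) (tabulate {n = N} suc) ≡ map (f ∘ suc ∘ toℕ) (allFin N)
    shift = ≡.trans (Listₚ.map-tabulate suc (f ∘ toℕ)) (≡.sym (Listₚ.map-tabulate id (f ∘ suc ∘ toℕ)))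

-- The substitution t = q² on monomials.
double : ∀ {n} → Mon n → Mon n
double (α , β , e) = α , β , e ℤ.+ e

module Assembly {c ℓ : Level} (R : CommutativeRing c ℓ) (n' k D : ℕ) (filtration : Filtration R D)
  (mono : Mon (suc n') → CommutativeRing.Carrier R)
  (mono-* : ∀ p p' → CommutativeRing._≈_ R (CommutativeRing._*_ R (mono p) (mono p')) (mono (monMul p p')))
  (mono-1 : CommutativeRing._≈_ R (mono (Polynomials.one-mon (suc n'))) (CommutativeRing.1# R))
  (mono-F : ∀ p → Filtration.F filtration (Polynomials.deg (suc n') p) (mono p)) where
  open CommutativeRing R hiding (zero) renaming (_+_ to _⊕_; _*_ to _⊗_; -_ to ⊝_; refl to ≈-refl; sym to ≈-sym; trans to ≈-trans)
  open FiniteSum commutativeSemiring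
  open IntegerRingSolver R
  open SetoidReasoning setoid
  open Exp semiring renaming (_^_ to _↑_)
  open Filtration filtration
  open Products R
  open Polynomials (suc n') using (deg; one-mon; monMul-comm; monMul-assoc; monMul-identity; deg-monMul)

  private
    n : ℕ
    n = suc n'
    𝟎 : Vec ℕ n
    𝟎 = Vec.replicate n 0

    _⊞_ : Vec ℕ n → Vec ℕ n → Vec ℕ n
    _⊞_ = Vec.zipWith _+_

    ⊞-identity : ∀ v → 𝟎 ⊞ v ≡ v
    ⊞-identity = Vecₚ.zipWith-identityˡ ℕₚ.+-identityˡ

    ⊞-identityʳ : ∀ v → v ⊞ 𝟎 ≡ v
    ⊞-identityʳ = Vecₚ.zipWith-identityʳ ℕₚ.+-identityʳ

  qPower : ℤ → Carrier
  qPower e = mono (𝟎 , 𝟎 , e)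

  q : Carrier
  q = qPower (ℤ.+ 1)

  qPower-+ : ∀ e e' → qPower e ⊗ qPower e' ≈ qPower (e ℤ.+ e')
  qPower-+ e e' = ≈-trans (mono-* _ _) (reflexive (cong₂ (λ u v → mono (u , v , e ℤ.+ e')) (⊞-identity 𝟎) (⊞-identity 𝟎)))

  q-↑ : ∀ m → q ↑ m ≈ qPower (ℤ.+ m)
  q-↑ zero    = ≈-sym mono-1
  q-↑ (suc m) = ≈-trans (*-congˡ (q-↑ m)) (qPower-+ _ _)

  qPower-cancel : ∀ e {a b} → qPower e ⊗ a ≈ qPower e ⊗ b → a ≈ b
  qPower-cancel e {a} {b} eq = ≈-trans (≈-sym (undo a)) (≈-trans (*-congˡ eq) (undo b))
    where
    undo : ∀ a → qPower (ℤ.- e) ⊗ (qPower e ⊗ a) ≈ a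
    undo a = ≈-trans (≈-sym (*-assoc _ _ _)) (≈-trans (*-congʳ (≈-trans (qPower-+ _ _)
      (≈-trans (reflexive (cong qPower (ℤₚ.+-inverseˡ e))) mono-1))) (*-identityˡ _))

  unit : ℕ → ℕ → Vec ℕ n
  unit i p = Vec.tabulate (λ j → if i ≡ᵇ toℕ j then p else 0)

  X Y : ℕ → Carrier
  X i = mono (unit i 1 , 𝟎 , ℤ.0ℤ)
  Y i = mono (𝟎 , unit i 1 , ℤ.0ℤ)

  lookup-unit : ∀ i p j → lookup (unit i p) j ≡ (if i ≡ᵇ toℕ j then p else 0)
  lookup-unit i p j = Vecₚ.lookup∘tabulate (λ j → if i ≡ᵇ toℕ j then p else 0) j

  unit-sum : ∀ {m} i → i < m → Vec.sum (Vec.tabulate {n = m} (λ j → if i ≡ᵇ toℕ j then 1 else 0)) ≡ 1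
  unit-sum {suc m} zero    _        = cong suc (all-0 m)
    where
    all-0 : ∀ m → Vec.sum (Vec.tabulate {n = m} (λ _ → 0)) ≡ 0
    all-0 zero    = refl
    all-0 (suc m) = all-0 m
  unit-sum {suc m} (suc i) (s≤s lt) = unit-sum i lt

  unit-0 : ∀ i → unit i 0 ≡ 𝟎
  unit-0 i = lookup-ext _ _ λ j → ≡.trans (lookup-unit i 0 j) (≡.trans (same (i ≡ᵇ toℕ j)) (≡.sym (Vecₚ.lookup-replicate j 0)))
    where
    same : ∀ b → (if b then 0 else 0) ≡ 0
    same true  = refl
    same false = refl

  unit-suc : ∀ i p → unit i 1 ⊞ unit i p ≡ unit i (suc p)
  unit-suc i p = lookup-ext _ _ λ j → ≡.trans (Vecₚ.lookup-zipWith _+_ j (unit i 1) (unit i p))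
    (≡.trans (cong₂ _+_ (lookup-unit i 1 j) (lookup-unit i p j)) (≡.trans (same (i ≡ᵇ toℕ j)) (≡.sym (lookup-unit i (suc p) j))))
    where
    same : ∀ b → (if b then 1 else 0) + (if b then p else 0) ≡ (if b then suc p else 0)
    same true  = refl
    same false = refl

  X-F : ∀ i → i < n → F 1 (X i)
  X-F i i<n = subst (λ d → F d (X i)) (unit-sum i i<n) (mono-F (unit i 1 , 𝟎 , ℤ.0ℤ))

  ⅀-upTo-suc : ∀ N (f : ℕ → Carrier) → ⅀ (upTo (suc N)) f ≈ ⅀ (upTo N) f ⊕ f N
  ⅀-upTo-suc N f = ≈-trans (reflexive (cong (λ l → ⅀ l f) (≡.sym (Listₚ.upTo-∷ʳ N))))
    (≈-trans (⅀-++ (upTo N) (N ∷ []) f) (+-congˡ (+-identityʳ (f N))))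

  geometric : ∀ w N → (⅀ (upTo N) (w ↑_) ⊗ (1# ⊕ (⊝ w))) ⊕ w ↑ N ≈ 1#
  geometric w zero    = ≈-trans (+-congʳ (zeroˡ _)) (+-identityˡ _)
  geometric w (suc N) = begin
    (⅀ (upTo (suc N)) (w ↑_) ⊗ (1# ⊕ (⊝ w))) ⊕ w ↑ suc N
      ≈⟨ +-congʳ (*-congʳ (⅀-upTo-suc N (w ↑_))) ⟩
    ((⅀ (upTo N) (w ↑_) ⊕ w ↑ N) ⊗ (1# ⊕ (⊝ w))) ⊕ (w ⊗ w ↑ N)
      ≈⟨ solve 3 (λ s p w → ((s :+ p) :* (con (ℤ.+ 1) :+ (:- w))) :+ (w :* p) := (s :* (con (ℤ.+ 1) :+ (:- w))) :+ p) ≈-refl _ (w ↑ N) w ⟩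
    (⅀ (upTo N) (w ↑_) ⊗ (1# ⊕ (⊝ w))) ⊕ w ↑ N
      ≈⟨ geometric w N ⟩
    1# ∎

  -- The error of the finite geometric sum is w^(D+1), which has degree above D.
  geometric-inverse : ∀ w → F 1 w → ⅀ (upTo (suc D)) (w ↑_) ⊗ (1# ⊕ (⊝ w)) ≈ 1#
  geometric-inverse w w∈ = ≈-trans (≈-sym (+-identityʳ _)) (≈-trans (+-congˡ (≈-sym (F-top (power (suc D))))) (geometric w (suc D)))
    where
    power : ∀ m → F m (w ↑ m)
    power zero    = F-0
    power (suc m) = F-* w∈ (power m)

  embed : List (Mon n) → Carrier
  embed L = ⅀ L (mono ∘ double)

  private
    monMul-double : ∀ (p p' : Mon n) → monMul (double p) (double p') ≡ double (monMul p p')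
    monMul-double (α , β , e) (α' , β' , e') = cong₂ _,_ refl (cong₂ _,_ refl
      (solve' 2 (λ e e' → (e :+' e) :+' (e' :+' e') :=' (e :+' e') :+' (e :+' e')) refl e e'))
      where open ℤ-Solver using () renaming (solve to solve'; _:+_ to _:+'_; _:=_ to _:='_)

  embed-polyMul : ∀ P Q → embed (polyMul P Q) ≈ embed P ⊗ embed Q
  embed-polyMul P Q = begin
    embed (polyMul P Q)
      ≈⟨ ≈-trans (⅀-concatMap _ P _) (⅀-cong P (λ p → ⅀-map (monMul p) Q _)) ⟩
    ⅀ P (λ p → ⅀ Q (λ p' → mono (double (monMul p p'))))
      ≈⟨ ⅀-cong P (λ p → ⅀-cong Q (λ p' → ≈-trans (reflexive (cong mono (≡.sym (monMul-double p p')))) (≈-sym (mono-* _ _)))) ⟩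
    ⅀ P (λ p → ⅀ Q (λ p' → mono (double p) ⊗ mono (double p')))
      ≈⟨ ⅀-cong P (λ p → ≈-sym (⅀-*ˡ Q _ _)) ⟩
    ⅀ P (λ p → mono (double p) ⊗ embed Q)
      ≈⟨ ≈-sym (⅀-*ʳ P _ _) ⟩
    embed P ⊗ embed Q ∎

  embed-product : ∀ Ps → embed (foldr polyMul one Ps) ≈ product (map embed Ps)
  embed-product []       = ≈-trans (+-identityʳ _) (≈-trans (reflexive (cong₂ (λ u v → mono (u , v , ℤ.0ℤ)) tab tab)) mono-1)
    where
    tab : Vec.tabulate (λ _ → 0) ≡ 𝟎
    tab = lookup-ext _ _ (λ j → ≡.trans (Vecₚ.lookup∘tabulate _ j) (≡.sym (Vecₚ.lookup-replicate j 0)))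
  embed-product (P ∷ Ps) = ≈-trans (embed-polyMul P _) (*-congˡ (embed-product Ps))

  ratio : ℕ → ℕ → ℕ → Carrier
  ratio i j m = (X i ⊗ Y j) ⊗ (q ↑ m ⊗ q ↑ m)

  private
    ratio-mono : ∀ i j m → ratio i j m ≈ mono (unit i 1 , unit j 1 , ℤ.+ (m + m))
    ratio-mono i j m = ≈-trans (*-cong (mono-* _ _) (≈-trans (≈-sym (^-homo-* q m m)) (q-↑ (m + m)))) (≈-trans (mono-* _ _)
      (reflexive (cong₂ (λ u v → mono (u , v , ℤ.+ (m + m))) (≡.trans (⊞-identityʳ _) (⊞-identityʳ _)) (≡.trans (⊞-identityʳ _) (⊞-identity _)))))

    ratio-↑ : ∀ i j m p → ratio i j m ↑ p ≈ mono (double (unit i p , unit j p , ℤ.+ (p * m)))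
    ratio-↑ i j m zero    = ≈-trans (≈-sym mono-1) (reflexive (cong₂ (λ u v → mono (u , v , ℤ.0ℤ)) (≡.sym (unit-0 i)) (≡.sym (unit-0 j))))
    ratio-↑ i j m (suc p) = ≈-trans (*-cong (ratio-mono i j m) (ratio-↑ i j m p)) (≈-trans (mono-* _ _)
      (reflexive (≡.trans (cong₂ (λ u v → mono (u , v , ℤ.+ (m + m) ℤ.+ (ℤ.+ (p * m) ℤ.+ ℤ.+ (p * m)))) (unit-suc i p) (unit-suc j p))
        (cong (λ e → mono (unit i (suc p) , unit j (suc p) , ℤ.+ e)) (interchange m m (p * m) (p * m))))))
      where open import Algebra.Properties.CommutativeSemigroup ℕₚ.+-commutativeSemigroup using (interchange)

  series : ℕ → ℕ → ℕ → Carrier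
  series i j m = ⅀ (upTo (suc D)) (ratio i j m ↑_)

  embed-geom : ∀ i j m → embed (geomUpTo n k D i j m) ≈ series (toℕ i) (toℕ j) (toℕ m)
  embed-geom i j m = ≈-trans (⅀-map (λ p → unitTimes n k p i , unitTimes n k p j , ℤ.+ (p * toℕ m)) (upTo (suc D)) (mono ∘ double)) (⅀-cong (upTo (suc D)) (λ p → ≈-sym (ratio-↑ (toℕ i) (toℕ j) (toℕ m) p)))

  product-concatMap : ∀ N (G : Fin N → List (List (Mon n))) (g : ℕ → Carrier) → (∀ i → product (map embed (G i)) ≈ g (toℕ i)) →
    product (map embed (concatMap G (allFin N))) ≈ ∏ N g
  product-concatMap N G g h = ≈-trans (go (allFin N)) (product-allFin N g)
    where
    go : ∀ is → product (map embed (concatMap G is)) ≈ product (map (g ∘ toℕ) is)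
    go []       = ≈-refl
    go (i ∷ is) = ≈-trans (reflexive (cong product (Listₚ.map-++ embed (G i) (concatMap G is))))
      (≈-trans (product-++ (map embed (G i)) _) (*-cong (h i) (go is)))

  embed-rhs : embed (rhsUpTo n k D) ≈ ∏ n (λ i → ∏ n (λ j → ∏ k (series i j)))
  embed-rhs = ≈-trans (embed-product (concatMap G (allFin n))) (product-concatMap n G (λ i → ∏ n (λ j → ∏ k (series i j))) (λ i →
    product-concatMap n (G' i) (λ j → ∏ k (series (toℕ i) j)) (λ j →
      ≈-trans (reflexive (cong product (≡.sym (Listₚ.map-∘ {g = embed} {f = geomUpTo n k D i j} (allFin k))))) (≈-trans (go i j (allFin k)) (product-allFin k (series (toℕ i) (toℕ j)))))))
    where
    G' : Fin n → Fin n → List (List (Mon n))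
    G' i j = map (λ m → geomUpTo n k D i j m) (allFin k)
    G : Fin n → List (List (Mon n))
    G i = concatMap (G' i) (allFin n)
    go : ∀ i j ms → product (map (λ m → embed (geomUpTo n k D i j m)) ms) ≈ product (map (series (toℕ i) (toℕ j) ∘ toℕ) ms)
    go i j []       = ≈-refl
    go i j (m ∷ ms) = *-cong (embed-geom i j m) (go i j ms)

  series-inverse : ∀ i j m → i < n → series i j m ⊗ (1# ⊕ (⊝ ratio i j m)) ≈ 1#
  series-inverse i j m i<n = geometric-inverse (ratio i j m) (F-* {d = 1} {e = 0} (F-* {d = 1} {e = 0} (X-F i i<n) F-0) F-0)

  rhs-inverse : embed (rhsUpTo n k D) ⊗ ∏ n (λ i → ∏ n (λ j → ∏ k (λ m → 1# ⊕ (⊝ ratio i j m)))) ≈ 1#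
  rhs-inverse = ≈-trans (*-congʳ embed-rhs) (∏-inverse n _ _ λ i i<n → ∏-inverse n _ _ λ j _ → ∏-inverse k _ _ λ m _ → series-inverse i j m i<n)

-- The statistic d as a difference of inversion numbers.

module DStat (k n D : ℕ) where
  open import Data.Nat.Combinatorics using (_C_; nC1≡n; nCk+nC[k+1]≡[n+1]C[k+1])
  open Tuples k n D

  private
    ∑-point : ∀ M a (h : ℕ → ℕ) → a < M → ∑ (upTo M) (λ x → 𝟙 (a ≡ᵇ x) * h x) ≡ h a
    ∑-point M a h a<M = ∑-pick M a (λ x → a ≡ᵇ x) h a<M (≡ᵇ-refl a) (λ x _ e → ≡.sym (ℕₚ.≡ᵇ⇒≡ a x (subst Bool.T (≡.sym e) tt)))

    occupied-∑ : ∀ {m} (a : Vec ℕ m) x → occupied a x ≡ ∑ (allFin m) (λ j → 𝟙 (lookup a j ≡ᵇ x))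
    occupied-∑ []       x = refl
    occupied-∑ {suc m} (a ∷ as) x = ≡.trans (cong (𝟙 (a ≡ᵇ x) +_) (occupied-∑ as x)) (≡.sym (ℕΣ.⅀-allFin-suc m (λ j → 𝟙 (lookup (a ∷ as) j ≡ᵇ x))))

    below-∑ : ∀ {m} (a : Vec ℕ m) x → below a x ≡ ∑ (allFin m) (λ j → 𝟙 (lookup a j <ᵇ x))
    below-∑ []       x = refl
    below-∑ {suc m} (a ∷ as) x = ≡.trans (cong (𝟙 (a <ᵇ x) +_) (below-∑ as x)) (≡.sym (ℕΣ.⅀-allFin-suc m (λ j → 𝟙 (lookup (a ∷ as) j <ᵇ x))))

  inversions-∑ : ∀ M (a b : Vec ℕ n) → (∀ j → lookup a j < M) →
    inversions M a b ≡ ∑ (allFin n) (λ i → ∑ (allFin n) (λ j → 𝟙 (lookup b i <ᵇ lookup a j)))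
  inversions-∑ M a b a< = begin
    ∑ (upTo M) (λ x → occupied a x * below b x)
      ≡⟨ ℕΣ.⅀-cong (upTo M) (λ x → ≡.trans (cong (_* below b x) (occupied-∑ a x)) (ℕΣ.⅀-*ʳ (allFin n) (below b x) (λ j → 𝟙 (lookup a j ≡ᵇ x)))) ⟩
    ∑ (upTo M) (λ x → ∑ (allFin n) (λ j → 𝟙 (lookup a j ≡ᵇ x) * below b x))
      ≡⟨ ℕΣ.⅀-swap (upTo M) (allFin n) (λ x j → 𝟙 (lookup a j ≡ᵇ x) * below b x) ⟩
    ∑ (allFin n) (λ j → ∑ (upTo M) (λ x → 𝟙 (lookup a j ≡ᵇ x) * below b x))
      ≡⟨ ℕΣ.⅀-cong (allFin n) (λ j → ≡.trans (∑-point M (lookup a j) (below b) (a< j)) (below-∑ b (lookup a j))) ⟩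
    ∑ (allFin n) (λ j → ∑ (allFin n) (λ i → 𝟙 (lookup b i <ᵇ lookup a j)))
      ≡⟨ ℕΣ.⅀-swap (allFin n) (allFin n) (λ j i → 𝟙 (lookup b i <ᵇ lookup a j)) ⟩
    _ ∎
    where open ≡.≡-Reasoning

  private
    -- λ_i - i and the position of row i differ by n
    position-ℤ : ∀ (p : Vec ℕ n) i → ((ℤ.+ lookup p i) ℤ.- (ℤ.+ ent n k i)) ℤ.+ ℤ.+ n ≡ ℤ.+ lookup (positions p) i
    position-ℤ p i rewrite lookup-positions p i = ≡.trans
      (cong (λ m → ((ℤ.+ lookup p i) ℤ.- (ℤ.+ suc (toℕ i))) ℤ.+ ℤ.+ m) (≡.sym (ℕₚ.m+[n∸m]≡n (Finₚ.toℕ<n i))))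
      (solve 3 (λ a s o → (a :- s) :+ (s :+ o) := a :+ o) refl (ℤ.+ lookup p i) (ℤ.+ suc (toℕ i)) (ℤ.+ (n ∸ suc (toℕ i))))
      where open ℤ-Solver

    does-< : ∀ u v a b m → u ℤ.+ m ≡ ℤ.+ a → v ℤ.+ m ≡ ℤ.+ b → does (u ℤ.<? v) ≡ (a <ᵇ b)
    does-< u v a b m e e' with u ℤ.<? v
    ... | yes lt = ≡.sym (<ᵇ-true (ℤₚ.drop‿+<+ (subst₂ ℤ._<_ e e' (ℤₚ.+-monoˡ-< m lt))))
    ... | no nlt = ≡.sym (<ᵇ-false (ℤₚ.drop‿+≤+ (subst₂ ℤ._≤_ e' e (ℤₚ.+-monoˡ-≤ m (ℤₚ.≮⇒≥ nlt)))))

    𝟙-∧ : ∀ a b → 𝟙 (a ∧ b) ≡ 𝟙 a * 𝟙 b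
    𝟙-∧ true  b = ≡.sym (ℕₚ.+-identityʳ _)
    𝟙-∧ false b = refl

  dstat-sum : ∀ ν → InBox ν → ∑ (allFin n) (λ i → ∑ (allFin n) λ j → ∑ (allFin k) λ a → ∑ (allFin k) λ b →
      𝟙 ((toℕ a <ᵇ toℕ b) ∧ does (((ℤ.+ lookup (lookup ν b) i) ℤ.- (ℤ.+ ent n k i)) ℤ.<? ((ℤ.+ lookup (lookup ν a) j) ℤ.- (ℤ.+ ent n k j))))) ≡ inv ν
  dstat-sum ν box = begin
    _ ≡⟨ ℕΣ.⅀-cong (allFin n) (λ i → ℕΣ.⅀-cong (allFin n) λ j → ℕΣ.⅀-cong (allFin k) λ a → ℕΣ.⅀-cong (allFin k) λ b →
           ≡.trans (𝟙-∧ (toℕ a <ᵇ toℕ b) _) (cong (λ c → 𝟙 (toℕ a <ᵇ toℕ b) * 𝟙 c) (does-< ((ℤ.+ lookup (lookup ν b) i) ℤ.- (ℤ.+ ent n k i)) ((ℤ.+ lookup (lookup ν a) j) ℤ.- (ℤ.+ ent n k j)) (lookup (pos ν b) i) (lookup (pos ν a) j) (ℤ.+ n) (position-ℤ (lookup ν b) i) (position-ℤ (lookup ν a) j)))) ⟩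
    ∑ (allFin n) (λ i → ∑ (allFin n) λ j → ∑ (allFin k) λ a → ∑ (allFin k) λ b → f i j a b)
      ≡⟨ ℕΣ.⅀-cong (allFin n) (λ i → ≡.trans (ℕΣ.⅀-swap (allFin n) (allFin k) (λ j a → ∑ (allFin k) λ b → f i j a b))
           (ℕΣ.⅀-cong (allFin k) (λ a → ℕΣ.⅀-swap (allFin n) (allFin k) (λ j b → f i j a b)))) ⟩
    ∑ (allFin n) (λ i → ∑ (allFin k) λ a → ∑ (allFin k) λ b → ∑ (allFin n) λ j → f i j a b)
      ≡⟨ ≡.trans (ℕΣ.⅀-swap (allFin n) (allFin k) (λ i a → ∑ (allFin k) λ b → ∑ (allFin n) λ j → f i j a b))
           (ℕΣ.⅀-cong (allFin k) (λ a → ℕΣ.⅀-swap (allFin n) (allFin k) (λ i b → ∑ (allFin n) λ j → f i j a b))) ⟩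
    ∑ (allFin k) (λ a → ∑ (allFin k) λ b → ∑ (allFin n) λ i → ∑ (allFin n) λ j → f i j a b)
      ≡⟨ ℕΣ.⅀-cong (allFin k) (λ a → ℕΣ.⅀-cong (allFin k) λ b → ≡.trans
           (ℕΣ.⅀-cong (allFin n) (λ i → ≡.sym (ℕΣ.⅀-*ˡ (allFin n) (𝟙 (toℕ a <ᵇ toℕ b)) (λ j → 𝟙 (lookup (pos ν b) i <ᵇ lookup (pos ν a) j)))))
           (≡.trans (≡.sym (ℕΣ.⅀-*ˡ (allFin n) (𝟙 (toℕ a <ᵇ toℕ b)) (λ i → ∑ (allFin n) (λ j → 𝟙 (lookup (pos ν b) i <ᵇ lookup (pos ν a) j)))))
             (cong (𝟙 (toℕ a <ᵇ toℕ b) *_) (≡.sym (inversions-∑ N (pos ν a) (pos ν b) (pos< a)))))) ⟩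
    inv ν ∎
    where
    open ≡.≡-Reasoning
    f : Fin n → Fin n → Fin k → Fin k → ℕ
    f i j a b = 𝟙 (toℕ a <ᵇ toℕ b) * 𝟙 (lookup (pos ν b) i <ᵇ lookup (pos ν a) j)
    pos< : ∀ c j → lookup (pos ν c) j < N
    pos< c = VAllₚ.lookup⁺ (subst (λ M → VAll (_< M) (pos ν c)) (ℕₚ.+-comm D n) (positions-< (lookup ν c) D (proj₂ (box c))))

  private
    pairs-1 : ∀ m → pairs m (λ _ _ → 1) ≡ m C 2
    pairs-1 zero    = refl
    pairs-1 (suc m) = ≡.trans (pairs-suc m (λ _ _ → 1)) (≡.trans (cong₂ _+_ (size m) (pairs-1 m))
      (≡.trans (cong (_+ m C 2) (≡.sym (nC1≡n m))) (nCk+nC[k+1]≡[n+1]C[k+1] m 1)))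
      where
      size : ∀ m → ∑ (allFin m) (λ _ → 1) ≡ m
      size zero    = refl
      size (suc m) = ≡.trans (ℕΣ.⅀-allFin-suc m (λ _ → 1)) (cong suc (size m))

  -- For empty partitions every colour occupies n - 1, ..., 0, so each pair of colours has one
  -- inversion for every pair of rows j < i. The binomial constant in d is thus the inversion number
  -- of the vacuum.
  inv-zero : (n C 2) * (k C 2) ≡ inv (Vec.replicate k (Vec.replicate n 0))
  inv-zero = begin
    (n C 2) * (k C 2)
      ≡⟨ cong₂ _*_ (≡.sym (pairs-1 n)) (≡.sym (pairs-1 k)) ⟩
    c * pairs k (λ _ _ → 1)
      ≡⟨ ≡.trans (ℕΣ.⅀-*ˡ (allFin k) c _) (ℕΣ.⅀-cong (allFin k) (λ a → ≡.trans (ℕΣ.⅀-*ˡ (allFin k) c _)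
           (ℕΣ.⅀-cong (allFin k) (λ b → ≡.trans (cong (c *_) (ℕₚ.*-identityʳ (𝟙 (toℕ a <ᵇ toℕ b)))) (≡.trans (ℕₚ.*-comm c (𝟙 (toℕ a <ᵇ toℕ b))) (cong (𝟙 (toℕ a <ᵇ toℕ b) *_) (each a b))))))) ⟩
    inv (Vec.replicate k (Vec.replicate n 0)) ∎
    where
    open ≡.≡-Reasoning
    c = pairs n (λ _ _ → 1)
    P = positions (Vec.replicate n 0)
    at : ∀ j → lookup P j ≡ n ∸ suc (toℕ j)
    at j = ≡.trans (lookup-positions (Vec.replicate n 0) j) (cong (_+ (n ∸ suc (toℕ j))) (Vecₚ.lookup-replicate j 0))
    at< : ∀ j → lookup P j < N
    at< j = subst (_< N) (≡.sym (at j)) (ℕₚ.<-≤-trans (ℕₚ.∸-monoʳ-< {n} {suc (toℕ j)} {0} (s≤s z≤n) (Finₚ.toℕ<n j)) (ℕₚ.m≤m+n n D))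
    compare : ∀ i j → (lookup P i <ᵇ lookup P j) ≡ (toℕ j <ᵇ toℕ i)
    compare i j rewrite at i | at j with toℕ j ℕₚ.<? toℕ i
    ... | yes lt = ≡.trans (<ᵇ-true (ℕₚ.∸-monoʳ-< (s≤s lt) (Finₚ.toℕ<n i))) (≡.sym (<ᵇ-true lt))
    ... | no nlt = ≡.trans (<ᵇ-false (ℕₚ.∸-monoʳ-≤ n (s≤s (ℕₚ.≮⇒≥ nlt)))) (≡.sym (<ᵇ-false (ℕₚ.≮⇒≥ nlt)))
    inversions-zero : inversions N P P ≡ c
    inversions-zero = ≡.trans (inversions-∑ N P P at<) (≡.trans (ℕΣ.⅀-swap (allFin n) (allFin n) (λ i j → 𝟙 (lookup P i <ᵇ lookup P j)))
      (ℕΣ.⅀-cong (allFin n) (λ j → ℕΣ.⅀-cong (allFin n) (λ i → ≡.trans (cong 𝟙 (compare i j)) (≡.sym (ℕₚ.*-identityʳ _))))))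
    each : ∀ a b → c ≡ inversions N (pos (Vec.replicate k (Vec.replicate n 0)) a) (pos (Vec.replicate k (Vec.replicate n 0)) b)
    each a b rewrite Vecₚ.lookup-replicate a (Vec.replicate n 0) | Vecₚ.lookup-replicate b (Vec.replicate n 0) = ≡.sym inversions-zero

  dstat-inv : ∀ ν → InBox ν → dstat n k ν ≡ (ℤ.+ inv (Vec.replicate k (Vec.replicate n 0))) ℤ.- (ℤ.+ inv ν)
  dstat-inv ν box = cong₂ (λ a b → (ℤ.+ a) ℤ.- (ℤ.+ b)) inv-zero (dstat-sum ν box)

-- The Cauchy identity in a filtered ring with monomials.

private
  ℤ-double : ∀ a b c → (a ℤ.+ b ℤ.+ c) ℤ.+ (a ℤ.+ b ℤ.+ c) ≡ (a ℤ.+ a) ℤ.+ ((b ℤ.+ b) ℤ.+ (c ℤ.+ c))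
  ℤ-double = solve 3 (λ a b c → (a :+ b :+ c) :+ (a :+ b :+ c) := (a :+ a) :+ ((b :+ b) :+ (c :+ c))) refl
    where open ℤ-Solver

  ℤ-gauge : ∀ a b → ((a ℤ.- b) ℤ.+ (a ℤ.- b)) ℤ.+ (b ℤ.+ b) ≡ a ℤ.+ a
  ℤ-gauge = solve 2 (λ a b → ((a :- b) :+ (a :- b)) :+ (b :+ b) := a :+ a) refl
    where open ℤ-Solver

  ℕ-interchange : ∀ a b c d → (a + b) + (c + d) ≡ (a + c) + (b + d)
  ℕ-interchange = solve 4 (λ a b c d → (a :+ b) :+ (c :+ d) := (a :+ c) :+ (b :+ d)) refl
    where open +-*-Solver

module CauchyIdentity {c ℓ : Level} (R : CommutativeRing c ℓ) (n' k D : ℕ) (filtration : Filtration R D)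
  (mono : Mon (suc n') → CommutativeRing.Carrier R)
  (mono-* : ∀ p p' → CommutativeRing._≈_ R (CommutativeRing._*_ R (mono p) (mono p')) (mono (monMul p p')))
  (mono-1 : CommutativeRing._≈_ R (mono (Polynomials.one-mon (suc n'))) (CommutativeRing.1# R))
  (mono-F : ∀ p → Filtration.F filtration (Polynomials.deg (suc n') p) (mono p)) where
  open CommutativeRing R hiding (zero) renaming (_+_ to _⊕_; _*_ to _⊗_; -_ to ⊝_; refl to ≈-refl; sym to ≈-sym; trans to ≈-trans)
  open FiniteSum commutativeSemiring
  open IntegerRingSolver R
  open SetoidReasoning setoid
  open Exp semiring renaming (_^_ to _↑_)
  open Filtration filtration
  open Products R
  open Assembly R n' k D filtration mono mono-* mono-1 mono-F
  open Words R q k n' D filtration (qPower-cancel (ℤ.+ 1)) using (n; words'; Ψ; Ψ-cauchy; allPochhammers; pochhammers)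
  open TupleWords R q k n' D filtration (qPower-cancel (ℤ.+ 1))
  open Tuples k n D
  open RowCounts n k
  open Tableaux k n D
  open DStat k n D
  open Commutation R q using (pochhammer)

  private
    𝟎 : Vec ℕ n
    𝟎 = Vec.replicate n 0

    _⊞_ : Vec ℕ n → Vec ℕ n → Vec ℕ n
    _⊞_ = Vec.zipWith _+_

    ⊞-identity : ∀ v → 𝟎 ⊞ v ≡ v
    ⊞-identity = Vecₚ.zipWith-identityˡ ℕₚ.+-identityˡ

    ⊞-identityʳ : ∀ v → v ⊞ 𝟎 ≡ v
    ⊞-identityʳ = Vecₚ.zipWith-identityʳ ℕₚ.+-identityʳ

  -- The largest index stands at the head: the head acts last, and the largest letter of a tableau
  -- is added last.
  vars : ℕ → (ℕ → Carrier) → List Carrier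
  vars zero    Z = []
  vars (suc m) Z = Z m ∷ vars m Z

  length-vars : ∀ m Z → length (vars m Z) ≡ m
  length-vars zero    Z = refl
  length-vars (suc m) Z = cong suc (length-vars m Z)

  chainOf : ∀ m Z → (ℕ → Tup) → Vec Tup (length (vars m Z))
  chainOf zero    Z χ = []
  chainOf (suc m) Z χ = χ m ∷ chainOf m Z χ

  private
    chainOf-cong : ∀ m Z {χ χ'} → (∀ i → i < m → χ i ≡ χ' i) → chainOf m Z χ ≡ chainOf m Z χ'
    chainOf-cong zero    Z h = refl
    chainOf-cong (suc m) Z h = cong₂ _∷_ (h m ℕₚ.≤-refl) (chainOf-cong m Z (λ i i< → h i (ℕₚ.m<n⇒m<1+n i<)))

    chainOf-injective : ∀ m Z {χ χ'} → chainOf m Z χ ≡ chainOf m Z χ' → ∀ i → i < m → χ i ≡ χ' i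
    chainOf-injective (suc m) Z e i i< with ℕₚ.m<1+n⇒m<n∨m≡n i<
    ... | inj₁ i<m  = chainOf-injective m Z (Vecₚ.∷-injectiveʳ e) i i<m
    ... | inj₂ refl = Vecₚ.∷-injectiveˡ e

    chainOf-∈ : ∀ m Z χ → (∀ i → i < m → χ i ∈ tuples) → ∀ j → lookup (chainOf m Z χ) j ∈ tuples
    chainOf-∈ (suc m) Z χ h zero    = h m ℕₚ.≤-refl
    chainOf-∈ (suc m) Z χ h (suc j) = chainOf-∈ m Z χ (λ i i< → h i (ℕₚ.m<n⇒m<1+n i<)) j

  chain-dichotomy : ∀ m Z ν (ch : Vec Tup (length (vars m Z))) → chainWeight (vars m Z) ν ch ≈ 0#
    ⊎ (∃ λ χ → χ m ≡ ν × χ 0 ≡ zeroTuple × (∀ i → i < m → StripAll (χ i) (χ (suc i))) × chainOf m Z χ ≡ ch)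
  chain-dichotomy zero Z ν [] with tuple-≟ ν zeroTuple
  ... | yes e = inj₂ ((λ _ → ν) , refl , e , (λ _ ()) , refl)
  ... | no _  = inj₁ ≈-refl
  chain-dichotomy (suc m) Z ν (μ ∷ ch) with stripAll? μ ν | chain-dichotomy m Z μ ch
  ... | no ¬s | _      = inj₁ (≈-trans (*-congʳ (reflexive (stripWeight-0 (Z m) μ ν ¬s))) (zeroˡ _))
  ... | yes s | inj₁ r = inj₁ (≈-trans (*-congˡ r) (zeroʳ _))
  ... | yes s | inj₂ (χ , χm , χ0 , strips , e) = inj₂ (χ' , at-top , ≡.trans (below-top 0 z≤n) χ0 , strips'
      , cong₂ _∷_ (≡.trans (below-top m ℕₚ.≤-refl) χm) (≡.trans (chainOf-cong m Z (λ i i< → below-top i (ℕₚ.<⇒≤ i<))) e))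
    where
    χ' : ℕ → Tup
    χ' i = if i ≤ᵇ m then χ i else ν
    -- A chain lists only the shapes below its top, so the old function is kept up to m and
    -- continued by the top shape `ν`.
    below-top : ∀ i → i ≤ m → χ' i ≡ χ i
    below-top i le rewrite ≤ᵇ-intro le = refl
    at-top : χ' (suc m) ≡ ν
    at-top rewrite <ᵇ-false (ℕₚ.≤-refl {m}) = refl
    strips' : ∀ i → i < suc m → StripAll (χ' i) (χ' (suc i))
    strips' i i< with ℕₚ.m<1+n⇒m<n∨m≡n i<
    ... | inj₁ i<m  = subst₂ StripAll (≡.sym (below-top i (ℕₚ.<⇒≤ i<m))) (≡.sym (below-top (suc i) i<m)) (strips i i<m)
    ... | inj₂ refl = subst₂ StripAll (≡.sym (≡.trans (below-top m ℕₚ.≤-refl) χm)) (≡.sym at-top) s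

  -- ι α e is the monomial with exponent α in one of the two alphabets and q-exponent e.
  module Alphabet (ι : Vec ℕ n → ℤ → Carrier) (ι-* : ∀ α α' e e' → ι α e ⊗ ι α' e' ≈ ι (α ⊞ α') (e ℤ.+ e'))
                  (ι-q : ∀ e → qPower e ≈ ι 𝟎 e) where

    Z : ℕ → Carrier
    Z i = ι (unit i 1) ℤ.0ℤ

    private
      ι-1 : 1# ≈ ι 𝟎 ℤ.0ℤ
      ι-1 = ≈-trans (≈-sym mono-1) (ι-q ℤ.0ℤ)

      Z-↑ : ∀ i p → Z i ↑ p ≈ ι (unit i p) ℤ.0ℤ
      Z-↑ i zero    = ≈-trans ι-1 (reflexive (cong (λ v → ι v ℤ.0ℤ) (≡.sym (unit-0 i))))
      Z-↑ i (suc p) = ≈-trans (*-congˡ (Z-↑ i p)) (≈-trans (ι-* _ _ _ _) (reflexive (cong (λ v → ι v ℤ.0ℤ) (unit-suc i p))))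

      upTo-vec : ℕ → (ℕ → ℕ) → Vec ℕ n
      upTo-vec m a = Vec.tabulate (λ j → if toℕ j <ᵇ m then a (toℕ j) else 0)

      lookup-upTo-vec : ∀ m a j → lookup (upTo-vec m a) j ≡ (if toℕ j <ᵇ m then a (toℕ j) else 0)
      lookup-upTo-vec m a j = Vecₚ.lookup∘tabulate (λ j → if toℕ j <ᵇ m then a (toℕ j) else 0) j

      upTo-vec-suc : ∀ m a → unit m (a m) ⊞ upTo-vec m a ≡ upTo-vec (suc m) a
      upTo-vec-suc m a = lookup-ext _ _ λ j → ≡.trans (Vecₚ.lookup-zipWith _+_ j (unit m (a m)) (upTo-vec m a))
        (≡.trans (cong₂ _+_ (lookup-unit m (a m) j) (lookup-upTo-vec m a j)) (≡.trans (split (toℕ j)) (≡.sym (lookup-upTo-vec (suc m) a j))))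
        where
        split : ∀ j → (if m ≡ᵇ j then a m else 0) + (if j <ᵇ m then a j else 0) ≡ (if j <ᵇ suc m then a j else 0)
        split j with ℕₚ.<-cmp j m
        ... | tri< j<m _ _ rewrite ≡ᵇ-false m j j<m | <ᵇ-true j<m | <ᵇ-true (ℕₚ.m<n⇒m<1+n j<m) = refl
        ... | tri≈ _ refl _ rewrite ≡ᵇ-refl j | <ᵇ-false (ℕₚ.≤-refl {j}) | <ᵇ-true (ℕₚ.≤-refl {suc j}) = ℕₚ.+-identityʳ (a j)
        ... | tri> _ _ m<j rewrite ≡ᵇ-false′ m j m<j | <ᵇ-false (ℕₚ.<⇒≤ m<j) | <ᵇ-false {j} {suc m} m<j = refl

      upTo-vec-0 : ∀ a → upTo-vec 0 a ≡ 𝟎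
      upTo-vec-0 a = lookup-ext _ _ λ j → ≡.trans (lookup-upTo-vec 0 a j) (≡.sym (Vecₚ.lookup-replicate j 0))

    module _ (ν : Tup) (box : InBox ν) where

      private
        mv st : Tab → ℕ → ℕ
        mv T i = moves (shape i T) (shape (suc i) T)
        st T i = stat (shape i T) (shape (suc i) T)

        chain-value : ∀ T → Valid T → ∀ m → m ≤ n →
          chainWeight (vars m Z) (shape m T) (chainOf m Z (λ i → shape i T)) ≈ ι (upTo-vec m (mv T)) (ℤ.+ (∑ (upTo m) (st T) + ∑ (upTo m) (st T)))
        chain-value T valid zero    _   = ≈-trans (reflexive (isZero-1 (shape 0 T) (shape-0 T)))
          (≈-trans ι-1 (reflexive (cong (λ v → ι v ℤ.0ℤ) (≡.sym (upTo-vec-0 (mv T))))))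
        chain-value T valid (suc m) m<n = begin
          stripWeight (Z m) (shape m T) (shape (suc m) T) ⊗ chainWeight (vars m Z) (shape m T) (chainOf m Z (λ i → shape i T))
            ≈⟨ *-cong weight (chain-value T valid m (ℕₚ.<⇒≤ m<n)) ⟩
          ι (unit m (mv T m)) (ℤ.+ (st T m + st T m)) ⊗ ι (upTo-vec m (mv T)) (ℤ.+ (S + S))
            ≈⟨ ι-* _ _ _ _ ⟩
          ι (unit m (mv T m) ⊞ upTo-vec m (mv T)) (ℤ.+ ((st T m + st T m) + (S + S)))
            ≈⟨ reflexive (cong₂ (λ v e → ι v (ℤ.+ e)) (upTo-vec-suc m (mv T)) (≡.trans (ℕ-interchange (st T m) (st T m) S S)
                 (cong₂ _+_ (≡.trans (ℕₚ.+-comm (st T m) S) (≡.sym (∑-upTo-suc m (st T)))) (≡.trans (ℕₚ.+-comm (st T m) S) (≡.sym (∑-upTo-suc m (st T))))))) ⟩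
          _ ∎
          where
          S = ∑ (upTo m) (st T)
          weight : stripWeight (Z m) (shape m T) (shape (suc m) T) ≈ ι (unit m (mv T m)) (ℤ.+ (st T m + st T m))
          weight = ≈-trans (reflexive (stripWeight-strip (Z m) (shape m T) (shape (suc m) T) (shape-strip T valid m m<n)))
            (≈-trans (*-cong (Z-↑ m (mv T m)) (≈-trans (q-↑ _) (ι-q _)))
            (≈-trans (ι-* _ _ _ _) (reflexive (cong (λ v → ι v (ℤ.+ (st T m + st T m))) (⊞-identityʳ _)))))

        tableau-chain : Tab → Vec Tup (length (vars n Z))
        tableau-chain T = chainOf n Z (λ i → shape i T)

        value : ∀ T → T ∈ tableaux n k ν → chainWeight (vars n Z) ν (tableau-chain T) ≈ ι (content n k T) (ℤ.+ (coinv n k ν T + coinv n k ν T))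
        value T T∈ with ∈-tableaux⁻ ν T T∈
        ... | valid , lengths = ≈-trans (reflexive (cong (λ μ → chainWeight (vars n Z) μ (tableau-chain T)) (≡.sym (shape-n ν T lengths))))
          (≈-trans (chain-value T valid n ℕₚ.≤-refl) (reflexive (cong₂ (λ v s → ι v (ℤ.+ (s + s))) contents (≡.sym (coinv-stat ν T box valid lengths)))))
          where
          contents : upTo-vec n (mv T) ≡ content n k T
          contents = lookup-ext _ _ λ j → ≡.trans (lookup-upTo-vec n (mv T) j) (≡.trans (cong (λ b → if b then mv T (toℕ j) else 0) (<ᵇ-true (Finₚ.toℕ<n j)))
            (≡.sym (content-moves ν T box valid lengths j)))

        chains : List (Vec Tup (length (vars n Z)))
        chains = choices (Vec.replicate (length (vars n Z)) tuples)

        chains-unique : Unique chains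
        chains-unique = choices-unique (Vec.replicate (length (vars n Z)) tuples) (λ j → subst Unique (≡.sym (Vecₚ.lookup-replicate j tuples)) tuples-unique)

        injective : ∀ T T' → T ∈ tableaux n k ν → T' ∈ tableaux n k ν → tableau-chain T ≡ tableau-chain T' → T ≡ T'
        injective T T' T∈ T'∈ e with ∈-tableaux⁻ ν T T∈ | ∈-tableaux⁻ ν T' T'∈
        ... | valid , lengths | valid' , lengths' = tableau-ext T T' valid valid' same
          where
          same : ∀ i → i ≤ n → shape i T ≡ shape i T'
          same i i≤n with ℕₚ.m≤n⇒m<n∨m≡n i≤n
          ... | inj₁ i<n  = chainOf-injective n Z e i i<n
          ... | inj₂ refl = ≡.trans (shape-n ν T lengths) (≡.sym (shape-n ν T' lengths'))

        member : ∀ T → T ∈ tableaux n k ν → tableau-chain T ∈ chains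
        member T T∈ with ∈-tableaux⁻ ν T T∈
        ... | valid , lengths = ∈-choices⁺ (Vec.replicate (length (vars n Z)) tuples) (tableau-chain T)
          (λ j → subst (lookup (tableau-chain T) j ∈_) (≡.sym (Vecₚ.lookup-replicate j tuples))
            (chainOf-∈ n Z (λ i → shape i T) (λ i i<n → ∈-tuples⁺ (shape i T) (shape-box ν T box valid lengths i (ℕₚ.<⇒≤ i<n))) j))

        support : ∀ ch → ch ∈ chains → chainWeight (vars n Z) ν ch ≈ 0# ⊎ (∃ λ T → T ∈ tableaux n k ν × tableau-chain T ≡ ch)
        support ch _ with chain-dichotomy n Z ν ch
        ... | inj₁ r = inj₁ r
        ... | inj₂ (χ , χn , χ0 , strips , e) with tableau-of χ χ0 strips
        ... | T , T∈ , shapes = inj₂ (T , subst (λ μ → T ∈ tableaux n k μ) χn T∈ , ≡.trans (chainOf-cong n Z (λ i i<n → shapes i (ℕₚ.<⇒≤ i<n))) e)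

      -- Tableaux correspond to the chains of strips that start from the empty tuple, and every
      -- other chain weighs zero. Along a chain the steps give the content and the one-sided
      -- statistics the coinversions.
      ⅀-tableaux : ⅀ (tableaux n k ν) (λ T → ι (content n k T) (ℤ.+ (coinv n k ν T + coinv n k ν T))) ≈ stripSum (vars n Z) ν
      ⅀-tableaux = begin
        _ ≈⟨ ⅀-cong∈ (tableaux n k ν) (λ T T∈ → ≈-sym (value T T∈)) ⟩
        ⅀ (tableaux n k ν) (λ T → chainWeight (vars n Z) ν (tableau-chain T))
          ≈⟨ ⅀-reindex (tableaux n k ν) chains tableau-chain (chainWeight (vars n Z) ν) (tableaux-unique ν) chains-unique injective member support ⟩
        ⅀ chains (chainWeight (vars n Z) ν)
          ≈⟨ ≈-sym (stripSum-chains (vars n Z) ν) ⟩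
        stripSum (vars n Z) ν ∎

  private
    ιˣ ιʸ : Vec ℕ n → ℤ → Carrier
    ιˣ α e = mono (α , 𝟎 , e)
    ιʸ β e = mono (𝟎 , β , e)

    module XA = Alphabet ιˣ (λ α α' e e' → ≈-trans (mono-* _ _) (reflexive (cong (λ v → mono (α ⊞ α' , v , e ℤ.+ e')) (⊞-identity 𝟎)))) (λ _ → ≈-refl)
    module YA = Alphabet ιʸ (λ β β' e e' → ≈-trans (mono-* _ _) (reflexive (cong (λ v → mono (v , β ⊞ β' , e ℤ.+ e')) (⊞-identity 𝟎)))) (λ _ → ≈-refl)

    xs ys : List Carrier
    xs = vars n X
    ys = vars n Y

    split-mono : ∀ α β d e e' → mono (double (α , β , d ℤ.+ (ℤ.+ e) ℤ.+ (ℤ.+ e')))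
      ≈ qPower (d ℤ.+ d) ⊗ (ιˣ α (ℤ.+ (e + e)) ⊗ ιʸ β (ℤ.+ (e' + e')))
    split-mono α β d e e' = ≈-sym (≈-trans (*-congˡ (mono-* _ _)) (≈-trans (mono-* _ _) (reflexive (≡.trans
      (cong₂ (λ u v → mono (u , v , (d ℤ.+ d) ℤ.+ (ℤ.+ (e + e) ℤ.+ ℤ.+ (e' + e')))) (≡.trans (⊞-identity _) (⊞-identityʳ α)) (≡.trans (⊞-identity _) (⊞-identity β)))
      (cong (λ z → mono (α , β , z)) (≡.sym (ℤ-double d (ℤ.+ e) (ℤ.+ e'))))))))

    embed-summand : ∀ ν → InBox ν → embed (summand n k ν) ≈ qPower (dstat n k ν ℤ.+ dstat n k ν) ⊗ (stripSum xs ν ⊗ stripSum ys ν)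
    embed-summand ν box = begin
      embed (summand n k ν)
        ≈⟨ ≈-trans (⅀-concatMap _ (LLT n k ν) (mono ∘ double)) (⅀-cong (LLT n k ν) (λ p → ⅀-map _ (LLT n k ν) (mono ∘ double))) ⟩
      ⅀ (LLT n k ν) (λ p → ⅀ (LLT n k ν) (λ p' → mono (double (proj₁ p , proj₁ p' , d ℤ.+ (ℤ.+ proj₂ p) ℤ.+ (ℤ.+ proj₂ p')))))
        ≈⟨ ⅀-cong (LLT n k ν) (λ p → ≈-trans (⅀-cong (LLT n k ν) (λ p' → split-mono (proj₁ p) (proj₁ p') d (proj₂ p) (proj₂ p')))
             (≈-sym (≈-trans (*-congˡ (⅀-*ˡ (LLT n k ν) _ _)) (⅀-*ˡ (LLT n k ν) _ _)))) ⟩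
      ⅀ (LLT n k ν) (λ p → qPower (d ℤ.+ d) ⊗ (ιˣ (proj₁ p) (ℤ.+ (proj₂ p + proj₂ p)) ⊗ ⅀ (LLT n k ν) (λ p' → ιʸ (proj₁ p') (ℤ.+ (proj₂ p' + proj₂ p')))))
        ≈⟨ ≈-sym (≈-trans (*-congˡ (⅀-*ʳ (LLT n k ν) _ _)) (⅀-*ˡ (LLT n k ν) _ _)) ⟩
      qPower (d ℤ.+ d) ⊗ (⅀ (LLT n k ν) (λ p → ιˣ (proj₁ p) (ℤ.+ (proj₂ p + proj₂ p))) ⊗ ⅀ (LLT n k ν) (λ p' → ιʸ (proj₁ p') (ℤ.+ (proj₂ p' + proj₂ p'))))
        ≈⟨ *-congˡ (*-cong (≈-trans (⅀-map _ (tableaux n k ν) _) (XA.⅀-tableaux ν box)) (≈-trans (⅀-map _ (tableaux n k ν) _) (YA.⅀-tableaux ν box))) ⟩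
      qPower (d ℤ.+ d) ⊗ (stripSum xs ν ⊗ stripSum ys ν) ∎
      where d = dstat n k ν

    -- Each alphabet contributes a factor q^(inv ν - inv 0) relative to Ψ. The power q^(2d) with d =
    -- inv 0 - inv ν cancels exactly the two of them.
    gauge : ∀ ν → InBox ν → qPower (dstat n k ν ℤ.+ dstat n k ν) ⊗ (stripSum xs ν ⊗ stripSum ys ν) ≈ Ψ xs (word ν) ⊗ Ψ ys (word ν)
    gauge ν box = qPower-cancel (ℤ.+ (I₀ + I₀)) (begin
      qPower (ℤ.+ (I₀ + I₀)) ⊗ (qPower (d ℤ.+ d) ⊗ (sx ⊗ sy))
        ≈⟨ *-congʳ (≈-trans (≈-sym (q-↑ (I₀ + I₀))) (^-homo-* q I₀ I₀)) ⟩
      (q ↑ I₀ ⊗ q ↑ I₀) ⊗ (qPower (d ℤ.+ d) ⊗ (sx ⊗ sy))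
        ≈⟨ solve 4 (λ a d x y → (a :* a) :* (d :* (x :* y)) := d :* ((a :* x) :* (a :* y))) ≈-refl _ _ _ _ ⟩
      qPower (d ℤ.+ d) ⊗ ((q ↑ I₀ ⊗ sx) ⊗ (q ↑ I₀ ⊗ sy))
        ≈⟨ *-congˡ (*-cong (stripSum-Ψ xs ν box) (stripSum-Ψ ys ν box)) ⟩
      qPower (d ℤ.+ d) ⊗ ((q ↑ I ⊗ Ψ xs (word ν)) ⊗ (q ↑ I ⊗ Ψ ys (word ν)))
        ≈⟨ solve 4 (λ a d x y → d :* ((a :* x) :* (a :* y)) := (d :* (a :* a)) :* (x :* y)) ≈-refl _ _ _ _ ⟩
      (qPower (d ℤ.+ d) ⊗ (q ↑ I ⊗ q ↑ I)) ⊗ (Ψ xs (word ν) ⊗ Ψ ys (word ν))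
        ≈⟨ *-congʳ (≈-trans (*-congˡ (≈-trans (≈-sym (^-homo-* q I I)) (q-↑ (I + I)))) (≈-trans (qPower-+ _ _) (reflexive (cong qPower total)))) ⟩
      qPower (ℤ.+ (I₀ + I₀)) ⊗ (Ψ xs (word ν) ⊗ Ψ ys (word ν)) ∎)
      where
      d = dstat n k ν
      I = inv ν
      I₀ = inv zeroTuple
      sx = stripSum xs ν
      sy = stripSum ys ν
      total : (d ℤ.+ d) ℤ.+ ℤ.+ (I + I) ≡ ℤ.+ (I₀ + I₀)
      total = ≡.trans (cong (λ z → (z ℤ.+ z) ℤ.+ ℤ.+ (I + I)) (dstat-inv ν box)) (ℤ-gauge (ℤ.+ I₀) (ℤ.+ I))

    embed-lhs : embed (lhsUpTo n k D) ≈ ⅀ (words' N) (λ w → Ψ xs w ⊗ Ψ ys w)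
    embed-lhs = begin
      embed (lhsUpTo n k D)
        ≈⟨ ⅀-concatMap (summand n k) tuples (mono ∘ double) ⟩
      ⅀ tuples (λ ν → embed (summand n k ν))
        ≈⟨ ⅀-cong∈ tuples (λ ν ν∈ → ≈-trans (embed-summand ν (∈-tuples⁻ ν ν∈)) (gauge ν (∈-tuples⁻ ν ν∈))) ⟩
      ⅀ tuples (λ ν → Ψ xs (word ν) ⊗ Ψ ys (word ν))
        ≈⟨ ⅀-word ys (Ψ xs) ⟩
      _ ∎

    pochhammer-∏ : ∀ i j m → pochhammer (X i) (Y j) m ≈ ∏ m (λ m → 1# ⊕ (⊝ ratio i j m))
    pochhammer-∏ i j zero    = ≈-refl
    pochhammer-∏ i j (suc m) = ≈-trans (*-comm _ _) (*-congʳ (pochhammer-∏ i j m))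

    pochhammers-∏ : ∀ m j → pochhammers (vars m X) (Y j) ≈ ∏ m (λ i → ∏ k (λ m → 1# ⊕ (⊝ ratio i j m)))
    pochhammers-∏ zero    j = ≈-refl
    pochhammers-∏ (suc m) j = *-cong (pochhammers-∏ m j) (pochhammer-∏ m j k)

    allPochhammers-∏ : ∀ m → allPochhammers xs (vars m Y) ≈ ∏ m (λ j → ∏ n (λ i → ∏ k (λ m → 1# ⊕ (⊝ ratio i j m))))
    allPochhammers-∏ zero    = ≈-refl
    allPochhammers-∏ (suc m) = *-cong (allPochhammers-∏ m) (pochhammers-∏ n m)

    xs-F : ∀ m → m ≤ n → All (F 1) (vars m X)
    xs-F zero    _   = []
    xs-F (suc m) m<n = X-F m m<n ∷ xs-F m (ℕₚ.<⇒≤ m<n)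

  -- Both sides are inverse to the same product Π in the truncated ring, the left one by `Ψ-cauchy`
  -- and the right one by `rhs-inverse`.
  cauchy : embed (lhsUpTo n k D) ≈ embed (rhsUpTo n k D)
  cauchy = begin
    L                ≈⟨ ≈-sym (*-identityʳ L) ⟩
    L ⊗ 1#           ≈⟨ *-congˡ (≈-sym rhs-inverse) ⟩
    L ⊗ (M ⊗ Π)      ≈⟨ solve 3 (λ l m p → l :* (m :* p) := (p :* l) :* m) ≈-refl L M Π ⟩
    (Π ⊗ L) ⊗ M      ≈⟨ *-congʳ (*-cong (≈-trans (∏-swap n n _) (≈-sym (allPochhammers-∏ n))) embed-lhs) ⟩
    (allPochhammers xs ys ⊗ ⅀ (words' N) (λ w → Ψ xs w ⊗ Ψ ys w)) ⊗ M
                     ≈⟨ *-congʳ (Ψ-cauchy xs ys (xs-F n ℕₚ.≤-refl) (ℕₚ.≤-reflexive (length-vars n X))) ⟩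
    1# ⊗ M           ≈⟨ *-identityˡ M ⟩
    M ∎
    where
    L = embed (lhsUpTo n k D)
    M = embed (rhsUpTo n k D)
    Π = ∏ n (λ i → ∏ n (λ j → ∏ k (λ m → 1# ⊕ (⊝ ratio i j m))))

-- Reading off the coefficients.

vecEq⁻ : ∀ {m} (u v : Vec ℕ m) → vecEq u v ≡ true → u ≡ v
vecEq⁻ []      []      _ = refl
vecEq⁻ (a ∷ u) (b ∷ v) e = cong₂ _∷_ (ℕₚ.≡ᵇ⇒≡ a b (subst Bool.T (≡.sym (proj₁ (∧-true {a ≡ᵇ b} e))) tt)) (vecEq⁻ u v (proj₂ (∧-true {a ≡ᵇ b} e)))

vecEq-refl : ∀ {m} (u : Vec ℕ m) → vecEq u u ≡ true
vecEq-refl []      = refl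
vecEq-refl (a ∷ u) rewrite ≡ᵇ-refl a = vecEq-refl u

monEq⁻ : ∀ {n} (m p : Mon n) → monEq m p ≡ true → m ≡ p
monEq⁻ (α , β , e) (α' , β' , e') eq with ∧-true {vecEq α α'} eq
... | eα , eq' with ∧-true {vecEq β β'} eq'
... | eβ , ee with e ℤ.≟ e' | ee
... | yes refl | _ = cong₂ _,_ (vecEq⁻ α α' eα) (cong₂ _,_ (vecEq⁻ β β' eβ) refl)

monEq-refl : ∀ {n} (m : Mon n) → monEq m m ≡ true
monEq-refl (α , β , e) rewrite vecEq-refl α | vecEq-refl β with e ℤ.≟ e
... | yes _ = refl
... | no ¬e = ⊥-elim (¬e refl)

double-injective : ∀ {n} (p m : Mon n) → double p ≡ double m → p ≡ m
double-injective (α , β , e) (α' , β' , e') eq with ×ₚ.,-injective eq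
... | refl , eq' with ×ₚ.,-injective eq'
... | refl , ee = cong (λ z → α , β , z) (halve e e' ee)
  where
  halve : ∀ e e' → e ℤ.+ e ≡ e' ℤ.+ e' → e ≡ e'
  halve e e' eq = ℤₚ.*-cancelˡ-≡ (ℤ.+ 2) e e' (≡.trans (twice e) (≡.trans eq (≡.sym (twice e'))))
    where
    twice : ∀ e → ℤ.+ 2 ℤ.* e ≡ e ℤ.+ e
    twice = solve 1 (λ e → con (ℤ.+ 2) :* e := e :+ e) refl
      where open ℤ-Solver

module Coefficients (n' k D : ℕ) where
  open Polynomials (suc n')
  open CauchyIdentity (polyRing D) n' k D (filtration D) monomial (λ p p' m _ → monomial-* p p' m) (λ m _ → refl)
    (λ p → monomial-degree D (deg p) p ℕₚ.≤-refl) using (cauchy)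

  doubled : List (Mon (suc n')) → Poly
  doubled L = FiniteSum.⅀ (CommutativeRing.commutativeSemiring (polyRing D)) L (monomial ∘ double)

  -- Since `double` is injective, no two distinct monomials are merged by t = q², and the
  -- multiplicity of m is found at its double.
  coeff-doubled : ∀ L m → co (doubled L) (double m) ≡ ℤ.+ coeff L m
  coeff-doubled []      m = refl
  coeff-doubled (p ∷ L) m with monEq m p in eq
  ... | true  = cong₂ ℤ._+_ (cong (ℤ.1ℤ ℤ.*_) (δᵐ-true (double p) (double m) (cong double (≡.sym (monEq⁻ m p eq))))) (coeff-doubled L m)
  ... | false = ≡.trans (cong₂ ℤ._+_ (cong (ℤ.1ℤ ℤ.*_) (δᵐ-false (double p) (double m) differ)) (coeff-doubled L m)) (ℤₚ.+-identityˡ _)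
    where
    differ : double p ≢ double m
    differ e with double-injective p m e
    ... | refl with ≡.trans (≡.sym eq) (monEq-refl m)
    ... | ()

  coefficients-agree : ∀ m → deg m ≤ D → coeff (lhsUpTo (suc n') k D) m ≡ coeff (rhsUpTo (suc n') k D) m
  coefficients-agree m m≤D = ℤₚ.+-injective (≡.trans (≡.sym (coeff-doubled (lhsUpTo (suc n') k D) m))
    (≡.trans (cauchy (double m) m≤D) (coeff-doubled (rhsUpTo (suc n') k D) m)))

theorem6p1 : (n k : ℕ) → 1 ≤ n → 1 ≤ k →
    (α β : Vec ℕ n) (e : ℤ) (D : ℕ) → sum α ≤ D →
    coeff (lhsUpTo n k D) (α , β , e) ≡ coeff (rhsUpTo n k D) (α , β , e)
theorem6p1 (suc n') k _ _ α β e D α≤D = Coefficients.coefficients-agree n' k D (α , β , e) α≤D
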